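{- There is a polynomial $p$ such that the following holds. Let $\tau$ be a linear-exponential term and let $\phi$ be an integer linear-exponential program, both over variables ranging over $\mathbb{N}$. If the problem "maximize $\tau$ subject to $\phi$" (respectively, "minimize $\tau$ subject to $\phi$") has an optimal solution, then it has an optimal solution representable by an ILESLP $\sigma=(x_0\gets\rho_0,\dots,x_n\gets\rho_n)$ of size at most $p(s)$, where $s$ is the size of $(\tau,\phi)$. Here "representable" means that $\{x_0,\dots,x_n\}$ contains all variables of $\tau$ and $\phi$, and the map sending each such variable $x$ to $[\![\sigma]\!](x)$ is an optimal solution.
   Context: A linear-exponential term is an expression $\sum_{i=1}^n\big(a_i x_i + b_i 2^{x_i} + \sum_{j=1}^n c_{i,j}(x_i \bmod 2^{x_j})\big)+d$ with all $a_i,b_i,c_{i,j},d\in\mathbb{Z}$. An integer linear-exponential program is a finite conjunction of constraints $\tau=0$ and $\tau\le 0$ with $\tau$ linear-exponential terms; a solution is an assignment of natural numbers to its variables satisfying all constraints. An optimal solution of "maximize (minimize) $\tau$ subject to $\phi$" is a solution of $\phi$ (assigning values also to the variables of $\tau$) at which $\tau$ attains its maximum (minimum) over all such solutions. Sizes of terms and programs are the number of symbols needed to write them, with integers in binary. A linear-exponential straight-line program (LESLP) is a sequence $\sigma=(x_0\gets\rho_0,\dots,x_n\gets\rho_n)$ of assignments to distinct variables, where each $\rho_i$ is $0$, $x_j+x_k$, $2^{x_j}$, or $a\cdot x_j$ with $a\in\mathbb{Q}$, for $j,k\in\{0,\dots,i-1\}$. Its semantics $[\![\sigma]\!]$ maps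 each $x_i$ to the real number obtained by evaluating $\rho_i$ with standard arithmetic. $\sigma$ is an ILESLP if $[\![\sigma]\!](x_i)\in\mathbb{Z}$ for all $i$. The size of $\sigma$ is the number of symbols needed to write it, with indices written in unary and each rational coefficient written as $m/g$ ($m\in\mathbb{Z}$, $g\ge 1$) with $m,g$ in binary. -}

module Defs where

open import Data.Nat as ℕ using (ℕ; zero; suc; _^_; NonZero)
open import Data.Nat.Properties using (m^n≢0)
open import Data.Nat.Logarithm using (⌊log₂_⌋)
open import Data.Integer as ℤ using (ℤ; +_; -[1+_]; ∣_∣)
open import Data.Integer.DivMod using () renaming (_/_ to _div_)
open import Data.List using (List; []; _∷_; _++_; [_]; map; concatMap)
open import Data.Nat.ListAction using (sum)
open import Data.List.Membership.Propositional using (_∈_)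
open import Data.List.Relation.Unary.Unique.Propositional using (Unique)
open import Data.Maybe using (Maybe; just; nothing)
open import Data.Product using (Σ; _×_; _,_; proj₁; proj₂; ∃)
open import Data.Bool using (if_then_else_)
open import Relation.Nullary using (does)
open import Relation.Binary.PropositionalEquality using (_≡_)

Var : Set
Var = ℕ

Assignment : Set
Assignment = Var → ℕ

-- Size (number of symbols) of an integer written in binary:
-- a sign symbol plus the binary digits of its absolute value.
zsize : ℤ → ℕ
zsize z = 2 ℕ.+ ⌊log₂ ∣ z ∣ ⌋

nsize : ℕ → ℕ
nsize n = 1 ℕ.+ ⌊log₂ n ⌋

data Atom : Set where
  lin  : Var → Atom
  pow2 : Var → Atom
  modp : Var → Var → Atom

record LETerm : Set where
  constructor leterm
  field
    monos : List (ℤ × Atom)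
    const : ℤ

evalAtom : Assignment → Atom → ℤ
evalAtom ν (lin x)    = + ν x
evalAtom ν (pow2 x)   = + (2 ^ ν x)
evalAtom ν (modp x y) = + (ℕ._%_ (ν x) (2 ^ ν y) {{m^n≢0 2 (ν y)}})

evalTerm : Assignment → LETerm → ℤ
evalTerm ν (leterm ms d) = go ms
  where
  go : List (ℤ × Atom) → ℤ
  go []             = d
  go ((c , a) ∷ ms) = c ℤ.* evalAtom ν a ℤ.+ go ms

atomVars : Atom → List Var
atomVars (lin x)    = x ∷ []
atomVars (pow2 x)   = x ∷ []
atomVars (modp x y) = x ∷ y ∷ []

termVars : LETerm → List Var
termVars (leterm ms d) = concatMap (λ m → atomVars (proj₂ m)) ms

-- symbols: each variable is one symbol; "2^x" two; "x mod 2^y" four;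
-- plus the coefficient and a connective.
atomSize : Atom → ℕ
atomSize (lin x)    = 1
atomSize (pow2 x)   = 2
atomSize (modp x y) = 4

termSize : LETerm → ℕ
termSize (leterm ms d) =
  sum (map (λ m → zsize (proj₁ m) ℕ.+ atomSize (proj₂ m) ℕ.+ 2) ms) ℕ.+ zsize d

data Constraint : Set where
  eq0 : LETerm → Constraint
  le0 : LETerm → Constraint

Program : Set
Program = List Constraint

SatC : Assignment → Constraint → Set
SatC ν (eq0 τ) = evalTerm ν τ ≡ + 0
SatC ν (le0 τ) = evalTerm ν τ ℤ.≤ + 0

Sat : Assignment → Program → Set
Sat ν []      = Data.Unit.⊤ where import Data.Unit
Sat ν (c ∷ φ) = SatC ν c × Sat ν φ

constrTerm : Constraint → LETerm
constrTerm (eq0 τ) = τ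
constrTerm (le0 τ) = τ

progVars : Program → List Var
progVars φ = concatMap (λ c → termVars (constrTerm c)) φ

progSize : Program → ℕ
progSize φ = sum (map (λ c → termSize (constrTerm c) ℕ.+ 3) φ)

probSize : LETerm → Program → ℕ
probSize τ φ = termSize τ ℕ.+ progSize φ

IsMaxSol : LETerm → Program → Assignment → Set
IsMaxSol τ φ ν = Sat ν φ × (∀ μ → Sat μ φ → evalTerm μ τ ℤ.≤ evalTerm ν τ)

IsMinSol : LETerm → Program → Assignment → Set
IsMinSol τ φ ν = Sat ν φ × (∀ μ → Sat μ φ → evalTerm ν τ ℤ.≤ evalTerm μ τ)

-- Linear-exponential straight-line programs.
-- Right-hand sides refer to earlier assignments by their position j.

data RHS : Set where
  zeroR : RHS
  addR  : ℕ → ℕ → RHS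
  powR  : ℕ → RHS
  scaleR : ℤ → ℕ → ℕ → RHS          -- scaleR m d j  is  (m / (suc d)) · x_j

LESLP : Set
LESLP = List (Var × RHS)

-- indices in unary: index j costs j+1 symbols; variable names 1 symbol;
-- rational coefficient m/g with m,g in binary.
rhsSize : RHS → ℕ
rhsSize zeroR          = 1
rhsSize (addR j k)     = suc j ℕ.+ suc k ℕ.+ 1
rhsSize (powR j)       = suc j ℕ.+ 2
rhsSize (scaleR m d j) = zsize m ℕ.+ nsize (suc d) ℕ.+ suc j ℕ.+ 2

leslpSize : LESLP → ℕ
leslpSize σ = sum (map (λ a → 2 ℕ.+ rhsSize (proj₂ a)) σ)

names : LESLP → List Var
names σ = map proj₁ σ

nth : {A : Set} → List A → ℕ → Maybe A
nth []       _       = nothing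
nth (a ∷ as) zero    = just a
nth (a ∷ as) (suc n) = nth as n

-- Evaluation of one right-hand side given the values of the earlier
-- assignments, in integer arithmetic.  It returns 'nothing' exactly when
-- the (real) value is not an integer, or a reference is not to an earlier
-- position.  (2^v for integer v is an integer iff v ≥ 0; (m/g)·v is an
-- integer iff g divides m·v.)
stepI : List ℤ → RHS → Maybe ℤ
stepI vs zeroR = just (+ 0)
stepI vs (addR j k) with nth vs j | nth vs k
... | just a | just b = just (a ℤ.+ b)
... | _      | _      = nothing
stepI vs (powR j) with nth vs j
... | just (+ n)     = just (+ (2 ^ n))
... | just -[1+ _ ]  = nothing
... | nothing        = nothing
stepI vs (scaleR m d j) with nth vs j
... | nothing = nothing
... | just a  =
  let q = (m ℤ.* a) div (+ suc d) in
  if does (+ suc d ℤ.* q ℤ.≟ m ℤ.* a) then just q else nothing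

runI : List ℤ → List RHS → Maybe (List ℤ)
runI vs []       = just vs
runI vs (ρ ∷ ρs) with stepI vs ρ
... | just v  = runI (vs ++ [ v ]) ρs
... | nothing = nothing

-- σ is an ILESLP (all variables distinct, all references to earlier
-- positions, all values integers) with value list vs = ⟦σ⟧(x_0),…,⟦σ⟧(x_n).
ILESLPWith : LESLP → List ℤ → Set
ILESLPWith σ vs = Unique (names σ) × runI [] (map proj₂ σ) ≡ just vs

Represents : LESLP → List ℤ → List Var → Assignment → Set
Represents σ vs xs ν =
  ∀ x → x ∈ xs → Σ ℕ λ i → nth (names σ) i ≡ just x × nth vs i ≡ just (+ ν x)

HasSmallOptimal : (Assignment → Set) → List Var → ℕ → Set
HasSmallOptimal Opt xs bound =
  Σ LESLP λ σ → Σ (List ℤ) λ vs → Σ Assignment λ ν →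
    ILESLPWith σ vs × leslpSize σ ℕ.≤ bound × Represents σ vs xs ν × Opt ν

{-# OPTIONS --safe #-}
-- Given an optimal solution, sort the values of the variables as 0 = Y₀ ≤ Y₁ ≤ … ≤ Yₘ and cut the
-- binary expansion of every Yⱼ at the positions Y₀, Y₁, …: Yⱼ = Σ dₗⱼ 2^Yₗ with digits dₗⱼ below
-- Bₗ = 2^(Yₗ₊₁ − Yₗ).  In the digits, every linear-exponential term is linear, and with its carries
-- fixed every inequality splits into one linear row per level l, with right-hand side linear in Bₗ.
--
-- The levels are normalised from the top one down.  As long as the nearly tight rows of level l do
-- not determine its digits in terms of Bₗ and u = dₗ,ₗ₊₁, Siegel's lemma gives a short direction v
-- annihilating them, and the digits can be moved along ±t v; once they do, u itself can be moved by
-- ±t while it is large.  The higher levels follow: their digits have the form (α Bₗ + β) / g, which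
-- stays integral because t is a multiple of a power of some Z with Π g ∣ Z ∣ 2^a (2^Z − 1).  Since
-- large gaps Yₗ₊₁ − Yₗ dominate all coefficients (small gaps are kept constant), the two
-- opposite moves change every Yⱼ, in particular the objective, by amounts of opposite sign; hence
-- by optimality the objective does not change, and one of the moves decreases a digit.
--
-- In the end all digits are (α Bₗ + β) / g with coefficients of polynomial bit size, and
-- Yⱼ = Σ (αₗⱼ 2^Yₗ₊₁ + βₗⱼ 2^Yₗ) / gₗ can be evaluated by a straight-line program.
module Submission where

import Data.Nat.Properties as ℕP
import Data.Integer.Properties as ℤP
open import Data.Nat.Tactic.RingSolver using () renaming (solve-∀ to solveℕ)
import Data.Fin.Properties as FinP
import Data.Nat.Divisibility as ℕD
import Data.Sum
open import Defs
import Data.Nat.DivMod as ℕM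
import Data.List.Relation.Unary.All.Properties as AllP
import Data.List.Properties as ListP
import Data.List.Relation.Unary.Unique.Propositional.Properties as UniqueP
open import Relation.Binary.PropositionalEquality hiding ([_])
open import Data.Nat as ℕ using (ℕ; zero; suc; z≤n; s≤s; _^_; _⊓_; _∸_; ⌊_/2⌋; ⌈_/2⌉; NonZero; _⊔_)
open import Data.Integer as ℤ using (ℤ; +_; -[1+_]; ∣_∣; 0ℤ; 1ℤ; _+_; _*_; _-_; -_; _≤_; _<_; +≤+; -≤+; +<+)
open import Data.Integer.Tactic.RingSolver using (solve-∀)
open import Data.Bool using (Bool; true; false; if_then_else_) renaming (T to IsTrue)
open import Data.Product using (Σ; _×_; _,_; proj₁; proj₂; ∃)
open import Data.Sum using (_⊎_; inj₁; inj₂)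
open import Data.Empty using (⊥-elim)
open import Relation.Nullary using (¬_; yes; no; Dec; ¬?; _×-dec_; does)
open import Data.Fin as Fin using (Fin; toℕ; fromℕ<; finToFun; funToFin; combine)
open import Relation.Nullary.Decidable using (decidable-stable; dec-true)
open import Data.Nat.DivMod using (_%_; _/_; m≡m%n+[m/n]*n; m%n<n)
open import Data.Nat.Coprimality using (Coprime; coprime-divisor)
open import Data.Integer.Divisibility.Signed as ℤD using (_∣_; divides)
open import Relation.Binary.Definitions using (tri<; tri≈; tri>)
open import Data.List using (List; []; _∷_; _++_; map; length; [_]; zip; upTo)
open import Data.List.Relation.Unary.All as All using (All; []; _∷_)
open import Data.List.Relation.Unary.Any using (here; there)
open import Data.List.Membership.Propositional using (_∈_; find; lose)
open import Data.List.Membership.Propositional.Properties using (∈-++⁺ˡ; ∈-++⁺ʳ; ∈-map⁺; ∈-map⁻; ∈-++⁻)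
open import Data.Integer.DivMod using (_/ℕ_; _%ℕ_; a≡a%ℕn+[a/ℕn]*n; n%ℕd<d; [n/ℕd]*d≤n; div-pos-is-/ℕ) renaming (_/_ to _div_)
open import Data.Nat.Induction using (<-wellFounded)
open import Induction.WellFounded using (Acc; acc)
open import Data.List.Relation.Unary.Any as Any using (Any)
open import Data.Nat.ListAction using (sum)
open import Data.List.Relation.Unary.Unique.Propositional using (Unique)
open import Data.Maybe using (Maybe; just; nothing)
open import Data.Nat.Logarithm using (⌊log₂_⌋; ⌊log₂⌋-mono-≤; ⌊log₂⌊n/2⌋⌋≡⌊log₂n⌋∸1; ⌊log₂[2^n]⌋≡n)
open import Data.List.Relation.Unary.AllPairs using (AllPairs; []; _∷_)
open import Data.List.Membership.DecPropositional ℕ._≟_ using (_∈?_)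

-- Finite sums and linear forms

-- A move at one level changes every higher `Y` through iterated exponentials, so the sizes of the
-- changes are out of reach; only signs and residues can be followed. For the signs, the objective
-- must itself be one of the numbers `Y j`. Hence `Objective` adds a variable equal to the objective
-- up to a sign, chosen so that its value at the optimum is a natural number. For the residues, each
-- `Y` is fed back as an exponent of two, so a congruence between old and new values has to survive
-- exponentiation again and again. It does when the modulus is its own period up to a power of two,
-- which is why `Per Z Z` is wanted. Each level then divides by its `g` and may cost one factor of
-- `Z`, which explains the power of `Z` in `t`. Such a `Z` comes from iterating the period of `G`,
-- the period of that period, and so on; `selfPeriod` keeps this within quadratically many bits. The
-- constants form a chain in which each is bounded from earlier ones. The number `P` enters this
-- chain through the bounds `C` and `U`, but only `2^P` has to dominate its end, so there is no
-- circularity.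

≤-cert : ∀ {x y} w → 0ℤ ≤ w → y ≡ x + w → x ≤ y
≤-cert {x} w p refl = subst (_≤ x + w) (ℤP.+-identityʳ x) (ℤP.+-monoʳ-≤ x p)

≤⇒0≤ : ∀ {x y} → x ≤ y → 0ℤ ≤ y - x
≤⇒0≤ = ℤP.i≤j⇒0≤j-i

0≤+ : ∀ {x y} → 0ℤ ≤ x → 0ℤ ≤ y → 0ℤ ≤ x + y
0≤+ = ℤP.+-mono-≤

0≤* : ∀ {x y} → 0ℤ ≤ x → 0ℤ ≤ y → 0ℤ ≤ x * y
0≤* {+ a} {+ b} p q = subst (0ℤ ≤_) (ℤP.pos-* a b) (+≤+ z≤n)

0<⇒1≤ : ∀ {x} → 0ℤ < x → 1ℤ ≤ x
0<⇒1≤ = ℤP.i<j⇒suc[i]≤j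

1≤⇒0< : ∀ {x} → 1ℤ ≤ x → 0ℤ < x
1≤⇒0< = ℤP.suc[i]≤j⇒i<j

Σ< : ℕ → (ℕ → ℤ) → ℤ
Σ< zero    f = 0ℤ
Σ< (suc n) f = Σ< n f + f n

Σ<-cong : ∀ n {f g : ℕ → ℤ} → (∀ j → j ℕ.< n → f j ≡ g j) → Σ< n f ≡ Σ< n g
Σ<-cong zero    h = refl
Σ<-cong (suc n) h = cong₂ _+_ (Σ<-cong n (λ j p → h j (ℕP.m<n⇒m<1+n p))) (h n ℕP.≤-refl)

Σ<-zero : ∀ n {f : ℕ → ℤ} → (∀ j → j ℕ.< n → f j ≡ 0ℤ) → Σ< n f ≡ 0ℤ
Σ<-zero zero    h = refl
Σ<-zero (suc n) h = cong₂ _+_ (Σ<-zero n (λ j p → h j (ℕP.m<n⇒m<1+n p))) (h n ℕP.≤-refl)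

private
  interchange : ∀ a b c d → (a + b) + (c + d) ≡ (a + c) + (b + d)
  interchange = solve-∀

Σ<-+ : ∀ n (f g : ℕ → ℤ) → Σ< n (λ j → f j + g j) ≡ Σ< n f + Σ< n g
Σ<-+ zero    f g = refl
Σ<-+ (suc n) f g = trans (cong (_+ (f n + g n)) (Σ<-+ n f g)) (interchange (Σ< n f) (Σ< n g) (f n) (g n))

Σ<-* : ∀ n c (f : ℕ → ℤ) → Σ< n (λ j → c * f j) ≡ c * Σ< n f
Σ<-* zero    c f = sym (ℤP.*-zeroʳ c)
Σ<-* (suc n) c f = trans (cong (_+ c * f n) (Σ<-* n c f)) (sym (ℤP.*-distribˡ-+ c (Σ< n f) (f n)))

Σ<-swap : ∀ n m (f : ℕ → ℕ → ℤ) → Σ< n (λ i → Σ< m (f i)) ≡ Σ< m (λ j → Σ< n (λ i → f i j))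
Σ<-swap zero    m f = sym (Σ<-zero m (λ _ _ → refl))
Σ<-swap (suc n) m f = trans (cong (_+ Σ< m (f n)) (Σ<-swap n m f)) (sym (Σ<-+ m _ _))

∣Σ<∣≤ : ∀ n (f : ℕ → ℤ) b → (∀ j → j ℕ.< n → ∣ f j ∣ ℕ.≤ b) → ∣ Σ< n f ∣ ℕ.≤ n ℕ.* b
∣Σ<∣≤ zero    f b h = z≤n
∣Σ<∣≤ (suc n) f b h = begin
  ∣ Σ< n f + f n ∣        ≤⟨ ℤP.∣i+j∣≤∣i∣+∣j∣ (Σ< n f) (f n) ⟩
  ∣ Σ< n f ∣ ℕ.+ ∣ f n ∣  ≤⟨ ℕP.+-mono-≤ (∣Σ<∣≤ n f b (λ j p → h j (ℕP.m<n⇒m<1+n p))) (h n ℕP.≤-refl) ⟩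
  n ℕ.* b ℕ.+ b           ≡⟨ ℕP.+-comm (n ℕ.* b) b ⟩
  suc n ℕ.* b             ∎
  where open ℕP.≤-Reasoning

dot : ℕ → (ℕ → ℤ) → (ℕ → ℤ) → ℤ
dot n a x = Σ< n (λ j → a j * x j)

dot-cong : ∀ n {a b x y : ℕ → ℤ} → (∀ j → j ℕ.< n → a j ≡ b j) → (∀ j → j ℕ.< n → x j ≡ y j) → dot n a x ≡ dot n b y
dot-cong n p q = Σ<-cong n (λ j l → cong₂ _*_ (p j l) (q j l))

dot-+ʳ : ∀ n a x y → dot n a (λ j → x j + y j) ≡ dot n a x + dot n a y
dot-+ʳ n a x y = trans (Σ<-cong n (λ j _ → ℤP.*-distribˡ-+ (a j) (x j) (y j))) (Σ<-+ n _ _)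

private
  scale-swap : ∀ a c x → a * (c * x) ≡ c * (a * x)
  scale-swap = solve-∀

dot-*ʳ : ∀ n c a x → dot n a (λ j → c * x j) ≡ c * dot n a x
dot-*ʳ n c a x = trans (Σ<-cong n (λ j _ → scale-swap (a j) c (x j))) (Σ<-* n c _)

dot-+ˡ : ∀ n a b x → dot n (λ j → a j + b j) x ≡ dot n a x + dot n b x
dot-+ˡ n a b x = trans (Σ<-cong n (λ j _ → ℤP.*-distribʳ-+ (x j) (a j) (b j))) (Σ<-+ n _ _)

dot-*ˡ : ∀ n c a x → dot n (λ j → c * a j) x ≡ c * dot n a x
dot-*ˡ n c a x = trans (Σ<-cong n (λ j _ → ℤP.*-assoc c (a j) (x j))) (Σ<-* n c _)

∣dot∣≤ : ∀ n (a x : ℕ → ℤ) A b → (∀ j → j ℕ.< n → ∣ a j ∣ ℕ.≤ A) → (∀ j → j ℕ.< n → ∣ x j ∣ ℕ.≤ b) → ∣ dot n a x ∣ ℕ.≤ n ℕ.* (A ℕ.* b)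
∣dot∣≤ n a x A b p q = ∣Σ<∣≤ n (λ j → a j * x j) (A ℕ.* b) (λ j l → subst (ℕ._≤ A ℕ.* b) (sym (ℤP.abs-* (a j) (x j))) (ℕP.*-mono-≤ (p j l) (q j l)))

δ : ℕ → ℕ → ℤ
δ i j = if i ℕ.≡ᵇ j then 1ℤ else 0ℤ

δ-same : ∀ i → δ i i ≡ 1ℤ
δ-same zero    = refl
δ-same (suc i) = δ-same i

δ-diff : ∀ i j → i ≢ j → δ i j ≡ 0ℤ
δ-diff zero    zero    h = ⊥-elim (h refl)
δ-diff zero    (suc j) h = refl
δ-diff (suc i) zero    h = refl
δ-diff (suc i) (suc j) h = δ-diff i j (λ e → h (cong suc e))

∣δ∣≤1 : ∀ i j → ∣ δ i j ∣ ℕ.≤ 1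
∣δ∣≤1 i j with i ℕ.≡ᵇ j
... | true  = ℕP.≤-refl
... | false = z≤n

Σ<-δ-below : ∀ n i (x : ℕ → ℤ) → n ℕ.≤ i → dot n (δ i) x ≡ 0ℤ
Σ<-δ-below n i x n≤i = Σ<-zero n (λ j j<n → trans (cong (_* x j) (δ-diff i j (λ { refl → ℕP.<-irrefl refl (ℕP.<-≤-trans j<n n≤i) }))) (ℤP.*-zeroˡ (x j)))

dot-δ : ∀ n i (x : ℕ → ℤ) → i ℕ.< n → dot n (δ i) x ≡ x i
dot-δ (suc n) i x i<n with i ℕ.≟ n
... | yes refl = trans (cong₂ _+_ (Σ<-δ-below n n x ℕP.≤-refl) (trans (cong (_* x n) (δ-same n)) (ℤP.*-identityˡ (x n)))) (ℤP.+-identityˡ (x n))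
... | no i≢n = trans (cong₂ _+_ (dot-δ n i x (ℕP.≤∧≢⇒< (ℕP.≤-pred i<n) i≢n)) (trans (cong (_* x n) (δ-diff i n i≢n)) (ℤP.*-zeroˡ (x n)))) (ℤP.+-identityʳ (x i))

-- Appends one element at index `r` to a family indexed below `r`: the extra unknown of a linear
-- system, or the next tight row.
ext : {X : Set} → (ℕ → X) → ℕ → X → ℕ → X
ext a r x i = if i ℕ.<ᵇ r then a i else x

ext-old : ∀ {X : Set} (a : ℕ → X) r x i → i ℕ.< r → ext a r x i ≡ a i
ext-old a r x i p with i ℕ.<ᵇ r | ℕP.<⇒<ᵇ p
... | true | _ = refl

ext-new : ∀ {X : Set} (a : ℕ → X) r x → ext a r x r ≡ x
ext-new a r x with r ℕ.<ᵇ r in eq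
... | false = refl
... | true = ⊥-elim (ℕP.<-irrefl refl (ℕP.<ᵇ⇒< r r (subst IsTrue (sym eq) _)))

^-distribʳ-* : ∀ x y k → (x ℕ.* y) ^ k ≡ x ^ k ℕ.* y ^ k
^-distribʳ-* x y zero    = refl
^-distribʳ-* x y (suc k) = trans (cong (x ℕ.* y ℕ.*_) (^-distribʳ-* x y k)) (ℕ-interchange x y (x ^ k) (y ^ k))
  where
  ℕ-interchange : ∀ a b c d → a ℕ.* b ℕ.* (c ℕ.* d) ≡ a ℕ.* c ℕ.* (b ℕ.* d)
  ℕ-interchange = solveℕ

<suc-cases : ∀ {i ℓ} → i ℕ.< suc ℓ → i ≡ ℓ ⊎ i ℕ.< ℓ
<suc-cases {i} {ℓ} p with i ℕ.≟ ℓ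
... | yes e = inj₁ e
... | no ne = inj₂ (ℕP.≤∧≢⇒< (ℕP.≤-pred p) ne)

true≢false : true ≢ false
true≢false ()

-- Siegel's lemma

choice : ∀ {X : Set} n (P : ℕ → X → Set) → X → (∀ i → i ℕ.< n → Σ X (P i)) →
         Σ (ℕ → X) λ f → ∀ i → i ℕ.< n → P i (f i)
choice {X} n P x₀ h = f , f-ok
  where
  f : ℕ → X
  f i with i ℕ.<? n
  ... | yes p = proj₁ (h i p)
  ... | no _  = x₀
  f-ok : ∀ i → i ℕ.< n → P i (f i)
  f-ok i p with i ℕ.<? n
  ... | yes q = proj₂ (h i q)
  ... | no ¬q = ⊥-elim (¬q p)

funToFin-cong : ∀ {m n} {f g : Fin m → Fin n} → (∀ i → f i ≡ g i) → funToFin f ≡ funToFin g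
funToFin-cong {zero}  h = refl
funToFin-cong {suc m} h = cong₂ combine (h Fin.zero) (funToFin-cong (λ i → h (Fin.suc i)))

vec : ∀ {n h} → (Fin n → Fin h) → ℕ → ℤ
vec {n} w j with j ℕ.<? n
... | yes p = + toℕ (w (fromℕ< p))
... | no _  = 0ℤ

vec-at : ∀ {n h} (w : Fin n → Fin h) (i : Fin n) → vec w (toℕ i) ≡ + toℕ (w i)
vec-at {n} w i with toℕ i ℕ.<? n
... | yes p = cong (λ k → + toℕ (w k)) (FinP.fromℕ<-toℕ i p)
... | no ¬p = ⊥-elim (¬p (FinP.toℕ<n i))

∣vec∣≤ : ∀ {n h} (w : Fin n → Fin (suc h)) j → ∣ vec w j ∣ ℕ.≤ h
∣vec∣≤ {n} w j with j ℕ.<? n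
... | yes p = ℕP.≤-pred (FinP.toℕ<n (w (fromℕ< p)))
... | no _  = z≤n

-- The factor 2 comes from the coarse bound on a difference of two vectors with entries in `[0, h]`,
-- where `h = (2nA + 1)^n`. The number is opaque, so that it is used only through its defining
-- equation.
abstract
  siegelBound : ℕ → ℕ → ℕ
  siegelBound n A = 2 ℕ.* suc (2 ℕ.* n ℕ.* A) ^ n

  siegelBound-def : ∀ n A → siegelBound n A ≡ 2 ℕ.* suc (2 ℕ.* n ℕ.* A) ^ n
  siegelBound-def n A = refl

-∣∣≤ : ∀ x N → ∣ x ∣ ℕ.≤ N → 0ℤ ≤ x + + N
-∣∣≤ (+ x) N p = +≤+ z≤n
-∣∣≤ (-[1+ x ]) N p = subst (0ℤ ≤_) (sym (ℤP.⊖-≥ p)) (+≤+ z≤n)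

∣-∣≤ : ∀ x y → ∣ x - y ∣ ℕ.≤ ∣ x ∣ ℕ.+ ∣ y ∣
∣-∣≤ x y = ℤP.∣i-j∣≤∣i∣+∣j∣ x y

module Pigeonhole (n r A h Q : ℕ) (a : ℕ → ℕ → ℤ)
         (a≤A : ∀ i j → i ℕ.< r → j ℕ.< n → ∣ a i j ∣ ℕ.≤ A)
         (N<Q : n ℕ.* (A ℕ.* h) ℕ.+ n ℕ.* (A ℕ.* h) ℕ.< Q) (Qr<hn : Q ^ r ℕ.< suc h ^ n) where
  private
    N : ℕ
    N = n ℕ.* (A ℕ.* h)

    w : Fin (suc h ^ n) → Fin n → Fin (suc h)
    w x = finToFun x

    val : Fin (suc h ^ n) → ℕ → ℤ
    val x i = dot n (a i) (vec (w x)) + + N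

    val≤ : ∀ x i → i ℕ.< r → ∣ dot n (a i) (vec (w x)) ∣ ℕ.≤ N
    val≤ x i p = ∣dot∣≤ n (a i) (vec (w x)) A h (λ j q → a≤A i j p q) (λ j _ → ∣vec∣≤ (w x) j)

    val<Q : ∀ x i → i ℕ.< r → ∣ val x i ∣ ℕ.< Q
    val<Q x i p = ℕP.≤-<-trans (ℕP.≤-trans (ℤP.∣i+j∣≤∣i∣+∣j∣ (dot n (a i) (vec (w x))) (+ N)) (ℕP.+-monoˡ-≤ N (val≤ x i p))) N<Q

    img : Fin (suc h ^ n) → Fin r → Fin Q
    img x i = fromℕ< (val<Q x (toℕ i) (FinP.toℕ<n i))

    nonneg-abs : ∀ {x y} → 0ℤ ≤ x → 0ℤ ≤ y → ∣ x ∣ ≡ ∣ y ∣ → x ≡ y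
    nonneg-abs {+ x} {+ y} _ _ e = cong +_ e

    +-cancelʳ : ∀ x y z → x + z ≡ y + z → x ≡ y
    +-cancelʳ x y z e = trans (back x z) (trans (cong (_- z) e) (sym (back y z)))
      where
      back : ∀ x z → x ≡ (x + z) - z
      back = solve-∀

    diff : ∀ {x y} → x Fin.< y → ¬ (∀ k → w x k ≡ w y k)
    diff {x} {y} x<y e = FinP.<⇒≢ x<y (trans (sym (FinP.funToFin-finToFin {n} {suc h} x)) (trans (funToFin-cong e) (FinP.funToFin-finToFin {n} {suc h} y)))

    negdot : ∀ x y → dot n x (λ j → - y j) ≡ - dot n x y
    negdot x y = trans (Σ<-cong n (λ j _ → cong (x j *_) (sym (ℤP.-1*i≡-i (y j))))) (trans (dot-*ʳ n (- 1ℤ) x y) (ℤP.-1*i≡-i _))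

  -- Adding `N` makes all values of the `r` forms on the box `[0, h]^n` natural numbers below `Q`.
  -- With fewer than `(h+1)^n` value tuples two box vectors agree in all forms, and their difference
  -- is the kernel vector.
  kernelVector : ∃ λ v → (∃ λ j → j ℕ.< n × v j ≢ 0ℤ) × (∀ j → ∣ v j ∣ ℕ.≤ 2 ℕ.* h) × (∀ i → i ℕ.< r → dot n (a i) v ≡ 0ℤ)
  kernelVector with FinP.pigeonhole Qr<hn (λ x → funToFin (img x))
  ... | x , y , x<y , e with FinP.any? (λ k → ¬? (w x k Fin.≟ w y k))
  ... | no ¬k = ⊥-elim (diff x<y (λ k → decidable-stable (w x k Fin.≟ w y k) (λ z → ¬k (k , z))))
  ... | yes (k , wk) = v , (toℕ k , FinP.toℕ<n k , v≢0) , vb , v0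
    where
    v : ℕ → ℤ
    v j = vec (w x) j - vec (w y) j
    v≢0 : v (toℕ k) ≢ 0ℤ
    v≢0 eq = wk (FinP.toℕ-injective (ℤP.+-injective (trans (sym (vec-at (w x) k)) (trans (ℤP.i-j≡0⇒i≡j _ _ eq) (vec-at (w y) k)))))
    vb : ∀ j → ∣ v j ∣ ℕ.≤ 2 ℕ.* h
    vb j = ℕP.≤-trans (∣-∣≤ (vec (w x) j) (vec (w y) j)) (ℕP.+-mono-≤ (∣vec∣≤ (w x) j) (ℕP.≤-trans (∣vec∣≤ (w y) j) (ℕP.≤-reflexive (sym (ℕP.+-identityʳ h)))))
    img≡ : ∀ i → img x i ≡ img y i
    img≡ i = trans (sym (FinP.finToFun-funToFin (img x) i)) (trans (cong (λ z → finToFun {Q} {r} z i) e) (FinP.finToFun-funToFin (img y) i))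
    val≡ : ∀ i → i ℕ.< r → dot n (a i) (vec (w x)) ≡ dot n (a i) (vec (w y))
    val≡ i p = +-cancelʳ (dot n (a i) (vec (w x))) (dot n (a i) (vec (w y))) (+ N) (nonneg-abs {val x i} {val y i} (-∣∣≤ (dot n (a i) (vec (w x))) N (val≤ x i p)) (-∣∣≤ (dot n (a i) (vec (w y))) N (val≤ y i p)) abs≡)
      where
      abs≡ : ∣ val x i ∣ ≡ ∣ val y i ∣
      abs≡ = subst (λ k → ∣ val x k ∣ ≡ ∣ val y k ∣) (FinP.toℕ-fromℕ< p) (trans (sym (FinP.toℕ-fromℕ< _)) (trans (cong toℕ (img≡ (fromℕ< p))) (FinP.toℕ-fromℕ< _)))
    v0 : ∀ i → i ℕ.< r → dot n (a i) v ≡ 0ℤ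
    v0 i p = trans (dot-+ʳ n (a i) (vec (w x)) (λ j → - vec (w y) j)) (trans (cong₂ _+_ (val≡ i p) (negdot (a i) (vec (w y)))) (ℤP.+-inverseʳ (dot n (a i) (vec (w y)))))

-- With `c = 2nA + 1` and `h = c^n`, a form takes at most `2nAh + 1 ≤ c (h+1)` values. The tuples
-- number at most `c^r (h+1)^r ≤ h (h+1)^r < (h+1)^(r+1) ≤ (h+1)^n`, so the same `h` serves every `r
-- < n`.
siegel : ∀ n r A (a : ℕ → ℕ → ℤ) → r ℕ.< n → (∀ i j → i ℕ.< r → j ℕ.< n → ∣ a i j ∣ ℕ.≤ A) →
  ∃ λ v → (∃ λ j → j ℕ.< n × v j ≢ 0ℤ) × (∀ j → ∣ v j ∣ ℕ.≤ siegelBound n A) × (∀ i → i ℕ.< r → dot n (a i) v ≡ 0ℤ)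
siegel n r A a r<n a≤A = subst (λ b → ∃ λ v → (∃ λ j → j ℕ.< n × v j ≢ 0ℤ) × (∀ j → ∣ v j ∣ ℕ.≤ b) × (∀ i → i ℕ.< r → dot n (a i) v ≡ 0ℤ)) (sym (siegelBound-def n A)) (Pigeonhole.kernelVector n r A (suc (2 ℕ.* n ℕ.* A) ^ n) _ a a≤A ℕP.≤-refl
  (bound (suc (2 ℕ.* n ℕ.* A)) (suc (2 ℕ.* n ℕ.* A) ^ n) refl refl))
  where
  lem : ∀ n A h → n ℕ.* (A ℕ.* h) ℕ.+ n ℕ.* (A ℕ.* h) ≡ 2 ℕ.* n ℕ.* A ℕ.* h
  lem = solveℕ
  bound : ∀ c h → c ≡ suc (2 ℕ.* n ℕ.* A) → h ≡ c ^ n → suc (n ℕ.* (A ℕ.* h) ℕ.+ n ℕ.* (A ℕ.* h)) ^ r ℕ.< suc h ^ n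
  bound c h refl e = begin-strict
    Q ^ r                      ≤⟨ ℕP.^-monoˡ-≤ r Q≤ ⟩
    (c ℕ.* suc h) ^ r          ≡⟨ ^-distribʳ-* c (suc h) r ⟩
    c ^ r ℕ.* suc h ^ r        ≤⟨ ℕP.*-monoˡ-≤ (suc h ^ r) (ℕP.^-monoʳ-≤ c (ℕP.<⇒≤ r<n)) ⟩
    c ^ n ℕ.* suc h ^ r        ≡⟨ cong (ℕ._* suc h ^ r) (sym e) ⟩
    h ℕ.* suc h ^ r            <⟨ ℕP.*-monoˡ-< (suc h ^ r) {{ℕP.m^n≢0 (suc h) r}} (ℕP.n<1+n h) ⟩
    suc h ^ suc r              ≤⟨ ℕP.^-monoʳ-≤ (suc h) r<n ⟩
    suc h ^ n                  ∎
    where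
    open ℕP.≤-Reasoning
    N = n ℕ.* (A ℕ.* h)
    Q = suc (N ℕ.+ N)
    Q≤ : Q ℕ.≤ c ℕ.* suc h
    Q≤ = s≤s (begin
      N ℕ.+ N                      ≡⟨ lem n A h ⟩
      2 ℕ.* n ℕ.* A ℕ.* h          ≤⟨ ℕP.*-monoʳ-≤ (2 ℕ.* n ℕ.* A) (ℕP.n≤1+n h) ⟩
      2 ℕ.* n ℕ.* A ℕ.* suc h      ≤⟨ ℕP.m≤n+m _ h ⟩
      h ℕ.+ 2 ℕ.* n ℕ.* A ℕ.* suc h ∎)

-- The witnesses v make the linear forms a 0, …, a (r-1) independent.
record Triangular (n r : ℕ) (a v : ℕ → ℕ → ℤ) : Set where
  field
    upper    : ∀ i l → i ℕ.< l → l ℕ.< r → dot n (a i) (v l) ≡ 0ℤ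
    diagonal : ∀ l → l ℕ.< r → dot n (a l) (v l) ≢ 0ℤ

combine-dot : ∀ n r (μ : ℕ → ℤ) (a : ℕ → ℕ → ℤ) (x : ℕ → ℤ) →
              dot n (λ j → Σ< r (λ l → μ l * a l j)) x ≡ Σ< r (λ l → μ l * dot n (a l) x)
combine-dot n r μ a x = trans (Σ<-cong n (λ j _ → trans (ℤP.*-comm _ (x j)) (sym (Σ<-* r (x j) (λ l → μ l * a l j)))))
  (trans (Σ<-swap n r (λ j l → x j * (μ l * a l j)))
    (Σ<-cong r (λ l _ → trans (Σ<-cong n (λ j _ → lem (x j) (μ l) (a l j))) (Σ<-* n (μ l) (λ j → a l j * x j)))))
  where
  lem : ∀ x m a → x * (m * a) ≡ m * (a * x)
  lem = solve-∀

-- Pairing the relation with the last witness `v r` kills every term except the last one, by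
-- `upper`; `diagonal` then forces the last coefficient to vanish, and the shorter relation is
-- treated in the same way.
independent : ∀ n r a v → Triangular n r a v → (μ : ℕ → ℤ) →
              (∀ j → j ℕ.< n → Σ< r (λ l → μ l * a l j) ≡ 0ℤ) → ∀ l → l ℕ.< r → μ l ≡ 0ℤ
independent n (suc r) a v tri μ h l l<r = go l (ℕP.≤-pred l<r)
  where
  open Triangular tri
  eq : Σ< (suc r) (λ i → μ i * dot n (a i) (v r)) ≡ 0ℤ
  eq = trans (sym (combine-dot n (suc r) μ a (v r))) (Σ<-zero n (λ j p → trans (cong (_* v r j) (h j p)) (ℤP.*-zeroˡ (v r j))))
  low0 : Σ< r (λ i → μ i * dot n (a i) (v r)) ≡ 0ℤ
  low0 = Σ<-zero r (λ i p → trans (cong (μ i *_) (upper i r p ℕP.≤-refl)) (ℤP.*-zeroʳ (μ i)))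
  top0 : μ r * dot n (a r) (v r) ≡ 0ℤ
  top0 = trans (sym (ℤP.+-identityˡ _)) (trans (cong (_+ μ r * dot n (a r) (v r)) (sym low0)) eq)
  μr0 : μ r ≡ 0ℤ
  μr0 with ℤP.i*j≡0⇒i≡0∨j≡0 (μ r) top0
  ... | inj₁ e = e
  ... | inj₂ e = ⊥-elim (diagonal r ℕP.≤-refl e)
  tri' : Triangular n r a v
  tri' = record { upper = λ i l p q → upper i l p (ℕP.m<n⇒m<1+n q) ; diagonal = λ l q → diagonal l (ℕP.m<n⇒m<1+n q) }
  h' : ∀ j → j ℕ.< n → Σ< r (λ l → μ l * a l j) ≡ 0ℤ
  h' j p = trans (sym (ℤP.+-identityʳ _)) (trans (cong (λ z → Σ< r (λ l → μ l * a l j) + z) (sym (trans (cong (_* a r j) μr0) (ℤP.*-zeroˡ (a r j))))) (h j p))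
  go : ∀ l → l ℕ.≤ r → μ l ≡ 0ℤ
  go l l≤r with l ℕ.≟ r
  ... | yes refl = μr0
  ... | no l≢r = independent n r a v tri' μ h' l (ℕP.≤∧≢⇒< l≤r l≢r)

-- Bounded inverses of triangular systems

RowInverse : ℕ → (ℕ → ℕ → ℤ) → ℕ → ℕ → (ℕ → ℤ) → Set
RowInverse n a i g μ = ∀ j → j ℕ.< n → Σ< n (λ l → μ l * a l j) ≡ + g * δ i j

BoundedRowInverse : ℕ → (ℕ → ℕ → ℤ) → ℕ → ℕ → ℕ × (ℕ → ℤ) → Set
BoundedRowInverse n a H i (g , μ) = 1 ℕ.≤ g × g ℕ.≤ H × (∀ l → ∣ μ l ∣ ℕ.≤ H) × RowInverse n a i g μ

module _ (n A H : ℕ) (a v : ℕ → ℕ → ℤ) (tri : Triangular n n a v) (i : ℕ) (w : ℕ → ℤ)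
         (wb : ∀ j → ∣ w j ∣ ℕ.≤ H)
         (w0 : ∀ j → j ℕ.< n → dot (suc n) (ext (λ l → a l j) n (- δ i j)) w ≡ 0ℤ)
         (k : ℕ) (k<n : k ℕ.< suc n) (wk : w k ≢ 0ℤ) where
  private
    lem : ∀ s t g → s + (- t) * g ≡ 0ℤ → s ≡ g * t
    lem s t g e = trans (id1 s t g) (trans (cong (_+ g * t) e) (ℤP.+-identityˡ (g * t)))
      where
      id1 : ∀ s t g → s ≡ (s + (- t) * g) + g * t
      id1 = solve-∀
    rel : ∀ j → j ℕ.< n → Σ< n (λ l → w l * a l j) ≡ w n * δ i j
    rel j p = lem _ (δ i j) (w n) (trans (cong₂ _+_ (Σ<-cong n (λ l q → trans (ℤP.*-comm (w l) (a l j)) (cong (_* w l) (sym (ext-old (λ l → a l j) n (- δ i j) l q))))) (cong (_* w n) (sym (ext-new (λ l → a l j) n (- δ i j))))) (w0 j p))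
    negrel : ∀ j → j ℕ.< n → Σ< n (λ l → (- w l) * a l j) ≡ (- w n) * δ i j
    negrel j p = trans (Σ<-cong n (λ l _ → lem2 (w l) (a l j))) (trans (Σ<-* n (- 1ℤ) (λ l → w l * a l j)) (trans (cong (- 1ℤ *_) (rel j p)) (sym (lem2 (w n) (δ i j)))))
      where
      lem2 : ∀ x y → (- x) * y ≡ - 1ℤ * (x * y)
      lem2 = solve-∀

  -- The last coordinate of the kernel vector is the denominator. If it were zero, the other
  -- coordinates would be a relation between independent rows and the whole vector would vanish. A
  -- negative sign is moved into the row.
  kernel⇒rowInverse : ∀ g → w n ≡ g → Σ (ℕ × (ℕ → ℤ)) (BoundedRowInverse n a H i)
  kernel⇒rowInverse (+ zero) e = ⊥-elim (wk (allzero k (ℕP.≤-pred k<n)))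
    where
    μ0 : ∀ l → l ℕ.< n → w l ≡ 0ℤ
    μ0 = independent n n a v tri w (λ j p → trans (rel j p) (trans (cong (_* δ i j) e) (ℤP.*-zeroˡ (δ i j))))
    allzero : ∀ k → k ℕ.≤ n → w k ≡ 0ℤ
    allzero k p with k ℕ.≟ n
    ... | yes refl = e
    ... | no ne = μ0 k (ℕP.≤∧≢⇒< p ne)
  kernel⇒rowInverse (+ suc g) e = (suc g , w) , s≤s z≤n , subst (λ z → ∣ z ∣ ℕ.≤ H) e (wb n) , wb , λ j p → trans (rel j p) (cong (_* δ i j) e)
  kernel⇒rowInverse -[1+ g ] e = (suc g , (λ l → - w l)) , s≤s z≤n , subst (λ z → ∣ z ∣ ℕ.≤ H) e (wb n) , (λ l → subst (ℕ._≤ H) (sym (ℤP.∣-i∣≡∣i∣ (w l))) (wb l)) , λ j p → trans (negrel j p) (cong (λ z → (- z) * δ i j) e)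

-- Siegel's lemma takes the place of Cramer's rule: the `n` equations
-- `Σ μ l * a l j - g * δ i j = 0` in the `n + 1` unknowns `μ`, `g` have a short nonzero solution.
rowInverse : ∀ n A a v → Triangular n n a v → 1 ℕ.≤ A → (∀ i j → i ℕ.< n → j ℕ.< n → ∣ a i j ∣ ℕ.≤ A) →
  ∀ i → Σ (ℕ × (ℕ → ℤ)) (BoundedRowInverse n a (siegelBound (suc n) A) i)
rowInverse n A a v tri 1≤A a≤A i = fin (siegel (suc n) n A b ℕP.≤-refl b≤A)
  where
  b : ℕ → ℕ → ℤ
  b j = ext (λ l → a l j) n (- δ i j)
  b≤A : ∀ j l → j ℕ.< n → l ℕ.< suc n → ∣ b j l ∣ ℕ.≤ A
  b≤A j l p q with l ℕ.<ᵇ n in e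
  ... | true  = a≤A l j (ℕP.<ᵇ⇒< l n (subst IsTrue (sym e) _)) p
  ... | false = ℕP.≤-trans (subst (ℕ._≤ 1) (sym (ℤP.∣-i∣≡∣i∣ (δ i j))) (∣δ∣≤1 i j)) 1≤A
  fin : (∃ λ v → (∃ λ j → j ℕ.< suc n × v j ≢ 0ℤ) × (∀ j → ∣ v j ∣ ℕ.≤ siegelBound (suc n) A) × (∀ i → i ℕ.< n → dot (suc n) (b i) v ≡ 0ℤ)) →
        Σ (ℕ × (ℕ → ℤ)) (BoundedRowInverse n a (siegelBound (suc n) A) i)
  fin (w , (k , k<n , wk) , wb , w0) = kernel⇒rowInverse n A (siegelBound (suc n) A) a v tri i w wb w0 k k<n wk (w n) refl

commonMultiple : ∀ n (f : ℕ → ℕ) b → 1 ℕ.≤ b → (∀ i → i ℕ.< n → 1 ℕ.≤ f i × f i ℕ.≤ b) →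
  ∃ λ G → 1 ℕ.≤ G × G ℕ.≤ b ^ n × (∀ i → i ℕ.< n → ∃ λ h → h ℕ.* f i ≡ G)
commonMultiple zero f b 1≤b h = 1 , ℕP.≤-refl , ℕP.≤-refl , λ _ ()
commonMultiple (suc n) f b 1≤b h with commonMultiple n f b 1≤b (λ i p → h i (ℕP.m<n⇒m<1+n p))
... | G , 1≤G , G≤ , c = f n ℕ.* G , ℕP.*-mono-≤ (proj₁ (h n ℕP.≤-refl)) 1≤G , ℕP.*-mono-≤ (proj₂ (h n ℕP.≤-refl)) G≤ , c'
  where
  c' : ∀ i → i ℕ.< suc n → ∃ λ h → h ℕ.* f i ≡ f n ℕ.* G
  c' i p with i ℕ.≟ n
  ... | yes refl = G , ℕP.*-comm G (f n)
  ... | no ne with c i (ℕP.≤∧≢⇒< (ℕP.≤-pred p) ne)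
  ... | x , e = f n ℕ.* x , trans (ℕP.*-assoc (f n) x (f i)) (cong (f n ℕ.*_) e)

cofactor≤ : ∀ h f G → 1 ℕ.≤ f → h ℕ.* f ≡ G → h ℕ.≤ G
cofactor≤ h f G 1≤f refl = ℕP.≤-trans (ℕP.≤-reflexive (sym (ℕP.*-identityʳ h))) (ℕP.*-monoʳ-≤ h 1≤f)

-- The common denominator is the product of the `n` row denominators, hence the bound `H ^ n`.
-- Scaling each row by its cofactor gives the additional factor `H` for the entries.
inverse : ∀ n A a v → Triangular n n a v → 1 ℕ.≤ A → (∀ i j → i ℕ.< n → j ℕ.< n → ∣ a i j ∣ ℕ.≤ A) →
  let H = siegelBound (suc n) A in
  Σ ℕ λ g → Σ (ℕ → ℕ → ℤ) λ M → 1 ℕ.≤ g × g ℕ.≤ H ^ n × (∀ i l → i ℕ.< n → ∣ M i l ∣ ℕ.≤ H ^ n ℕ.* H) ×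
    (∀ i → i ℕ.< n → RowInverse n a i g (M i))
inverse n A a v tri 1≤A a≤A = G , (λ i l → + h i * μ i l) , 1≤G , G≤ , Mb , Mok
  where
  H = siegelBound (suc n) A
  ch = choice n (BoundedRowInverse n a H) (1 , λ _ → 0ℤ) (λ i _ → rowInverse n A a v tri 1≤A a≤A i)
  gs : ℕ → ℕ
  gs i = proj₁ (proj₁ ch i)
  μ : ℕ → ℕ → ℤ
  μ i = proj₂ (proj₁ ch i)
  ok = proj₂ ch
  1≤H : 1 ℕ.≤ H
  1≤H = subst (1 ℕ.≤_) (sym (siegelBound-def (suc n) A)) (ℕP.*-mono-≤ {1} {2} (s≤s z≤n) (ℕP.m^n>0 (suc (2 ℕ.* suc n ℕ.* A)) (suc n)))
  cm = commonMultiple n gs H 1≤H (λ i p → proj₁ (ok i p) , proj₁ (proj₂ (ok i p)))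
  G = proj₁ cm
  1≤G = proj₁ (proj₂ cm)
  G≤ = proj₁ (proj₂ (proj₂ cm))
  hs = choice n (λ i h → h ℕ.* gs i ≡ G) 0 (proj₂ (proj₂ (proj₂ cm)))
  h = proj₁ hs
  Mb : ∀ i l → i ℕ.< n → ∣ + h i * μ i l ∣ ℕ.≤ H ^ n ℕ.* H
  Mb i l p = subst (ℕ._≤ H ^ n ℕ.* H) (sym (ℤP.abs-* (+ h i) (μ i l))) (ℕP.*-mono-≤ (ℕP.≤-trans (cofactor≤ (h i) (gs i) G (proj₁ (ok i p)) (proj₂ hs i p)) G≤) (proj₁ (proj₂ (proj₂ (ok i p))) l))
  Mok : ∀ i → i ℕ.< n → RowInverse n a i G (λ l → + h i * μ i l)
  Mok i p j q = trans (Σ<-cong n (λ l _ → ℤP.*-assoc (+ h i) (μ i l) (a l j))) (trans (Σ<-* n (+ h i) _) (trans (cong (+ h i *_) (proj₂ (proj₂ (proj₂ (ok i p))) j q))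
     (trans (sym (ℤP.*-assoc (+ h i) (+ gs i) (δ i j))) (cong (_* δ i j) (trans (sym (ℤP.pos-* (h i) (gs i))) (cong +_ (proj₂ hs i p)))))))

-- Periods of powers of two

-- X divides 2^b - 1 up to a power of two; y stands for 2^b - 1.
record Per (X b : ℕ) : Set where
  constructor mkPer
  field
    y a     : ℕ
    y-def   : suc y ≡ 2 ^ b
    divisor : X ℕD.∣ 2 ^ a ℕ.* y

-- The geometric sum `1 + (1+y) + ... + (1+y)^(k-1)`, that is `((1+y)^k - 1) / y`.
geo : ℕ → ℕ → ℕ
geo y zero    = 0
geo y (suc k) = suc (suc y ℕ.* geo y k)

geo-pow : ∀ y k → suc (y ℕ.* geo y k) ≡ suc y ^ k
geo-pow y zero    = cong suc (ℕP.*-zeroʳ y)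
geo-pow y (suc k) = trans (lem y (geo y k)) (cong (suc y ℕ.*_) (geo-pow y k))
  where
  lem : ∀ y g → 1 ℕ.+ y ℕ.* (1 ℕ.+ (1 ℕ.+ y) ℕ.* g) ≡ (1 ℕ.+ y) ℕ.* (1 ℕ.+ y ℕ.* g)
  lem = solveℕ

-- The sum has `k` terms, each congruent to 1 modulo `y`.
geo-mod : ∀ y k → ∃ λ e → geo y k ≡ k ℕ.+ y ℕ.* e
geo-mod y zero    = 0 , sym (ℕP.*-zeroʳ y)
geo-mod y (suc k) with geo-mod y k
... | e , eq = k ℕ.+ e ℕ.+ y ℕ.* e , trans (cong (λ g → suc (suc y ℕ.* g)) eq) (lem y k e)
  where
  lem : ∀ y k e → 1 ℕ.+ (1 ℕ.+ y) ℕ.* (k ℕ.+ y ℕ.* e) ≡ 1 ℕ.+ k ℕ.+ y ℕ.* (k ℕ.+ e ℕ.+ y ℕ.* e)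
  lem = solveℕ

∣-geo : ∀ X y a → X ℕD.∣ 2 ^ a ℕ.* y → X ℕD.∣ 2 ^ a ℕ.* geo y X
∣-geo X y a d with geo-mod y X
... | e , eq = subst (X ℕD.∣_) (sym (trans (cong (2 ^ a ℕ.*_) eq) (lem (2 ^ a) X y e)))
    (ℕD.∣m∣n⇒∣m+n (ℕD.n∣m*n (2 ^ a)) (ℕD.∣m⇒∣m*n e d))
  where
  lem : ∀ p X y e → p ℕ.* (X ℕ.+ y ℕ.* e) ≡ p ℕ.* X ℕ.+ p ℕ.* y ℕ.* e
  lem = solveℕ

-- For `y = 2^b - 1` one has `2^(bX) - 1 = y * geo y X`. Up to powers of two, `Y` divides the first
-- factor, and `X` divides the second because it divides both `y` and the number `X` of summands.
Per-* : ∀ {X Y b} → Per X b → Per Y b → Per (X ℕ.* Y) (b ℕ.* X)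
Per-* {X} {Y} {b} (mkPer y a e d) (mkPer y' a' e' d') =
  mkPer (y ℕ.* geo y X) (a ℕ.+ a') (trans (geo-pow y X) (trans (cong (_^ X) e) (ℕP.^-*-assoc 2 b X))) (
  subst ((X ℕ.* Y) ℕD.∣_) eq (ℕD.*-pres-∣ (∣-geo X y a d) d''))
  where
  y≡ : y' ≡ y
  y≡ = ℕP.suc-injective (trans e' (sym e))
  d'' : Y ℕD.∣ 2 ^ a' ℕ.* y
  d'' = subst (λ z → Y ℕD.∣ 2 ^ a' ℕ.* z) y≡ d'
  lem : ∀ p g q y → p ℕ.* g ℕ.* (q ℕ.* y) ≡ p ℕ.* q ℕ.* (y ℕ.* g)
  lem = solveℕ
  eq : 2 ^ a ℕ.* geo y X ℕ.* (2 ^ a' ℕ.* y) ≡ 2 ^ (a ℕ.+ a') ℕ.* (y ℕ.* geo y X)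
  eq = trans (lem (2 ^ a) (geo y X) (2 ^ a') y) (cong (ℕ._* (y ℕ.* geo y X)) (sym (ℕP.^-distribˡ-+-* 2 a a')))

Per-mono : ∀ {X b} c → Per X b → Per X (b ℕ.* c)
Per-mono {X} {b} c (mkPer y a e d) = mkPer (y ℕ.* geo y c) a (trans (geo-pow y c) (trans (cong (_^ c) e) (ℕP.^-*-assoc 2 b c)))
  (subst (X ℕD.∣_) (ℕP.*-assoc (2 ^ a) y (geo y c)) (ℕD.∣m⇒∣m*n (geo y c) d))

Per-double : ∀ {X b} → Per X b → Per (2 ℕ.* X) b
Per-double {X} (mkPer y a e d) = mkPer y (suc a) e (subst (2 ℕ.* X ℕD.∣_) (sym (ℕP.*-assoc 2 (2 ^ a) y)) (ℕD.*-monoʳ-∣ 2 d))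

⌊/2⌋-double : ∀ n → ⌊ n /2⌋ ℕ.+ ⌊ n /2⌋ ℕ.≤ n
⌊/2⌋-double n = ℕP.≤-trans (ℕP.+-monoʳ-≤ ⌊ n /2⌋ (ℕP.⌊n/2⌋≤⌈n/2⌉ n)) (ℕP.≤-reflexive (ℕP.⌊n/2⌋+⌈n/2⌉≡n n))

-- Counting residues up to sign gives a period 2r with r ≤ G/2; the halving keeps iterated periods short.
halfPeriod : ∀ G → 2 ℕ.≤ G → ∃ λ r → 1 ℕ.≤ r × r ℕ.≤ ⌊ G /2⌋ × Per G (2 ℕ.* r)
halfPeriod G 2≤G with FinP.any? {suc ⌊ G /2⌋} (λ i → G ℕD.∣? 2 ^ toℕ i)
-- Here `G` divides a power of two, so every period is admissible; `3 = 2^2 - 1` belongs to `r = 1`.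
... | yes (i , d) = 1 , ℕP.≤-refl , ℕP.⌊n/2⌋-mono 2≤G , mkPer 3 (toℕ i) refl (ℕD.∣m⇒∣m*n 3 d)
... | no ¬d = go (FinP.pigeonhole (ℕP.n<1+n h) cls)
  where
  h = ⌊ G /2⌋
  instance
    nz : NonZero G
    nz = ℕ.>-nonZero (ℕP.<-trans (s≤s z≤n) 2≤G)
  x : ℕ → ℕ
  x i = 2 ^ i % G
  x<G : ∀ i → x i ℕ.< G
  x<G i = m%n<n (2 ^ i) G
  x>0 : ∀ (i : Fin (suc h)) → 1 ℕ.≤ x (toℕ i)
  x>0 i with x (toℕ i) in e
  ... | zero = ⊥-elim (¬d (i , ℕD.m%n≡0⇒n∣m (2 ^ toℕ i) G e))
  ... | suc _ = s≤s z≤n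
  -- The residue up to sign. It lies between 1 and `h`, so the `h + 1` exponents `0, ..., h` fall
  -- into `h` classes.
  c : ℕ → ℕ
  c i = x i ⊓ (G ∸ x i)
  c≥1 : ∀ (i : Fin (suc h)) → 1 ℕ.≤ c (toℕ i)
  c≥1 i = ℕP.⊓-glb (x>0 i) (ℕP.m<n⇒0<n∸m (x<G (toℕ i)))
  c≤h : ∀ i → c i ℕ.≤ h
  c≤h i = subst (ℕ._≤ h) (sym (ℕP.n≡⌊n+n/2⌋ (c i))) (ℕP.⌊n/2⌋-mono (ℕP.≤-trans (ℕP.+-mono-≤ (ℕP.m⊓n≤m (x i) (G ∸ x i)) (ℕP.m⊓n≤n (x i) (G ∸ x i))) (ℕP.≤-reflexive (ℕP.m+[n∸m]≡n (ℕP.<⇒≤ (x<G i))))))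
  c<h : ∀ (i : Fin (suc h)) → ℕ.pred (c (toℕ i)) ℕ.< h
  c<h i = ℕP.≤-trans (ℕP.≤-reflexive (ℕP.suc-pred (c (toℕ i)) {{ℕ.>-nonZero (c≥1 i)}})) (c≤h (toℕ i))
  cls : Fin (suc h) → Fin h
  cls i = fromℕ< (c<h i)
  case : ∀ i j → c i ≡ c j → x i ≡ x j ⊎ x i ℕ.+ x j ≡ G
  case i j e with ℕP.⊓-sel (x i) (G ∸ x i) | ℕP.⊓-sel (x j) (G ∸ x j)
  ... | inj₁ p | inj₁ q = inj₁ (trans (sym p) (trans e q))
  ... | inj₁ p | inj₂ q = inj₂ (trans (cong (ℕ._+ x j) (trans (sym p) (trans e q))) (ℕP.m∸n+n≡m (ℕP.<⇒≤ (x<G j))))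
  ... | inj₂ p | inj₁ q = inj₂ (trans (cong (x i ℕ.+_) (trans (sym q) (trans (sym e) p))) (ℕP.m+[n∸m]≡n (ℕP.<⇒≤ (x<G i))))
  ... | inj₂ p | inj₂ q = inj₁ (ℕP.∸-cancelˡ-≡ (ℕP.<⇒≤ (x<G i)) (ℕP.<⇒≤ (x<G j)) (trans (sym p) (trans e q)))
  split : ∀ i → 2 ^ i ≡ x i ℕ.+ 2 ^ i / G ℕ.* G
  split i = m≡m%n+[m/n]*n (2 ^ i) G
  divides-diff : ∀ i r y → suc y ≡ 2 ^ r → x i ≡ x (i ℕ.+ r) → G ℕD.∣ 2 ^ i ℕ.* y
  divides-diff i r y ey e = ℕD.∣m+n∣m⇒∣n (subst (G ℕD.∣_) eq (ℕD.n∣m*n (2 ^ (i ℕ.+ r) / G))) (ℕD.n∣m*n (2 ^ i / G))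
    where
    lem : ∀ p y → p ℕ.* (1 ℕ.+ y) ≡ p ℕ.+ p ℕ.* y
    lem = solveℕ
    eq : 2 ^ (i ℕ.+ r) / G ℕ.* G ≡ 2 ^ i / G ℕ.* G ℕ.+ 2 ^ i ℕ.* y
    eq = ℕP.+-cancelˡ-≡ (x i) _ _ (trans (cong (ℕ._+ 2 ^ (i ℕ.+ r) / G ℕ.* G) e) (trans (sym (split (i ℕ.+ r)))
           (trans (ℕP.^-distribˡ-+-* 2 i r) (trans (cong (2 ^ i ℕ.*_) (sym ey)) (trans (lem (2 ^ i) y) (trans (cong (ℕ._+ 2 ^ i ℕ.* y) (split i)) (ℕP.+-assoc (x i) _ _)))))))
  divides-sum : ∀ i r y → suc y ≡ 2 ^ r → x i ℕ.+ x (i ℕ.+ r) ≡ G → G ℕD.∣ 2 ^ i ℕ.* (2 ℕ.+ y)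
  divides-sum i r y ey e = subst (G ℕD.∣_) eq (ℕD.∣m∣n⇒∣m+n (ℕD.∣m∣n⇒∣m+n (ℕD.∣-refl {G}) (ℕD.n∣m*n (2 ^ i / G))) (ℕD.n∣m*n (2 ^ (i ℕ.+ r) / G)))
    where
    lem : ∀ p y → p ℕ.+ p ℕ.* (1 ℕ.+ y) ≡ p ℕ.* (2 ℕ.+ y)
    lem = solveℕ
    lem' : ∀ a b c d → a ℕ.+ b ℕ.+ c ℕ.+ d ≡ (a ℕ.+ c) ℕ.+ (b ℕ.+ d)
    lem' = solveℕ
    eq : G ℕ.+ 2 ^ i / G ℕ.* G ℕ.+ 2 ^ (i ℕ.+ r) / G ℕ.* G ≡ 2 ^ i ℕ.* (2 ℕ.+ y)
    eq = trans (cong (λ z → z ℕ.+ 2 ^ i / G ℕ.* G ℕ.+ 2 ^ (i ℕ.+ r) / G ℕ.* G) (sym e))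
           (trans (lem' (x i) (x (i ℕ.+ r)) (2 ^ i / G ℕ.* G) (2 ^ (i ℕ.+ r) / G ℕ.* G))
             (trans (cong₂ ℕ._+_ (sym (split i)) (trans (sym (split (i ℕ.+ r))) (trans (ℕP.^-distribˡ-+-* 2 i r) (cong (2 ^ i ℕ.*_) (sym ey))))) (lem (2 ^ i) y)))
  -- The factor `y = 2^r - 1` handles equal residues and `y + 2 = 2^r + 1` handles opposite ones.
  -- Their product `2^(2r) - 1` covers both cases with one period.
  per : ∀ i r → x i ≡ x (i ℕ.+ r) ⊎ x i ℕ.+ x (i ℕ.+ r) ≡ G → Per G (2 ℕ.* r)
  per i r s = mkPer (y ℕ.* (2 ℕ.+ y)) (i ℕ.+ i) e2 (d s)
    where
    y = ℕ.pred (2 ^ r)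
    ey : suc y ≡ 2 ^ r
    ey = ℕP.suc-pred (2 ^ r) {{ℕP.m^n≢0 2 r}}
    lem : ∀ y → 1 ℕ.+ y ℕ.* (2 ℕ.+ y) ≡ (1 ℕ.+ y) ℕ.* (1 ℕ.+ y)
    lem = solveℕ
    e2 : suc (y ℕ.* (2 ℕ.+ y)) ≡ 2 ^ (2 ℕ.* r)
    e2 = trans (lem y) (trans (cong₂ ℕ._*_ ey ey) (trans (sym (ℕP.^-distribˡ-+-* 2 r r)) (cong (λ z → 2 ^ (r ℕ.+ z)) (sym (ℕP.+-identityʳ r)))))
    l1 : ∀ p y → p ℕ.* y ℕ.* (p ℕ.* (2 ℕ.+ y)) ≡ p ℕ.* p ℕ.* (y ℕ.* (2 ℕ.+ y))
    l1 = solveℕ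
    eqn : 2 ^ i ℕ.* y ℕ.* (2 ^ i ℕ.* (2 ℕ.+ y)) ≡ 2 ^ (i ℕ.+ i) ℕ.* (y ℕ.* (2 ℕ.+ y))
    eqn = trans (l1 (2 ^ i) y) (cong (ℕ._* (y ℕ.* (2 ℕ.+ y))) (sym (ℕP.^-distribˡ-+-* 2 i i)))
    d : x i ≡ x (i ℕ.+ r) ⊎ x i ℕ.+ x (i ℕ.+ r) ≡ G → G ℕD.∣ 2 ^ (i ℕ.+ i) ℕ.* (y ℕ.* (2 ℕ.+ y))
    d (inj₁ e) = subst (G ℕD.∣_) eqn (ℕD.∣m⇒∣m*n (2 ^ i ℕ.* (2 ℕ.+ y)) (divides-diff i r y ey e))
    d (inj₂ e) = subst (G ℕD.∣_) eqn (ℕD.∣n⇒∣m*n (2 ^ i ℕ.* y) (divides-sum i r y ey e))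
  go : (∃ λ i → ∃ λ j → i Fin.< j × cls i ≡ cls j) → ∃ λ r → 1 ℕ.≤ r × r ℕ.≤ h × Per G (2 ℕ.* r)
  go (i , j , i<j , e) = r , ℕP.m<n⇒0<n∸m i<j , ℕP.≤-trans (ℕP.m∸n≤m (toℕ j) (toℕ i)) (ℕP.≤-pred (FinP.toℕ<n j)) , per (toℕ i) r s
    where
    r = toℕ j ∸ toℕ i
    j≡ : toℕ i ℕ.+ r ≡ toℕ j
    j≡ = ℕP.m+[n∸m]≡n (ℕP.<⇒≤ i<j)
    ce : c (toℕ i) ≡ c (toℕ j)
    ce = ℕP.pred-injective {{ℕ.>-nonZero (c≥1 i)}} {{ℕ.>-nonZero (c≥1 j)}} (trans (sym (FinP.toℕ-fromℕ< (c<h i))) (trans (cong toℕ e) (FinP.toℕ-fromℕ< (c<h j))))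
    s : x (toℕ i) ≡ x (toℕ i ℕ.+ r) ⊎ x (toℕ i) ℕ.+ x (toℕ i ℕ.+ r) ≡ G
    s = subst (λ z → x (toℕ i) ≡ x z ⊎ x (toℕ i) ℕ.+ x z ≡ G) (sym j≡) (case (toℕ i) (toℕ j) ce)

double<⇒< : ∀ {a b} → a ℕ.+ a ℕ.< b ℕ.+ b → a ℕ.< b
double<⇒< {a} {b} p with a ℕ.<? b
... | yes q = q
... | no ¬q = ⊥-elim (ℕP.<⇒≱ p (ℕP.+-mono-≤ (ℕP.≮⇒≥ ¬q) (ℕP.≮⇒≥ ¬q)))

-- Let `2r` be a period of `G` and `Z'` a self-periodic multiple of `r`. Then `2Z'` is a period both
-- of `G` and of itself, so `Per-*` gives `G * 2Z'` the period `2Z' * G`, which is the same number.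
-- Since `r ≤ G/2`, there are at most `L` rounds, each adding at most `L + 1` bits; a period bounded
-- only by `G` would not limit the number of rounds in this way.
selfPeriod : ∀ L G → 1 ℕ.≤ G → G ℕ.< 2 ^ L → ∃ λ Z → G ℕD.∣ Z × 1 ℕ.≤ Z × Z ℕ.≤ 2 ^ (suc L ℕ.* L) × Per Z Z
selfPeriod L (suc zero) _ _ = 1 , ℕD.∣-refl , ℕP.≤-refl , ℕP.m^n>0 2 (suc L ℕ.* L) , mkPer 1 0 refl (ℕD.1∣ 1)
selfPeriod zero (suc (suc G)) _ (s≤s ())
selfPeriod (suc L) G@(suc (suc _)) 1≤G G<2^L with halfPeriod G (s≤s (s≤s z≤n))
... | r , 1≤r , r≤ , perG with selfPeriod L r 1≤r (double<⇒< (ℕP.≤-<-trans (ℕP.≤-trans (ℕP.+-mono-≤ r≤ r≤) (⌊/2⌋-double G)) (subst (G ℕ.<_) (cong (2 ^ L ℕ.+_) (ℕP.+-identityʳ (2 ^ L))) G<2^L)))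
... | Z , ℕD.divides q Z≡ , 1≤Z , Z≤ , perZ = G ℕ.* (2 ℕ.* Z) , ℕD.m∣m*n (2 ℕ.* Z) , ℕP.*-mono-≤ 1≤G (ℕP.*-mono-≤ {1} {2} (s≤s z≤n) 1≤Z) , bd ,
    subst (Per (G ℕ.* (2 ℕ.* Z))) (ℕP.*-comm (2 ℕ.* Z) G) (Per-* p1 p2)
  where
  p1 : Per G (2 ℕ.* Z)
  p1 = subst (Per G) (trans (lem r q) (cong (2 ℕ.*_) (sym Z≡))) (Per-mono q perG)
    where
    lem : ∀ r q → 2 ℕ.* r ℕ.* q ≡ 2 ℕ.* (q ℕ.* r)
    lem = solveℕ
  p2 : Per (2 ℕ.* Z) (2 ℕ.* Z)
  p2 = Per-double (subst (Per Z) (ℕP.*-comm Z 2) (Per-mono 2 perZ))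
  bd : G ℕ.* (2 ℕ.* Z) ℕ.≤ 2 ^ (suc (suc L) ℕ.* suc L)
  bd = ℕP.≤-trans (ℕP.*-mono-≤ (ℕP.<⇒≤ G<2^L) (ℕP.*-monoʳ-≤ 2 Z≤)) (ℕP.≤-trans (ℕP.≤-reflexive (sym (ℕP.^-distribˡ-+-* 2 (suc L) (suc (suc L ℕ.* L))))) (ℕP.^-monoʳ-≤ 2 ex))
    where
    lem : ∀ L → (2 ℕ.+ L) ℕ.* (1 ℕ.+ L) ≡ (1 ℕ.+ L) ℕ.+ (1 ℕ.+ (1 ℕ.+ L) ℕ.* L) ℕ.+ L
    lem = solveℕ
    ex : suc L ℕ.+ suc (suc L ℕ.* L) ℕ.≤ suc (suc L) ℕ.* suc L
    ex = ℕP.≤-trans (ℕP.m≤m+n _ L) (ℕP.≤-reflexive (sym (lem L)))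

Per-^ : ∀ {Z} → Per Z Z → ∀ h → Per (Z ^ suc h) (Z ^ suc h)
Per-^ {Z} p zero = subst (λ x → Per x x) (sym (ℕP.*-identityʳ Z)) p
Per-^ {Z} p (suc h) = subst (Per (Z ^ suc (suc h))) (ℕP.*-comm (Z ^ suc h) Z) (Per-* (Per-mono (Z ^ h) p) (Per-^ p h))

odd-cancel : ∀ X y → ¬ (2 ℕD.∣ X) → X ℕD.∣ 2 ℕ.* y → X ℕD.∣ y
odd-cancel X y odd d = coprime-divisor cop d
  where
  cop : Coprime X 2
  cop {zero} (_ , d) with ℕD.0∣⇒≡0 d
  ... | ()
  cop {suc zero} _ = refl
  cop {suc (suc zero)} (d , _) = ⊥-elim (odd d)
  cop {suc (suc (suc _))} (_ , d) with ℕD.∣⇒≤ d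
  ... | s≤s (s≤s ())

-- Only the power of two contained in `X` can be used up by `2 ^ a`, and it is smaller than `2 ^ L`.
-- Each factor 2 split off from `X` lowers `L` by one.
shrinkExponent : ∀ L X y a → X ℕ.< 2 ^ L → X ℕD.∣ 2 ^ a ℕ.* y → X ℕD.∣ 2 ^ L ℕ.* y
shrinkExponent L X y zero X< d = ℕD.∣n⇒∣m*n (2 ^ L) (subst (X ℕD.∣_) (ℕP.+-identityʳ y) d)
shrinkExponent L X y (suc a) X< d with 2 ℕD.∣? X
... | no odd = shrinkExponent L X y a X< (odd-cancel X (2 ^ a ℕ.* y) odd (subst (X ℕD.∣_) (ℕP.*-assoc 2 (2 ^ a) y) d))
shrinkExponent zero X y (suc a) X< d | yes (ℕD.divides q refl) = subst (q ℕ.* 2 ℕD.∣_) (sym (ℕP.+-identityʳ y)) (subst (q ℕ.* 2 ℕD.∣_) y≡0 (ℕD._∣0 (q ℕ.* 2)))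
  where
  q≡0 : q ℕ.* 2 ≡ 0
  q≡0 = ℕP.n<1⇒n≡0 X<
  zero-prod : ∀ y p → p ≢ 0 → p ℕ.* y ≡ 0 → 0 ≡ y
  zero-prod y p p≢0 e with ℕP.m*n≡0⇒m≡0∨n≡0 p e
  ... | inj₁ z = ⊥-elim (p≢0 z)
  ... | inj₂ z = sym z
  y≡0 : 0 ≡ y
  y≡0 = zero-prod y (2 ^ suc a) (ℕ.≢-nonZero⁻¹ (2 ^ suc a) {{ℕP.m^n≢0 2 (suc a)}}) (ℕD.0∣⇒≡0 (subst (ℕD._∣ 2 ^ suc a ℕ.* y) q≡0 d))
shrinkExponent (suc L) X y (suc a) X< d | yes (ℕD.divides q refl) =
  subst₂ ℕD._∣_ (ℕP.*-comm 2 q) (sym (ℕP.*-assoc 2 (2 ^ L) y)) (ℕD.*-monoʳ-∣ 2 (shrinkExponent L q y a q< (ℕD.*-cancelˡ-∣ 2 (subst₂ ℕD._∣_ (ℕP.*-comm q 2) (ℕP.*-assoc 2 (2 ^ a) y) d))))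
  where
  q< : q ℕ.< 2 ^ L
  q< = ℕP.*-cancelˡ-< 2 q (2 ^ L) (subst (ℕ._< 2 ^ suc L) (ℕP.*-comm q 2) X<)

pos-∸ : ∀ {a b} → a ℕ.≤ b → + (b ∸ a) ≡ + b - + a
pos-∸ {a} {b} p = sym (trans (ℤP.m-n≡m⊖n b a) (ℤP.⊖-≥ p))

pos2 : ℕ → ℤ
pos2 n = + (2 ^ n)

pos2-+ : ∀ a b → pos2 (a ℕ.+ b) ≡ pos2 a * pos2 b
pos2-+ a b = trans (cong +_ (ℕP.^-distribˡ-+-* 2 a b)) (ℤP.pos-* (2 ^ a) (2 ^ b))

module _ {X L : ℕ} (per : Per X X) (X<2^L : X ℕ.< 2 ^ L) where
  private
    shifted : ∀ q e → L ℕ.≤ q → X ℕD.∣ e → (+ X) ∣ pos2 (q ℕ.+ e) - pos2 q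
    shifted q e L≤q (ℕD.divides c refl) with Per-mono c per
    ... | mkPer y a ey d with shrinkExponent L X y a X<2^L d
    ... | ℕD.divides k ek = divides (+ (2 ^ (q ∸ L)) * + k) eq
      where
      lem : ∀ p t k x → p * t * (1ℤ + x) - p * t ≡ p * (t * x)
      lem = solve-∀
      e1 : pos2 q ≡ + (2 ^ (q ∸ L)) * pos2 L
      e1 = trans (cong pos2 (sym (ℕP.m∸n+n≡m L≤q))) (pos2-+ (q ∸ L) L)
      e2 : pos2 (c ℕ.* X) ≡ 1ℤ + + y
      e2 = cong +_ (trans (cong (2 ^_) (ℕP.*-comm c X)) (sym ey))
      e3 : pos2 L * + y ≡ + k * + X
      e3 = trans (sym (ℤP.pos-* (2 ^ L) y)) (trans (cong +_ ek) (ℤP.pos-* k X))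
      eq : pos2 (q ℕ.+ c ℕ.* X) - pos2 q ≡ (+ (2 ^ (q ∸ L)) * + k) * + X
      eq = trans (cong (_- pos2 q) (pos2-+ q (c ℕ.* X))) (trans (cong₂ (λ u v → u * v - u) e1 e2)
            (trans (lem (+ (2 ^ (q ∸ L))) (pos2 L) (+ k) (+ y)) (trans (cong (+ (2 ^ (q ∸ L)) *_) e3) (sym (ℤP.*-assoc (+ (2 ^ (q ∸ L))) (+ k) (+ X))))))

    ℕ-∣ : ∀ e → (+ X) ∣ + e → X ℕD.∣ e
    ℕ-∣ e d = ℤD.∣⇒∣ᵤ d

  -- Exponents congruent modulo `X` differ by a multiple of the period `X`, so the powers are
  -- congruent modulo the same `X`. The hypotheses `L ≤ p` and `L ≤ q` supply the power of two that
  -- `Per` leaves open.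
  pos2-cong-mod : ∀ p q → L ℕ.≤ p → L ℕ.≤ q → (+ X) ∣ + p - + q → (+ X) ∣ pos2 p - pos2 q
  pos2-cong-mod p q L≤p L≤q d with ℕP.≤-total q p
  ... | inj₁ q≤p = subst (λ z → (+ X) ∣ pos2 z - pos2 q) (ℕP.m+[n∸m]≡n q≤p) (shifted q (p ∸ q) L≤q (ℕ-∣ (p ∸ q) (subst ((+ X) ∣_) (trans (ℤP.m-n≡m⊖n p q) (ℤP.⊖-≥ q≤p)) d)))
  ... | inj₂ p≤q = subst ((+ X) ∣_) (flip (pos2 p) (pos2 q)) (ℤD.∣m⇒∣-m (subst (λ z → (+ X) ∣ pos2 z - pos2 p) (ℕP.m+[n∸m]≡n p≤q) (shifted p (q ∸ p) L≤p (ℕ-∣ (q ∸ p) d'))))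
    where
    flip : ∀ a b → - (b - a) ≡ a - b
    flip = solve-∀
    d' : (+ X) ∣ + (q ∸ p)
    d' = subst ((+ X) ∣_) (trans (flip (+ q) (+ p)) (trans (ℤP.m-n≡m⊖n q p) (ℤP.⊖-≥ p≤q))) (ℤD.∣m⇒∣-m d)

-- Signs of perturbations

-- The zero case is a joint one: if neither of two opposite moves may improve a quantity, it is
-- constant under both.
data Opp : ℤ → ℤ → Set where
  opp+ : ∀ {x y} → 0ℤ < x → y < 0ℤ → Opp x y
  opp- : ∀ {x y} → x < 0ℤ → 0ℤ < y → Opp x y
  opp0 : Opp 0ℤ 0ℤ

pos-dominates : ∀ {a D r} → 0ℤ < a → 0ℤ < D → ∣ r ∣ ℕ.< ∣ D ∣ → 0ℤ < a * D + r
pos-dominates {a} {D} {r} 0<a 0<D r<D = 1≤⇒0< (≤-cert ((a - 1ℤ) * D + (D + r - 1ℤ)) (0≤+ (0≤* (≤⇒0≤ (0<⇒1≤ 0<a)) (ℤP.<⇒≤ 0<D)) (≤⇒0≤ (0<⇒1≤ (D+r r D 0<D r<D)))) (lem a D r))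
  where
  lem : ∀ a D r → a * D + r ≡ 1ℤ + ((a - 1ℤ) * D + (D + r - 1ℤ))
  lem = solve-∀
  D+r : ∀ r D → 0ℤ < D → ∣ r ∣ ℕ.< ∣ D ∣ → 0ℤ < D + r
  D+r (+ r) (+ suc D) _ _ = +<+ (s≤s z≤n)
  D+r (-[1+ r ]) (+ D) _ p = subst (0ℤ <_) (sym (ℤP.⊖-≥ (ℕP.<⇒≤ p))) (+<+ (ℕP.m<n⇒0<n∸m p))
  D+r (+ r) -[1+ D ] () _
  D+r -[1+ r ] -[1+ D ] () _
  D+r (+ r) (+ zero) (+<+ ()) _

dominates : ∀ {a D r} → 0ℤ < a → D < 0ℤ → ∣ r ∣ ℕ.< ∣ D ∣ → a * D + r < 0ℤ
dominates {a} {D} {r} 0<a D<0 p = subst (_< 0ℤ) (lem a D r) (ℤP.neg-mono-< (pos-dominates {a} { - D} { - r} 0<a (ℤP.neg-mono-< D<0) (subst₂ ℕ._<_ (sym (ℤP.∣-i∣≡∣i∣ r)) (sym (ℤP.∣-i∣≡∣i∣ D)) p)))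
  where
  lem : ∀ a D r → - (a * (- D) + - r) ≡ a * D + r
  lem = solve-∀

neg-flip : ∀ a D r → (- a) * (- D) + r ≡ a * D + r
neg-flip = solve-∀

∣neg∣< : ∀ r D → ∣ r ∣ ℕ.< ∣ D ∣ → ∣ r ∣ ℕ.< ∣ - D ∣
∣neg∣< r D p = subst (∣ r ∣ ℕ.<_) (sym (ℤP.∣-i∣≡∣i∣ D)) p

-- A nonzero integer `a` satisfies `∣ a * D ∣ ≥ ∣ D ∣`, so the remainders cannot reverse the signs,
-- however large `a` is.
Opp-dominated : ∀ {a D D' r r'} → a ≢ 0ℤ → Opp D D' → D ≢ 0ℤ → (D ≢ 0ℤ → ∣ r ∣ ℕ.< ∣ D ∣) → (D' ≢ 0ℤ → ∣ r' ∣ ℕ.< ∣ D' ∣) → Opp (a * D + r) (a * D' + r')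
Opp-dominated a≢0 opp0 D≢0 p q = ⊥-elim (D≢0 refl)
Opp-dominated {a} {D} {D'} {r} {r'} a≢0 (opp+ x y) D≢0 p q with ℤP.<-cmp 0ℤ a
... | tri< 0<a _ _ = opp+ (pos-dominates {a} 0<a x (p D≢0)) (dominates {a} 0<a y (q (ℤP.<⇒≢ y)))
... | tri≈ _ e _ = ⊥-elim (a≢0 (sym e))
... | tri> _ _ a<0 = opp- (subst (_< 0ℤ) (neg-flip a D r) (dominates { - a} (ℤP.neg-mono-< a<0) (ℤP.neg-mono-< x) (∣neg∣< r D (p D≢0))))
                          (subst (0ℤ <_) (neg-flip a D' r') (pos-dominates { - a} (ℤP.neg-mono-< a<0) (ℤP.neg-mono-< y) (∣neg∣< r' D' (q (ℤP.<⇒≢ y)))))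
Opp-dominated {a} {D} {D'} {r} {r'} a≢0 (opp- x y) D≢0 p q with ℤP.<-cmp 0ℤ a
... | tri< 0<a _ _ = opp- (dominates {a} 0<a x (p D≢0)) (pos-dominates {a} 0<a y (q (λ e → ℤP.<⇒≢ y (sym e))))
... | tri≈ _ e _ = ⊥-elim (a≢0 (sym e))
... | tri> _ _ a<0 = opp+ (subst (0ℤ <_) (neg-flip a D r) (pos-dominates { - a} (ℤP.neg-mono-< a<0) (ℤP.neg-mono-< x) (∣neg∣< r D (p D≢0))))
                          (subst (_< 0ℤ) (neg-flip a D' r') (dominates { - a} (ℤP.neg-mono-< a<0) (ℤP.neg-mono-< y) (∣neg∣< r' D' (q (λ e → ℤP.<⇒≢ y (sym e))))))

Opp-scale : ∀ c {x y} → Opp x y → Opp (c * x) (c * y)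
Opp-scale c {x} {y} o with c ℤ.≟ 0ℤ | x ℤ.≟ 0ℤ
... | yes refl | _ = subst₂ Opp (sym (ℤP.*-zeroˡ x)) (sym (ℤP.*-zeroˡ y)) opp0
Opp-scale c opp0 | no _ | _ = subst₂ Opp (sym (ℤP.*-zeroʳ c)) (sym (ℤP.*-zeroʳ c)) opp0
Opp-scale c (opp+ p q) | no _ | yes e = ⊥-elim (ℤP.<⇒≢ p (sym e))
Opp-scale c (opp- p q) | no _ | yes e = ⊥-elim (ℤP.<⇒≢ p e)
Opp-scale c {x} {y} o | no c≢0 | no x≢0 = subst₂ Opp (ℤP.+-identityʳ (c * x)) (ℤP.+-identityʳ (c * y)) (Opp-dominated c≢0 o x≢0 (0<∣ x ∣') (0<∣ y ∣'))
  where
  0<∣_∣' : ∀ z → z ≢ 0ℤ → 0 ℕ.< ∣ z ∣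
  0<∣ + zero ∣' p = ⊥-elim (p refl)
  0<∣ + suc _ ∣' p = s≤s z≤n
  0<∣ -[1+ _ ] ∣' p = s≤s z≤n

Opp-unscale : ∀ g x y → 1 ℕ.≤ g → Opp (+ g * x) (+ g * y) → Opp x y
Opp-unscale g x y 1≤g o = go (sg x) (sg y) o refl refl
  where
  instance
    gp : ℤ.Positive (+ g)
    gp = ℤ.positive (+<+ 1≤g)
    gn : ℤ.NonNegative (+ g)
    gn = _
  sg : ∀ x → (0ℤ < + g * x → 0ℤ < x) × (+ g * x < 0ℤ → x < 0ℤ) × (+ g * x ≡ 0ℤ → x ≡ 0ℤ)
  sg x = (λ p → ℤP.*-cancelˡ-<-nonNeg (+ g) (subst (_< + g * x) (sym (ℤP.*-zeroʳ (+ g))) p))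
       , (λ p → ℤP.*-cancelˡ-<-nonNeg (+ g) (subst (+ g * x <_) (sym (ℤP.*-zeroʳ (+ g))) p))
       , (λ p → ℤP.*-cancelˡ-≡ (+ g) x 0ℤ {{ℤ.≢-nonZero (λ e → ℤP.<⇒≢ (+<+ 1≤g) (sym e))}} (trans p (sym (ℤP.*-zeroʳ (+ g)))))
  go : (0ℤ < + g * x → 0ℤ < x) × (+ g * x < 0ℤ → x < 0ℤ) × (+ g * x ≡ 0ℤ → x ≡ 0ℤ) →
       (0ℤ < + g * y → 0ℤ < y) × (+ g * y < 0ℤ → y < 0ℤ) × (+ g * y ≡ 0ℤ → y ≡ 0ℤ) →
       ∀ {u v} → Opp u v → u ≡ + g * x → v ≡ + g * y → Opp x y
  go (a , b , c) (a' , b' , c') (opp+ p q) refl refl = opp+ (a p) (b' q)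
  go (a , b , c) (a' , b' , c') (opp- p q) refl refl = opp- (b p) (a' q)
  go (a , b , c) (a' , b' , c') opp0 e e' = subst₂ Opp (sym (c (sym e))) (sym (c' (sym e'))) opp0

pos2-mono-< : ∀ {a b} → a ℕ.< b → pos2 a < pos2 b
pos2-mono-< p = +<+ (ℕP.^-monoʳ-< 2 (s≤s (s≤s z≤n)) p)

private
  0<-diff : ∀ {a b} → a < b → 0ℤ < b - a
  0<-diff {a} {b} p = subst (_< b - a) (ℤP.+-inverseʳ a) (ℤP.+-monoˡ-< (- a) p)

  diff<0 : ∀ {a b} → b < a → b - a < 0ℤ
  diff<0 {a} {b} p = subst (b - a <_) (ℤP.+-inverseʳ a) (ℤP.+-monoˡ-< (- a) p)

  undiff : ∀ {a b} → 0ℤ < b - a → a < b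
  undiff {a} {b} p = subst₂ _<_ (ℤP.+-identityʳ a) (lem a b) (ℤP.+-monoʳ-< a p)
    where
    lem : ∀ a b → a + (b - a) ≡ b
    lem = solve-∀

  undiff' : ∀ {a b} → b - a < 0ℤ → b < a
  undiff' {a} {b} p = subst₂ _<_ (lem a b) (ℤP.+-identityʳ a) (ℤP.+-monoʳ-< a p)
    where
    lem : ∀ a b → a + (b - a) ≡ b
    lem = solve-∀

Opp-pos2 : ∀ y yp yn → Opp (+ yp - + y) (+ yn - + y) → Opp (pos2 yp - pos2 y) (pos2 yn - pos2 y)
Opp-pos2 y yp yn o = go o refl refl
  where
  up : ∀ x → 0ℤ < + x - + y → 0ℤ < pos2 x - pos2 y
  up x p = 0<-diff {pos2 y} {pos2 x} (pos2-mono-< (ℤP.drop‿+<+ (undiff {+ y} {+ x} p)))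
  down : ∀ x → + x - + y < 0ℤ → pos2 x - pos2 y < 0ℤ
  down x p = diff<0 {pos2 y} {pos2 x} (pos2-mono-< (ℤP.drop‿+<+ (undiff' {+ y} {+ x} p)))
  go : ∀ {u v} → Opp u v → u ≡ + yp - + y → v ≡ + yn - + y → Opp (pos2 yp - pos2 y) (pos2 yn - pos2 y)
  go (opp+ p q) refl refl = opp+ (up yp p) (down yn q)
  go (opp- p q) refl refl = opp- (down yp p) (up yn q)
  go opp0 e e' = subst₂ Opp (z yp e) (z yn e') opp0
    where
    z : ∀ x → 0ℤ ≡ + x - + y → 0ℤ ≡ pos2 x - pos2 y
    z x e = trans (sym (ℤP.+-inverseʳ (pos2 y))) (cong (λ t → pos2 t - pos2 y) (sym (ℤP.+-injective (ℤP.i-j≡0⇒i≡j (+ x) (+ y) (sym e)))))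

∣pos2-diff∣≤ : ∀ a b → ∣ pos2 a - pos2 b ∣ ℕ.≤ 2 ^ (a ⊔ b)
∣pos2-diff∣≤ a b with ℕP.≤-total a b
... | inj₁ p = subst (ℕ._≤ 2 ^ (a ⊔ b)) (sym (trans (cong ∣_∣ (ℤP.m-n≡m⊖n (2 ^ a) (2 ^ b))) (ℤP.∣⊖∣-≤ (ℕP.^-monoʳ-≤ 2 p)))) (ℕP.≤-trans (ℕP.m∸n≤m (2 ^ b) (2 ^ a)) (ℕP.^-monoʳ-≤ 2 (ℕP.m≤n⊔m a b)))
... | inj₂ p = subst (ℕ._≤ 2 ^ (a ⊔ b)) (sym (cong ∣_∣ (trans (ℤP.m-n≡m⊖n (2 ^ a) (2 ^ b)) (ℤP.⊖-≥ (ℕP.^-monoʳ-≤ 2 p))))) (ℕP.≤-trans (ℕP.m∸n≤m (2 ^ a) (2 ^ b)) (ℕP.^-monoʳ-≤ 2 (ℕP.m≤m⊔n a b)))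

private
  half : ∀ {a b} → a ℕ.< b → 2 ^ b ℕ.≤ 2 ℕ.* (2 ^ b ∸ 2 ^ a)
  half {a} {b} p = begin
    2 ^ b                              ≡⟨ sym (ℕP.m+n∸n≡m (2 ^ b) (2 ^ b)) ⟩
    2 ^ b ℕ.+ 2 ^ b ∸ 2 ^ b            ≤⟨ ℕP.∸-monoʳ-≤ (2 ^ b ℕ.+ 2 ^ b) (ℕP.^-monoʳ-≤ 2 p) ⟩
    2 ^ b ℕ.+ 2 ^ b ∸ 2 ℕ.* 2 ^ a      ≡⟨ cong (λ z → 2 ^ b ℕ.+ z ∸ 2 ℕ.* 2 ^ a) (sym (ℕP.+-identityʳ (2 ^ b))) ⟩
    2 ℕ.* 2 ^ b ∸ 2 ℕ.* 2 ^ a          ≡⟨ sym (ℕP.*-distribˡ-∸ 2 (2 ^ b) (2 ^ a)) ⟩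
    2 ℕ.* (2 ^ b ∸ 2 ^ a)              ∎
    where open ℕP.≤-Reasoning

∣pos2-diff∣≥ : ∀ a b → pos2 a - pos2 b ≢ 0ℤ → 2 ^ (a ⊔ b) ℕ.≤ 2 ℕ.* ∣ pos2 a - pos2 b ∣
∣pos2-diff∣≥ a b ne with ℕP.<-cmp a b
... | tri< p _ _ = subst₂ (λ u v → 2 ^ u ℕ.≤ 2 ℕ.* v) (sym (ℕP.m≤n⇒m⊔n≡n (ℕP.<⇒≤ p))) (sym (trans (cong ∣_∣ (ℤP.m-n≡m⊖n (2 ^ a) (2 ^ b))) (ℤP.∣⊖∣-≤ (ℕP.^-monoʳ-≤ 2 (ℕP.<⇒≤ p))))) (half p)
... | tri≈ _ e _ = ⊥-elim (ne (trans (cong (λ z → pos2 z - pos2 b) e) (ℤP.+-inverseʳ (pos2 b))))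
... | tri> _ _ p = subst₂ (λ u v → 2 ^ u ℕ.≤ 2 ℕ.* v) (sym (ℕP.m≥n⇒m⊔n≡m (ℕP.<⇒≤ p))) (sym (cong ∣_∣ (trans (ℤP.m-n≡m⊖n (2 ^ a) (2 ^ b)) (ℤP.⊖-≥ (ℕP.^-monoʳ-≤ 2 (ℕP.<⇒≤ p)))))) (half p)

Gaps : ℕ → (ℕ → Bool) → (ℕ → ℕ) → (ℕ → ℕ) → Set
Gaps m big lo y = ∀ h → h ℕ.< m → (lo h ℕ.+ y h ℕ.≤ y (suc h)) × (big h ≡ false → y (suc h) ≡ lo h ℕ.+ y h)

-- A perturbation y' of y changes a combination of the 2^(y h) by rest; the sign of the
-- change is that of the leading coefficient, since big gaps exceed P.
module Perturbation (m P S : ℕ) (big : ℕ → Bool) (lo : ℕ → ℕ) (y : ℕ → ℕ) (A b : ℕ → ℤ)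
    (big-lo : ∀ h → h ℕ.< m → big h ≡ true → P ℕ.≤ lo h)
    (P-large : 4 ℕ.* suc m ℕ.* S ℕ.< 2 ^ P)
    (A≤ : ∀ h → h ℕ.< m → big h ≡ true → ∣ A h ∣ ℕ.≤ S)
    (b≤ : ∀ h → h ℕ.< m → big h ≡ true → ∣ b h ∣ ℕ.≤ S)
    (A0 : ∀ h → h ℕ.< m → big h ≡ false → A h ≡ 0ℤ)
    (b≤small : ∀ h → h ℕ.< m → big h ≡ false → ∣ b h ∣ ℕ.≤ S ℕ.* 2 ^ lo h)
    (gaps : Gaps m big lo y) where

  change : (ℕ → ℕ) → ℕ → ℤ
  change y' h = pos2 (y' h) - pos2 (y h)

  -- Contributions are listed by level, so the change at `h` occurs twice, with `b h` and with the
  -- `A` of the level below; `opposite` collects the two in its argument `lead`.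
  rest : (ℕ → ℕ) → ℤ → ℕ → ℤ
  rest y' w zero    = w * pos2 (y 0)
  rest y' w (suc h) = rest y' w h + (A h * change y' (suc h) + b h * change y' h)

  module _ (y' : ℕ → ℕ) (gaps' : Gaps m big lo y') (w : ℤ) (w≤ : ∣ w ∣ ℕ.≤ S) (y0 : y' 0 ≡ y 0) where
    top : ℕ → ℕ
    top h = y' h ⊔ y h

    top-gap : ∀ h → h ℕ.< m → lo h ℕ.+ top h ℕ.≤ top (suc h)
    top-gap h p = ℕP.≤-trans (ℕP.≤-reflexive (ℕP.+-distribˡ-⊔ (lo h) (y' h) (y h))) (ℕP.⊔-mono-≤ (proj₁ (gaps' h p)) (proj₁ (gaps h p)))

    top-mono : ∀ h → h ℕ.< m → 2 ^ top h ℕ.≤ 2 ^ top (suc h)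
    top-mono h p = ℕP.^-monoʳ-≤ 2 (ℕP.≤-trans (ℕP.m≤n+m (top h) (lo h)) (top-gap h p))

    change-small : ∀ h → h ℕ.< m → big h ≡ false → change y' (suc h) ≡ pos2 (lo h) * change y' h
    change-small h p s = trans (cong₂ _-_ (trans (cong pos2 (proj₂ (gaps' h p) s)) (pos2-+ (lo h) (y' h))) (trans (cong pos2 (proj₂ (gaps h p) s)) (pos2-+ (lo h) (y h)))) (lem (pos2 (lo h)) (pos2 (y' h)) (pos2 (y h)))
      where
      lem : ∀ l a b → l * a - l * b ≡ l * (a - b)
      lem = solve-∀

    change≤ : ∀ h → ∣ change y' h ∣ ℕ.≤ 2 ^ top h
    change≤ h = ∣pos2-diff∣≤ (y' h) (y h)

    term≤ : ∀ h → h ℕ.< m → ∣ A h * change y' (suc h) + b h * change y' h ∣ ℕ.≤ 2 ℕ.* S ℕ.* 2 ^ top (suc h)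
    term≤ h p with big h in e
    ... | true = begin
      ∣ A h * change y' (suc h) + b h * change y' h ∣            ≤⟨ ℤP.∣i+j∣≤∣i∣+∣j∣ (A h * change y' (suc h)) (b h * change y' h) ⟩
      ∣ A h * change y' (suc h) ∣ ℕ.+ ∣ b h * change y' h ∣      ≡⟨ cong₂ ℕ._+_ (ℤP.abs-* (A h) (change y' (suc h))) (ℤP.abs-* (b h) (change y' h)) ⟩
      ∣ A h ∣ ℕ.* ∣ change y' (suc h) ∣ ℕ.+ ∣ b h ∣ ℕ.* ∣ change y' h ∣ ≤⟨ ℕP.+-mono-≤ (ℕP.*-mono-≤ (A≤ h p e) (change≤ (suc h))) (ℕP.*-mono-≤ (b≤ h p e) (ℕP.≤-trans (change≤ h) (top-mono h p))) ⟩
      S ℕ.* 2 ^ top (suc h) ℕ.+ S ℕ.* 2 ^ top (suc h)            ≡⟨ lem S (2 ^ top (suc h)) ⟩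
      2 ℕ.* S ℕ.* 2 ^ top (suc h)                                ∎
      where
      open ℕP.≤-Reasoning
      lem : ∀ s t → s ℕ.* t ℕ.+ s ℕ.* t ≡ 2 ℕ.* s ℕ.* t
      lem = solveℕ
    ... | false = begin
      ∣ A h * change y' (suc h) + b h * change y' h ∣            ≡⟨ cong (λ a → ∣ a * change y' (suc h) + b h * change y' h ∣) (A0 h p e) ⟩
      ∣ 0ℤ * change y' (suc h) + b h * change y' h ∣             ≡⟨ cong ∣_∣ (trans (cong (_+ b h * change y' h) (ℤP.*-zeroˡ (change y' (suc h)))) (ℤP.+-identityˡ (b h * change y' h))) ⟩
      ∣ b h * change y' h ∣                                      ≡⟨ ℤP.abs-* (b h) (change y' h) ⟩
      ∣ b h ∣ ℕ.* ∣ change y' h ∣                                ≤⟨ ℕP.*-monoˡ-≤ ∣ change y' h ∣ (b≤small h p e) ⟩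
      S ℕ.* 2 ^ lo h ℕ.* ∣ change y' h ∣                         ≡⟨ ℕP.*-assoc S (2 ^ lo h) ∣ change y' h ∣ ⟩
      S ℕ.* (2 ^ lo h ℕ.* ∣ change y' h ∣)                       ≡⟨ cong (S ℕ.*_) (sym (ℤP.abs-* (pos2 (lo h)) (change y' h))) ⟩
      S ℕ.* ∣ pos2 (lo h) * change y' h ∣                        ≡⟨ cong (λ z → S ℕ.* ∣ z ∣) (sym (change-small h p e)) ⟩
      S ℕ.* ∣ change y' (suc h) ∣                                ≤⟨ ℕP.*-mono-≤ (ℕP.m≤n*m S 2) (change≤ (suc h)) ⟩
      2 ℕ.* S ℕ.* 2 ^ top (suc h)                                ∎
      where open ℕP.≤-Reasoning

    rest≤ : ∀ h → h ℕ.≤ m → ∣ rest y' w h ∣ ℕ.≤ (1 ℕ.+ 2 ℕ.* h) ℕ.* S ℕ.* 2 ^ top h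
    rest≤ zero p = subst₂ ℕ._≤_ (sym (ℤP.abs-* w (pos2 (y 0)))) (cong (ℕ._* 2 ^ top 0) (sym (ℕP.+-identityʳ S))) (ℕP.*-mono-≤ w≤ (ℕP.^-monoʳ-≤ 2 (ℕP.m≤n⊔m (y' 0) (y 0))))
    rest≤ (suc h) p = begin
      ∣ rest y' w h + t ∣                                       ≤⟨ ℤP.∣i+j∣≤∣i∣+∣j∣ (rest y' w h) t ⟩
      ∣ rest y' w h ∣ ℕ.+ ∣ t ∣                                 ≤⟨ ℕP.+-mono-≤ (ℕP.≤-trans (rest≤ h (ℕP.<⇒≤ p)) (ℕP.*-monoʳ-≤ ((1 ℕ.+ 2 ℕ.* h) ℕ.* S) (top-mono h p))) (term≤ h p) ⟩
      (1 ℕ.+ 2 ℕ.* h) ℕ.* S ℕ.* T ℕ.+ 2 ℕ.* S ℕ.* T             ≡⟨ lem h S T ⟩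
      (1 ℕ.+ 2 ℕ.* suc h) ℕ.* S ℕ.* T                           ∎
      where
      open ℕP.≤-Reasoning
      t = A h * change y' (suc h) + b h * change y' h
      T = 2 ^ top (suc h)
      lem : ∀ h s t → (1 ℕ.+ 2 ℕ.* h) ℕ.* s ℕ.* t ℕ.+ 2 ℕ.* s ℕ.* t ≡ (1 ℕ.+ 2 ℕ.* (1 ℕ.+ h)) ℕ.* s ℕ.* t
      lem = solveℕ

    -- Everything below the top power adds up to at most `2 (h+1) S` times `2 ^ top h`. A nonzero
    -- change of the top power is at least half of `2 ^ top (suc h)`, which a big gap makes at least
    -- `2 ^ P` times larger than `2 ^ top h`. The two factors of 2 give the 4 in `P-large`.
    dominated : ∀ h → h ℕ.< m → big h ≡ true → change y' (suc h) ≢ 0ℤ → ∣ b h * change y' h + rest y' w h ∣ ℕ.< ∣ change y' (suc h) ∣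
    dominated h p e ne = ℕP.*-cancelˡ-< 2 _ _ (begin-strict
      2 ℕ.* ∣ b h * change y' h + rest y' w h ∣                        ≤⟨ ℕP.*-monoʳ-≤ 2 (ℤP.∣i+j∣≤∣i∣+∣j∣ (b h * change y' h) (rest y' w h)) ⟩
      2 ℕ.* (∣ b h * change y' h ∣ ℕ.+ ∣ rest y' w h ∣)                ≡⟨ cong (λ z → 2 ℕ.* (z ℕ.+ ∣ rest y' w h ∣)) (ℤP.abs-* (b h) (change y' h)) ⟩
      2 ℕ.* (∣ b h ∣ ℕ.* ∣ change y' h ∣ ℕ.+ ∣ rest y' w h ∣)          ≤⟨ ℕP.*-monoʳ-≤ 2 (ℕP.+-mono-≤ (ℕP.*-mono-≤ (b≤ h p e) (change≤ h)) (rest≤ h (ℕP.<⇒≤ p))) ⟩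
      2 ℕ.* (S ℕ.* T ℕ.+ (1 ℕ.+ 2 ℕ.* h) ℕ.* S ℕ.* T)                  ≡⟨ lem h S T ⟩
      4 ℕ.* suc h ℕ.* S ℕ.* T                                          ≤⟨ ℕP.*-monoˡ-≤ T (ℕP.*-monoˡ-≤ S (ℕP.*-monoʳ-≤ 4 {suc h} {suc m} (ℕP.m<n⇒m<1+n p))) ⟩
      4 ℕ.* suc m ℕ.* S ℕ.* T                                          <⟨ ℕP.*-monoˡ-< T {{ℕP.m^n≢0 2 (top h)}} P-large ⟩
      2 ^ P ℕ.* T                                                      ≡⟨ sym (ℕP.^-distribˡ-+-* 2 P (top h)) ⟩
      2 ^ (P ℕ.+ top h)                                                ≤⟨ ℕP.^-monoʳ-≤ 2 (ℕP.≤-trans (ℕP.+-monoˡ-≤ (top h) (big-lo h p e)) (top-gap h p)) ⟩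
      2 ^ top (suc h)                                                  ≤⟨ ∣pos2-diff∣≥ (y' (suc h)) (y (suc h)) ne ⟩
      2 ℕ.* ∣ change y' (suc h) ∣                                      ∎)
      where
      open ℕP.≤-Reasoning
      T = 2 ^ top h
      lem : ∀ h s t → 2 ℕ.* (s ℕ.* t ℕ.+ (1 ℕ.+ 2 ℕ.* h) ℕ.* s ℕ.* t) ≡ 4 ℕ.* (1 ℕ.+ h) ℕ.* s ℕ.* t
      lem = solveℕ

  module _ (yp yn : ℕ → ℕ) (gp : Gaps m big lo yp) (gn : Gaps m big lo yn) (w : ℤ) (w≤ : ∣ w ∣ ℕ.≤ S)
           (yp0 : yp 0 ≡ y 0) (yn0 : yn 0 ≡ y 0) where
    private
      w≤' : ∣ - w ∣ ℕ.≤ S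
      w≤' = subst (ℕ._≤ S) (sym (ℤP.∣-i∣≡∣i∣ w)) w≤

      reflOpp : ∀ w → Opp w (- w)
      reflOpp w with ℤP.<-cmp 0ℤ w
      ... | tri< p _ _ = opp+ p (ℤP.neg-mono-< p)
      ... | tri≈ _ refl _ = opp0
      ... | tri> _ _ p = opp- p (ℤP.neg-mono-< p)

    -- The sign is sought from the top power downwards. At a big gap a nonzero collected coefficient
    -- times a nonzero change decides it; if one of them is zero, the power drops out and `b h`
    -- becomes the new `lead`. At a small gap the upper change is `2 ^ lo h` times the lower one, so
    -- the coefficient is passed down. At the bottom only `w` and `- w` remain. The argument `lead`
    -- may grow freely, since only whether it vanishes counts.
    opposite : ∀ h → h ℕ.≤ m → (∀ i → i ℕ.≤ h → Opp (change yp i) (change yn i)) →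
               ∀ lead → Opp (lead * change yp h + rest yp w h) (lead * change yn h + rest yn (- w) h)
    opposite zero _ _ lead = subst₂ Opp (e yp yp0 w) (e yn yn0 (- w)) (subst₂ Opp (ℤP.*-comm (pos2 (y 0)) w) (ℤP.*-comm (pos2 (y 0)) (- w)) (Opp-scale (pos2 (y 0)) (reflOpp w)))
      where
      e : ∀ y' → y' 0 ≡ y 0 → ∀ v → v * pos2 (y 0) ≡ lead * change y' 0 + v * pos2 (y 0)
      e y' q v = sym (trans (cong (λ z → lead * z + v * pos2 (y 0)) (trans (cong (λ t → pos2 t - pos2 (y 0)) q) (ℤP.+-inverseʳ (pos2 (y 0))))) (trans (cong (_+ v * pos2 (y 0)) (ℤP.*-zeroʳ lead)) (ℤP.+-identityˡ _)))
    opposite (suc h) p o lead with big h in e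
    ... | false = subst₂ Opp (push yp gp w) (push yn gn (- w)) (opposite h (ℕP.<⇒≤ p) (λ i q → o i (ℕP.m≤n⇒m≤1+n q)) ((lead + A h) * pos2 (lo h) + b h))
      where
      lem : ∀ lead a l b c r → ((lead + a) * l + b) * c + r ≡ lead * (l * c) + (r + (a * (l * c) + b * c))
      lem = solve-∀
      push : ∀ y' → (g : Gaps m big lo y') → ∀ v → ((lead + A h) * pos2 (lo h) + b h) * change y' h + rest y' v h ≡ lead * change y' (suc h) + rest y' v (suc h)
      push y' g v = trans (lem lead (A h) (pos2 (lo h)) (b h) (change y' h) (rest y' v h)) (cong (λ z → lead * z + (rest y' v h + (A h * z + b h * change y' h))) (sym (trans (cong₂ _-_ (trans (cong pos2 (proj₂ (g h p) e)) (pos2-+ (lo h) (y' h))) (trans (cong pos2 (proj₂ (gaps h p) e)) (pos2-+ (lo h) (y h)))) (lem' (pos2 (lo h)) (pos2 (y' h)) (pos2 (y h))))))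
        where
        lem' : ∀ l a b → l * a - l * b ≡ l * (a - b)
        lem' = solve-∀
    ... | true with lead + A h ℤ.≟ 0ℤ | change yp (suc h) ℤ.≟ 0ℤ
    ... | yes e0 | _ = subst₂ Opp (drop (change yp (suc h)) (change yp h) (rest yp w h)) (drop (change yn (suc h)) (change yn h) (rest yn (- w) h)) (opposite h (ℕP.<⇒≤ p) (λ i q → o i (ℕP.m≤n⇒m≤1+n q)) (b h))
      where
      lem : ∀ lead a b c d r → lead * d + (r + (a * d + b * c)) ≡ (lead + a) * d + (b * c + r)
      lem = solve-∀
      drop : ∀ d c r → b h * c + r ≡ lead * d + (r + (A h * d + b h * c))
      drop d c r = sym (trans (lem lead (A h) (b h) c d r) (trans (cong (λ z → z * d + (b h * c + r)) e0) (trans (cong (_+ (b h * c + r)) (ℤP.*-zeroˡ d)) (ℤP.+-identityˡ _))))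
    ... | no _ | yes d0 = subst₂ Opp (drop (change yp (suc h)) (change yp h) (rest yp w h) d0) (drop (change yn (suc h)) (change yn h) (rest yn (- w) h) (zero-right (o (suc h) ℕP.≤-refl) d0)) (opposite h (ℕP.<⇒≤ p) (λ i q → o i (ℕP.m≤n⇒m≤1+n q)) (b h))
      where
      zero-right : ∀ {u v} → Opp u v → u ≡ 0ℤ → v ≡ 0ℤ
      zero-right (opp+ p q) e = ⊥-elim (ℤP.<⇒≢ p (sym e))
      zero-right (opp- p q) e = ⊥-elim (ℤP.<⇒≢ p e)
      zero-right opp0 e = refl
      lem : ∀ lead a b c r → lead * 0ℤ + (r + (a * 0ℤ + b * c)) ≡ b * c + r
      lem = solve-∀
      drop : ∀ d c r → d ≡ 0ℤ → b h * c + r ≡ lead * d + (r + (A h * d + b h * c))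
      drop d c r refl = sym (lem lead (A h) (b h) c r)
    ... | no a≢0 | no d≢0 = subst₂ Opp (lem lead (A h) (b h) (change yp h) (change yp (suc h)) (rest yp w h)) (lem lead (A h) (b h) (change yn h) (change yn (suc h)) (rest yn (- w) h))
        (Opp-dominated a≢0 (o (suc h) ℕP.≤-refl) d≢0 (dominated yp gp w w≤ yp0 h p e) (dominated yn gn (- w) w≤' yn0 h p e))
      where
      lem : ∀ lead a b c d r → (lead + a) * d + (b * c + r) ≡ lead * d + (r + (a * d + b * c))
      lem = solve-∀

-- Level systems

record Row : Set where
  constructor row
  field
    ra     : ℕ → ℤ
    rc rc' : ℤ
open Row public

RowOK : ℕ → (ℕ → ℤ) → ℤ → Row → Set
RowOK n d B (row a c c') = dot n a d + c ≤ c' * B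

-- A linear-exponential inequality, split into one row per level by the carries c.
record Family : Set where
  constructor family
  field
    fa   : ℕ → ℕ → ℤ
    κ fc : ℕ → ℤ
open Family public

familyRow : ℕ → Family → Row
familyRow ℓ f = row (fa f ℓ) (κ f ℓ + fc f ℓ) (fc f (suc ℓ))

-- The row `d j + room ≤ room * B` states `d j < B` for `j > ℓ` and `d j ≤ 0` for `j ≤ ℓ` in one
-- shape. The second case holds because `Y j < 2 ^ Y j`, so the number `Y j` has no digits from
-- level `j` on.
room : ℕ → ℕ → ℤ
room ℓ j = if j ℕ.≤ᵇ ℓ then 0ℤ else 1ℤ

digitRows : ℕ → ℕ → List Row
digitRows ℓ zero    = []
digitRows ℓ (suc j) = row (λ i → - δ j i) 0ℤ 0ℤ ∷ row (δ j) (room ℓ j) (room ℓ j) ∷ digitRows ℓ j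

lower∈ : ∀ ℓ n j → j ℕ.< n → row (λ i → - δ j i) 0ℤ 0ℤ ∈ digitRows ℓ n
lower∈ ℓ (suc n) j p with j ℕ.≟ n
... | yes refl = here refl
... | no ne = there (there (lower∈ ℓ n j (ℕP.≤∧≢⇒< (ℕP.≤-pred p) ne)))

upper∈ : ∀ ℓ n j → j ℕ.< n → row (δ j) (room ℓ j) (room ℓ j) ∈ digitRows ℓ n
upper∈ ℓ (suc n) j p with j ℕ.≟ n
... | yes refl = there (here refl)
... | no ne = there (there (upper∈ ℓ n j (ℕP.≤∧≢⇒< (ℕP.≤-pred p) ne)))

-- res d Y ℓ j is the residue of the j-th number modulo 2^(Y ℓ).
res : (ℕ → ℕ → ℤ) → (ℕ → ℕ) → ℕ → ℕ → ℤ
res d Y zero    j = 0ℤ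
res d Y (suc ℓ) j = res d Y ℓ j + d ℓ j * pos2 (Y ℓ)

partial : ℕ → Family → (ℕ → ℕ → ℤ) → (ℕ → ℕ) → ℕ → ℤ
partial n f d Y zero    = 0ℤ
partial n f d Y (suc ℓ) = partial n f d Y ℓ + (dot n (fa f ℓ) (d ℓ) + κ f ℓ) * pos2 (Y ℓ)

pos2-∸ : ∀ {a b} → a ℕ.≤ b → pos2 (b ∸ a) * pos2 a ≡ pos2 b
pos2-∸ {a} {b} p = trans (sym (pos2-+ (b ∸ a) a)) (cong pos2 (ℕP.m∸n+n≡m p))

0≤pos2 : ∀ a → 0ℤ ≤ pos2 a
0≤pos2 a = +≤+ z≤n

*-monoʳ-≤-pos2 : ∀ a {x y} → x ≤ y → x * pos2 a ≤ y * pos2 a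
*-monoʳ-≤-pos2 a {x} {y} p = ≤-cert ((y - x) * pos2 a) (0≤* (≤⇒0≤ p) (0≤pos2 a)) (lem x y (pos2 a))
  where
  lem : ∀ x y z → y * z ≡ x * z + (y - x) * z
  lem = solve-∀

neg-dot-δ : ∀ n j d → j ℕ.< n → dot n (λ i → - δ j i) d ≡ - d j
neg-dot-δ n j d p = trans (Σ<-cong n (λ i _ → lem (δ j i) (d i))) (trans (Σ<-* n (- 1ℤ) (λ i → δ j i * d i)) (trans (cong (- 1ℤ *_) (dot-δ n j d p)) (ℤP.-1*i≡-i (d j))))
  where
  lem : ∀ a b → (- a) * b ≡ - 1ℤ * (a * b)
  lem = solve-∀

module System (m : ℕ) (big : ℕ → Bool) (lo : ℕ → ℕ) (fams : List Family) where
  n : ℕ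
  n = suc m

  rows : ℕ → List Row
  rows ℓ = map (familyRow ℓ) fams ++ digitRows ℓ n

  -- In `y-eq`, the number with index `ℓ + 1` has its last digit at level `ℓ`, so this digit
  -- completes it and thereby fixes the next cut position.
  record LevelOK (ℓ y y' : ℕ) (r : ℤ) (d : ℕ → ℤ) : Set where
    field
      y-eq   : + y' ≡ r + d (suc ℓ) * pos2 y
      gap-lo : lo ℓ ℕ.+ y ℕ.≤ y'
      gap-hi : big ℓ ≡ false → y' ≡ lo ℓ ℕ.+ y
      row-ok : All (RowOK n d (pos2 (y' ∸ y))) (rows ℓ)

    y≤y' : y ℕ.≤ y'
    y≤y' = ℕP.≤-trans (ℕP.m≤n+m y (lo ℓ)) gap-lo

    digit≥0 : ∀ j → j ℕ.< n → 0ℤ ≤ d j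
    digit≥0 j p = subst (0ℤ ≤_) (ℤP.neg-involutive (d j)) (ℤP.neg-mono-≤ (subst₂ _≤_ (trans (ℤP.+-identityʳ (dot n (λ i → - δ j i) d)) (neg-dot-δ n j d p)) (ℤP.*-zeroˡ (pos2 (y' ∸ y)))
        (All.lookup row-ok (∈-++⁺ʳ (map (familyRow ℓ) fams) (lower∈ ℓ n j p)))))

    digit-room : ∀ j → j ℕ.< n → d j + room ℓ j ≤ room ℓ j * pos2 (y' ∸ y)
    digit-room j p = subst (λ z → z + room ℓ j ≤ room ℓ j * pos2 (y' ∸ y)) (dot-δ n j d p) (All.lookup row-ok (∈-++⁺ʳ (map (familyRow ℓ) fams) (upper∈ ℓ n j p)))

    digit-zero : ∀ j → j ℕ.< n → j ℕ.≤ ℓ → d j ≡ 0ℤ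
    digit-zero j p q with j ℕ.≤ᵇ ℓ | ℕP.≤⇒≤ᵇ q | digit-room j p
    ... | true | _ | h = ℤP.≤-antisym (subst₂ _≤_ (ℤP.+-identityʳ (d j)) (ℤP.*-zeroˡ (pos2 (y' ∸ y))) h) (digit≥0 j p)

    digit<B : ∀ j → j ℕ.< n → d j + 1ℤ ≤ pos2 (y' ∸ y)
    digit<B j p with j ℕ.≤ᵇ ℓ in e | digit-room j p
    ... | false | h = subst (d j + 1ℤ ≤_) (ℤP.*-identityˡ (pos2 (y' ∸ y))) h
    ... | true | _ = subst (λ z → z + 1ℤ ≤ pos2 (y' ∸ y)) (sym (digit-zero j p (ℕP.≤ᵇ⇒≤ j ℓ (subst IsTrue (sym e) _)))) (+≤+ (ℕP.m^n>0 2 (y' ∸ y)))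

  OKat : (ℕ → ℕ) → (ℕ → ℕ → ℤ) → ℕ → Set
  OKat Y d ℓ = LevelOK ℓ (Y ℓ) (Y (suc ℓ)) (res d Y ℓ (suc ℓ)) (d ℓ)

  record Upto (Y : ℕ → ℕ) (d : ℕ → ℕ → ℤ) (L : ℕ) : Set where
    field
      Y-zero : Y 0 ≡ 0
      level  : ∀ ℓ → ℓ ℕ.< L → OKat Y d ℓ

    res-stable : L ℕ.≤ m → ∀ ℓ j → j ℕ.≤ ℓ → ℓ ℕ.≤ L → res d Y ℓ j ≡ + Y j
    res-stable L≤m zero zero z≤n _ = cong +_ (sym Y-zero)
    res-stable L≤m (suc ℓ) j p q with j ℕ.≟ suc ℓ
    ... | yes refl = sym (LevelOK.y-eq (level ℓ q))
    ... | no ne = trans (cong₂ _+_ (res-stable L≤m ℓ j j≤ℓ (ℕP.<⇒≤ q)) (trans (cong (_* pos2 (Y ℓ)) (LevelOK.digit-zero (level ℓ q) j (s≤s (ℕP.≤-trans j≤ℓ (ℕP.≤-trans (ℕP.<⇒≤ q) L≤m))) j≤ℓ)) (ℤP.*-zeroˡ (pos2 (Y ℓ))))) (ℤP.+-identityʳ (+ Y j))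
      where
      j≤ℓ : j ℕ.≤ ℓ
      j≤ℓ = ℕP.≤-pred (ℕP.≤∧≢⇒< p ne)

    -- Row `ℓ` times `2 ^ Y ℓ` turns the bound with carry `fc f ℓ` into the bound with carry
    -- `fc f (suc ℓ)`, because `B * 2 ^ Y ℓ = 2 ^ Y (suc ℓ)`.
    partial≤ : ∀ f → f ∈ fams → 0ℤ ≤ fc f 0 → ∀ ℓ → ℓ ℕ.≤ L → partial n f d Y ℓ ≤ fc f ℓ * pos2 (Y ℓ)
    partial≤ f f∈ c0 zero p = 0≤* c0 (0≤pos2 (Y 0))
    partial≤ f f∈ c0 (suc ℓ) p = subst (partial n f d Y ℓ + (D + κ f ℓ) * pos2 (Y ℓ) ≤_) e2
        (ℤP.≤-trans (ℤP.+-monoˡ-≤ ((D + κ f ℓ) * pos2 (Y ℓ)) (partial≤ f f∈ c0 ℓ (ℕP.<⇒≤ p)))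
          (subst (_≤ fc f (suc ℓ) * B * pos2 (Y ℓ)) (e1 (fc f ℓ) D (κ f ℓ) (pos2 (Y ℓ))) (*-monoʳ-≤-pos2 (Y ℓ) (All.lookup (LevelOK.row-ok (level ℓ p)) (∈-++⁺ˡ (∈-map⁺ (familyRow ℓ) f∈))))))
      where
      D = dot n (fa f ℓ) (d ℓ)
      B = pos2 (Y (suc ℓ) ∸ Y ℓ)
      e1 : ∀ c D k p → (D + (k + c)) * p ≡ c * p + (D + k) * p
      e1 = solve-∀
      e2 : fc f (suc ℓ) * B * pos2 (Y ℓ) ≡ fc f (suc ℓ) * pos2 (Y (suc ℓ))
      e2 = trans (ℤP.*-assoc (fc f (suc ℓ)) B (pos2 (Y ℓ))) (cong (fc f (suc ℓ) *_) (pos2-∸ (LevelOK.y≤y' (level ℓ p))))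

  State : (ℕ → ℕ) → (ℕ → ℕ → ℤ) → Set
  State Y d = Upto Y d m

  -- σ · (Y ℓ + lo ℓ - Y (ℓ+1)) ≤ 0
  record GapFamily (ℓ : ℕ) (σ : ℤ) (f : Family) : Set where
    field
      f∈    : f ∈ fams
      coeff : ∀ i j → fa f i j ≡ σ * (δ ℓ j - δ (suc ℓ) j)
      κ-0   : κ f 0 ≡ σ * + lo ℓ
      κ-suc : ∀ i → κ f (suc i) ≡ 0ℤ
      c-0   : fc f 0 ≡ 0ℤ
      c-end : fc f (suc ℓ) ≤ 0ℤ

    dot-gap : ℓ ℕ.< m → ∀ i x → dot n (fa f i) x ≡ σ * (x ℓ - x (suc ℓ))
    dot-gap ℓ<m i x = begin
      dot n (fa f i) x                                        ≡⟨ dot-cong n {y = x} (λ j _ → coeff i j) (λ _ _ → refl) ⟩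
      dot n (λ j → σ * (δ ℓ j - δ (suc ℓ) j)) x               ≡⟨ dot-*ˡ n σ (λ j → δ ℓ j - δ (suc ℓ) j) x ⟩
      σ * dot n (λ j → δ ℓ j - δ (suc ℓ) j) x                 ≡⟨ cong (σ *_) (dot-+ˡ n (δ ℓ) (λ j → - δ (suc ℓ) j) x) ⟩
      σ * (dot n (δ ℓ) x + dot n (λ j → - δ (suc ℓ) j) x)     ≡⟨ cong (σ *_) (cong₂ _+_ (dot-δ n ℓ x (ℕP.m<n⇒m<1+n ℓ<m)) (neg-dot-δ n (suc ℓ) x (s≤s ℓ<m))) ⟩
      σ * (x ℓ - x (suc ℓ))                                   ∎
      where open ≡-Reasoning

    partial-gap : ℓ ℕ.< m → ∀ d Y i → Y 0 ≡ 0 → partial n f d Y (suc i) ≡ σ * (res d Y (suc i) ℓ - res d Y (suc i) (suc ℓ) + + lo ℓ)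
    partial-gap ℓ<m d Y zero Y0 = trans (cong₂ (λ a b → 0ℤ + (a + b) * pos2 (Y 0)) (dot-gap ℓ<m 0 (d 0)) κ-0) (trans (cong (λ y → 0ℤ + (σ * (d 0 ℓ - d 0 (suc ℓ)) + σ * + lo ℓ) * pos2 y) Y0) (trans (lem σ (d 0 ℓ) (d 0 (suc ℓ)) (+ lo ℓ)) (cong (λ y → σ * (0ℤ + d 0 ℓ * pos2 y - (0ℤ + d 0 (suc ℓ) * pos2 y) + + lo ℓ)) (sym Y0))))
      where
      lem : ∀ s a b l → 0ℤ + (s * (a - b) + s * l) * 1ℤ ≡ s * (0ℤ + a * 1ℤ - (0ℤ + b * 1ℤ) + l)
      lem = solve-∀
    partial-gap ℓ<m d Y (suc i) Y0 = trans (cong₂ _+_ (partial-gap ℓ<m d Y i Y0) (cong₂ (λ a b → (a + b) * pos2 (Y (suc i))) (dot-gap ℓ<m (suc i) (d (suc i))) (κ-suc i)))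
      (lem σ (res d Y (suc i) ℓ) (res d Y (suc i) (suc ℓ)) (+ lo ℓ) (d (suc i) ℓ) (d (suc i) (suc ℓ)) (pos2 (Y (suc i))))
      where
      lem : ∀ s r r' l a b p → s * (r - r' + l) + (s * (a - b) + 0ℤ) * p ≡ s * (r + a * p - (r' + b * p) + l)
      lem = solve-∀

    gap-row : ∀ {Y d} → State Y d → ℓ ℕ.< m → σ * (0ℤ - d ℓ (suc ℓ)) + (κ f ℓ + fc f ℓ) ≤ 0ℤ
    gap-row {Y} {d} st ℓ<m = ℤP.≤-trans (subst (λ z → z + (κ f ℓ + fc f ℓ) ≤ fc f (suc ℓ) * B) e (All.lookup (LevelOK.row-ok ok) (∈-++⁺ˡ (∈-map⁺ (familyRow ℓ) f∈)))) c≤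
      where
      ok = Upto.level st ℓ ℓ<m
      B = pos2 (Y (suc ℓ) ∸ Y ℓ)
      e : dot n (fa f ℓ) (d ℓ) ≡ σ * (0ℤ - d ℓ (suc ℓ))
      e = trans (dot-gap ℓ<m ℓ (d ℓ)) (cong (λ z → σ * (z - d ℓ (suc ℓ))) (LevelOK.digit-zero ok ℓ (ℕP.m<n⇒m<1+n ℓ<m) ℕP.≤-refl))
      c≤ : fc f (suc ℓ) * B ≤ 0ℤ
      c≤ = subst (fc f (suc ℓ) * B ≤_) (ℤP.*-zeroˡ B) (*-monoʳ-≤-pos2 (Y (suc ℓ) ∸ Y ℓ) c-end)

    -- In a changed state the width of level `ℓ` depends on the new `Y (suc ℓ)`, so the gap cannot
    -- be read off the rows of that level. It follows instead from the rows below and the bound on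
    -- `u`, which is free of the width.
    gap-preserved : ∀ {Y d} → Upto Y d ℓ → ℓ ℕ.< m → ∀ u → σ * (0ℤ - u) + (κ f ℓ + fc f ℓ) ≤ 0ℤ →
                    σ * (+ lo ℓ + + Y ℓ - (res d Y ℓ (suc ℓ) + u * pos2 (Y ℓ))) ≤ 0ℤ
    gap-preserved {Y} {d} up ℓ<m u h = ℤP.≤-trans (subst (_≤ (σ * (0ℤ - u) + (κ f ℓ + fc f ℓ)) * pos2 (Y ℓ)) (sym split) bound) (subst ((σ * (0ℤ - u) + (κ f ℓ + fc f ℓ)) * pos2 (Y ℓ) ≤_) (ℤP.*-zeroˡ (pos2 (Y ℓ))) (*-monoʳ-≤-pos2 (Y ℓ) h))
      where
      V = partial n f d Y ℓ
      V≤ : V ≤ fc f ℓ * pos2 (Y ℓ)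
      V≤ = Upto.partial≤ up f f∈ (ℤP.≤-reflexive (sym c-0)) ℓ ℕP.≤-refl
      lem : ∀ s u k c p → c * p + (k - s * u) * p ≡ (s * (0ℤ - u) + (k + c)) * p
      lem = solve-∀
      bound : V + (κ f ℓ - σ * u) * pos2 (Y ℓ) ≤ (σ * (0ℤ - u) + (κ f ℓ + fc f ℓ)) * pos2 (Y ℓ)
      bound = subst (V + (κ f ℓ - σ * u) * pos2 (Y ℓ) ≤_) (lem σ u (κ f ℓ) (fc f ℓ) (pos2 (Y ℓ))) (ℤP.+-monoˡ-≤ ((κ f ℓ - σ * u) * pos2 (Y ℓ)) V≤)
      V-eq : ∀ i → i ≡ ℓ → partial n f d Y i + κ f i * pos2 (Y i) ≡ σ * (+ lo ℓ + + Y i - res d Y i (suc ℓ))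
      V-eq zero refl = trans (cong₂ (λ a y → 0ℤ + a * pos2 y) κ-0 (Upto.Y-zero up)) (trans (lem0 σ (+ lo ℓ)) (cong (λ y → σ * (+ lo ℓ + + y - 0ℤ)) (sym (Upto.Y-zero up))))
        where
        lem0 : ∀ s l → 0ℤ + s * l * 1ℤ ≡ s * (l + 0ℤ - 0ℤ)
        lem0 = solve-∀
      V-eq (suc i) refl = trans (cong₂ (λ a b → a + b * pos2 (Y (suc i))) (partial-gap ℓ<m d Y i (Upto.Y-zero up)) (κ-suc i)) (trans (cong (λ z → σ * (z - res d Y (suc i) (suc ℓ) + + lo ℓ) + 0ℤ * pos2 (Y (suc i))) (Upto.res-stable up (ℕP.<⇒≤ ℓ<m) ℓ ℓ ℕP.≤-refl ℕP.≤-refl)) (lem1 σ (+ Y (suc i)) (res d Y (suc i) (suc ℓ)) (+ lo ℓ) (pos2 (Y (suc i)))))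
        where
        lem1 : ∀ s y r l p → s * (y - r + l) + 0ℤ * p ≡ s * (l + y - r)
        lem1 = solve-∀
      split : σ * (+ lo ℓ + + Y ℓ - (res d Y ℓ (suc ℓ) + u * pos2 (Y ℓ))) ≡ V + (κ f ℓ - σ * u) * pos2 (Y ℓ)
      split = trans (l2 σ (+ lo ℓ) (+ Y ℓ) (res d Y ℓ (suc ℓ)) u (pos2 (Y ℓ))) (trans (cong (λ z → z - σ * u * pos2 (Y ℓ)) (sym (V-eq ℓ refl))) (l3 V (κ f ℓ) (σ * u) (pos2 (Y ℓ))))
        where
        l2 : ∀ s l y r u p → s * (l + y - (r + u * p)) ≡ s * (l + y - r) - s * u * p
        l2 = solve-∀
        l3 : ∀ v k x p → v + k * p - x * p ≡ v + (k - x) * p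
        l3 = solve-∀

-- Propagating a change of digits to the higher levels

exact-/ℕ : ∀ a g → (+ suc g) ∣ a → + suc g * (a /ℕ suc g) ≡ a
exact-/ℕ a g (divides q e) = sym (trans (a≡a%ℕn+[a/ℕn]*n a (suc g)) (trans (cong₂ _+_ (cong +_ r≡0) (ℤP.*-comm (a /ℕ suc g) (+ suc g))) (ℤP.+-identityˡ (+ suc g * (a /ℕ suc g)))))
  where
  open import Data.Integer.DivMod using (n%ℕd<d)
  r = a %ℕ suc g
  d : (+ suc g) ∣ + r
  d = ℤD.∣m+n∣n⇒∣m {m = + r} {n = (a /ℕ suc g) * + suc g} (subst ((+ suc g) ∣_) (a≡a%ℕn+[a/ℕn]*n a (suc g)) (divides q e)) (divides (a /ℕ suc g) refl)
  r≡0 : r ≡ 0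
  r≡0 with r in eq
  ... | zero = refl
  ... | suc r' = ⊥-elim (ℕP.<⇒≱ (n%ℕd<d a (suc g)) (subst (suc g ℕ.≤_) (sym eq) (ℕD.∣⇒≤ (subst (λ z → suc g ℕD.∣ z) eq (ℤD.∣⇒∣ᵤ d)))))

*-cancelˡ-pos : ∀ g {x y} → + suc g * x ≡ + suc g * y → x ≡ y
*-cancelˡ-pos g {x} {y} e = ℤP.*-cancelˡ-≡ (+ suc g) x y e

record Scheme : Set where
  constructor scheme
  field
    gp  : ℕ
    α β : ℕ → ℤ
  g : ℕ
  g = suc gp
open Scheme public

Follows : ℕ → Scheme → ℤ → (ℕ → ℤ) → Set
Follows n s B d = ∀ j → j ℕ.< n → + g s * d j ≡ α s j * B + β s j

contribution : ∀ n s j y y' d → j ℕ.< n → Follows n s (pos2 (y' ∸ y)) d → y ℕ.≤ y' →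
               + g s * (d j * pos2 y) ≡ α s j * pos2 y' + β s j * pos2 y
contribution n s j y y' d p f h = trans (sym (ℤP.*-assoc (+ g s) (d j) (pos2 y))) (trans (cong (_* pos2 y) (f j p)) (trans (lem (α s j) (pos2 (y' ∸ y)) (β s j) (pos2 y)) (cong (λ z → α s j * z + β s j * pos2 y) (pos2-∸ h))))
  where
  lem : ∀ a B b q → (a * B + b) * q ≡ a * (B * q) + b * q
  lem = solve-∀

-- A value of `B` above `∣ p ∣` rules out `q > 0`. For `q = 0` the inequality does not contain `B`,
-- and for `q < 0` it holds for every `B'` above `∣ p ∣`.
qp-shift : ∀ q p B B' → ∣ p ∣ ℕ.< B → ∣ p ∣ ℕ.< B' → q * + B + p ≤ 0ℤ → q * + B' + p ≤ 0ℤ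
qp-shift (+ zero) p B B' _ _ h = subst (λ z → z + p ≤ 0ℤ) (trans (ℤP.*-zeroˡ (+ B)) (sym (ℤP.*-zeroˡ (+ B')))) h
qp-shift (+ suc q) p B B' b _ h = ⊥-elim (ℤP.<⇒≱ (pos-dominates {+ suc q} {+ B} {p} (+<+ (s≤s z≤n)) (+<+ (ℕP.≤-<-trans z≤n b)) b) h)
qp-shift -[1+ q ] p B B' _ b h = ℤP.<⇒≤ (subst (_< 0ℤ) (lem (+ suc q) (+ B') p) (ℤP.neg-mono-< (pos-dominates {+ suc q} {+ B'} { - p} (+<+ (s≤s z≤n)) (+<+ (ℕP.≤-<-trans z≤n b)) (subst (ℕ._< B') (sym (ℤP.∣-i∣≡∣i∣ p)) b))))
  where
  lem : ∀ q B p → - (q * B + - p) ≡ (- q) * B + p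
  lem = solve-∀

dot-affine : ∀ n a (x w v : ℕ → ℤ) c B → (∀ j → j ℕ.< n → c * x j ≡ w j * B + v j) → c * dot n a x ≡ dot n a w * B + dot n a v
dot-affine n a x w v c B h = begin
  c * dot n a x                                ≡⟨ sym (dot-*ʳ n c a x) ⟩
  dot n a (λ j → c * x j)                      ≡⟨ dot-cong n {a} (λ _ _ → refl) (λ j p → trans (h j p) (cong (_+ v j) (ℤP.*-comm (w j) B))) ⟩
  dot n a (λ j → B * w j + v j)                ≡⟨ dot-+ʳ n a (λ j → B * w j) v ⟩
  dot n a (λ j → B * w j) + dot n a v          ≡⟨ cong (_+ dot n a v) (trans (dot-*ʳ n B a w) (ℤP.*-comm B (dot n a w))) ⟩
  dot n a w * B + dot n a v                    ∎
  where open ≡-Reasoning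

row-scaled : ∀ n s B d ρ → Follows n s B d →
  (dot n (ra ρ) (α s) - + g s * rc' ρ) * B + (dot n (ra ρ) (β s) + + g s * rc ρ) ≡ + g s * (dot n (ra ρ) d + rc ρ - rc' ρ * B)
row-scaled n s B d (row a c c') h = trans (lem1 (dot n a (α s)) (dot n a (β s)) (+ g s) c c' B) (trans (cong (λ z → z + + g s * (c - c' * B)) (sym (dot-affine n a d (α s) (β s) (+ g s) B h))) (lem2 (+ g s) (dot n a d) c (c' * B)))
  where
  lem1 : ∀ x y g c c' B → (x - g * c') * B + (y + g * c) ≡ (x * B + y) + g * (c - c' * B)
  lem1 = solve-∀
  lem2 : ∀ g x c y → g * x + g * (c - y) ≡ g * (x + c - y)
  lem2 = solve-∀

*-pos-≤0 : ∀ g x → x ≤ 0ℤ → + suc g * x ≤ 0ℤ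
*-pos-≤0 g x h = subst (+ suc g * x ≤_) (ℤP.*-zeroʳ (+ suc g)) (ℤP.*-monoˡ-≤-nonNeg (+ suc g) h)

*-pos-≤0⁻ : ∀ g x → + suc g * x ≤ 0ℤ → x ≤ 0ℤ
*-pos-≤0⁻ g x h = ℤP.*-cancelˡ-≤-pos x 0ℤ (+ suc g) (subst (+ suc g * x ≤_) (sym (ℤP.*-zeroʳ (+ suc g))) h)

≤⇒-≤0 : ∀ {x y} → x ≤ y → x - y ≤ 0ℤ
≤⇒-≤0 {x} {y} h = ≤-cert (y - x) (≤⇒0≤ h) (lem x y)
  where
  lem : ∀ x y → 0ℤ ≡ x - y + (y - x)
  lem = solve-∀

-≤0⇒≤ : ∀ {x y} → x - y ≤ 0ℤ → x ≤ y
-≤0⇒≤ {x} {y} h = ≤-cert (0ℤ - (x - y)) (≤⇒0≤ h) (lem x y)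
  where
  lem : ∀ x y → y ≡ x + (0ℤ - (x - y))
  lem = solve-∀

row-shift : ∀ n s B B' d d' ρ → Follows n s (+ B) d → Follows n s (+ B') d' →
  ∣ dot n (ra ρ) (β s) + + g s * rc ρ ∣ ℕ.< B → ∣ dot n (ra ρ) (β s) + + g s * rc ρ ∣ ℕ.< B' →
  RowOK n d (+ B) ρ → RowOK n d' (+ B') ρ
row-shift n s B B' d d' ρ f f' b b' h = -≤0⇒≤ (*-pos-≤0⁻ (gp s) _ (subst (_≤ 0ℤ) (row-scaled n s (+ B') d' ρ f')
  (qp-shift (dot n (ra ρ) (α s) - + g s * rc' ρ) _ B B' b b' (subst (_≤ 0ℤ) (sym (row-scaled n s (+ B) d ρ f)) (*-pos-≤0 (gp s) _ (≤⇒-≤0 h))))))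

pick : {X : Set} → ℕ → ℕ → X → X → X → X
pick ℓ k x y z with ℕP.<-cmp ℓ k
... | tri< _ _ _ = x
... | tri≈ _ _ _ = y
... | tri> _ _ _ = z

pick-< : ∀ {X : Set} {ℓ k} {x y z : X} → ℓ ℕ.< k → pick ℓ k x y z ≡ x
pick-< {ℓ = ℓ} {k} p with ℕP.<-cmp ℓ k
... | tri< _ _ _ = refl
... | tri≈ ¬p _ _ = ⊥-elim (¬p p)
... | tri> ¬p _ _ = ⊥-elim (¬p p)

pick-≡ : ∀ {X : Set} {k} {x y z : X} → pick k k x y z ≡ y
pick-≡ {k = k} with ℕP.<-cmp k k
... | tri< _ ne _ = ⊥-elim (ne refl)
... | tri≈ _ _ _ = refl
... | tri> _ ne _ = ⊥-elim (ne refl)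

pick-> : ∀ {X : Set} {ℓ k} {x y z : X} → k ℕ.< ℓ → pick ℓ k x y z ≡ z
pick-> {ℓ = ℓ} {k} p with ℕP.<-cmp ℓ k
... | tri< _ _ ¬p = ⊥-elim (¬p p)
... | tri≈ _ _ ¬p = ⊥-elim (¬p p)
... | tri> _ _ _ = refl

record Levels : Set where
  field
    m      : ℕ
    big    : ℕ → Bool
    lo     : ℕ → ℕ
    fams   : List Family
    P      : ℕ
    big-lo : ∀ ℓ → ℓ ℕ.< m → big ℓ ≡ true → P ℕ.≤ lo ℓ
    gapLo  : ∀ ℓ → ℓ ℕ.< m → Σ Family (System.GapFamily m big lo fams ℓ 1ℤ)
    gapHi  : ∀ ℓ → ℓ ℕ.< m → big ℓ ≡ false → Σ Family (System.GapFamily m big lo fams ℓ (- 1ℤ))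

module Moves (levels : Levels) where
  open Levels levels
  open System m big lo fams

  width : (ℕ → ℕ) → ℕ → ℤ
  width Y ℓ = pos2 (Y (suc ℓ) ∸ Y ℓ)

  record LiftData : Set where
    field
      Z       : ℕ
      per     : Per Z Z
      1≤Z     : 1 ℕ.≤ Z
      Z<2^P   : Z ^ suc (suc m) ℕ.< 2 ^ P
      Y       : ℕ → ℕ
      d       : ℕ → ℕ → ℤ
      st      : State Y d
      k       : ℕ
      k<m     : k ℕ.< m
      bigk    : big k ≡ true
      sch     : ℕ → Scheme
      follows : ∀ ℓ → k ℕ.< ℓ → ℓ ℕ.< m → Follows n (sch ℓ) (width Y ℓ) (d ℓ)
      α-next  : ∀ ℓ → k ℕ.< ℓ → ℓ ℕ.< m → α (sch ℓ) (suc ℓ) ≡ 0ℤ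
      g∣Z     : ∀ ℓ → k ℕ.< ℓ → ℓ ℕ.< m → g (sch ℓ) ℕD.∣ Z
      p-bound : ∀ ℓ → k ℕ.< ℓ → ℓ ℕ.< m → big ℓ ≡ true → ∀ ρ → ρ ∈ rows ℓ → ∣ dot n (ra ρ) (β (sch ℓ)) + + g (sch ℓ) * rc ρ ∣ ℕ.< 2 ^ P
      dk      : ℕ → ℤ
      yk      : ℕ
      levelk  : LevelOK k (Y k) yk (res d Y k (suc k)) dk
      modk    : ∀ j → j ℕ.< n → (+ (Z ^ (m ∸ k))) ∣ dk j - d k j

  module Lift (liftData : LiftData) where
    open LiftData liftData

    -- Dividing by a denominator `g ∣ Z` weakens a congruence modulo `M ℓ` to one modulo
    -- `M (suc ℓ)`. The exponent leaves one factor `Z` at the top level `m`.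
    M : ℕ → ℕ
    M ℓ = Z ^ (suc m ∸ ℓ)

    M-suc : ∀ ℓ → ℓ ℕ.≤ m → M ℓ ≡ Z ℕ.* M (suc ℓ)
    M-suc ℓ p = cong (Z ^_) (ℕP.+-∸-assoc 1 p)

    perM : ∀ ℓ → ℓ ℕ.≤ m → Per (M ℓ) (M ℓ)
    perM ℓ p = subst (λ e → Per (Z ^ e) (Z ^ e)) (sym (ℕP.+-∸-assoc 1 p)) (Per-^ per (m ∸ ℓ))

    M< : ∀ ℓ → M ℓ ℕ.< 2 ^ P
    M< ℓ = ℕP.≤-<-trans (ℕP.^-monoʳ-≤ Z {{ℕ.>-nonZero 1≤Z}} (ℕP.≤-trans (ℕP.m∸n≤m (suc m) ℓ) (ℕP.n≤1+n (suc m)))) Z<2^P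

    -- Above `k` the digit that determines the next cut position is kept, in accordance with
    -- `α-next`. Thus the new `Y (suc ℓ)`, and with it the width, is available before the other
    -- digits of the level are computed from the width.
    uf : ℕ → ℤ
    uf ℓ = pick ℓ k (d ℓ (suc ℓ)) (dk (suc k)) (d ℓ (suc ℓ))

    evalScheme : ℕ → ℤ → ℕ → ℤ
    evalScheme ℓ B = if big ℓ then (λ j → (α (sch ℓ) j * B + β (sch ℓ) j) /ℕ g (sch ℓ)) else d ℓ

    df : ℕ → ℤ → ℕ → ℤ
    df ℓ B = pick ℓ k (d ℓ) dk (evalScheme ℓ B)

    traj : ℕ → ℕ × (ℕ → ℤ)
    traj zero    = 0 , λ _ → 0ℤ
    traj (suc ℓ) = y' , λ j → r j + df ℓ (pos2 (y' ∸ y)) j * pos2 y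
      where
      y = proj₁ (traj ℓ)
      r = proj₂ (traj ℓ)
      -- The absolute value only serves to land in ℕ: below and at `k` the argument is a known
      -- natural number, and above `k` the lower gap bound makes it nonnegative.
      y' = ∣ r (suc ℓ) + uf ℓ * pos2 y ∣

    Y' : ℕ → ℕ
    Y' ℓ = proj₁ (traj ℓ)
    r' : ℕ → ℕ → ℤ
    r' ℓ = proj₂ (traj ℓ)
    d' : ℕ → ℕ → ℤ
    d' ℓ = df ℓ (width Y' ℓ)

    res-r' : ∀ ℓ j → res d' Y' ℓ j ≡ r' ℓ j
    res-r' zero j = refl
    res-r' (suc ℓ) j = cong (_+ d' ℓ j * pos2 (Y' ℓ)) (res-r' ℓ j)

    d'-below : ∀ ℓ → ℓ ℕ.< k → d' ℓ ≡ d ℓ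
    d'-below ℓ p = pick-< p
    d'-at : d' k ≡ dk
    d'-at = pick-≡ {k = k} {d k} {dk} {evalScheme k (width Y' k)}

    abs-of : ∀ {x} y → + y ≡ x → ∣ x ∣ ≡ y
    abs-of y refl = refl

    below : ∀ ℓ → ℓ ℕ.≤ k → Y' ℓ ≡ Y ℓ × (∀ j → r' ℓ j ≡ res d Y ℓ j)
    below zero p = sym (Upto.Y-zero st) , λ _ → refl
    below (suc ℓ) p = Yeq , λ j → cong₂ _+_ (proj₂ ih j) (cong₂ _*_ (cong (λ f → f j) (d'-below ℓ p)) (cong pos2 (proj₁ ih)))
      where
      ih = below ℓ (ℕP.<⇒≤ p)
      Yeq : Y' (suc ℓ) ≡ Y (suc ℓ)
      Yeq = abs-of (Y (suc ℓ)) (trans (LevelOK.y-eq (Upto.level st ℓ (ℕP.<-trans p k<m))) (sym (cong₂ _+_ (proj₂ ih (suc ℓ)) (cong₂ _*_ (pick-< p) (cong pos2 (proj₁ ih))))))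

    Y'-k : Y' (suc k) ≡ yk
    Y'-k = abs-of yk (trans (LevelOK.y-eq levelk) (sym (cong₂ _+_ (proj₂ (below k ℕP.≤-refl) (suc k)) (cong₂ _*_ (pick-≡ {k = k}) (cong pos2 (proj₁ (below k ℕP.≤-refl)))))))

    transport : ∀ ℓ {y₁ y₂ z₁ z₂ r₁ r₂ e₁ e₂} → y₁ ≡ y₂ → z₁ ≡ z₂ → r₁ ≡ r₂ → e₁ ≡ e₂ → LevelOK ℓ y₁ z₁ r₁ e₁ → LevelOK ℓ y₂ z₂ r₂ e₂
    transport ℓ refl refl refl refl x = x

    level-below : ∀ ℓ → ℓ ℕ.< k → OKat Y' d' ℓ
    level-below ℓ p = transport ℓ (sym (proj₁ (below ℓ (ℕP.<⇒≤ p)))) (sym (proj₁ (below (suc ℓ) p))) (sym (trans (res-r' ℓ (suc ℓ)) (proj₂ (below ℓ (ℕP.<⇒≤ p)) (suc ℓ)))) (sym (d'-below ℓ p)) (Upto.level st ℓ (ℕP.<-trans p k<m))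

    level-at : OKat Y' d' k
    level-at = transport k (sym (proj₁ (below k ℕP.≤-refl))) (sym Y'-k) (sym (trans (res-r' k (suc k)) (proj₂ (below k ℕP.≤-refl) (suc k)))) (sym d'-at) levelk

    -- The field `large` prepares `pos2-cong-mod`: exponents that differ must both be at least `P`.
    record Inv (ℓ : ℕ) : Set where
      field
        upto  : Upto Y' d' ℓ
        fol   : ∀ i → k ℕ.< i → i ℕ.< ℓ → Follows n (sch i) (width Y' i) (d' i)
        mod-r : ∀ j → j ℕ.< n → (+ M ℓ) ∣ r' ℓ j - res d Y ℓ j
        mod-Y : (+ M ℓ) ∣ + Y' ℓ - + Y ℓ
        large : Y' ℓ ≡ Y ℓ ⊎ (P ℕ.≤ Y' ℓ × P ℕ.≤ Y ℓ)

    init : Inv (suc k)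
    init = record
      { upto = record { Y-zero = refl ; level = λ ℓ p → lv ℓ p }
      ; fol = λ i p q → ⊥-elim (ℕP.<⇒≱ p (ℕP.≤-pred q))
      ; mod-r = mr
      ; mod-Y = subst ((+ M (suc k)) ∣_) mY (mr (suc k) (s≤s k<m))
      ; large = inj₂ (big≥ (ℕP.≤-reflexive (sym Y'-k)) (LevelOK.gap-lo levelk) , big≥ ℕP.≤-refl (LevelOK.gap-lo okk)) }
      where
      okk = Upto.level st k k<m
      big≥ : ∀ {x y z} → x ℕ.≤ y → lo k ℕ.+ z ℕ.≤ x → P ℕ.≤ y
      big≥ {z = z} p q = ℕP.≤-trans (ℕP.≤-trans (big-lo k k<m bigk) (ℕP.m≤m+n (lo k) z)) (ℕP.≤-trans q p)
      lv : ∀ ℓ → ℓ ℕ.< suc k → OKat Y' d' ℓ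
      lv ℓ p = Data.Sum.[ (λ { refl → level-at }) , level-below ℓ ]′ (<suc-cases p)
      lem : ∀ r a b p → r + a * p - (r + b * p) ≡ p * (a - b)
      lem = solve-∀
      mr : ∀ j → j ℕ.< n → (+ M (suc k)) ∣ r' (suc k) j - res d Y (suc k) j
      mr j p = subst ((+ M (suc k)) ∣_) (sym (trans (cong (λ z → z - res d Y (suc k) j) (cong₂ _+_ (proj₂ (below k ℕP.≤-refl) j) (cong₂ _*_ (cong (λ f → f j) d'-at) (cong pos2 (proj₁ (below k ℕP.≤-refl)))))) (lem (res d Y k j) (dk j) (d k j) (pos2 (Y k)))))
        (ℤD.∣n⇒∣m*n (pos2 (Y k)) (modk j p))
      mY : r' (suc k) (suc k) - res d Y (suc k) (suc k) ≡ + Y' (suc k) - + Y (suc k)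
      mY = cong₂ _-_ (trans (sym (res-r' (suc k) (suc k))) (sym (LevelOK.y-eq level-at))) (sym (LevelOK.y-eq okk))

    mod-pos2 : ∀ ℓ → ℓ ℕ.≤ m → ∀ a b → a ≡ b ⊎ (P ℕ.≤ a × P ℕ.≤ b) → (+ M ℓ) ∣ + a - + b → (+ M ℓ) ∣ pos2 a - pos2 b
    mod-pos2 ℓ p a b (inj₁ refl) _ = subst ((+ M ℓ) ∣_) (sym (ℤP.+-inverseʳ (pos2 a))) (divides 0ℤ refl)
    mod-pos2 ℓ p a b (inj₂ (x , y)) h = pos2-cong-mod (perM ℓ p) (M< ℓ) a b x y h

    module Step (ℓ : ℕ) (k<ℓ : k ℕ.< ℓ) (ℓ<m : ℓ ℕ.< m) (inv : Inv ℓ) where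
      open Inv inv
      s = sch ℓ
      ok : OKat Y d ℓ
      ok = Upto.level st ℓ ℓ<m
      open LevelOK ok using () renaming (y≤y' to Y≤)
      u = d ℓ (suc ℓ)
      u≡ : uf ℓ ≡ u
      u≡ = pick-> k<ℓ
      X : ℤ
      X = res d' Y' ℓ (suc ℓ) + u * pos2 (Y' ℓ)

      lower : + lo ℓ + + Y' ℓ ≤ X
      lower = -≤0⇒≤ (subst (_≤ 0ℤ) (ℤP.*-identityˡ (+ lo ℓ + + Y' ℓ - X)) (System.GapFamily.gap-preserved gf upto ℓ<m u (System.GapFamily.gap-row gf st ℓ<m)))
        where gf = proj₂ (gapLo ℓ ℓ<m)

      X-eq : + Y' (suc ℓ) ≡ X
      X-eq = trans (ℤP.0≤i⇒+∣i∣≡i (subst (0ℤ ≤_) e (ℤP.≤-trans (+≤+ z≤n) lower))) (sym e)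
        where
        e : X ≡ r' ℓ (suc ℓ) + uf ℓ * pos2 (Y' ℓ)
        e = cong₂ (λ a b → a + b * pos2 (Y' ℓ)) (res-r' ℓ (suc ℓ)) (sym u≡)

      gapLo' : lo ℓ ℕ.+ Y' ℓ ℕ.≤ Y' (suc ℓ)
      gapLo' = ℤP.drop‿+≤+ (subst (_≤ + Y' (suc ℓ)) (sym (ℤP.pos-+ (lo ℓ) (Y' ℓ))) (subst (+ lo ℓ + + Y' ℓ ≤_) (sym X-eq) lower))

      gapHi' : big ℓ ≡ false → Y' (suc ℓ) ≡ lo ℓ ℕ.+ Y' ℓ
      gapHi' e = ℕP.≤-antisym (ℤP.drop‿+≤+ (subst₂ _≤_ (sym X-eq) (sym (ℤP.pos-+ (lo ℓ) (Y' ℓ))) up)) gapLo'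
        where
        gf = proj₂ (gapHi ℓ ℓ<m e)
        lem : ∀ a x → - 1ℤ * (a - x) ≡ x - a
        lem = solve-∀
        up : X ≤ + lo ℓ + + Y' ℓ
        up = -≤0⇒≤ (subst (_≤ 0ℤ) (lem (+ lo ℓ + + Y' ℓ) X) (System.GapFamily.gap-preserved gf upto ℓ<m u (System.GapFamily.gap-row gf st ℓ<m)))

      Y'≤ : Y' ℓ ℕ.≤ Y' (suc ℓ)
      Y'≤ = ℕP.≤-trans (ℕP.m≤n+m (Y' ℓ) (lo ℓ)) gapLo'

      mod-D : (+ M ℓ) ∣ pos2 (Y' ℓ) - pos2 (Y ℓ)
      mod-D = mod-pos2 ℓ (ℕP.<⇒≤ ℓ<m) (Y' ℓ) (Y ℓ) large mod-Y

      mod-Y⁺ : (+ M ℓ) ∣ + Y' (suc ℓ) - + Y (suc ℓ)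
      mod-Y⁺ = subst ((+ M ℓ) ∣_) (sym (trans (cong₂ _-_ (trans X-eq (cong (_+ u * pos2 (Y' ℓ)) (res-r' ℓ (suc ℓ)))) (LevelOK.y-eq ok)) (lem (r' ℓ (suc ℓ)) (res d Y ℓ (suc ℓ)) u (pos2 (Y' ℓ)) (pos2 (Y ℓ)))))
          (ℤD.∣m∣n⇒∣m+n (mod-r (suc ℓ) (s≤s ℓ<m)) (ℤD.∣n⇒∣m*n u mod-D))
        where
        lem : ∀ a b u p q → a + u * p - (b + u * q) ≡ (a - b) + u * (p - q)
        lem = solve-∀

      large⁺ : Y' (suc ℓ) ≡ Y (suc ℓ) ⊎ (P ℕ.≤ Y' (suc ℓ) × P ℕ.≤ Y (suc ℓ))
      large⁺ with big ℓ in e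
      ... | true = inj₂ (ℕP.≤-trans (ℕP.≤-trans (big-lo ℓ ℓ<m e) (ℕP.m≤m+n (lo ℓ) (Y' ℓ))) gapLo' , ℕP.≤-trans (ℕP.≤-trans (big-lo ℓ ℓ<m e) (ℕP.m≤m+n (lo ℓ) (Y ℓ))) (LevelOK.gap-lo ok))
      ... | false with large
      ... | inj₁ q = inj₁ (trans (gapHi' e) (trans (cong (lo ℓ ℕ.+_) q) (sym (LevelOK.gap-hi ok e))))
      ... | inj₂ (a , b) = inj₂ (ℕP.≤-trans a Y'≤ , ℕP.≤-trans b Y≤)

      mod-D⁺ : (+ M ℓ) ∣ pos2 (Y' (suc ℓ)) - pos2 (Y (suc ℓ))
      mod-D⁺ = mod-pos2 ℓ (ℕP.<⇒≤ ℓ<m) (Y' (suc ℓ)) (Y (suc ℓ)) large⁺ mod-Y⁺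

      widthP : big ℓ ≡ true → ∀ y y' → lo ℓ ℕ.+ y ℕ.≤ y' → P ℕ.≤ y' ∸ y
      widthP e y y' h = ℕP.≤-trans (big-lo ℓ ℓ<m e) (ℕP.m+n≤o⇒m≤o∸n (lo ℓ) h)

      mod-B : big ℓ ≡ true → (+ M ℓ) ∣ width Y' ℓ - width Y ℓ
      mod-B e = mod-pos2 ℓ (ℕP.<⇒≤ ℓ<m) (Y' (suc ℓ) ∸ Y' ℓ) (Y (suc ℓ) ∸ Y ℓ) (inj₂ (widthP e _ _ gapLo' , widthP e _ _ (LevelOK.gap-lo ok)))
          (subst ((+ M ℓ) ∣_) (sym (trans (cong₂ _-_ (pos-∸ Y'≤) (pos-∸ Y≤)) (lem (+ Y' (suc ℓ)) (+ Y' ℓ) (+ Y (suc ℓ)) (+ Y ℓ)))) (ℤD.∣m∣n⇒∣m-n mod-Y⁺ mod-Y))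
        where
        lem : ∀ a b c e → (a - b) - (c - e) ≡ (a - c) - (b - e)
        lem = solve-∀

      g∣M : (+ g s) ∣ (+ M ℓ)
      g∣M = ℤD.∣ᵤ⇒∣ (ℕD.∣-trans (g∣Z ℓ k<ℓ ℓ<m) (subst (Z ℕD.∣_) (sym (M-suc ℓ (ℕP.<⇒≤ ℓ<m))) (ℕD.m∣m*n (M (suc ℓ)))))

      -- The numerator changes by `α` times the change of the width, a multiple of `M ℓ` and hence
      -- of `g`, so the quotient remains exact.
      fol-big : big ℓ ≡ true → Follows n s (width Y' ℓ) (d' ℓ)
      fol-big e j p = trans (cong (λ f → + g s * f j) (trans (pick-> k<ℓ) (cong (λ b → if b then (λ j → (α s j * width Y' ℓ + β s j) /ℕ g s) else d ℓ) e)))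
          (exact-/ℕ (α s j * width Y' ℓ + β s j) (gp s) (subst ((+ g s) ∣_) (sym eq) (ℤD.∣m∣n⇒∣m+n (divides (d ℓ j) (ℤP.*-comm (+ g s) (d ℓ j))) (ℤD.∣n⇒∣m*n (α s j) (ℤD.∣-trans g∣M (mod-B e))))))
        where
        lem : ∀ a B' B b → a * B' + b ≡ (a * B + b) + a * (B' - B)
        lem = solve-∀
        eq : α s j * width Y' ℓ + β s j ≡ + g s * d ℓ j + α s j * (width Y' ℓ - width Y ℓ)
        eq = trans (lem (α s j) (width Y' ℓ) (width Y ℓ) (β s j)) (cong (_+ α s j * (width Y' ℓ - width Y ℓ)) (sym (follows ℓ k<ℓ ℓ<m j p)))

      d'-small : big ℓ ≡ false → d' ℓ ≡ d ℓ
      d'-small e = trans (pick-> k<ℓ) (cong (λ b → if b then (λ j → (α s j * width Y' ℓ + β s j) /ℕ g s) else d ℓ) e)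

      width-small : big ℓ ≡ false → width Y' ℓ ≡ width Y ℓ
      width-small e = cong pos2 (trans (trans (cong (_∸ Y' ℓ) (gapHi' e)) (ℕP.m+n∸n≡m (lo ℓ) (Y' ℓ))) (sym (trans (cong (_∸ Y ℓ) (LevelOK.gap-hi ok e)) (ℕP.m+n∸n≡m (lo ℓ) (Y ℓ)))))

      fol⁺ : Follows n s (width Y' ℓ) (d' ℓ)
      fol⁺ = go (big ℓ) refl
        where
        go : ∀ b → big ℓ ≡ b → Follows n s (width Y' ℓ) (d' ℓ)
        go true  e = fol-big e
        go false e = λ j p → trans (cong (λ f → + g s * f j) (d'-small e)) (trans (follows ℓ k<ℓ ℓ<m j p) (cong (λ B → α s j * B + β s j) (sym (width-small e))))

      u'≡ : d' ℓ (suc ℓ) ≡ u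
      u'≡ = *-cancelˡ-pos (gp s) (trans (fol⁺ (suc ℓ) (s≤s ℓ<m)) (trans (cong (λ a → a * width Y' ℓ + β s (suc ℓ)) a0) (trans (cong (_+ β s (suc ℓ)) (trans (ℤP.*-zeroˡ (width Y' ℓ)) (sym (ℤP.*-zeroˡ (width Y ℓ))))) (trans (cong (λ a → a * width Y ℓ + β s (suc ℓ)) (sym a0)) (sym (follows ℓ k<ℓ ℓ<m (suc ℓ) (s≤s ℓ<m)))))))
        where a0 = α-next ℓ k<ℓ ℓ<m

      rows⁺ : All (RowOK n (d' ℓ) (width Y' ℓ)) (rows ℓ)
      rows⁺ = go (big ℓ) refl
        where
        big2 : ∀ {e x} → P ℕ.≤ e → x ℕ.< 2 ^ P → x ℕ.< 2 ^ e
        big2 p q = ℕP.<-≤-trans q (ℕP.^-monoʳ-≤ 2 p)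
        go : ∀ b → big ℓ ≡ b → All (RowOK n (d' ℓ) (width Y' ℓ)) (rows ℓ)
        go true e = All.tabulate (λ {ρ} ρ∈ → row-shift n s (2 ^ (Y (suc ℓ) ∸ Y ℓ)) (2 ^ (Y' (suc ℓ) ∸ Y' ℓ)) (d ℓ) (d' ℓ) ρ (follows ℓ k<ℓ ℓ<m) (fol-big e)
             (big2 (widthP e _ _ (LevelOK.gap-lo ok)) (p-bound ℓ k<ℓ ℓ<m e ρ ρ∈)) (big2 (widthP e _ _ gapLo') (p-bound ℓ k<ℓ ℓ<m e ρ ρ∈)) (All.lookup (LevelOK.row-ok ok) ρ∈))
        go false e = subst₂ (λ f B → All (RowOK n f B) (rows ℓ)) (sym (d'-small e)) (sym (width-small e)) (LevelOK.row-ok ok)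

      ok⁺ : OKat Y' d' ℓ
      ok⁺ = record { y-eq = trans X-eq (cong (λ z → res d' Y' ℓ (suc ℓ) + z * pos2 (Y' ℓ)) (sym u'≡)) ; gap-lo = gapLo' ; gap-hi = gapHi' ; row-ok = rows⁺ }

      -- Multiplied by `g`, the new summand is a combination of the powers at both ends of the gap,
      -- whose changes are divisible by `M ℓ = Z * M (suc ℓ)`. Cancelling `g ∣ Z` leaves the modulus
      -- `M (suc ℓ)`.
      mod-r⁺ : ∀ j → j ℕ.< n → (+ M (suc ℓ)) ∣ r' (suc ℓ) j - res d Y (suc ℓ) j
      mod-r⁺ j p = subst ((+ M (suc ℓ)) ∣_) (sym (lem (r' ℓ j) (res d Y ℓ j) (d' ℓ j * pos2 (Y' ℓ)) (d ℓ j * pos2 (Y ℓ)))) (ℤD.∣m∣n⇒∣m+n (ℤD.∣-trans M∣M (mod-r j p)) x-div)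
        where
        lem : ∀ a b c e → a + c - (b + e) ≡ (a - b) + (c - e)
        lem = solve-∀
        M∣M : (+ M (suc ℓ)) ∣ (+ M ℓ)
        M∣M = ℤD.∣ᵤ⇒∣ (subst (M (suc ℓ) ℕD.∣_) (sym (M-suc ℓ (ℕP.<⇒≤ ℓ<m))) (ℕD.n∣m*n Z))
        x = d' ℓ j * pos2 (Y' ℓ) - d ℓ j * pos2 (Y ℓ)
        gx : + g s * x ≡ α s j * (pos2 (Y' (suc ℓ)) - pos2 (Y (suc ℓ))) + β s j * (pos2 (Y' ℓ) - pos2 (Y ℓ))
        gx = trans (l2 (+ g s) (d' ℓ j * pos2 (Y' ℓ)) (d ℓ j * pos2 (Y ℓ))) (trans (cong₂ _-_ (contribution n s j (Y' ℓ) (Y' (suc ℓ)) (d' ℓ) p fol⁺ Y'≤) (contribution n s j (Y ℓ) (Y (suc ℓ)) (d ℓ) p (follows ℓ k<ℓ ℓ<m) Y≤)) (l3 (α s j) (pos2 (Y' (suc ℓ))) (pos2 (Y (suc ℓ))) (β s j) (pos2 (Y' ℓ)) (pos2 (Y ℓ))))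
          where
          l2 : ∀ g a b → g * (a - b) ≡ g * a - g * b
          l2 = solve-∀
          l3 : ∀ a p q b r t → (a * p + b * r) - (a * q + b * t) ≡ a * (p - q) + b * (r - t)
          l3 = solve-∀
        gx-div : (+ M ℓ) ∣ + g s * x
        gx-div = subst ((+ M ℓ) ∣_) (sym gx) (ℤD.∣m∣n⇒∣m+n (ℤD.∣n⇒∣m*n (α s j) mod-D⁺) (ℤD.∣n⇒∣m*n (β s j) mod-D))
        gM∣M : (+ g s * + M (suc ℓ)) ∣ (+ M ℓ)
        gM∣M = subst₂ _∣_ (ℤP.pos-* (g s) (M (suc ℓ))) (cong +_ (sym (M-suc ℓ (ℕP.<⇒≤ ℓ<m)))) (ℤD.∣ᵤ⇒∣ (ℕD.*-monoˡ-∣ (M (suc ℓ)) (g∣Z ℓ k<ℓ ℓ<m)))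
        x-div : (+ M (suc ℓ)) ∣ x
        x-div = ℤD.*-cancelˡ-∣ (+ g s) (ℤD.∣-trans gM∣M gx-div)

      next : Inv (suc ℓ)
      next = record
        { upto = record { Y-zero = refl ; level = lv }
        ; fol = fl
        ; mod-r = mod-r⁺
        ; mod-Y = ℤD.∣-trans (ℤD.∣ᵤ⇒∣ (subst (M (suc ℓ) ℕD.∣_) (sym (M-suc ℓ (ℕP.<⇒≤ ℓ<m))) (ℕD.n∣m*n Z))) mod-Y⁺
        ; large = large⁺ }
        where
        lv : ∀ i → i ℕ.< suc ℓ → OKat Y' d' i
        lv i p = Data.Sum.[ (λ { refl → ok⁺ }) , Upto.level upto i ]′ (<suc-cases p)
        fl : ∀ i → k ℕ.< i → i ℕ.< suc ℓ → Follows n (sch i) (width Y' i) (d' i)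
        fl i q p = Data.Sum.[ (λ { refl → fol⁺ }) , fol i q ]′ (<suc-cases p)

    inv : ∀ ℓ → k ℕ.< ℓ → ℓ ℕ.≤ m → Inv ℓ
    inv (suc ℓ) p q = Data.Sum.[ (λ { refl → init }) , (λ k<ℓ → Step.next ℓ k<ℓ q (inv ℓ k<ℓ (ℕP.<⇒≤ q))) ]′ (<suc-cases p)

    lifted : State Y' d'
    lifted = Inv.upto (inv m k<m ℕP.≤-refl)

    lifted-follows : ∀ i → k ℕ.< i → i ℕ.< m → Follows n (sch i) (width Y' i) (d' i)
    lifted-follows = Inv.fol (inv m k<m ℕP.≤-refl)

-- Opposite displacements

module Twins (levels : Levels) where
  open Levels levels
  open System m big lo fams
  open Moves levels

  -- The data shared by two moves at level `k` along `γ`, by `t` and by `- t`. Multiplying by the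
  -- common denominator `G` turns the changes of residues into integer combinations of powers of two
  -- with coefficients `cof * α` and `cof * β`, to which `Perturbation` applies.
  record Setting : Set where
    field
      Z     : ℕ
      per   : Per Z Z
      1≤Z   : 1 ℕ.≤ Z
      Z<2^P : Z ^ suc (suc m) ℕ.< 2 ^ P
      Y     : ℕ → ℕ
      d     : ℕ → ℕ → ℤ
      st    : State Y d
      k     : ℕ
      k<m   : k ℕ.< m
      bigk  : big k ≡ true
      sch   : ℕ → Scheme
      follows : ∀ ℓ → k ℕ.< ℓ → ℓ ℕ.< m → Follows n (sch ℓ) (width Y ℓ) (d ℓ)
      α-next  : ∀ ℓ → k ℕ.≤ ℓ → ℓ ℕ.< m → α (sch ℓ) (suc ℓ) ≡ 0ℤ
      G     : ℕ
      1≤G   : 1 ℕ.≤ G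
      G∣Z   : G ℕD.∣ Z
      cof   : ℕ → ℕ
      cof-G : ∀ ℓ → k ℕ.≤ ℓ → ℓ ℕ.< m → cof ℓ ℕ.* g (sch ℓ) ≡ G
      p-bound : ∀ ℓ → k ℕ.< ℓ → ℓ ℕ.< m → big ℓ ≡ true → ∀ ρ → ρ ∈ rows ℓ → ∣ dot n (ra ρ) (β (sch ℓ)) + + g (sch ℓ) * rc ρ ∣ ℕ.< 2 ^ P
      S     : ℕ
      P-large : 4 ℕ.* suc m ℕ.* S ℕ.< 2 ^ P
      α≤    : ∀ ℓ j → k ℕ.≤ ℓ → ℓ ℕ.< m → j ℕ.< n → big ℓ ≡ true → ∣ + cof ℓ * α (sch ℓ) j ∣ ℕ.≤ S
      β≤    : ∀ ℓ j → k ℕ.< ℓ → ℓ ℕ.< m → j ℕ.< n → big ℓ ≡ true → ∣ + cof ℓ * β (sch ℓ) j ∣ ℕ.≤ S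
      α0    : ∀ ℓ j → k ℕ.< ℓ → ℓ ℕ.< m → j ℕ.< n → big ℓ ≡ false → α (sch ℓ) j ≡ 0ℤ
      β≤small : ∀ ℓ j → k ℕ.< ℓ → ℓ ℕ.< m → j ℕ.< n → big ℓ ≡ false → ∣ + cof ℓ * β (sch ℓ) j ∣ ℕ.≤ S ℕ.* 2 ^ lo ℓ
      t     : ℤ
      γ     : ℕ → ℤ
      γ≤    : ∀ j → j ℕ.< n → ∣ + cof k * (t * γ j) ∣ ℕ.≤ S

    g∣Z : ∀ ℓ → k ℕ.< ℓ → ℓ ℕ.< m → g (sch ℓ) ℕD.∣ Z
    g∣Z ℓ p q = ℕD.∣-trans (ℕD.divides (cof ℓ) (sym (cof-G ℓ (ℕP.<⇒≤ p) q))) G∣Z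

    -- The relation `relk` concerns differences only: the digits at level `k` need not follow a
    -- scheme yet, but their change does.
    record Displacement (τ : ℤ) : Set where
      field
        dk   : ℕ → ℤ
        yk   : ℕ
        levelk : LevelOK k (Y k) yk (res d Y k (suc k)) dk
        modk : ∀ j → j ℕ.< n → (+ (Z ^ (m ∸ k))) ∣ dk j - d k j
        relk : ∀ j → j ℕ.< n → + g (sch k) * (dk j - d k j) ≡ α (sch k) j * (pos2 (yk ∸ Y k) - width Y k) + τ * γ j

  module Coefficients (S₀ : Setting) where
    open Setting S₀

    coefA coefB : ℕ → ℕ → ℤ
    coefA j h = + cof (h ℕ.+ k) * α (sch (h ℕ.+ k)) j
    -- At the bottom `Y k` itself does not change; the displacement at level `k` enters through `w`
    -- instead.
    coefB j zero    = 0ℤ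
    coefB j (suc h) = + cof (suc h ℕ.+ k) * β (sch (suc h ℕ.+ k)) j

    private
      in-range : ∀ h → h ℕ.< m ∸ k → h ℕ.+ k ℕ.< m
      in-range h p = ℕP.m≤o∸n⇒m+n≤o (suc h) (ℕP.<⇒≤ k<m) p

      k≤ : ∀ h → k ℕ.≤ h ℕ.+ k
      k≤ h = ℕP.m≤n+m k h

      P-large' : 4 ℕ.* suc (m ∸ k) ℕ.* S ℕ.< 2 ^ P
      P-large' = ℕP.≤-<-trans (ℕP.*-monoˡ-≤ S (ℕP.*-monoʳ-≤ 4 {suc (m ∸ k)} {suc m} (s≤s (ℕP.m∸n≤m m k)))) P-large

      b≤' : ∀ j → j ℕ.< n → ∀ h → h ℕ.< m ∸ k → big (h ℕ.+ k) ≡ true → ∣ coefB j h ∣ ℕ.≤ S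
      b≤' j j<n zero p e = z≤n
      b≤' j j<n (suc h) p e = β≤ (suc h ℕ.+ k) j (s≤s (k≤ h)) (in-range (suc h) p) j<n e

      A0' : ∀ j → j ℕ.< n → ∀ h → h ℕ.< m ∸ k → big (h ℕ.+ k) ≡ false → coefA j h ≡ 0ℤ
      A0' j j<n zero p e with trans (sym bigk) e
      ... | ()
      A0' j j<n (suc h) p e = trans (cong (+ cof (suc h ℕ.+ k) *_) (α0 (suc h ℕ.+ k) j (s≤s (k≤ h)) (in-range (suc h) p) j<n e)) (ℤP.*-zeroʳ (+ cof (suc h ℕ.+ k)))

      bs' : ∀ j → j ℕ.< n → ∀ h → h ℕ.< m ∸ k → big (h ℕ.+ k) ≡ false → ∣ coefB j h ∣ ℕ.≤ S ℕ.* 2 ^ lo (h ℕ.+ k)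
      bs' j j<n zero p e = z≤n
      bs' j j<n (suc h) p e = β≤small (suc h ℕ.+ k) j (s≤s (k≤ h)) (in-range (suc h) p) j<n e

    shifted-gaps : ∀ {Y d} → State Y d → Gaps (m ∸ k) (λ h → big (h ℕ.+ k)) (λ h → lo (h ℕ.+ k)) (λ h → Y (h ℕ.+ k))
    shifted-gaps st h p = LevelOK.gap-lo ok , LevelOK.gap-hi ok
      where ok = Upto.level st (h ℕ.+ k) (in-range h p)

    module _ (j : ℕ) (j<n : j ℕ.< n) where
      open Perturbation (m ∸ k) P S (λ h → big (h ℕ.+ k)) (λ h → lo (h ℕ.+ k)) (λ h → Y (h ℕ.+ k)) (coefA j) (coefB j)
        (λ h p → big-lo (h ℕ.+ k) (in-range h p)) P-large'
        (λ h p → α≤ (h ℕ.+ k) j (k≤ h) (in-range h p) j<n) (b≤' j j<n) (A0' j j<n) (bs' j j<n) (shifted-gaps st) public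

  module Displaced (S₀ : Setting) (τ : ℤ) (D : Setting.Displacement S₀ τ) where
    open Setting S₀
    open Displacement D
    open Coefficients S₀ using (coefA; coefB)

    liftData : LiftData
    liftData = record { Z = Z ; per = per ; 1≤Z = 1≤Z ; Z<2^P = Z<2^P ; Y = Y ; d = d ; st = st ; k = k ; k<m = k<m ; bigk = bigk ; sch = sch ; follows = follows
      ; α-next = λ ℓ p → α-next ℓ (ℕP.<⇒≤ p) ; g∣Z = g∣Z ; p-bound = p-bound ; dk = dk ; yk = yk ; levelk = levelk ; modk = modk }

    open Lift liftData public

    Y'≤ : ∀ ℓ → ℓ ℕ.< m → Y' ℓ ℕ.≤ Y' (suc ℓ)
    Y'≤ ℓ p = LevelOK.y≤y' (Upto.level lifted ℓ p)

    Y≤ : ∀ ℓ → ℓ ℕ.< m → Y ℓ ℕ.≤ Y (suc ℓ)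
    Y≤ ℓ p = LevelOK.y≤y' (Upto.level st ℓ p)

    w : ℕ → ℤ
    w j = + cof k * (τ * γ j)

    G-split : ∀ ℓ → k ℕ.≤ ℓ → ℓ ℕ.< m → + G ≡ + cof ℓ * + g (sch ℓ)
    G-split ℓ p q = trans (cong +_ (sym (cof-G ℓ p q))) (ℤP.pos-* (cof ℓ) (g (sch ℓ)))

    shiftedY : ℕ → ℕ
    shiftedY h = Y' (h ℕ.+ k)

    -- The base case is `relk` multiplied by `cof k * 2 ^ Y k`. Above it, `contribution` expresses a
    -- digit times its power through the two ends of the gap, which is the recursion defining
    -- `rest`.
    rest-eq : ∀ j (j<n : j ℕ.< n) h → suc h ℕ.+ k ℕ.≤ m → Coefficients.rest S₀ j j<n shiftedY (w j) (suc h) ≡ + G * (r' (suc h ℕ.+ k) j - res d Y (suc h ℕ.+ k) j)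
    rest-eq j j<n zero p = sym (begin
        + G * (r' k j + d' k j * pos2 (Y' k) - (res d Y k j + d k j * pos2 (Y k)))
          ≡⟨ cong (+ G *_) (cong (_- (res d Y k j + d k j * pos2 (Y k))) (cong₂ _+_ (proj₂ (below k ℕP.≤-refl) j) (cong₂ _*_ (cong (λ f → f j) d'-at) (cong pos2 (proj₁ (below k ℕP.≤-refl)))))) ⟩
        + G * (res d Y k j + dk j * pos2 (Y k) - (res d Y k j + d k j * pos2 (Y k)))
          ≡⟨ cong (_* (res d Y k j + dk j * pos2 (Y k) - (res d Y k j + d k j * pos2 (Y k)))) (G-split k ℕP.≤-refl k<m) ⟩
        + cof k * + g (sch k) * (res d Y k j + dk j * pos2 (Y k) - (res d Y k j + d k j * pos2 (Y k)))
          ≡⟨ l1 (+ cof k) (+ g (sch k)) (res d Y k j) (dk j) (d k j) (pos2 (Y k)) ⟩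
        + cof k * (+ g (sch k) * (dk j - d k j)) * pos2 (Y k)
          ≡⟨ cong (λ z → + cof k * z * pos2 (Y k)) (relk j j<n) ⟩
        + cof k * (α (sch k) j * (pos2 (yk ∸ Y k) - width Y k) + τ * γ j) * pos2 (Y k)
          ≡⟨ l2 (+ cof k) (α (sch k) j) (pos2 (yk ∸ Y k)) (width Y k) (τ * γ j) (pos2 (Y k)) ⟩
        w j * pos2 (Y k) + + cof k * α (sch k) j * (pos2 (yk ∸ Y k) * pos2 (Y k) - width Y k * pos2 (Y k))
          ≡⟨ cong (λ z → w j * pos2 (Y k) + + cof k * α (sch k) j * z) (cong₂ _-_ (trans (pos2-∸ (LevelOK.y≤y' levelk)) (cong pos2 (sym Y'-k))) (pos2-∸ (Y≤ k k<m))) ⟩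
        w j * pos2 (Y k) + coefA j 0 * (pos2 (Y' (suc k)) - pos2 (Y (suc k)))
          ≡⟨ l3 (w j * pos2 (Y k)) (coefA j 0 * (pos2 (Y' (suc k)) - pos2 (Y (suc k)))) (pos2 (Y' k) - pos2 (Y k)) ⟩
        w j * pos2 (Y k) + (coefA j 0 * (pos2 (Y' (suc k)) - pos2 (Y (suc k))) + 0ℤ * (pos2 (Y' k) - pos2 (Y k))) ∎)
      where
      open ≡-Reasoning
      l1 : ∀ c g r x y p → c * g * (r + x * p - (r + y * p)) ≡ c * (g * (x - y)) * p
      l1 = solve-∀
      l2 : ∀ c a B' B t p → c * (a * (B' - B) + t) * p ≡ c * t * p + c * a * (B' * p - B * p)
      l2 = solve-∀
      l3 : ∀ x y z → x + y ≡ x + (y + 0ℤ * z)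
      l3 = solve-∀
    rest-eq j j<n (suc h) p = begin
        Coefficients.rest S₀ j j<n (λ i → Y' (i ℕ.+ k)) (w j) (suc h) + (+ cof ℓ * α s j * (pos2 (Y' (suc ℓ)) - pos2 (Y (suc ℓ))) + + cof ℓ * β s j * (pos2 (Y' ℓ) - pos2 (Y ℓ)))
          ≡⟨ cong₂ _+_ (rest-eq j j<n h (ℕP.<⇒≤ p)) (l1 (+ cof ℓ) (α s j) (β s j) (pos2 (Y' (suc ℓ))) (pos2 (Y (suc ℓ))) (pos2 (Y' ℓ)) (pos2 (Y ℓ))) ⟩
        + G * (r' ℓ j - res d Y ℓ j) + + cof ℓ * ((α s j * pos2 (Y' (suc ℓ)) + β s j * pos2 (Y' ℓ)) - (α s j * pos2 (Y (suc ℓ)) + β s j * pos2 (Y ℓ)))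
          ≡⟨ cong (λ z → + G * (r' ℓ j - res d Y ℓ j) + + cof ℓ * z) (cong₂ _-_ (sym (contribution n s j (Y' ℓ) (Y' (suc ℓ)) (d' ℓ) j<n (lifted-follows ℓ k<ℓ p) (Y'≤ ℓ p))) (sym (contribution n s j (Y ℓ) (Y (suc ℓ)) (d ℓ) j<n (follows ℓ k<ℓ p) (Y≤ ℓ p)))) ⟩
        + G * (r' ℓ j - res d Y ℓ j) + + cof ℓ * (+ g s * (d' ℓ j * pos2 (Y' ℓ)) - + g s * (d ℓ j * pos2 (Y ℓ)))
          ≡⟨ cong (λ z → z * (r' ℓ j - res d Y ℓ j) + + cof ℓ * (+ g s * (d' ℓ j * pos2 (Y' ℓ)) - + g s * (d ℓ j * pos2 (Y ℓ)))) (G-split ℓ (ℕP.<⇒≤ k<ℓ) p) ⟩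
        + cof ℓ * + g s * (r' ℓ j - res d Y ℓ j) + + cof ℓ * (+ g s * (d' ℓ j * pos2 (Y' ℓ)) - + g s * (d ℓ j * pos2 (Y ℓ)))
          ≡⟨ l2 (+ cof ℓ) (+ g s) (r' ℓ j) (res d Y ℓ j) (d' ℓ j * pos2 (Y' ℓ)) (d ℓ j * pos2 (Y ℓ)) ⟩
        + cof ℓ * + g s * (r' (suc ℓ) j - res d Y (suc ℓ) j)
          ≡⟨ cong (_* (r' (suc ℓ) j - res d Y (suc ℓ) j)) (sym (G-split ℓ (ℕP.<⇒≤ k<ℓ) p)) ⟩
        + G * (r' (suc ℓ) j - res d Y (suc ℓ) j) ∎
      where
      open ≡-Reasoning
      ℓ = suc h ℕ.+ k
      s = sch ℓ
      k<ℓ : k ℕ.< ℓ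
      k<ℓ = s≤s (ℕP.m≤n+m k h)
      l1 : ∀ c a b x x' y y' → c * a * (x - x') + c * b * (y - y') ≡ c * ((a * x + b * y) - (a * x' + b * y'))
      l1 = solve-∀
      l2 : ∀ c g r r' x x' → c * g * (r - r') + c * (g * x - g * x') ≡ c * g * (r + x - (r' + x'))
      l2 = solve-∀

    -- By `α-next` the power of `Y j` does not occur in its own change. The change is expressed
    -- through strictly lower positions, which permits the induction in `ΔOpp`.
    ΔY-eq : ∀ h (p : suc h ℕ.+ k ℕ.≤ m) → let j = suc h ℕ.+ k in
            + G * (+ Y' j - + Y j) ≡ coefB j h * Coefficients.change S₀ j (s≤s p) shiftedY h + Coefficients.rest S₀ j (s≤s p) shiftedY (w j) h
    ΔY-eq h p = begin
      + G * (+ Y' j - + Y j)                       ≡⟨ cong (+ G *_) (cong₂ _-_ (trans (LevelOK.y-eq (Upto.level lifted (h ℕ.+ k) p)) (res-r' j j)) (LevelOK.y-eq (Upto.level st (h ℕ.+ k) p))) ⟩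
      + G * (r' j j - res d Y j j)                 ≡⟨ sym (rest-eq j (s≤s p) h p) ⟩
      R + (coefA j h * C⁺ + coefB j h * C)         ≡⟨ cong (λ z → R + (z * C⁺ + coefB j h * C)) (trans (cong (+ cof (h ℕ.+ k) *_) (α-next (h ℕ.+ k) (ℕP.m≤n+m k h) p)) (ℤP.*-zeroʳ (+ cof (h ℕ.+ k)))) ⟩
      R + (0ℤ * C⁺ + coefB j h * C)                ≡⟨ l R C⁺ (coefB j h * C) ⟩
      coefB j h * C + R                            ∎
      where
      open ≡-Reasoning
      j = suc h ℕ.+ k
      C  = Coefficients.change S₀ j (s≤s p) shiftedY h
      C⁺ = Coefficients.change S₀ j (s≤s p) shiftedY (suc h)
      R  = Coefficients.rest S₀ j (s≤s p) shiftedY (w j) h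
      l : ∀ r c x → r + (0ℤ * c + x) ≡ x + r
      l = solve-∀

  module Pair (S₀ : Setting) (D⁺ : Setting.Displacement S₀ (Setting.t S₀)) (D⁻ : Setting.Displacement S₀ (- Setting.t S₀)) where
    open Setting S₀
    module L⁺ = Displaced S₀ t D⁺
    module L⁻ = Displaced S₀ (- t) D⁻

    private
      zero-diff : ∀ {a b} → a ≡ b → 0ℤ ≡ + a - + b
      zero-diff {a} refl = sym (ℤP.+-inverseʳ (+ a))

      neg-w : ∀ j → L⁻.w j ≡ - L⁺.w j
      neg-w j = lem (+ cof k) t (γ j)
        where
        lem : ∀ c t x → c * (- t * x) ≡ - (c * (t * x))
        lem = solve-∀

    -- Opposite changes of the lower `Y` give opposite changes of their powers of two by `Opp-pos2`;
    -- then `opposite` with leading coefficient `coefB j h` settles the next one.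
    ΔOpp : ∀ h → h ℕ.+ k ℕ.≤ m → ∀ i → i ℕ.≤ h → Opp (+ L⁺.Y' (i ℕ.+ k) - + Y (i ℕ.+ k)) (+ L⁻.Y' (i ℕ.+ k) - + Y (i ℕ.+ k))
    ΔOpp zero p zero z≤n = subst₂ Opp (zero-diff (proj₁ (L⁺.below k ℕP.≤-refl))) (zero-diff (proj₁ (L⁻.below k ℕP.≤-refl))) opp0
    ΔOpp (suc h) p i i≤h = Data.Sum.[ (λ { refl → top }) , (λ q → ih i (ℕP.≤-pred q)) ]′ (<suc-cases (s≤s i≤h))
      where
      ih = ΔOpp h (ℕP.<⇒≤ p)
      j = suc h ℕ.+ k
      h≤ : h ℕ.≤ m ∸ k
      h≤ = ℕP.m+n≤o⇒m≤o∸n h (ℕP.<⇒≤ p)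
      top : Opp (+ L⁺.Y' j - + Y j) (+ L⁻.Y' j - + Y j)
      top = Opp-unscale G _ _ 1≤G (subst₂ Opp (sym (L⁺.ΔY-eq h p)) (trans (cong (λ v → Coefficients.coefB S₀ j h * Coefficients.change S₀ j (s≤s p) L⁻.shiftedY h + Coefficients.rest S₀ j (s≤s p) L⁻.shiftedY v h) (sym (neg-w j))) (sym (L⁻.ΔY-eq h p)))
        (Coefficients.opposite S₀ j (s≤s p) L⁺.shiftedY L⁻.shiftedY (Coefficients.shifted-gaps S₀ L⁺.lifted) (Coefficients.shifted-gaps S₀ L⁻.lifted) (L⁺.w j) (γ≤ j (s≤s p))
          (proj₁ (L⁺.below k ℕP.≤-refl)) (proj₁ (L⁻.below k ℕP.≤-refl)) h h≤ (λ i q → Opp-pos2 (Y (i ℕ.+ k)) (L⁺.Y' (i ℕ.+ k)) (L⁻.Y' (i ℕ.+ k)) (ih i q)) (Coefficients.coefB S₀ j h)))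

    ΔOpp-all : ∀ ℓ → ℓ ℕ.≤ m → Opp (+ L⁺.Y' ℓ - + Y ℓ) (+ L⁻.Y' ℓ - + Y ℓ)
    ΔOpp-all ℓ p with ℕP.≤-total ℓ k
    ... | inj₁ q = subst₂ Opp (zero-diff (proj₁ (L⁺.below ℓ q))) (zero-diff (proj₁ (L⁻.below ℓ q))) opp0
    ... | inj₂ q = subst (λ i → Opp (+ L⁺.Y' i - + Y i) (+ L⁻.Y' i - + Y i)) e (ΔOpp (ℓ ∸ k) (subst (ℕ._≤ m) (sym e) p) (ℓ ∸ k) ℕP.≤-refl)
      where
      e : ℓ ∸ k ℕ.+ k ≡ ℓ
      e = ℕP.m∸n+n≡m q

    Extremal : ℕ → ℕ → Set
    Extremal z opt = (∀ Y d → State Y d → Y z ℕ.≤ opt) ⊎ (∀ Y d → State Y d → opt ℕ.≤ Y z)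

    -- If the changes of `Y z` were nonzero, one of the two lifted states would be better than the
    -- extremal one.
    unchanged : ∀ z → z ℕ.≤ m → Extremal z (Y z) → L⁺.Y' z ≡ Y z × L⁻.Y' z ≡ Y z
    unchanged z z≤m ext = go (ΔOpp-all z z≤m) refl refl ext
      where
      pos⇒< : ∀ {a b} → 0ℤ < + a - + b → b ℕ.< a
      pos⇒< {a} {b} p = ℤP.drop‿+<+ (subst₂ _<_ (ℤP.+-identityʳ (+ b)) (lem (+ a) (+ b)) (ℤP.+-monoʳ-< (+ b) p))
        where
        lem : ∀ a b → b + (a - b) ≡ a
        lem = solve-∀
      neg⇒< : ∀ {a b} → + a - + b < 0ℤ → a ℕ.< b
      neg⇒< {a} {b} p = ℤP.drop‿+<+ (subst₂ _<_ (lem (+ a) (+ b)) (ℤP.+-identityʳ (+ b)) (ℤP.+-monoʳ-< (+ b) p))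
        where
        lem : ∀ a b → b + (a - b) ≡ a
        lem = solve-∀
      go : ∀ {u v} → Opp u v → u ≡ + L⁺.Y' z - + Y z → v ≡ + L⁻.Y' z - + Y z → Extremal z (Y z) → L⁺.Y' z ≡ Y z × L⁻.Y' z ≡ Y z
      go (opp+ p q) refl refl (inj₁ h) = ⊥-elim (ℕP.<⇒≱ (pos⇒< {L⁺.Y' z} p) (h _ _ L⁺.lifted))
      go (opp+ p q) refl refl (inj₂ h) = ⊥-elim (ℕP.<⇒≱ (neg⇒< {L⁻.Y' z} q) (h _ _ L⁻.lifted))
      go (opp- p q) refl refl (inj₁ h) = ⊥-elim (ℕP.<⇒≱ (pos⇒< {L⁻.Y' z} q) (h _ _ L⁻.lifted))
      go (opp- p q) refl refl (inj₂ h) = ⊥-elim (ℕP.<⇒≱ (neg⇒< {L⁺.Y' z} p) (h _ _ L⁺.lifted))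
      go opp0 e e' _ = ℤP.+-injective (ℤP.i-j≡0⇒i≡j (+ L⁺.Y' z) (+ Y z) (sym e)) , ℤP.+-injective (ℤP.i-j≡0⇒i≡j (+ L⁻.Y' z) (+ Y z) (sym e'))

-- Normalising the levels

^-∣-mono : ∀ Z {a b} → a ℕ.≤ b → Z ^ a ℕD.∣ Z ^ b
^-∣-mono Z {a} {b} p = ℕD.divides (Z ^ (b ∸ a)) (trans (cong (Z ^_) (sym (ℕP.m∸n+n≡m p))) (ℕP.^-distribˡ-+-* Z (b ∸ a) a))

∣*∣≤ : ∀ x y {a b} → ∣ x ∣ ℕ.≤ a → ∣ y ∣ ℕ.≤ b → ∣ x * y ∣ ℕ.≤ a ℕ.* b
∣*∣≤ x y p q = subst (ℕ._≤ _) (sym (ℤP.abs-* x y)) (ℕP.*-mono-≤ p q)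

∣+∣≤ : ∀ x y {a b} → ∣ x ∣ ℕ.≤ a → ∣ y ∣ ℕ.≤ b → ∣ x + y ∣ ℕ.≤ a ℕ.+ b
∣+∣≤ x y p q = ℕP.≤-trans (ℤP.∣i+j∣≤∣i∣+∣j∣ x y) (ℕP.+-mono-≤ p q)

i≤+∣i∣ : ∀ i → i ≤ + ∣ i ∣
i≤+∣i∣ (+ n)    = ℤP.≤-refl
i≤+∣i∣ -[1+ n ] = -≤+

n<2^n : ∀ n → n ℕ.< 2 ^ n
n<2^n zero    = s≤s z≤n
n<2^n (suc n) = ℕP.≤-trans (ℕP.+-mono-≤ (ℕP.m^n>0 2 n) (n<2^n n)) (ℕP.+-monoʳ-≤ (2 ^ n) (ℕP.m≤m+n (2 ^ n) 0))

v[v+1]<2^v : ∀ v → 6 ℕ.≤ v → v ℕ.* suc v ℕ.< 2 ^ v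
v[v+1]<2^v v p = subst (λ v → v ℕ.* suc v ℕ.< 2 ^ v) (ℕP.m+[n∸m]≡n p) (go (v ∸ 6))
  where
  lem : ∀ x → 2 ℕ.* ((6 ℕ.+ x) ℕ.* (7 ℕ.+ x)) ≡ (7 ℕ.+ x) ℕ.* (8 ℕ.+ x) ℕ.+ (7 ℕ.+ x) ℕ.* (4 ℕ.+ x)
  lem = solveℕ
  go : ∀ x → (6 ℕ.+ x) ℕ.* (7 ℕ.+ x) ℕ.< 2 ^ (6 ℕ.+ x)
  go zero    = ℕP.m≤m+n 43 21
  go (suc x) = ℕP.≤-<-trans (ℕP.≤-trans (ℕP.≤-reflexive (cong₂ ℕ._*_ (ℕP.+-suc 6 x) (ℕP.+-suc 7 x))) (ℕP.≤-trans (ℕP.m≤m+n _ ((7 ℕ.+ x) ℕ.* (4 ℕ.+ x))) (ℕP.≤-reflexive (sym (lem x))))) (ℕP.<-≤-trans (ℕP.*-monoʳ-< 2 (go x)) (ℕP.≤-reflexive (cong (2 ^_) (sym (ℕP.+-suc 6 x)))))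

grow : ∀ v y → 1 ℕ.≤ v → v ℕ.+ y ℕ.≤ v ℕ.* 2 ^ y
grow (suc v) y _ = begin
  suc v ℕ.+ y              ≡⟨ lem v y ⟩
  suc y ℕ.+ v              ≤⟨ ℕP.+-mono-≤ (n<2^n y) (ℕP.m≤m*n v (2 ^ y) {{ℕP.m^n≢0 2 y}}) ⟩
  2 ^ y ℕ.+ v ℕ.* 2 ^ y    ∎
  where
  open ℕP.≤-Reasoning
  lem : ∀ v y → 1 ℕ.+ v ℕ.+ y ≡ 1 ℕ.+ y ℕ.+ v
  lem = solveℕ

-- The lexicographic form of `qp-shift`: the sign of `q` decides because `B` outweighs everything
-- linear in `u`, and if `q = 0` the argument is repeated with `u` in the place of `B`.
qpu-shift : ∀ q p w u u' B B' S → ∣ p ∣ ℕ.≤ S → ∣ w ∣ ℕ.≤ S → S ℕ.< u → S ℕ.< u' → S ℕ.* suc u ℕ.< B → S ℕ.* suc u' ℕ.< B' →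
            q * + B + (p * + u + w) ≤ 0ℤ → q * + B' + (p * + u' + w) ≤ 0ℤ
qpu-shift q p w u u' B B' S p≤ w≤ S<u S<u' b b' h = go q h
  where
  rest≤ : ∀ x → ∣ p * + x + w ∣ ℕ.≤ S ℕ.* suc x
  rest≤ x = ℕP.≤-trans (∣+∣≤ (p * + x) w (∣*∣≤ p (+ x) p≤ ℕP.≤-refl) w≤) (ℕP.≤-reflexive (trans (ℕP.+-comm (S ℕ.* x) S) (sym (ℕP.*-suc S x))))
  go : ∀ q → q * + B + (p * + u + w) ≤ 0ℤ → q * + B' + (p * + u' + w) ≤ 0ℤ
  go (+ zero) h = subst (_≤ 0ℤ) (sym (drop B' u')) (qp-shift p w u u' (ℕP.≤-<-trans w≤ S<u) (ℕP.≤-<-trans w≤ S<u') (subst (_≤ 0ℤ) (drop B u) h))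
    where
    drop : ∀ B u → 0ℤ * + B + (p * + u + w) ≡ p * + u + w
    drop B u = trans (cong (_+ (p * + u + w)) (ℤP.*-zeroˡ (+ B))) (ℤP.+-identityˡ (p * + u + w))
  go (+ suc q) h = ⊥-elim (ℤP.<⇒≱ (pos-dominates {+ suc q} {+ B} {p * + u + w} (+<+ (s≤s z≤n)) (+<+ (ℕP.≤-<-trans z≤n b)) (ℕP.≤-<-trans (rest≤ u) b)) h)
  go -[1+ q ] h = ℤP.<⇒≤ (subst (_< 0ℤ) (lem (+ suc q) (+ B') (p * + u' + w)) (ℤP.neg-mono-< (pos-dominates {+ suc q} {+ B'} { - (p * + u' + w)} (+<+ (s≤s z≤n)) (+<+ (ℕP.≤-<-trans z≤n b')) (subst (ℕ._< B') (sym (ℤP.∣-i∣≡∣i∣ (p * + u' + w))) (ℕP.≤-<-trans (rest≤ u') b')))))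
    where
    lem : ∀ q B p → - (q * B + - p) ≡ (- q) * B + p
    lem = solve-∀

record NormalForm (m : ℕ) (big : ℕ → Bool) (lo : ℕ → ℕ) (fams : List Family) (K E z opt : ℕ) : Set where
  field
    Y       : ℕ → ℕ
    d       : ℕ → ℕ → ℤ
    st      : System.State m big lo fams Y d
    sch     : ℕ → Scheme
    follows : ∀ ℓ → ℓ ℕ.< m → Follows (suc m) (sch ℓ) (pos2 (Y (suc ℓ) ∸ Y ℓ)) (d ℓ)
    Y-opt   : Y z ≡ opt
    α-next  : ∀ ℓ → ℓ ℕ.< m → α (sch ℓ) (suc ℓ) ≡ 0ℤ
    g≤K     : ∀ ℓ → ℓ ℕ.< m → g (sch ℓ) ℕ.≤ K
    α≤E     : ∀ ℓ → ℓ ℕ.< m → big ℓ ≡ true → ∀ j → j ℕ.< suc m → ∣ α (sch ℓ) j ∣ ℕ.≤ E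
    β≤E     : ∀ ℓ → ℓ ℕ.< m → big ℓ ≡ true → ∀ j → j ℕ.< suc m → ∣ β (sch ℓ) j ∣ ℕ.≤ E
    α-small : ∀ ℓ → ℓ ℕ.< m → big ℓ ≡ false → ∀ j → j ℕ.< suc m → α (sch ℓ) j ≡ 0ℤ
    β-small : ∀ ℓ → ℓ ℕ.< m → big ℓ ≡ false → ∀ j → j ℕ.< suc m → ∣ β (sch ℓ) j ∣ ℕ.≤ 2 ^ lo ℓ

-- `A` and `C` bound the rows, `K` the denominators, `Γ` the directions, `T` the step `t`, `Sl` the
-- slack of a nearly tight row, `S₃` the rows after their solution is substituted, `U` the final
-- value of `u`, `E` the coefficients of the schemes, and `S` those coefficients after clearing
-- denominators.
record Parameters : Set where
  field
    m : ℕ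
    big : ℕ → Bool
    lo : ℕ → ℕ
    fams : List Family
    P : ℕ
    lo-big : ∀ ℓ → ℓ ℕ.< m → big ℓ ≡ true → lo ℓ ≡ P
    gapLo : ∀ ℓ → ℓ ℕ.< m → Σ Family (System.GapFamily m big lo fams ℓ 1ℤ)
    gapHi : ∀ ℓ → ℓ ℕ.< m → big ℓ ≡ false → Σ Family (System.GapFamily m big lo fams ℓ (- 1ℤ))
    A C : ℕ
    1≤A : 1 ℕ.≤ A
    row-bound : ∀ ℓ → ℓ ℕ.< m → ∀ ρ → ρ ∈ System.rows m big lo fams ℓ → (∀ j → j ℕ.< suc m → ∣ ra ρ j ∣ ℕ.≤ A) × ∣ rc ρ ∣ ℕ.≤ C × ∣ rc' ρ ∣ ℕ.≤ C
    z : ℕ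
    z≤m : z ℕ.≤ m
    opt : ℕ
    extremal : (∀ Y d → System.State m big lo fams Y d → Y z ℕ.≤ opt) ⊎ (∀ Y d → System.State m big lo fams Y d → opt ℕ.≤ Y z)
    K E T Γ Sl S₃ U S : ℕ
    1≤K : 1 ℕ.≤ K
    periods : ∀ G → 1 ℕ.≤ G → G ℕ.≤ K ^ m → ∃ λ Z → G ℕD.∣ Z × 1 ℕ.≤ Z × Per Z Z × Z ^ suc (suc m) ℕ.≤ T
    T<2^P : T ℕ.< 2 ^ P
    K-bound : suc m ℕ.* (siegelBound (suc (suc m)) A ^ suc m ℕ.* siegelBound (suc (suc m)) A) ℕ.≤ K
    g-bound : siegelBound (suc (suc m)) A ^ suc m ℕ.≤ K
    Γ-bound : siegelBound (suc m) A ℕ.≤ Γ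
    K≤Γ : K ℕ.≤ Γ
    Sl-bound : T ℕ.* (suc m ℕ.* (A ℕ.* siegelBound (suc m) A)) ℕ.≤ Sl
    S₃-bound : suc m ℕ.* (A ℕ.* (K ℕ.* (C ℕ.+ Sl))) ℕ.+ K ℕ.* C ℕ.+ suc m ℕ.* (A ℕ.* K) ℕ.≤ S₃
    U-bound : S₃ ℕ.+ T ℕ.+ P ℕ.+ 6 ℕ.≤ U
    E-bound : K ℕ.* C ℕ.+ K ℕ.* (C ℕ.+ Sl) ℕ.+ K ℕ.* U ℕ.≤ E
    p-bound : suc m ℕ.* (A ℕ.* E) ℕ.+ K ℕ.* C ℕ.< 2 ^ P
    S-bound : K ^ m ℕ.* E ℕ.+ K ^ m ℕ.* (T ℕ.* Γ) ℕ.+ K ^ m ℕ.≤ S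
    P-large : 4 ℕ.* suc m ℕ.* S ℕ.< 2 ^ P

module Stages (parameters : Parameters) where
  open Parameters parameters

  big-lo : ∀ ℓ → ℓ ℕ.< m → big ℓ ≡ true → P ℕ.≤ lo ℓ
  big-lo ℓ p e = ℕP.≤-reflexive (sym (lo-big ℓ p e))

  levels : Levels
  levels = record { m = m ; big = big ; lo = lo ; fams = fams ; P = P ; big-lo = big-lo ; gapLo = gapLo ; gapHi = gapHi }

  open System m big lo fams
  open Moves levels using (width)
  open Twins levels

  -- These properties do not mention `Y` or `d`, so they survive all later moves at lower levels.
  record Static (ℓ : ℕ) (s : Scheme) : Set where
    field
      α-nx    : α s (suc ℓ) ≡ 0ℤ
      g≤K     : g s ℕ.≤ K
      α≤E     : big ℓ ≡ true → ∀ j → j ℕ.< n → ∣ α s j ∣ ℕ.≤ E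
      β≤E     : big ℓ ≡ true → ∀ j → j ℕ.< n → ∣ β s j ∣ ℕ.≤ E
      α-small : big ℓ ≡ false → ∀ j → j ℕ.< n → α s j ≡ 0ℤ
      β-small : big ℓ ≡ false → ∀ j → j ℕ.< n → ∣ β s j ∣ ℕ.≤ 2 ^ lo ℓ

  record Stage (k : ℕ) (sch : ℕ → Scheme) : Set where
    constructor stage
    field
      Y       : ℕ → ℕ
      d       : ℕ → ℕ → ℤ
      st      : State Y d
      follows : ∀ ℓ → k ℕ.< ℓ → ℓ ℕ.< m → Follows n (sch ℓ) (width Y ℓ) (d ℓ)
      Y-opt   : Y z ≡ opt

  record AboveData : Set where
    field
      k      : ℕ
      k<m    : k ℕ.< m
      bigk   : big k ≡ true
      sch    : ℕ → Scheme
      static : ∀ ℓ → k ℕ.< ℓ → ℓ ℕ.< m → Static ℓ (sch ℓ)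

  module AtLevel (aboveData : AboveData) where
    open AboveData aboveData

    -- Two kinds of moves share this interface: those along a kernel direction, where the width is
    -- fixed and `s` is the zero scheme, and those changing `u`, where the digits also react to the
    -- width through `α s`.
    record ShiftData : Set where
      field
        s    : Scheme
        s-nx : α s (suc k) ≡ 0ℤ
        s-g  : g s ℕ.≤ K
        s-α  : ∀ j → j ℕ.< n → ∣ α s j ∣ ℕ.≤ E
        γ    : ℕ → ℤ
        γ≤Γ  : ∀ j → j ℕ.< n → ∣ γ j ∣ ℕ.≤ Γ

    module Shift (shiftData : ShiftData) where
      open ShiftData shiftData

      trivial : Scheme
      trivial = scheme 0 (λ _ → 0ℤ) (λ _ → 0ℤ)

      -- The levels below `k` receive denominator 1, so that one common multiple can be taken over
      -- all levels.
      sch* : ℕ → Scheme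
      sch* ℓ = pick ℓ k trivial s (sch ℓ)

      above : ∀ ℓ → k ℕ.< ℓ → sch* ℓ ≡ sch ℓ
      above ℓ p = pick-> p

      at : sch* k ≡ s
      at = pick-≡ {k = k} {trivial} {s} {sch k}

      g* : ∀ ℓ → ℓ ℕ.< m → 1 ℕ.≤ g (sch* ℓ) × g (sch* ℓ) ℕ.≤ K
      g* ℓ p = s≤s z≤n , bound (ℕP.<-cmp ℓ k)
        where
        bound : _ → g (sch* ℓ) ℕ.≤ K
        bound (tri< q _ _) = subst (λ s → g s ℕ.≤ K) (sym (pick-< {ℓ = ℓ} {k} {trivial} {s} {sch ℓ} q)) 1≤K
        bound (tri≈ _ refl _) = subst (λ s → g s ℕ.≤ K) (sym at) s-g
        bound (tri> _ _ q) = subst (λ s → g s ℕ.≤ K) (sym (above ℓ q)) (Static.g≤K (static ℓ q p))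

      common = commonMultiple m (λ ℓ → g (sch* ℓ)) K 1≤K g*
      G : ℕ
      G = proj₁ common
      1≤G : 1 ℕ.≤ G
      1≤G = proj₁ (proj₂ common)
      G≤ : G ℕ.≤ K ^ m
      G≤ = proj₁ (proj₂ (proj₂ common))
      cofs = choice m (λ ℓ h → h ℕ.* g (sch* ℓ) ≡ G) 0 (proj₂ (proj₂ (proj₂ common)))
      cof : ℕ → ℕ
      cof = proj₁ cofs
      cof-G : ∀ ℓ → ℓ ℕ.< m → cof ℓ ℕ.* g (sch* ℓ) ≡ G
      cof-G = proj₂ cofs
      cof≤ : ∀ ℓ → ℓ ℕ.< m → cof ℓ ℕ.≤ K ^ m
      cof≤ ℓ p = ℕP.≤-trans (cofactor≤ (cof ℓ) (g (sch* ℓ)) G (s≤s z≤n) (cof-G ℓ p)) G≤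
      period = periods G 1≤G G≤
      Z : ℕ
      Z = proj₁ period
      G∣Z : G ℕD.∣ Z
      G∣Z = proj₁ (proj₂ period)
      1≤Z : 1 ℕ.≤ Z
      1≤Z = proj₁ (proj₂ (proj₂ period))
      per : Per Z Z
      per = proj₁ (proj₂ (proj₂ (proj₂ period)))
      -- A move needs the factor `Z ^ (m ∸ k)` for the levels above, and one further `Z` if its own
      -- digits are divided by a denominator. The exponent `m + 2` suffices for every `k`.
      t : ℕ
      t = Z ^ suc (suc m)
      t≤T : t ℕ.≤ T
      t≤T = proj₂ (proj₂ (proj₂ (proj₂ period)))
      1≤t : 1 ℕ.≤ t
      1≤t = ℕP.m^n>0 Z {{ℕ.>-nonZero 1≤Z}} (suc (suc m))
      s∣Z : g s ℕD.∣ Z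
      s∣Z = ℕD.∣-trans (ℕD.divides (cof k) (sym (subst (λ s → cof k ℕ.* g s ≡ G) at (cof-G k k<m)))) G∣Z

      S-parts : K ^ m ℕ.* E ℕ.≤ S × K ^ m ℕ.* (T ℕ.* Γ) ℕ.≤ S × K ^ m ℕ.≤ S
      S-parts = ℕP.≤-trans (ℕP.≤-trans (ℕP.m≤m+n (K ^ m ℕ.* E) (K ^ m ℕ.* (T ℕ.* Γ))) (ℕP.m≤m+n (K ^ m ℕ.* E ℕ.+ K ^ m ℕ.* (T ℕ.* Γ)) (K ^ m))) S-bound
              , ℕP.≤-trans (ℕP.≤-trans (ℕP.m≤n+m (K ^ m ℕ.* (T ℕ.* Γ)) (K ^ m ℕ.* E)) (ℕP.m≤m+n (K ^ m ℕ.* E ℕ.+ K ^ m ℕ.* (T ℕ.* Γ)) (K ^ m))) S-bound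
              , ℕP.≤-trans (ℕP.m≤n+m (K ^ m) (K ^ m ℕ.* E ℕ.+ K ^ m ℕ.* (T ℕ.* Γ))) S-bound

      setting : Stage k sch → Setting
      setting sg = record
        { Z = Z ; per = per ; 1≤Z = 1≤Z ; Z<2^P = ℕP.≤-<-trans t≤T T<2^P
        ; Y = Stage.Y sg ; d = Stage.d sg ; st = Stage.st sg ; k = k ; k<m = k<m ; bigk = bigk ; sch = sch*
        ; follows = λ ℓ p q → subst (λ s → Follows n s (width (Stage.Y sg) ℓ) (Stage.d sg ℓ)) (sym (above ℓ p)) (Stage.follows sg ℓ p q)
        ; α-next = λ ℓ p q → case≤ ℓ p (λ s → α s (suc ℓ) ≡ 0ℤ) (λ { refl → s-nx }) (λ k<ℓ → Static.α-nx (static ℓ k<ℓ q))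
        ; G = G ; 1≤G = 1≤G ; G∣Z = G∣Z ; cof = cof ; cof-G = λ ℓ _ q → cof-G ℓ q
        ; p-bound = λ ℓ p q e ρ ρ∈ → subst (λ s → ∣ dot n (ra ρ) (β s) + + g s * rc ρ ∣ ℕ.< 2 ^ P) (sym (above ℓ p)) (pb ℓ p q e ρ ρ∈)
        ; S = S ; P-large = P-large
        ; α≤ = λ ℓ j p q j<n e → ∣*∣S ℓ q (case≤ ℓ p (λ s → ∣ α s j ∣ ℕ.≤ E) (λ _ → s-α j j<n) (λ k<ℓ → Static.α≤E (static ℓ k<ℓ q) e j j<n)) (proj₁ S-parts)
        ; β≤ = λ ℓ j p q j<n e → ∣*∣S ℓ q (subst (λ s → ∣ β s j ∣ ℕ.≤ E) (sym (above ℓ p)) (Static.β≤E (static ℓ p q) e j j<n)) (proj₁ S-parts)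
        ; α0 = λ ℓ j p q j<n e → subst (λ s → α s j ≡ 0ℤ) (sym (above ℓ p)) (Static.α-small (static ℓ p q) e j j<n)
        ; β≤small = λ ℓ j p q j<n e → ∣*∣S ℓ q (subst (λ s → ∣ β s j ∣ ℕ.≤ 2 ^ lo ℓ) (sym (above ℓ p)) (Static.β-small (static ℓ p q) e j j<n)) (ℕP.*-monoˡ-≤ (2 ^ lo ℓ) (proj₂ (proj₂ S-parts)))
        ; t = + t ; γ = γ
        ; γ≤ = λ j j<n → ℕP.≤-trans (∣*∣≤ (+ cof k) (+ t * γ j) (cof≤ k k<m) (∣*∣≤ (+ t) (γ j) t≤T (γ≤Γ j j<n))) (proj₁ (proj₂ S-parts))
        }
        where
        case≤ : ∀ ℓ → k ℕ.≤ ℓ → (Q : Scheme → Set) → (ℓ ≡ k → Q s) → (k ℕ.< ℓ → Q (sch ℓ)) → Q (sch* ℓ)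
        case≤ ℓ p Q x y = Data.Sum.[ (λ { refl → subst Q (sym at) (x refl) }) , (λ k<ℓ → subst Q (sym (above ℓ k<ℓ)) (y k<ℓ)) ]′ (<suc-cases (s≤s p))
        ∣*∣S : ∀ ℓ → ℓ ℕ.< m → ∀ {x b c} → ∣ x ∣ ℕ.≤ b → K ^ m ℕ.* b ℕ.≤ c → ∣ + cof ℓ * x ∣ ℕ.≤ c
        ∣*∣S ℓ q {x} p r = ℕP.≤-trans (∣*∣≤ (+ cof ℓ) x (cof≤ ℓ q) p) r
        pb : ∀ ℓ → k ℕ.< ℓ → ℓ ℕ.< m → big ℓ ≡ true → ∀ ρ → ρ ∈ rows ℓ → ∣ dot n (ra ρ) (β (sch ℓ)) + + g (sch ℓ) * rc ρ ∣ ℕ.< 2 ^ P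
        pb ℓ p q e ρ ρ∈ = ℕP.≤-<-trans (∣+∣≤ (dot n (ra ρ) (β (sch ℓ))) (+ g (sch ℓ) * rc ρ) (∣dot∣≤ n (ra ρ) (β (sch ℓ)) A E (proj₁ (row-bound ℓ q ρ ρ∈)) (Static.β≤E (static ℓ p q) e)) (∣*∣≤ (+ g (sch ℓ)) (rc ρ) (Static.g≤K (static ℓ p q)) (proj₁ (proj₂ (row-bound ℓ q ρ ρ∈))))) p-bound

      module _ (sg : Stage k sch) where
        open Stage sg
        private
          S₀ = setting sg

        record Result (dk : ℕ → ℤ) (yk : ℕ) : Set where
          field
            new    : Stage k sch
            same-Y : Stage.Y new k ≡ Y k
            next-Y : Stage.Y new (suc k) ≡ yk
            at-k   : Stage.d new k ≡ dk

        Disp : ℤ → (ℕ → ℤ) → ℕ → Set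
        Disp τ dk yk = LevelOK k (Y k) yk (res d Y k (suc k)) dk
                     × (∀ j → j ℕ.< n → (+ (Z ^ (m ∸ k))) ∣ dk j - d k j)
                     × (∀ j → j ℕ.< n → + g s * (dk j - d k j) ≡ α s j * (pos2 (yk ∸ Y k) - width Y k) + τ * γ j)

        disp : ∀ τ dk yk → Disp τ dk yk → Setting.Displacement S₀ τ
        disp τ dk yk (lv , md , rl) = record { dk = dk ; yk = yk ; levelk = lv ; modk = md
          ; relk = λ j p → subst (λ s → + g s * (dk j - d k j) ≡ α s j * (pos2 (yk ∸ Y k) - width Y k) + τ * γ j) (sym at) (rl j p) }

        -- The opposite displacement is needed only to contradict extremality.
        move : ∀ {dp yp dn yn} → Disp (+ t) dp yp → Disp (- + t) dn yn → Result dn yn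
        move {dp} {yp} {dn} {yn} D⁺ D⁻ = record
          { new = stage L⁻.Y' L⁻.d' L⁻.lifted (λ ℓ p q → subst (λ s → Follows n s (width L⁻.Y' ℓ) (L⁻.d' ℓ)) (above ℓ p) (L⁻.lifted-follows ℓ p q)) (trans (proj₂ (unchanged z z≤m extr)) Y-opt)
          ; same-Y = proj₁ (L⁻.below k ℕP.≤-refl)
          ; next-Y = L⁻.Y'-k
          ; at-k = L⁻.d'-at }
          where
          open Pair S₀ (disp (+ t) dp yp D⁺) (disp (- + t) dn yn D⁻)
          extr : Extremal z (Y z)
          extr = subst (Extremal z) (sym Y-opt) extremal

    record Found (sg : Stage k sch) (v : ℕ → ℤ) : Set where
      field
        new    : Stage k sch
        same-Y : Stage.Y new k ≡ Stage.Y sg k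
        next-Y : Stage.Y new (suc k) ≡ Stage.Y sg (suc k)
        x      : ℤ
        along  : ∀ j → Stage.d new k j ≡ Stage.d sg k j + x * v j
        ρ      : Row
        ρ∈     : ρ ∈ rows k
        moves  : dot n (ra ρ) v ≢ 0ℤ
        near   : ∣ rc' ρ * width (Stage.Y new) k - (dot n (ra ρ) (Stage.d new k) + rc ρ) ∣ ℕ.≤ Sl

    module Along (v : ℕ → ℤ) (v≤ : ∀ j → ∣ v j ∣ ℕ.≤ siegelBound n A) (v-u : v (suc k) ≡ 0ℤ)
                 (j₀ : ℕ) (j₀<n : j₀ ℕ.< n) (v-pos : 0ℤ < v j₀) where
      shiftData : ShiftData
      shiftData = record { s = scheme 0 (λ _ → 0ℤ) (λ _ → 0ℤ) ; s-nx = refl ; s-g = 1≤K ; s-α = λ _ _ → z≤n ; γ = v ; γ≤Γ = λ j _ → ℕP.≤-trans (v≤ j) Γ-bound }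

      open Shift shiftData

      Near : Stage k sch → Row → Set
      Near sg ρ = dot n (ra ρ) v ≢ 0ℤ × ∣ rc' ρ * width (Stage.Y sg) k - (dot n (ra ρ) (Stage.d sg k) + rc ρ) ∣ ℕ.≤ Sl

      near? : ∀ sg ρ → Dec (Near sg ρ)
      near? sg ρ = ¬? (dot n (ra ρ) v ℤ.≟ 0ℤ) ×-dec (_ ℕ.≤? Sl)

      module _ (sg : Stage k sch) (far : ¬ Any (Near sg) (rows k)) where
        open Stage sg
        private
          ok = Upto.level st k k<m

        -- A row annihilated by `v` keeps its value. Every other row has slack above `Sl`, which is
        -- at least the largest change a step of either sign can cause.
        displaced : ∀ τ → ∣ τ ∣ ≡ t → Disp sg τ (λ j → d k j + τ * v j) (Y (suc k))
        displaced τ τ≡t = record { y-eq = trans (LevelOK.y-eq ok) (cong (λ x → res d Y k (suc k) + x * pos2 (Y k)) (sym u-eq)) ; gap-lo = LevelOK.gap-lo ok ; gap-hi = LevelOK.gap-hi ok ; row-ok = All.tabulate (λ {ρ} → rowok ρ) }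
            , (λ j p → subst ((+ (Z ^ (m ∸ k))) ∣_) (sym (l2 (d k j) (τ * v j))) (ℤD.∣m⇒∣m*n (v j) div))
            , (λ j p → l3 (d k j) (τ * v j) (pos2 (Y (suc k) ∸ Y k)))
          where
          u-eq : d k (suc k) + τ * v (suc k) ≡ d k (suc k)
          u-eq = trans (cong (λ x → d k (suc k) + τ * x) v-u) (trans (cong (λ x → d k (suc k) + x) (ℤP.*-zeroʳ τ)) (ℤP.+-identityʳ (d k (suc k))))
          div : (+ (Z ^ (m ∸ k))) ∣ τ
          div = ℤD.∣ᵤ⇒∣ (subst (Z ^ (m ∸ k) ℕD.∣_) (sym τ≡t) (^-∣-mono Z (ℕP.≤-trans (ℕP.m∸n≤m m k) (ℕP.≤-trans (ℕP.n≤1+n m) (ℕP.n≤1+n (suc m))))))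
          l2 : ∀ x y → x + y - x ≡ y
          l2 = solve-∀
          l3 : ∀ x y B → 1ℤ * (x + y - x) ≡ 0ℤ * (B - B) + y
          l3 = solve-∀
          rowok : ∀ ρ → ρ ∈ rows k → RowOK n (λ j → d k j + τ * v j) (width Y k) ρ
          rowok ρ ρ∈ = subst (λ x → x + rc ρ ≤ rc' ρ * width Y k) (sym eq) (go (dot n (ra ρ) v ℤ.≟ 0ℤ))
            where
            a = ra ρ
            D = dot n a (d k)
            old : D + rc ρ ≤ rc' ρ * width Y k
            old = All.lookup (LevelOK.row-ok ok) ρ∈
            eq : dot n a (λ j → d k j + τ * v j) ≡ D + τ * dot n a v
            eq = trans (dot-+ʳ n a (d k) (λ j → τ * v j)) (cong (λ x → D + x) (dot-*ʳ n τ a v))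
            l4 : ∀ D x c w → w ≡ D + x + c + (w - (D + c) - x)
            l4 = solve-∀
            go : Dec (dot n a v ≡ 0ℤ) → D + τ * dot n a v + rc ρ ≤ rc' ρ * width Y k
            go (yes e) = subst (λ x → D + x + rc ρ ≤ rc' ρ * width Y k) (sym (trans (cong (τ *_) e) (ℤP.*-zeroʳ τ))) (subst (λ x → x + rc ρ ≤ rc' ρ * width Y k) (sym (ℤP.+-identityʳ D)) old)
            go (no ne) = ≤-cert (rc' ρ * width Y k - (D + rc ρ) - τ * dot n a v) (≤⇒0≤ (ℤP.≤-trans (i≤+∣i∣ (τ * dot n a v)) big-slack)) (l4 D (τ * dot n a v) (rc ρ) (rc' ρ * width Y k))
              where
              slack>Sl : Sl ℕ.< ∣ rc' ρ * width Y k - (D + rc ρ) ∣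
              slack>Sl with ∣ rc' ρ * width Y k - (D + rc ρ) ∣ ℕ.≤? Sl
              ... | yes q = ⊥-elim (far (lose ρ∈ (ne , q)))
              ... | no ¬q = ℕP.≰⇒> ¬q
              τ≤ : ∣ τ * dot n a v ∣ ℕ.≤ Sl
              τ≤ = ℕP.≤-trans (∣*∣≤ τ (dot n a v) (ℕP.≤-trans (ℕP.≤-reflexive τ≡t) t≤T) (∣dot∣≤ n a v A (siegelBound n A) (proj₁ (row-bound k k<m ρ ρ∈)) (λ j _ → v≤ j))) Sl-bound
              big-slack : + ∣ τ * dot n a v ∣ ≤ rc' ρ * width Y k - (D + rc ρ)
              big-slack = subst (+ ∣ τ * dot n a v ∣ ≤_) (ℤP.0≤i⇒+∣i∣≡i (≤⇒0≤ old)) (+≤+ (ℕP.≤-trans τ≤ (ℕP.<⇒≤ slack>Sl)))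

        step : Result sg (λ j → d k j + - + t * v j) (Y (suc k))
        step = move sg (displaced (+ t) refl) (displaced (- + t) (ℤP.∣-i∣≡∣i∣ (+ t)))

        decreases : ∣ Stage.d (Result.new step) k j₀ ∣ ℕ.< ∣ d k j₀ ∣
        decreases = ℤP.drop‿+<+ (subst₂ _<_ (sym (ℤP.0≤i⇒+∣i∣≡i (LevelOK.digit≥0 ok' j₀ j₀<n))) (sym (ℤP.0≤i⇒+∣i∣≡i (LevelOK.digit≥0 ok j₀ j₀<n)))
            (subst (_< d k j₀) (sym (cong (λ f → f j₀) (Result.at-k step))) (subst (d k j₀ + - + t * v j₀ <_) (ℤP.+-identityʳ (d k j₀)) (ℤP.+-monoʳ-< (d k j₀) neg))))
          where
          ok' = Upto.level (Stage.st (Result.new step)) k k<m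
          neg : - + t * v j₀ < 0ℤ
          neg = subst (_< 0ℤ) (trans (cong -_ (ℤP.+-identityʳ (+ t * v j₀))) (ℤP.neg-distribˡ-* (+ t) (v j₀))) (ℤP.neg-mono-< (pos-dominates {+ t} {v j₀} {0ℤ} (+<+ 1≤t) v-pos (0<∣∣ v-pos)))
            where
            0<∣∣ : ∀ {x} → 0ℤ < x → 0 ℕ.< ∣ x ∣
            0<∣∣ {+ x} (+<+ p) = p

      -- Each step subtracts a positive multiple of `v j₀ > 0` from the digit `j₀`, which stays
      -- nonnegative in every state. So after finitely many steps some row that varies along `v` is
      -- nearly tight.
      search : ∀ sg → Acc ℕ._<_ ∣ Stage.d sg k j₀ ∣ → Found sg v
      search sg (acc rs) = go (Any.any? (near? sg) (rows k))
        where
        go : Dec (Any (Near sg) (rows k)) → Found sg v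
        go (yes q) = record { new = sg ; same-Y = refl ; next-Y = refl ; x = 0ℤ ; along = λ j → l (Stage.d sg k j) (v j) ; ρ = proj₁ (find q) ; ρ∈ = proj₁ (proj₂ (find q)) ; moves = proj₁ (proj₂ (proj₂ (find q))) ; near = proj₂ (proj₂ (proj₂ (find q))) }
          where
          l : ∀ x y → x ≡ x + 0ℤ * y
          l = solve-∀
        go (no far) = record { new = F.new ; same-Y = trans F.same-Y (Result.same-Y r) ; next-Y = trans F.next-Y (Result.next-Y r) ; x = F.x - + t
            ; along = λ j → trans (F.along j) (trans (cong (λ f → f j + F.x * v j) (Result.at-k r)) (l (Stage.d sg k j) (+ t) (v j) F.x)) ; ρ = F.ρ ; ρ∈ = F.ρ∈ ; moves = F.moves ; near = F.near }
          where
          r = step sg far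
          module F = Found (search (Result.new r) (rs (decreases sg far)))
          l : ∀ d t v x → d + - t * v + x * v ≡ d + (x - t) * v
          l = solve-∀

    -- Encodes an equation `lhs · d = p B + q u + w` for the digits of the level. The vector `wit`
    -- is the direction along which the form was found; it certifies independence in `Triangular`.
    record Form : Set where
      constructor form
      field
        lhs wit : ℕ → ℤ
        p q w   : ℤ
    open Form

    record Tight (sg : Stage k sch) (r : ℕ) : Set where
      field
        L     : ℕ → Form
        first : lhs (L 0) ≡ δ (suc k)
        tri   : Triangular n r (λ i → lhs (L i)) (λ i → wit (L i))
        lhs≤  : ∀ i j → i ℕ.< r → j ℕ.< n → ∣ lhs (L i) j ∣ ℕ.≤ A
        value : ∀ i → i ℕ.< r → dot n (lhs (L i)) (Stage.d sg k) ≡ p (L i) * width (Stage.Y sg) k + q (L i) * Stage.d sg k (suc k) + w (L i)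
        p≤    : ∀ i → i ℕ.< r → ∣ p (L i) ∣ ℕ.≤ C
        q≤    : ∀ i → i ℕ.< r → ∣ q (L i) ∣ ℕ.≤ 1
        w≤    : ∀ i → i ℕ.< r → ∣ w (L i) ∣ ℕ.≤ C ℕ.+ Sl

    -- The collection starts with the tautology `u = u`, so that every later kernel direction
    -- annihilates `u` and therefore leaves `Y (suc k)` and the width alone.
    tight₁ : ∀ sg → Tight sg 1
    tight₁ sg = record
      { L = λ _ → form (δ (suc k)) (δ (suc k)) 0ℤ 1ℤ 0ℤ
      ; first = refl
      ; tri = record { upper = λ { i zero () _ ; i (suc l) _ (s≤s ()) } ; diagonal = λ _ _ e → 1≢0 (trans (sym (trans (dot-δ n (suc k) (δ (suc k)) (s≤s k<m)) (δ-same (suc k)))) e) }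
      ; lhs≤ = λ _ j _ _ → ℕP.≤-trans (∣δ∣≤1 (suc k) j) 1≤A
      ; value = λ _ _ → trans (dot-δ n (suc k) (Stage.d sg k) (s≤s k<m)) (l (Stage.d sg k (suc k)) (width (Stage.Y sg) k))
      ; p≤ = λ _ _ → z≤n ; q≤ = λ _ _ → s≤s z≤n ; w≤ = λ _ _ → z≤n }
      where
      1≢0 : 1ℤ ≢ 0ℤ
      1≢0 ()
      l : ∀ x B → x ≡ 0ℤ * B + 1ℤ * x + 0ℤ
      l = solve-∀

    module _ (sg : Stage k sch) (r : ℕ) (1≤r : 1 ℕ.≤ r) (tg : Tight sg r) (v : ℕ → ℤ)
             (v0 : ∀ i → i ℕ.< r → dot n (lhs (Tight.L tg i)) v ≡ 0ℤ) (fd : Found sg v) where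
      private
        module F = Found fd
        module Tg = Tight tg
        slack : ℤ
        slack = rc' F.ρ * width (Stage.Y F.new) k - (dot n (ra F.ρ) (Stage.d F.new k) + rc F.ρ)
        newForm : Form
        newForm = form (ra F.ρ) v (rc' F.ρ) 0ℤ (- rc F.ρ - slack)
        L' : ℕ → Form
        L' = ext Tg.L r newForm
        old : ∀ i → i ℕ.< r → L' i ≡ Tg.L i
        old i p = ext-old Tg.L r newForm i p
        top : L' r ≡ newForm
        top = ext-new Tg.L r newForm
        elim : (Q : ℕ → Form → Set) → (∀ i → i ℕ.< r → Q i (Tg.L i)) → Q r newForm → ∀ i → i ℕ.< suc r → Q i (L' i)
        elim Q x y i p = Data.Sum.[ (λ { refl → subst (Q r) (sym top) y }) , (λ q → subst (Q i) (sym (old i q)) (x i q)) ]′ (<suc-cases p)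
        width-eq : width (Stage.Y sg) k ≡ width (Stage.Y F.new) k
        width-eq = cong₂ (λ a b → pos2 (a ∸ b)) (sym F.next-Y) (sym F.same-Y)
        v-u : v (suc k) ≡ 0ℤ
        v-u = trans (sym (dot-δ n (suc k) v (s≤s k<m))) (trans (cong (λ a → dot n a v) (sym Tg.first)) (v0 0 1≤r))
        u-eq : Stage.d F.new k (suc k) ≡ Stage.d sg k (suc k)
        u-eq = trans (F.along (suc k)) (trans (cong (λ y → Stage.d sg k (suc k) + F.x * y) v-u) (trans (cong (λ y → Stage.d sg k (suc k) + y) (ℤP.*-zeroʳ F.x)) (ℤP.+-identityʳ (Stage.d sg k (suc k)))))
        dot-same : ∀ i → i ℕ.< r → dot n (lhs (Tg.L i)) (Stage.d F.new k) ≡ dot n (lhs (Tg.L i)) (Stage.d sg k)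
        dot-same i p = trans (dot-cong n {lhs (Tg.L i)} (λ _ _ → refl) (λ j _ → F.along j)) (trans (dot-+ʳ n (lhs (Tg.L i)) (Stage.d sg k) (λ j → F.x * v j)) (trans (cong (λ y → dot n (lhs (Tg.L i)) (Stage.d sg k) + y) (trans (dot-*ʳ n F.x (lhs (Tg.L i)) v) (trans (cong (F.x *_) (v0 i p)) (ℤP.*-zeroʳ F.x)))) (ℤP.+-identityʳ (dot n (lhs (Tg.L i)) (Stage.d sg k)))))

      -- The direction `v` is annihilated by the old forms and not by the new one, which keeps the
      -- system triangular. Moving along it also preserves the old equations. The slack of the new
      -- row is absorbed in its constant term, whence the bound `C + Sl`.
      tighten : Tight F.new (suc r)
      tighten = record
        { L = L'
        ; first = trans (cong lhs (old 0 1≤r)) Tg.first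
        ; tri = record
          { upper = λ i l i<l l<r → elim (λ l f → i ℕ.< l → dot n (lhs (L' i)) (wit f) ≡ 0ℤ)
              (λ l q i<l → subst (λ f → dot n (lhs f) (wit (Tg.L l)) ≡ 0ℤ) (sym (old i (ℕP.<-trans i<l q))) (Triangular.upper Tg.tri i l i<l q))
              (λ i<r → subst (λ f → dot n (lhs f) v ≡ 0ℤ) (sym (old i i<r)) (v0 i i<r)) l l<r i<l
          ; diagonal = elim (λ _ f → dot n (lhs f) (wit f) ≢ 0ℤ) (Triangular.diagonal Tg.tri) F.moves }
        ; lhs≤ = λ i j p j<n → elim (λ _ f → ∣ lhs f j ∣ ℕ.≤ A) (λ i p → Tg.lhs≤ i j p j<n) (proj₁ (row-bound k k<m F.ρ F.ρ∈) j j<n) i p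
        ; value = elim (λ _ f → dot n (lhs f) (Stage.d F.new k) ≡ p f * width (Stage.Y F.new) k + q f * Stage.d F.new k (suc k) + w f)
            (λ i q → trans (dot-same i q) (trans (Tg.value i q) (cong₂ (λ B u → p (Tg.L i) * B + Form.q (Tg.L i) * u + w (Tg.L i)) width-eq (sym u-eq))))
            (l (dot n (ra F.ρ) (Stage.d F.new k)) (rc F.ρ) (rc' F.ρ * width (Stage.Y F.new) k) (Stage.d F.new k (suc k)))
        ; p≤ = elim (λ _ f → ∣ p f ∣ ℕ.≤ C) Tg.p≤ (proj₂ (proj₂ (row-bound k k<m F.ρ F.ρ∈)))
        ; q≤ = elim (λ _ f → ∣ q f ∣ ℕ.≤ 1) Tg.q≤ z≤n
        ; w≤ = elim (λ _ f → ∣ w f ∣ ℕ.≤ C ℕ.+ Sl) Tg.w≤ (ℕP.≤-trans (ℤP.∣i-j∣≤∣i∣+∣j∣ (- rc F.ρ) slack) (ℕP.+-mono-≤ (subst (ℕ._≤ C) (sym (ℤP.∣-i∣≡∣i∣ (rc F.ρ))) (proj₁ (proj₂ (row-bound k k<m F.ρ F.ρ∈)))) F.near))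
        }
        where
        l : ∀ D c x u → D ≡ x + 0ℤ * u + (- c - (x - (D + c)))
        l = solve-∀

    saturate : ∀ h r → r ℕ.+ h ≡ n → 1 ℕ.≤ r → (sg : Stage k sch) → Tight sg r → Σ (Stage k sch) λ sg' → Tight sg' n
    saturate zero r e 1≤r sg tg = sg , subst (Tight sg) (trans (sym (ℕP.+-identityʳ r)) e) tg
    saturate (suc h) r e 1≤r sg tg = go (siegel n r A (λ i → lhs (Tight.L tg i)) r<n (Tight.lhs≤ tg))
      where
      r<n : r ℕ.< n
      r<n = ℕP.≤-trans (ℕP.≤-trans (ℕP.m≤m+n (suc r) h) (ℕP.≤-reflexive (sym (ℕP.+-suc r h)))) (ℕP.≤-reflexive e)
      direct : ∀ v → (∀ j → ∣ v j ∣ ℕ.≤ siegelBound n A) → (∀ i → i ℕ.< r → dot n (lhs (Tight.L tg i)) v ≡ 0ℤ) → ∀ j → j ℕ.< n → 0ℤ < v j → Σ (Stage k sch) λ sg' → Tight sg' n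
      direct v vb v0 j j<n pos = saturate h (suc r) (trans (sym (ℕP.+-suc r h)) e) (s≤s z≤n) (Found.new fd) (tighten sg r 1≤r tg v v0 fd)
        where
        v-u : v (suc k) ≡ 0ℤ
        v-u = trans (sym (dot-δ n (suc k) v (s≤s k<m))) (trans (cong (λ a → dot n a v) (sym (Tight.first tg))) (v0 0 1≤r))
        fd = Along.search v vb v-u j j<n pos sg (<-wellFounded _)
      go : _ → Σ (Stage k sch) λ sg' → Tight sg' n
      go (v , (j , j<n , vj) , vb , v0) with ℤP.<-cmp 0ℤ (v j)
      ... | tri< pos _ _ = direct v vb v0 j j<n pos
      ... | tri≈ _ e0 _ = ⊥-elim (vj (sym e0))
      ... | tri> _ _ neg = direct (λ i → - v i) (λ i → subst (ℕ._≤ siegelBound n A) (sym (ℤP.∣-i∣≡∣i∣ (v i))) (vb i))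
              (λ i p → trans (neg-dot (lhs (Tight.L tg i)) v) (cong -_ (v0 i p))) j j<n (ℤP.neg-mono-< neg)
        where
        neg-dot : ∀ a x → dot n a (λ j → - x j) ≡ - dot n a x
        neg-dot a x = trans (Σ<-cong n (λ j _ → cong (a j *_) (sym (ℤP.-1*i≡-i (x j))))) (trans (dot-*ʳ n (- 1ℤ) a x) (ℤP.-1*i≡-i (dot n a x)))

    phase1 : Stage k sch → Σ (Stage k sch) λ sg' → Tight sg' n
    phase1 sg = saturate m 1 refl (s≤s z≤n) sg (tight₁ sg)

    record Coeffs : Set where
      field
        gp₂     : ℕ
        α₂ γ β₀ : ℕ → ℤ
        g₂≤     : suc gp₂ ℕ.≤ K
        α₂≤     : ∀ j → j ℕ.< n → ∣ α₂ j ∣ ℕ.≤ K ℕ.* C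
        γ≤      : ∀ j → j ℕ.< n → ∣ γ j ∣ ℕ.≤ K
        β₀≤     : ∀ j → j ℕ.< n → ∣ β₀ j ∣ ℕ.≤ K ℕ.* (C ℕ.+ Sl)
        α₂-u    : α₂ (suc k) ≡ 0ℤ
        γ-u     : γ (suc k) ≡ + suc gp₂
        β₀-u    : β₀ (suc k) ≡ 0ℤ

    Rel : Coeffs → ℤ → ℤ → (ℕ → ℤ) → Set
    Rel c B u d = ∀ j → j ℕ.< n → + suc gp₂ * d j ≡ α₂ j * B + (γ j * u + β₀ j)
      where open Coeffs c

    solve : (sg : Stage k sch) → Tight sg n → Σ Coeffs λ c → Rel c (width (Stage.Y sg) k) (Stage.d sg k (suc k)) (Stage.d sg k)
    solve sg tg = build (inverse n A (λ i → lhs (L i)) (λ i → wit (L i)) tri 1≤A lhs≤)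
      where
      open Tight tg
      H' = siegelBound (suc n) A
      dk = Stage.d sg k
      B = width (Stage.Y sg) k
      u = dk (suc k)
      -- The solved equation for coordinate `suc k` is replaced by the identity
      -- `g u = 0 B + g u + 0`, so that `α-next` will hold literally.
      set : (ℕ → ℤ) → ℤ → ℕ → ℤ
      set f x j = pick j (suc k) (f j) x (f j)
      set-at : ∀ f x → set f x (suc k) ≡ x
      set-at f x = pick-≡ {k = suc k} {f (suc k)} {x} {f (suc k)}
      set-off : ∀ f x j → j ≢ suc k → set f x j ≡ f j
      set-off f x j ne with ℕP.<-cmp j (suc k)
      ... | tri< _ _ _ = refl
      ... | tri≈ _ e _ = ⊥-elim (ne e)
      ... | tri> _ _ _ = refl
      set≤ : ∀ f x j b → ∣ x ∣ ℕ.≤ b → ∣ f j ∣ ℕ.≤ b → ∣ set f x j ∣ ℕ.≤ b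
      set≤ f x j b p q with ℕP.<-cmp j (suc k)
      ... | tri< _ _ _ = q
      ... | tri≈ _ _ _ = p
      ... | tri> _ _ _ = q
      build : (Σ ℕ λ g → Σ (ℕ → ℕ → ℤ) λ M → 1 ℕ.≤ g × g ℕ.≤ H' ^ n × (∀ i l → i ℕ.< n → ∣ M i l ∣ ℕ.≤ H' ^ n ℕ.* H') × (∀ i → i ℕ.< n → RowInverse n (λ i → lhs (L i)) i g (M i))) →
              Σ Coeffs λ c → Rel c B u dk
      build (zero , M , () , _)
      build (suc gp , M , _ , g≤ , M≤ , inv) = record
          { gp₂ = gp ; α₂ = set α' 0ℤ ; γ = set γ' (+ suc gp) ; β₀ = set β' 0ℤ
          ; g₂≤ = gK
          ; α₂≤ = λ j p → set≤ α' 0ℤ j (K ℕ.* C) z≤n (sum≤ j p (λ l → Form.p (L l)) C p≤)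
          ; γ≤ = λ j p → set≤ γ' (+ suc gp) j K gK (ℕP.≤-trans (sum≤ j p (λ l → q (L l)) 1 q≤) (ℕP.≤-reflexive (ℕP.*-identityʳ K)))
          ; β₀≤ = λ j p → set≤ β' 0ℤ j (K ℕ.* (C ℕ.+ Sl)) z≤n (sum≤ j p (λ l → w (L l)) (C ℕ.+ Sl) w≤)
          ; α₂-u = set-at α' 0ℤ ; γ-u = set-at γ' (+ suc gp) ; β₀-u = set-at β' 0ℤ } , rel
        where
        gK = ℕP.≤-trans g≤ g-bound
        comb : (ℕ → ℤ) → ℕ → ℤ
        comb f i = Σ< n (λ l → M i l * f l)
        α' = comb (λ l → Form.p (L l))
        γ' = comb (λ l → q (L l))
        β' = comb (λ l → w (L l))
        sum≤ : ∀ i → i ℕ.< n → ∀ f b → (∀ l → l ℕ.< n → ∣ f l ∣ ℕ.≤ b) → ∣ comb f i ∣ ℕ.≤ K ℕ.* b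
        sum≤ i p f b h = ℕP.≤-trans (∣Σ<∣≤ n (λ l → M i l * f l) (H' ^ n ℕ.* H' ℕ.* b) (λ l q → ∣*∣≤ (M i l) (f l) (M≤ i l p) (h l q)))
          (ℕP.≤-trans (ℕP.≤-reflexive (sym (ℕP.*-assoc n (H' ^ n ℕ.* H') b))) (ℕP.*-monoˡ-≤ b K-bound))
        expand : ∀ i → i ℕ.< n → + suc gp * dk i ≡ α' i * B + (γ' i * u + β' i)
        expand i i<n = begin
          + suc gp * dk i                                              ≡⟨ cong (+ suc gp *_) (sym (dot-δ n i dk i<n)) ⟩
          + suc gp * dot n (δ i) dk                                    ≡⟨ sym (dot-*ˡ n (+ suc gp) (δ i) dk) ⟩
          dot n (λ j → + suc gp * δ i j) dk                            ≡⟨ dot-cong n {y = dk} (λ j p → sym (inv i i<n j p)) (λ _ _ → refl) ⟩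
          dot n (λ j → Σ< n (λ l → M i l * lhs (L l) j)) dk            ≡⟨ combine-dot n n (M i) (λ l → lhs (L l)) dk ⟩
          Σ< n (λ l → M i l * dot n (lhs (L l)) dk)                    ≡⟨ Σ<-cong n (λ l p → trans (cong (M i l *_) (value l p)) (l₁ (M i l) (Form.p (L l)) B (q (L l)) u (w (L l)))) ⟩
          Σ< n (λ l → B * (M i l * Form.p (L l)) + (u * (M i l * q (L l)) + M i l * w (L l)))
            ≡⟨ trans (Σ<-+ n (λ l → B * (M i l * Form.p (L l))) (λ l → u * (M i l * q (L l)) + M i l * w (L l)))
                 (cong₂ _+_ (Σ<-* n B (λ l → M i l * Form.p (L l))) (trans (Σ<-+ n (λ l → u * (M i l * q (L l))) (λ l → M i l * w (L l))) (cong (_+ β' i) (Σ<-* n u (λ l → M i l * q (L l)))))) ⟩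
          B * α' i + (u * γ' i + β' i)                                 ≡⟨ cong₂ (λ x y → x + (y + β' i)) (ℤP.*-comm B (α' i)) (ℤP.*-comm u (γ' i)) ⟩
          α' i * B + (γ' i * u + β' i)                                 ∎
          where
          open ≡-Reasoning
          l₁ : ∀ M p B q u w → M * (p * B + q * u + w) ≡ B * (M * p) + (u * (M * q) + M * w)
          l₁ = solve-∀
        l₂ : ∀ g u B → g * u ≡ 0ℤ * B + (g * u + 0ℤ)
        l₂ = solve-∀
        rel : ∀ j → j ℕ.< n → + suc gp * dk j ≡ set α' 0ℤ j * B + (set γ' (+ suc gp) j * u + set β' 0ℤ j)
        rel j p = go (j ℕ.≟ suc k)
          where
          go : Dec (j ≡ suc k) → + suc gp * dk j ≡ set α' 0ℤ j * B + (set γ' (+ suc gp) j * u + set β' 0ℤ j)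
          go (yes refl) = trans (l₂ (+ suc gp) u B) (sym (cong₂ (λ a r → a * B + r) (set-at α' 0ℤ) (cong₂ (λ c b → c * u + b) (set-at γ' (+ suc gp)) (set-at β' 0ℤ))))
          go (no ne) = trans (expand j p) (sym (cong₂ (λ a r → a * B + r) (set-off α' 0ℤ j ne) (cong₂ (λ c b → c * u + b) (set-off γ' (+ suc gp) j ne) (set-off β' 0ℤ j ne))))

    module Phase2 (c : Coeffs) where
      open Coeffs c
      g₂ : ℕ
      g₂ = suc gp₂

      E-parts : K ℕ.* C ℕ.≤ E × K ℕ.* (C ℕ.+ Sl) ℕ.+ K ℕ.* U ℕ.≤ E
      E-parts = ℕP.≤-trans (ℕP.≤-trans (ℕP.m≤m+n (K ℕ.* C) (K ℕ.* (C ℕ.+ Sl))) (ℕP.m≤m+n _ (K ℕ.* U))) E-bound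
              , ℕP.≤-trans (ℕP.+-monoˡ-≤ (K ℕ.* U) (ℕP.m≤n+m (K ℕ.* (C ℕ.+ Sl)) (K ℕ.* C))) E-bound

      shiftData : ShiftData
      shiftData = record { s = scheme gp₂ α₂ (λ _ → 0ℤ) ; s-nx = α₂-u ; s-g = g₂≤ ; s-α = λ j p → ℕP.≤-trans (α₂≤ j p) (proj₁ E-parts) ; γ = γ ; γ≤Γ = λ j p → ℕP.≤-trans (γ≤ j p) K≤Γ }

      open Shift shiftData

      -- The value of `u` is counted as part of the constant term. This has polynomial bit size only
      -- once `u ≤ U`.
      schemeAt : ℤ → Scheme
      schemeAt u = scheme gp₂ α₂ (λ j → γ j * u + β₀ j)

      module _ (sg : Stage k sch) (rel : Rel c (width (Stage.Y sg) k) (Stage.d sg k (suc k)) (Stage.d sg k)) (U≤u : U ℕ.≤ ∣ Stage.d sg k (suc k) ∣) where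
        open Stage sg
        private
          ok = Upto.level st k k<m
          u = d k (suc k)
          un = ∣ u ∣
          u≡ : + un ≡ u
          u≡ = ℤP.0≤i⇒+∣i∣≡i (LevelOK.digit≥0 ok (suc k) (s≤s k<m))
          R = res d Y k (suc k)
          B = width Y k

          res≥0 : ∀ ℓ → ℓ ℕ.≤ k → 0ℤ ≤ res d Y ℓ (suc k)
          res≥0 zero p = ℤP.≤-refl
          res≥0 (suc ℓ) p = 0≤+ (res≥0 ℓ (ℕP.<⇒≤ p)) (0≤* (LevelOK.digit≥0 (Upto.level st ℓ (ℕP.<-trans p k<m)) (suc k) (s≤s k<m)) (0≤pos2 (Y ℓ)))

          S₃-parts : suc m ℕ.* (A ℕ.* (K ℕ.* (C ℕ.+ Sl))) ℕ.+ K ℕ.* C ℕ.≤ S₃ × suc m ℕ.* (A ℕ.* K) ℕ.≤ S₃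
          S₃-parts = ℕP.≤-trans (ℕP.m≤m+n _ (suc m ℕ.* (A ℕ.* K))) S₃-bound , ℕP.≤-trans (ℕP.m≤n+m (suc m ℕ.* (A ℕ.* K)) (suc m ℕ.* (A ℕ.* (K ℕ.* (C ℕ.+ Sl))) ℕ.+ K ℕ.* C)) S₃-bound

        -- From `y' ≥ v * 2 ^ Y k ≥ v + Y k` the gap is at least `v`, and
        -- `2 ^ v > v (v+1) ≥ S₃ (v+1)`. The summand 6 serves the inequality `v (v+1) < 2 ^ v`.
        far-apart : ∀ v y' → S₃ ℕ.+ P ℕ.+ 6 ℕ.≤ v → + y' ≡ R + + v * pos2 (Y k) → lo k ℕ.+ Y k ℕ.≤ y' × P ℕ.≤ y' ∸ Y k × S₃ ℕ.* suc v ℕ.< 2 ^ (y' ∸ Y k)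
        far-apart v y' h e = subst (λ x → x ℕ.+ Y k ℕ.≤ y') (sym (lo-big k k<m bigk)) (ℕP.≤-trans (ℕP.+-monoˡ-≤ (Y k) P≤v) v+Y≤)
            , ℕP.≤-trans P≤v v≤ , ℕP.<-≤-trans (quad v (ℕP.≤-trans (ℕP.m≤n+m 6 (S₃ ℕ.+ P)) h) (ℕP.≤-trans (ℕP.m≤m+n S₃ P) (ℕP.≤-trans (ℕP.m≤m+n (S₃ ℕ.+ P) 6) h))) (ℕP.^-monoʳ-≤ 2 v≤)
          where
          P≤v : P ℕ.≤ v
          P≤v = ℕP.≤-trans (ℕP.m≤n+m P S₃) (ℕP.≤-trans (ℕP.m≤m+n (S₃ ℕ.+ P) 6) h)
          v+Y≤ : v ℕ.+ Y k ℕ.≤ y'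
          v+Y≤ = ℤP.drop‿+≤+ (ℤP.≤-trans (+≤+ (grow v (Y k) (ℕP.≤-trans (ℕP.m≤n+m 1 (S₃ ℕ.+ P ℕ.+ 5)) (ℕP.≤-trans (ℕP.≤-reflexive (ℕP.+-assoc (S₃ ℕ.+ P) 5 1)) h))))
             (subst (+ (v ℕ.* 2 ^ Y k) ≤_) (sym e) (subst (_≤ R + + v * pos2 (Y k)) (sym (ℤP.pos-* v (2 ^ Y k))) (subst (_≤ R + + v * pos2 (Y k)) (ℤP.+-identityˡ (+ v * pos2 (Y k))) (ℤP.+-monoˡ-≤ (+ v * pos2 (Y k)) (res≥0 k ℕP.≤-refl))))))
          v≤ : v ℕ.≤ y' ∸ Y k
          v≤ = ℕP.m+n≤o⇒m≤o∸n v v+Y≤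
          quad : ∀ v → 6 ℕ.≤ v → S₃ ℕ.≤ v → S₃ ℕ.* suc v ℕ.< 2 ^ v
          quad v p q = ℕP.≤-<-trans (ℕP.*-monoˡ-≤ (suc v) q) (v[v+1]<2^v v p)

        module Sided (τ : ℤ) (τ≡t : ∣ τ ∣ ≡ t) (v : ℕ) (v≡ : + v ≡ u + τ) (v≥ : S₃ ℕ.+ P ℕ.+ 6 ℕ.≤ v) where
          y' : ℕ
          y' = ∣ R + + v * pos2 (Y k) ∣
          y'≡ : + y' ≡ R + + v * pos2 (Y k)
          y'≡ = ℤP.0≤i⇒+∣i∣≡i (0≤+ (res≥0 k ℕP.≤-refl) (0≤* {+ v} {pos2 (Y k)} (+≤+ z≤n) (0≤pos2 (Y k))))
          B' : ℤ
          B' = pos2 (y' ∸ Y k)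
          fa' = far-apart v y' v≥ y'≡
          un≥ : S₃ ℕ.+ P ℕ.+ 6 ℕ.≤ un
          un≥ = ℕP.≤-trans (ℕP.≤-trans (ℕP.+-monoˡ-≤ 6 (ℕP.+-monoˡ-≤ P (ℕP.m≤m+n S₃ T))) U-bound) U≤u
          fa₀ = far-apart un (Y (suc k)) un≥ (trans (LevelOK.y-eq ok) (cong (λ x → R + x * pos2 (Y k)) (sym u≡)))
          -- One factor `Z` beyond the modulus in `modk`, to pay for the division by `g₂`.
          X : ℕ
          X = Z ^ suc (m ∸ k)
          X∣τ : (+ X) ∣ τ
          X∣τ = ℤD.∣ᵤ⇒∣ (subst (X ℕD.∣_) (sym τ≡t) (^-∣-mono Z (s≤s (ℕP.≤-trans (ℕP.m∸n≤m m k) (ℕP.n≤1+n m)))))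
          X<2^P : X ℕ.< 2 ^ P
          X<2^P = ℕP.≤-<-trans (ℕP.≤-trans (ℕP.^-monoʳ-≤ Z {{ℕ.>-nonZero 1≤Z}} (s≤s (ℕP.≤-trans (ℕP.m∸n≤m m k) (ℕP.n≤1+n m)))) t≤T) T<2^P
          -- Changing `u` by `τ` shifts the exponent of the width by `2 ^ Y k * τ`, a multiple of
          -- `X`; as `X` is its own period, the width itself is unchanged modulo `X`.
          exps : + (y' ∸ Y k) - + (Y (suc k) ∸ Y k) ≡ pos2 (Y k) * τ
          exps = trans (cong₂ _-_ (pos-∸ (ℕP.≤-trans (ℕP.m≤n+m (Y k) (lo k)) (proj₁ fa'))) (pos-∸ (LevelOK.y≤y' ok))) (trans (cong₂ (λ a b → (a - + Y k) - (b - + Y k)) (trans y'≡ (cong (λ x → R + x * pos2 (Y k)) v≡)) (LevelOK.y-eq ok)) (l R u τ (pos2 (Y k)) (+ Y k)))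
            where
            l : ∀ R u τ p y → (R + (u + τ) * p - y) - (R + u * p - y) ≡ p * τ
            l = solve-∀
          X∣B : (+ X) ∣ B' - B
          X∣B = pos2-cong-mod (Per-^ per (m ∸ k)) X<2^P (y' ∸ Y k) (Y (suc k) ∸ Y k) (proj₁ (proj₂ fa')) (proj₁ (proj₂ fa₀)) (subst ((+ X) ∣_) (sym exps) (ℤD.∣n⇒∣m*n (pos2 (Y k)) X∣τ))
          X∣diff : ∀ j → (+ X) ∣ α₂ j * (B' - B) + τ * γ j
          X∣diff j = ℤD.∣m∣n⇒∣m+n (ℤD.∣n⇒∣m*n (α₂ j) X∣B) (ℤD.∣m⇒∣m*n (γ j) X∣τ)
          g∣X : (+ g₂) ∣ (+ X)
          g∣X = ℤD.∣ᵤ⇒∣ (ℕD.∣-trans s∣Z (ℕD.m∣m*n (Z ^ (m ∸ k))))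
          dk : ℕ → ℤ
          dk j = (α₂ j * B' + (γ j * + v + β₀ j)) /ℕ g₂
          num : ∀ j → j ℕ.< n → α₂ j * B' + (γ j * + v + β₀ j) ≡ + g₂ * d k j + (α₂ j * (B' - B) + τ * γ j)
          num j p = trans (cong (λ x → α₂ j * B' + (γ j * x + β₀ j)) v≡) (trans (l (α₂ j) B' B (γ j) u τ (β₀ j)) (cong (_+ (α₂ j * (B' - B) + τ * γ j)) (sym (rel j p))))
            where
            l : ∀ a B' B c u τ b → a * B' + (c * (u + τ) + b) ≡ (a * B + (c * u + b)) + (a * (B' - B) + τ * c)
            l = solve-∀
          exact : ∀ j → j ℕ.< n → + g₂ * dk j ≡ α₂ j * B' + (γ j * + v + β₀ j)
          exact j p = exact-/ℕ (α₂ j * B' + (γ j * + v + β₀ j)) gp₂ (subst ((+ g₂) ∣_) (sym (num j p)) (ℤD.∣m∣n⇒∣m+n (divides (d k j) (ℤP.*-comm (+ g₂) (d k j))) (ℤD.∣-trans g∣X (X∣diff j))))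
          rel' : Rel c B' (+ v) dk
          rel' = exact
          relk : ∀ j → j ℕ.< n → + g₂ * (dk j - d k j) ≡ α₂ j * (B' - B) + τ * γ j
          relk j p = trans (l₁ (+ g₂) (dk j) (d k j)) (trans (cong (_- + g₂ * d k j) (trans (exact j p) (num j p))) (l₂ (+ g₂ * d k j) (α₂ j * (B' - B) + τ * γ j)))
            where
            l₁ : ∀ g x y → g * (x - y) ≡ g * x - g * y
            l₁ = solve-∀
            l₂ : ∀ x y → x + y - x ≡ y
            l₂ = solve-∀
          modk : ∀ j → j ℕ.< n → (+ (Z ^ (m ∸ k))) ∣ dk j - d k j
          modk j p = ℤD.*-cancelˡ-∣ (+ g₂) (ℤD.∣-trans gZ∣X (subst ((+ X) ∣_) (sym (relk j p)) (X∣diff j)))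
            where
            gZ∣X : (+ g₂ * + (Z ^ (m ∸ k))) ∣ (+ X)
            gZ∣X = subst (_∣ (+ X)) (ℤP.pos-* g₂ (Z ^ (m ∸ k))) (ℤD.∣ᵤ⇒∣ (ℕD.*-monoˡ-∣ (Z ^ (m ∸ k)) s∣Z))
          u'≡ : dk (suc k) ≡ + v
          u'≡ = *-cancelˡ-pos gp₂ (trans (exact (suc k) (s≤s k<m)) (trans (cong₂ (λ a r → a * B' + r) α₂-u (cong₂ (λ a b → a * + v + b) γ-u β₀-u)) (l (+ g₂) (+ v) B')))
            where
            l : ∀ g v B → 0ℤ * B + (g * v + 0ℤ) ≡ g * v
            l = solve-∀
          rowok : ∀ ρ → ρ ∈ rows k → RowOK n dk B' ρ
          rowok ρ ρ∈ = -≤0⇒≤ (*-pos-≤0⁻ gp₂ _ (subst (_≤ 0ℤ) (trans (sym (shape B' (+ v))) (row-scaled n (schemeAt (+ v)) B' dk ρ rel'))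
              (qpu-shift (dot n a α₂ - + g₂ * rc' ρ) (dot n a γ) (dot n a β₀ + + g₂ * rc ρ) un v (2 ^ (Y (suc k) ∸ Y k)) (2 ^ (y' ∸ Y k)) S₃ p≤ w≤ (lt un≥) (lt v≥) (proj₂ (proj₂ fa₀)) (proj₂ (proj₂ fa'))
                (subst (λ x → (dot n a α₂ - + g₂ * rc' ρ) * B + (dot n a γ * x + (dot n a β₀ + + g₂ * rc ρ)) ≤ 0ℤ) (sym u≡) (subst (_≤ 0ℤ) (trans (sym (row-scaled n (schemeAt u) B (d k) ρ rel)) (shape B u)) (*-pos-≤0 gp₂ _ (≤⇒-≤0 (All.lookup (LevelOK.row-ok ok) ρ∈))))))))
            where
            a = ra ρ
            rb = row-bound k k<m ρ ρ∈
            p≤ : ∣ dot n a γ ∣ ℕ.≤ S₃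
            p≤ = ℕP.≤-trans (∣dot∣≤ n a γ A K (proj₁ rb) γ≤) (proj₂ S₃-parts)
            w≤ : ∣ dot n a β₀ + + g₂ * rc ρ ∣ ℕ.≤ S₃
            w≤ = ℕP.≤-trans (∣+∣≤ (dot n a β₀) (+ g₂ * rc ρ) (∣dot∣≤ n a β₀ A (K ℕ.* (C ℕ.+ Sl)) (proj₁ rb) β₀≤) (∣*∣≤ (+ g₂) (rc ρ) g₂≤ (proj₁ (proj₂ rb)))) (proj₁ S₃-parts)
            lt : ∀ {x} → S₃ ℕ.+ P ℕ.+ 6 ℕ.≤ x → S₃ ℕ.< x
            lt {x} h = ℕP.≤-trans (ℕP.≤-trans (ℕP.m≤m+n (suc S₃) (P ℕ.+ 5)) (ℕP.≤-reflexive (lemℕ S₃ P))) h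
              where
              lemℕ : ∀ s p → 1 ℕ.+ s ℕ.+ (p ℕ.+ 5) ≡ s ℕ.+ p ℕ.+ 6
              lemℕ = solveℕ
            shape : ∀ B x → (dot n a α₂ - + g₂ * rc' ρ) * B + (dot n a (λ j → γ j * x + β₀ j) + + g₂ * rc ρ) ≡ (dot n a α₂ - + g₂ * rc' ρ) * B + (dot n a γ * x + (dot n a β₀ + + g₂ * rc ρ))
            shape B x = cong (λ y → (dot n a α₂ - + g₂ * rc' ρ) * B + y) (trans (cong (_+ + g₂ * rc ρ) (trans (dot-+ʳ n a (λ j → γ j * x) β₀) (cong (_+ dot n a β₀) (trans (dot-cong n {a} (λ _ _ → refl) (λ j _ → ℤP.*-comm (γ j) x)) (trans (dot-*ʳ n x a γ) (ℤP.*-comm x (dot n a γ))))))) (ℤP.+-assoc (dot n a γ * x) (dot n a β₀) (+ g₂ * rc ρ)))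
          displaced : Disp sg τ dk y'
          displaced = record { y-eq = trans y'≡ (cong (λ x → R + x * pos2 (Y k)) (sym u'≡)) ; gap-lo = proj₁ fa' ; gap-hi = λ e → ⊥-elim (true≢false (trans (sym bigk) e)) ; row-ok = All.tabulate (λ {ρ} → rowok ρ) } , modk , relk

        t≤un : t ℕ.≤ un
        t≤un = ℕP.≤-trans t≤T (ℕP.≤-trans (ℕP.≤-trans (ℕP.m≤n+m T S₃) (ℕP.≤-trans (ℕP.m≤m+n (S₃ ℕ.+ T) P) (ℕP.m≤m+n (S₃ ℕ.+ T ℕ.+ P) 6))) (ℕP.≤-trans U-bound U≤u))

        minus-≡ : + (un ∸ t) ≡ u + - + t
        minus-≡ = trans (sym (trans (ℤP.m-n≡m⊖n un t) (ℤP.⊖-≥ t≤un))) (cong (_- + t) u≡)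

        -- The summand `T` in `U-bound` is reserved for this: the lowered digit still satisfies the
        -- hypothesis of `far-apart`.
        minus≥ : S₃ ℕ.+ P ℕ.+ 6 ℕ.≤ un ∸ t
        minus≥ = ℕP.m+n≤o⇒m≤o∸n (S₃ ℕ.+ P ℕ.+ 6) (ℕP.≤-trans (ℕP.+-monoʳ-≤ (S₃ ℕ.+ P ℕ.+ 6) t≤T) (ℕP.≤-trans (ℕP.≤-reflexive (l S₃ P T)) (ℕP.≤-trans U-bound U≤u)))
          where
          l : ∀ s p t → s ℕ.+ p ℕ.+ 6 ℕ.+ t ≡ s ℕ.+ t ℕ.+ p ℕ.+ 6
          l = solveℕ

        module Down = Sided (- + t) (ℤP.∣-i∣≡∣i∣ (+ t)) (un ∸ t) minus-≡ minus≥
        module Up = Sided (+ t) refl (un ℕ.+ t) (trans (ℤP.pos-+ un t) (cong (_+ + t) u≡)) (ℕP.≤-trans minus≥ (ℕP.≤-trans (ℕP.m∸n≤m un t) (ℕP.m≤m+n un t)))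

        down : Result sg Down.dk Down.y'
        down = move sg Up.displaced Down.displaced

        module _ (r : Result sg Down.dk Down.y') where
          open Result r

          down-u : Stage.d new k (suc k) ≡ + (un ∸ t)
          down-u = trans (cong (λ f → f (suc k)) at-k) Down.u'≡

          down-rel : Rel c (width (Stage.Y new) k) (Stage.d new k (suc k)) (Stage.d new k)
          down-rel j p = trans (cong (λ f → + g₂ * f j) at-k) (trans (Down.rel' j p) (cong₂ (λ B x → α₂ j * B + (γ j * x + β₀ j)) (cong₂ (λ a b → pos2 (a ∸ b)) (sym next-Y) (sym same-Y)) (sym down-u)))

          down-< : ∣ Stage.d new k (suc k) ∣ ℕ.< un
          down-< = ℕP.≤-<-trans (ℕP.≤-reflexive (cong ∣_∣ down-u)) (ℕP.∸-monoʳ-< {un} {t} {0} 1≤t t≤un)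

      phase2 : ∀ sg → Rel c (width (Stage.Y sg) k) (Stage.d sg k (suc k)) (Stage.d sg k) → Acc ℕ._<_ ∣ Stage.d sg k (suc k) ∣ →
               Σ (Stage k sch) λ sg' → Rel c (width (Stage.Y sg') k) (Stage.d sg' k (suc k)) (Stage.d sg' k) × ∣ Stage.d sg' k (suc k) ∣ ℕ.≤ U
      phase2 sg rel (acc rs) = go (∣ Stage.d sg k (suc k) ∣ ℕ.≤? U)
        where
        go : Dec (∣ Stage.d sg k (suc k) ∣ ℕ.≤ U) → _
        go (yes h) = sg , rel , h
        go (no h) = phase2 (Result.new r) (down-rel sg rel big-u r) (rs (down-< sg rel big-u r))
          where
          big-u : U ℕ.≤ ∣ Stage.d sg k (suc k) ∣
          big-u = ℕP.<⇒≤ (ℕP.≰⇒> h)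
          r = down sg rel big-u

      static₂ : ∀ u → ∣ u ∣ ℕ.≤ U → Static k (schemeAt u)
      static₂ u h = record { α-nx = α₂-u ; g≤K = g₂≤ ; α≤E = λ _ j p → ℕP.≤-trans (α₂≤ j p) (proj₁ E-parts)
        ; β≤E = λ _ j p → ℕP.≤-trans (∣+∣≤ (γ j * u) (β₀ j) (∣*∣≤ (γ j) u (γ≤ j p) h) (β₀≤ j p)) (ℕP.≤-trans (ℕP.≤-reflexive (ℕP.+-comm (K ℕ.* U) (K ℕ.* (C ℕ.+ Sl)))) (proj₂ E-parts))
        ; α-small = λ e → ⊥-elim (true≢false (trans (sym bigk) e)) ; β-small = λ e → ⊥-elim (true≢false (trans (sym bigk) e)) }

    complete : Stage k sch → Σ Scheme λ s → Static k s × Σ (Stage k sch) λ sg → Follows n s (width (Stage.Y sg) k) (Stage.d sg k)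
    complete sg₀ = schemeAt u , static₂ u (proj₂ (proj₂ final)) , proj₁ final , proj₁ (proj₂ final)
      where
      one = phase1 sg₀
      sol = solve (proj₁ one) (proj₂ one)
      open Phase2 (proj₁ sol)
      final = phase2 (proj₁ one) (proj₂ sol) (<-wellFounded _)
      u = Stage.d (proj₁ final) k (suc k)

  record Done (k : ℕ) : Set where
    field
      sch     : ℕ → Scheme
      static  : ∀ ℓ → k ℕ.≤ ℓ → ℓ ℕ.< m → Static ℓ (sch ℓ)
      Y       : ℕ → ℕ
      d       : ℕ → ℕ → ℤ
      st      : State Y d
      follows : ∀ ℓ → k ℕ.≤ ℓ → ℓ ℕ.< m → Follows n (sch ℓ) (width Y ℓ) (d ℓ)
      Y-opt   : Y z ≡ opt

  private
    extend : ∀ k sch s (sg : Stage k sch) → (∀ ℓ → k ℕ.< ℓ → ℓ ℕ.< m → Static ℓ (sch ℓ)) → Static k s → Follows n s (width (Stage.Y sg) k) (Stage.d sg k) → Done k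
    extend k sch s sg static sk fk = record
      { sch = sch' ; static = λ ℓ p q → cases ℓ p (Static ℓ) (λ { refl → sk }) (λ r → static ℓ r q)
      ; Y = Stage.Y sg ; d = Stage.d sg ; st = Stage.st sg
      ; follows = λ ℓ p q → cases ℓ p (λ s → Follows n s (width (Stage.Y sg) ℓ) (Stage.d sg ℓ)) (λ { refl → fk }) (λ r → Stage.follows sg ℓ r q)
      ; Y-opt = Stage.Y-opt sg }
      where
      sch' : ℕ → Scheme
      sch' ℓ = pick ℓ k s s (sch ℓ)
      cases : ∀ ℓ → k ℕ.≤ ℓ → (Q : Scheme → Set) → (ℓ ≡ k → Q s) → (k ℕ.< ℓ → Q (sch ℓ)) → Q (sch' ℓ)
      cases ℓ p Q x y = Data.Sum.[ (λ { refl → subst Q (sym (pick-≡ {k = k} {s} {s} {sch k})) (x refl) }) , (λ r → subst Q (sym (pick-> r)) (y r)) ]′ (<suc-cases (s≤s p))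

  -- At a small level the width is the constant `2 ^ lo k`, so the digits themselves, being smaller,
  -- serve as constant terms with denominator 1.
  frozen : ∀ k → k ℕ.< m → big k ≡ false → ∀ {Y d} → State Y d → Static k (scheme 0 (λ _ → 0ℤ) (d k))
  frozen k k<m e {Y} {d} st = record { α-nx = refl ; g≤K = 1≤K ; α≤E = λ e' → ⊥-elim (true≢false (trans (sym e') e)) ; β≤E = λ e' → ⊥-elim (true≢false (trans (sym e') e)) ; α-small = λ _ _ _ → refl
      ; β-small = λ _ j p → ℤP.drop‿+≤+ (subst (_≤ pos2 (lo k)) (sym (ℤP.0≤i⇒+∣i∣≡i (LevelOK.digit≥0 ok j p))) (ℤP.≤-trans (≤-cert 1ℤ (+≤+ z≤n) refl) (subst (λ x → d k j + 1ℤ ≤ pos2 x) (trans (cong (_∸ Y k) (LevelOK.gap-hi ok e)) (ℕP.m+n∸n≡m (lo k) (Y k))) (LevelOK.digit<B ok j p)))) }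
    where
    ok = Upto.level st k k<m

  descend : ∀ k → k ℕ.< m → Done (suc k) → Done k
  descend k k<m D = go (big k) refl
    where
    module D = Done D
    sg : Stage k D.sch
    sg = stage D.Y D.d D.st D.follows D.Y-opt
    go : ∀ b → big k ≡ b → Done k
    go true e = extend k D.sch (proj₁ r) (proj₁ (proj₂ (proj₂ r))) D.static (proj₁ (proj₂ r)) (proj₂ (proj₂ (proj₂ r)))
      where r = AtLevel.complete (record { k = k ; k<m = k<m ; bigk = e ; sch = D.sch ; static = D.static }) sg
    go false e = extend k D.sch (scheme 0 (λ _ → 0ℤ) (D.d k)) sg D.static (frozen k k<m e D.st) (λ j _ → l (D.d k j) (width D.Y k))
      where
      l : ∀ x B → 1ℤ * x ≡ 0ℤ * B + x
      l = solve-∀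

  descend-all : ∀ k → k ℕ.≤ m → Done k → Done 0
  descend-all zero    _ D = D
  descend-all (suc k) p D = descend-all k (ℕP.<⇒≤ p) (descend k p D)

  normalise : ∀ Y d → State Y d → Y z ≡ opt → Done 0
  normalise Y d st e = descend-all m ℕP.≤-refl (record
    { sch = λ _ → scheme 0 (λ _ → 0ℤ) (λ _ → 0ℤ) ; static = λ ℓ p q → ⊥-elim (ℕP.<⇒≱ q p) ; Y = Y ; d = d ; st = st ; follows = λ ℓ p q → ⊥-elim (ℕP.<⇒≱ q p) ; Y-opt = e })

  normalForm : ∀ Y d → State Y d → Y z ≡ opt → NormalForm m big lo fams K E z opt
  normalForm Y d st e = record { Y = D.Y ; d = D.d ; st = D.st ; sch = D.sch ; follows = λ ℓ p → D.follows ℓ z≤n p ; Y-opt = D.Y-opt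
    ; α-next = λ ℓ p → Static.α-nx (D.static ℓ z≤n p) ; g≤K = λ ℓ p → Static.g≤K (D.static ℓ z≤n p)
    ; α≤E = λ ℓ p → Static.α≤E (D.static ℓ z≤n p) ; β≤E = λ ℓ p → Static.β≤E (D.static ℓ z≤n p)
    ; α-small = λ ℓ p → Static.α-small (D.static ℓ z≤n p) ; β-small = λ ℓ p → Static.β-small (D.static ℓ z≤n p) }
    where
    module D = Done (normalise Y d st e)

-- Linear-exponential terms in digits

-- The value of `x mod 2^y` consists of the digits of `x` at the levels below the position of `y`,
-- which is a linear expression in the digits.
atomA : (Var → ℕ) → Atom → ℕ → ℕ → ℤ
atomA idx (lin x)    ℓ j = δ (idx x) j
atomA idx (pow2 x)   ℓ j = 0ℤ
atomA idx (modp x y) ℓ j = (if ℓ ℕ.<ᵇ idx y then 1ℤ else 0ℤ) * δ (idx x) j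

atomκ : (Var → ℕ) → Atom → ℕ → ℤ
atomκ idx (lin x)    ℓ = 0ℤ
atomκ idx (pow2 x)   ℓ = δ (idx x) ℓ
atomκ idx (modp x y) ℓ = 0ℤ

monosA : (Var → ℕ) → List (ℤ × Atom) → ℕ → ℕ → ℤ
monosA idx []             ℓ j = 0ℤ
monosA idx ((c , a) ∷ ms) ℓ j = c * atomA idx a ℓ j + monosA idx ms ℓ j

-- The constant of the term is attached to level 0, where the power is `2 ^ Y 0 = 1`.
monosκ : (Var → ℕ) → List (ℤ × Atom) → ℤ → ℕ → ℤ
monosκ idx []             e ℓ = e * δ 0 ℓ
monosκ idx ((c , a) ∷ ms) e ℓ = c * atomκ idx a ℓ + monosκ idx ms e ℓ

-- the first summand stops below m, where digits are defined
total : ℕ → (ℕ → ℕ → ℤ) → (ℕ → ℤ) → (ℕ → ℕ → ℤ) → (ℕ → ℕ) → ℤ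
total m a k d Y = Σ< m (λ ℓ → dot (suc m) (a ℓ) (d ℓ) * pos2 (Y ℓ)) + Σ< (suc m) (λ ℓ → k ℓ * pos2 (Y ℓ))

total-linear : ∀ m c a k a' k' d Y → total m (λ ℓ j → c * a ℓ j + a' ℓ j) (λ ℓ → c * k ℓ + k' ℓ) d Y ≡ c * total m a k d Y + total m a' k' d Y
total-linear m c a k a' k' d Y = begin
  Σ< m (λ ℓ → dot n (λ j → c * a ℓ j + a' ℓ j) (d ℓ) * p ℓ) + Σ< n (λ ℓ → (c * k ℓ + k' ℓ) * p ℓ)
    ≡⟨ cong₂ _+_ (trans (Σ<-cong m (λ ℓ _ → trans (cong (_* p ℓ) (trans (dot-+ˡ n (λ j → c * a ℓ j) (a' ℓ) (d ℓ)) (cong (_+ dot n (a' ℓ) (d ℓ)) (dot-*ˡ n c (a ℓ) (d ℓ))))) (l₁ c (dot n (a ℓ) (d ℓ)) (dot n (a' ℓ) (d ℓ)) (p ℓ)))) (lin-sum m (λ ℓ → dot n (a ℓ) (d ℓ) * p ℓ) (λ ℓ → dot n (a' ℓ) (d ℓ) * p ℓ)))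
                 (trans (Σ<-cong n (λ ℓ _ → l₁ c (k ℓ) (k' ℓ) (p ℓ))) (lin-sum n (λ ℓ → k ℓ * p ℓ) (λ ℓ → k' ℓ * p ℓ))) ⟩
  (c * X + X') + (c * W + W')     ≡⟨ l₂ c X X' W W' ⟩
  c * (X + W) + (X' + W')         ∎
  where
  open ≡-Reasoning
  n = suc m
  p : ℕ → ℤ
  p ℓ = pos2 (Y ℓ)
  X  = Σ< m (λ ℓ → dot n (a ℓ) (d ℓ) * p ℓ)
  X' = Σ< m (λ ℓ → dot n (a' ℓ) (d ℓ) * p ℓ)
  W  = Σ< n (λ ℓ → k ℓ * p ℓ)
  W' = Σ< n (λ ℓ → k' ℓ * p ℓ)
  l₁ : ∀ c x y p → (c * x + y) * p ≡ c * (x * p) + y * p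
  l₁ = solve-∀
  l₂ : ∀ c x x' w w' → (c * x + x') + (c * w + w') ≡ c * (x + w) + (x' + w')
  l₂ = solve-∀
  lin-sum : ∀ b (f f' : ℕ → ℤ) → Σ< b (λ ℓ → c * f ℓ + f' ℓ) ≡ c * Σ< b f + Σ< b f'
  lin-sum b f f' = trans (Σ<-+ b (λ ℓ → c * f ℓ) f') (cong (_+ Σ< b f') (Σ<-* b c f))

Σ<-truncate : ∀ m b (f : ℕ → ℤ) → b ℕ.≤ m → Σ< m (λ ℓ → (if ℓ ℕ.<ᵇ b then 1ℤ else 0ℤ) * f ℓ) ≡ Σ< b f
Σ<-truncate zero zero f z≤n = refl
Σ<-truncate (suc m) b f p with b ℕ.≟ suc m
... | yes refl = Σ<-cong (suc m) (λ ℓ q → trans (cong (_* f ℓ) (ind ℓ q)) (ℤP.*-identityˡ (f ℓ)))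
  where
  ind : ∀ ℓ → ℓ ℕ.< suc m → (if ℓ ℕ.<ᵇ suc m then 1ℤ else 0ℤ) ≡ 1ℤ
  ind ℓ q with ℓ ℕ.<ᵇ suc m | ℕP.<⇒<ᵇ q
  ... | true | _ = refl
... | no ne = trans (cong₂ _+_ (Σ<-truncate m b f b≤m) (trans (cong (_* f m) ind) (ℤP.*-zeroˡ (f m)))) (ℤP.+-identityʳ (Σ< b f))
  where
  b≤m : b ℕ.≤ m
  b≤m = ℕP.≤-pred (ℕP.≤∧≢⇒< p ne)
  ind : (if m ℕ.<ᵇ b then 1ℤ else 0ℤ) ≡ 0ℤ
  ind with m ℕ.<ᵇ b in e
  ... | false = refl
  ... | true = ⊥-elim (ℕP.<⇒≱ (ℕP.<ᵇ⇒< m b (subst IsTrue (sym e) _)) b≤m)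

res-Σ< : ∀ d Y ℓ j → Σ< ℓ (λ i → d i j * pos2 (Y i)) ≡ res d Y ℓ j
res-Σ< d Y zero j = refl
res-Σ< d Y (suc ℓ) j = cong (_+ d ℓ j * pos2 (Y ℓ)) (res-Σ< d Y ℓ j)

partial-total : ∀ m f d Y → partial (suc m) f d Y m + κ f m * pos2 (Y m) ≡ total m (fa f) (κ f) d Y
partial-total m f d Y = trans (cong (_+ κ f m * pos2 (Y m)) (split m)) (ℤP.+-assoc (Σ< m (λ i → dot (suc m) (fa f i) (d i) * pos2 (Y i))) (Σ< m (λ i → κ f i * pos2 (Y i))) (κ f m * pos2 (Y m)))
  where
  l : ∀ a b x y p → a + b + (x + y) * p ≡ (a + x * p) + (b + y * p)
  l = solve-∀
  split : ∀ ℓ → partial (suc m) f d Y ℓ ≡ Σ< ℓ (λ i → dot (suc m) (fa f i) (d i) * pos2 (Y i)) + Σ< ℓ (λ i → κ f i * pos2 (Y i))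
  split zero = refl
  split (suc ℓ) = trans (cong (_+ (dot (suc m) (fa f ℓ) (d ℓ) + κ f ℓ) * pos2 (Y ℓ)) (split ℓ)) (l (Σ< ℓ (λ i → dot (suc m) (fa f i) (d i) * pos2 (Y i))) (Σ< ℓ (λ i → κ f i * pos2 (Y i))) (dot (suc m) (fa f ℓ) (d ℓ)) (κ f ℓ) (pos2 (Y ℓ)))

-- Evaluating terms at a state

module Evaluate (m : ℕ) (big : ℕ → Bool) (lo : ℕ → ℕ) (fams : List Family) (idx : Var → ℕ) (idx≤ : ∀ x → idx x ℕ.≤ m)
                {Y : ℕ → ℕ} {d : ℕ → ℕ → ℤ} (st : System.State m big lo fams Y d) where
  open System m big lo fams
  μ : Assignment
  μ x = Y (idx x)

  res-range : ∀ ℓ j → ℓ ℕ.≤ m → j ℕ.< n → 0ℤ ≤ res d Y ℓ j × res d Y ℓ j + 1ℤ ≤ pos2 (Y ℓ)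
  res-range zero j p q = ℤP.≤-refl , +≤+ (ℕP.m^n>0 2 (Y 0))
  res-range (suc ℓ) j p q = 0≤+ (proj₁ ih) (0≤* (LevelOK.digit≥0 ok j q) (0≤pos2 (Y ℓ)))
      , subst (res d Y (suc ℓ) j + 1ℤ ≤_) (pos2-∸ (LevelOK.y≤y' ok)) (≤-cert ((B - (d ℓ j + 1ℤ)) * pos2 (Y ℓ) + (pos2 (Y ℓ) - (res d Y ℓ j + 1ℤ))) (0≤+ (0≤* (≤⇒0≤ (LevelOK.digit<B ok j q)) (0≤pos2 (Y ℓ))) (≤⇒0≤ (proj₂ ih))) (l B (pos2 (Y ℓ)) (d ℓ j) (res d Y ℓ j)))
    where
    ok = Upto.level st ℓ p
    ih = res-range ℓ j (ℕP.<⇒≤ p) q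
    B = pos2 (Y (suc ℓ) ∸ Y ℓ)
    l : ∀ B p d r → B * p ≡ r + d * p + 1ℤ + ((B - (d + 1ℤ)) * p + (p - (r + 1ℤ)))
    l = solve-∀

  Y-mono : ∀ a h → a ℕ.+ h ℕ.≤ m → Y a ℕ.≤ Y (a ℕ.+ h)
  Y-mono a zero p = ℕP.≤-reflexive (cong Y (sym (ℕP.+-identityʳ a)))
  Y-mono a (suc h) p = subst (λ z → Y a ℕ.≤ Y z) (sym (ℕP.+-suc a h)) (ℕP.≤-trans (Y-mono a h (ℕP.<⇒≤ p')) (LevelOK.y≤y' (Upto.level st (a ℕ.+ h) p')))
    where
    p' : a ℕ.+ h ℕ.< m
    p' = subst (ℕ._≤ m) (ℕP.+-suc a h) p

  res-mod : ∀ b j h → b ℕ.+ h ℕ.≤ m → j ℕ.< n → ∃ λ q → res d Y (b ℕ.+ h) j ≡ res d Y b j + + q * pos2 (Y b)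
  res-mod b j zero p q = 0 , trans (cong (λ z → res d Y z j) (ℕP.+-identityʳ b)) (l (res d Y b j) (pos2 (Y b)))
    where
    l : ∀ r p → r ≡ r + 0ℤ * p
    l = solve-∀
  res-mod b j (suc h) p q with res-mod b j h (ℕP.<⇒≤ (subst (ℕ._≤ m) (ℕP.+-suc b h) p)) q
  ... | c , e = c ℕ.+ ∣ d (b ℕ.+ h) j ∣ ℕ.* 2 ^ (Y (b ℕ.+ h) ∸ Y b) , trans (cong (λ z → res d Y z j) (ℕP.+-suc b h)) (trans (cong₂ _+_ e (cong₂ _*_ (sym D≡) (sym (pos2-∸ (Y-mono b h (ℕP.<⇒≤ p')))))) (trans (l (res d Y b j) (+ c) (pos2 (Y b)) (+ D) (pos2 (Y (b ℕ.+ h) ∸ Y b))) (cong (λ z → res d Y b j + z * pos2 (Y b)) (trans (cong (λ z → + c + z) (sym (ℤP.pos-* D (2 ^ (Y (b ℕ.+ h) ∸ Y b))))) (sym (ℤP.pos-+ c (D ℕ.* 2 ^ (Y (b ℕ.+ h) ∸ Y b))))))))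
    where
    p' : b ℕ.+ h ℕ.< m
    p' = subst (ℕ._≤ m) (ℕP.+-suc b h) p
    D = ∣ d (b ℕ.+ h) j ∣
    D≡ : + D ≡ d (b ℕ.+ h) j
    D≡ = ℤP.0≤i⇒+∣i∣≡i (LevelOK.digit≥0 (Upto.level st (b ℕ.+ h) p') j q)
    l : ∀ r c p D e → r + c * p + D * (e * p) ≡ r + (c + D * e) * p
    l = solve-∀

  -- The residue lies in `[0, 2 ^ Y b)` by the digit bounds and differs from `Y j` by a multiple of
  -- `2 ^ Y b`, since all higher cut positions are at least `Y b`.
  res-% : ∀ b j → b ℕ.≤ m → j ℕ.≤ m → res d Y b j ≡ + (ℕM._%_ (Y j) (2 ^ Y b) {{ℕP.m^n≢0 2 (Y b)}})
  res-% b j b≤m j≤m = trans (sym r≡) (cong +_ (sym eq))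
    where
    instance
      nz : NonZero (2 ^ Y b)
      nz = ℕP.m^n≢0 2 (Y b)
    rg = res-range b j b≤m (s≤s j≤m)
    r = ∣ res d Y b j ∣
    r≡ : + r ≡ res d Y b j
    r≡ = ℤP.0≤i⇒+∣i∣≡i (proj₁ rg)
    r< : r ℕ.< 2 ^ Y b
    r< = ℕP.≤-trans (ℕP.≤-reflexive (ℕP.+-comm 1 r)) (ℤP.drop‿+≤+ (subst (λ z → z + 1ℤ ≤ pos2 (Y b)) (sym r≡) (proj₂ rg)))
    md = res-mod b j (m ∸ b) (ℕP.≤-reflexive (ℕP.m+[n∸m]≡n b≤m)) (s≤s j≤m)
    c = proj₁ md
    Yj : Y j ≡ r ℕ.+ c ℕ.* 2 ^ Y b
    Yj = ℤP.+-injective (trans (sym (Upto.res-stable st ℕP.≤-refl m j j≤m ℕP.≤-refl)) (trans (trans (cong (λ z → res d Y z j) (sym (ℕP.m+[n∸m]≡n b≤m))) (proj₂ md)) (trans (cong₂ _+_ (sym r≡) (sym (ℤP.pos-* c (2 ^ Y b)))) (sym (ℤP.pos-+ r (c ℕ.* 2 ^ Y b))))))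
    eq : Y j ℕM.% 2 ^ Y b ≡ r
    eq = trans (cong (ℕM._% 2 ^ Y b) Yj) (trans (ℕM.[m+kn]%n≡m%n r c (2 ^ Y b)) (ℕM.m<n⇒m%n≡m r<))

  atom-eval : ∀ a → total m (atomA idx a) (atomκ idx a) d Y ≡ evalAtom μ a
  atom-eval (lin x) = trans (cong₂ _+_ (trans (Σ<-cong m (λ ℓ _ → cong (_* pos2 (Y ℓ)) (dot-δ n (idx x) (d ℓ) (s≤s (idx≤ x))))) (trans (res-Σ< d Y m (idx x)) (Upto.res-stable st ℕP.≤-refl m (idx x) (idx≤ x) ℕP.≤-refl))) (Σ<-zero n (λ ℓ _ → ℤP.*-zeroˡ (pos2 (Y ℓ))))) (ℤP.+-identityʳ (+ Y (idx x)))
  atom-eval (pow2 x) = trans (cong₂ _+_ (Σ<-zero m (λ ℓ _ → trans (cong (_* pos2 (Y ℓ)) (Σ<-zero n (λ j _ → ℤP.*-zeroˡ (d ℓ j)))) (ℤP.*-zeroˡ (pos2 (Y ℓ))))) (dot-δ n (idx x) (λ ℓ → pos2 (Y ℓ)) (s≤s (idx≤ x)))) (ℤP.+-identityˡ (pos2 (Y (idx x))))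
  atom-eval (modp x y) = trans (cong₂ _+_ (trans (Σ<-cong m (λ ℓ _ → trans (cong (_* pos2 (Y ℓ)) (trans (dot-*ˡ n (ind ℓ) (δ (idx x)) (d ℓ)) (cong (ind ℓ *_) (dot-δ n (idx x) (d ℓ) (s≤s (idx≤ x)))))) (ℤP.*-assoc (ind ℓ) (d ℓ (idx x)) (pos2 (Y ℓ))))) (trans (Σ<-truncate m (idx y) (λ ℓ → d ℓ (idx x) * pos2 (Y ℓ)) (idx≤ y)) (trans (res-Σ< d Y (idx y) (idx x)) (res-% (idx y) (idx x) (idx≤ y) (idx≤ x))))) (Σ<-zero n (λ ℓ _ → ℤP.*-zeroˡ (pos2 (Y ℓ))))) (ℤP.+-identityʳ _)
    where
    ind : ℕ → ℤ
    ind ℓ = if ℓ ℕ.<ᵇ idx y then 1ℤ else 0ℤ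

  term-eval : ∀ ms e → total m (monosA idx ms) (monosκ idx ms e) d Y ≡ evalTerm μ (leterm ms e)
  term-eval [] e = trans (cong₂ _+_ (Σ<-zero m (λ ℓ _ → trans (cong (_* pos2 (Y ℓ)) (Σ<-zero n (λ j _ → ℤP.*-zeroˡ (d ℓ j)))) (ℤP.*-zeroˡ (pos2 (Y ℓ)))))
      (trans (Σ<-cong n (λ ℓ _ → ℤP.*-assoc e (δ 0 ℓ) (pos2 (Y ℓ)))) (trans (Σ<-* n e (λ ℓ → δ 0 ℓ * pos2 (Y ℓ))) (cong (e *_) (trans (dot-δ n 0 (λ ℓ → pos2 (Y ℓ)) (s≤s z≤n)) (cong pos2 (Upto.Y-zero st))))))) (trans (ℤP.+-identityˡ (e * 1ℤ)) (ℤP.*-identityʳ e))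
  term-eval ((c , a) ∷ ms) e = trans (total-linear m c (atomA idx a) (atomκ idx a) (monosA idx ms) (monosκ idx ms e) d Y) (cong₂ (λ x y → c * x + y) (atom-eval a) (term-eval ms e))

-- The ceiling of `V / 2^y`, obtained as the negative of the floor of `- V / 2^y`. Its minimality
-- yields both the rows and the sign of the last carry.
carry : ∀ V y → Σ ℤ λ c → V ≤ c * pos2 y × (∀ u → V ≤ u * pos2 y → c ≤ u)
carry V y = - q , ≤-cert (- V - q * pos2 y) (≤⇒0≤ ([n/ℕd]*d≤n (- V) (2 ^ y))) (l₀ V q (pos2 y)) , least
  where
  instance
    nz : NonZero (2 ^ y)
    nz = ℕP.m^n≢0 2 y
  q = (- V) /ℕ (2 ^ y)
  r = (- V) %ℕ (2 ^ y)
  l₀ : ∀ V q p → - q * p ≡ V + (- V - q * p)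
  l₀ = solve-∀
  least : ∀ u → V ≤ u * pos2 y → - q ≤ u
  least u h = subst (- q ≤_) (ℤP.neg-involutive u) (ℤP.neg-mono-≤ -u≤q)
    where
    lt : - u * pos2 y < (1ℤ + q) * pos2 y
    lt = ℤP.≤-<-trans (≤-cert (u * pos2 y - V) (≤⇒0≤ h) (l₁ V u (pos2 y))) (subst₂ _<_ (sym (a≡a%ℕn+[a/ℕn]*n (- V) (2 ^ y))) (l₂ q (pos2 y)) (ℤP.+-monoˡ-< (q * pos2 y) (+<+ (n%ℕd<d (- V) (2 ^ y)))))
      where
      l₁ : ∀ V u p → - V ≡ - u * p + (u * p - V)
      l₁ = solve-∀
      l₂ : ∀ q p → p + q * p ≡ (1ℤ + q) * p
      l₂ = solve-∀
    -u≤q : - u ≤ q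
    -u≤q = ℤP.≮⇒≥ (λ q<-u → ℤP.<⇒≱ lt (*-monoʳ-≤-pos2 y (ℤP.i<j⇒suc[i]≤j q<-u)))

partial-irrelevant : ∀ n a k c c' d Y ℓ → partial n (family a k c) d Y ℓ ≡ partial n (family a k c') d Y ℓ
partial-irrelevant n a k c c' d Y zero = refl
partial-irrelevant n a k c c' d Y (suc ℓ) = cong (_+ (dot n (a ℓ) (d ℓ) + k ℓ) * pos2 (Y ℓ)) (partial-irrelevant n a k c c' d Y ℓ)

-- The level system of a solution

*-pos2-cancel-≤ : ∀ y {a b} → a * pos2 y ≤ b * pos2 y → a ≤ b
*-pos2-cancel-≤ y {a} {b} h = ℤP.*-cancelʳ-≤-pos a b (pos2 y) {{ℤ.positive (+<+ (ℕP.m^n>0 2 y))}} h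

∣∣≤-of-range : ∀ {c} b → - + b ≤ c → c ≤ + b → ∣ c ∣ ℕ.≤ b
∣∣≤-of-range {+ c} b _ h = ℤP.drop‿+≤+ h
∣∣≤-of-range { -[1+ c ]} b h _ = ℤP.drop‿+≤+ (subst (_≤ + b) refl (subst (+ suc c ≤_) (ℤP.neg-involutive (+ b)) (ℤP.neg-mono-≤ h)))

carry≤ : ∀ V y b → ∣ V ∣ ℕ.≤ b ℕ.* 2 ^ y → ∣ proj₁ (carry V y) ∣ ℕ.≤ b
carry≤ V y b h = ∣∣≤-of-range b (*-pos2-cancel-≤ y (ℤP.≤-trans lower (proj₁ (proj₂ c)))) (proj₂ (proj₂ c) (+ b) upper)
  where
  c = carry V y
  upper : V ≤ + b * pos2 y
  upper = ℤP.≤-trans (i≤+∣i∣ V) (subst (+ ∣ V ∣ ≤_) (ℤP.pos-* b (2 ^ y)) (+≤+ h))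
  lower : - + b * pos2 y ≤ V
  lower = subst₂ _≤_ (trans (cong -_ (ℤP.pos-* b (2 ^ y))) (ℤP.neg-distribˡ-* (+ b) (pos2 y))) (ℤP.neg-involutive V)
    (ℤP.neg-mono-≤ (ℤP.≤-trans (i≤+∣i∣ (- V)) (+≤+ (subst (ℕ._≤ b ℕ.* 2 ^ y) (sym (ℤP.∣-i∣≡∣i∣ V)) h))))

digitRows-ok : ∀ ℓ N n d B → N ℕ.≤ n → (∀ j → j ℕ.< n → 0ℤ ≤ d j) → (∀ j → j ℕ.< n → d j + room ℓ j ≤ room ℓ j * B) → All (RowOK n d B) (digitRows ℓ N)
digitRows-ok ℓ zero n d B p h h' = []
digitRows-ok ℓ (suc j) n d B p h h' =
    subst₂ _≤_ (sym (trans (ℤP.+-identityʳ (dot n (λ i → - δ j i) d)) (neg-dot-δ n j d p))) (sym (ℤP.*-zeroˡ B)) (ℤP.neg-mono-≤ (h j p))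
  ∷ subst (λ x → x + room ℓ j ≤ room ℓ j * B) (sym (dot-δ n j d p)) (h' j p)
  ∷ digitRows-ok ℓ j n d B (ℕP.<⇒≤ p) h h'

weight : LETerm → ℕ
weight (leterm [] e)             = ∣ e ∣
weight (leterm ((c , a) ∷ ms) e) = ∣ c ∣ ℕ.+ weight (leterm ms e)

monosA≤ : ∀ idx ms e ℓ j → ∣ monosA idx ms ℓ j ∣ ℕ.≤ weight (leterm ms e)
monosA≤ idx [] e ℓ j = z≤n
monosA≤ idx ((c , a) ∷ ms) e ℓ j = ∣+∣≤ (c * atomA idx a ℓ j) (monosA idx ms ℓ j) (ℕP.≤-trans (∣*∣≤ c (atomA idx a ℓ j) ℕP.≤-refl (at a)) (ℕP.≤-reflexive (ℕP.*-identityʳ ∣ c ∣))) (monosA≤ idx ms e ℓ j)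
  where
  at : ∀ a → ∣ atomA idx a ℓ j ∣ ℕ.≤ 1
  at (lin x) = ∣δ∣≤1 (idx x) j
  at (pow2 x) = z≤n
  at (modp x y) with ℓ ℕ.<ᵇ idx y
  ... | true = subst (λ z → ∣ z ∣ ℕ.≤ 1) (sym (ℤP.*-identityˡ (δ (idx x) j))) (∣δ∣≤1 (idx x) j)
  ... | false = subst (λ z → ∣ z ∣ ℕ.≤ 1) (sym (ℤP.*-zeroˡ (δ (idx x) j))) z≤n

monosκ≤ : ∀ idx ms e ℓ → ∣ monosκ idx ms e ℓ ∣ ℕ.≤ weight (leterm ms e)
monosκ≤ idx [] e ℓ = ℕP.≤-trans (∣*∣≤ e (δ 0 ℓ) ℕP.≤-refl (∣δ∣≤1 0 ℓ)) (ℕP.≤-reflexive (ℕP.*-identityʳ ∣ e ∣))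
monosκ≤ idx ((c , a) ∷ ms) e ℓ = ∣+∣≤ (c * atomκ idx a ℓ) (monosκ idx ms e ℓ) (ℕP.≤-trans (∣*∣≤ c (atomκ idx a ℓ) ℕP.≤-refl (at a)) (ℕP.≤-reflexive (ℕP.*-identityʳ ∣ c ∣))) (monosκ≤ idx ms e ℓ)
  where
  at : ∀ a → ∣ atomκ idx a ℓ ∣ ℕ.≤ 1
  at (lin x) = z≤n
  at (pow2 x) = ∣δ∣≤1 (idx x) ℓ
  at (modp x y) = z≤n

Coef : Set
Coef = (ℕ → ℕ → ℤ) × (ℕ → ℤ)

gapκ : ℤ → ℕ → ℕ → ℤ
gapκ σ l zero    = σ * + l
gapκ σ l (suc _) = 0ℤ

gapCoef : ℤ → ℕ → ℕ → Coef
gapCoef σ l ℓ = (λ i j → σ * (δ ℓ j - δ (suc ℓ) j)) , gapκ σ l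

module Initial (m : ℕ) (Y : ℕ → ℕ) (Y-zero : Y 0 ≡ 0) (Y-mono : ∀ ℓ → ℓ ℕ.< m → Y ℓ ℕ.≤ Y (suc ℓ))
    (idx : Var → ℕ) (idx≤ : ∀ x → idx x ℕ.≤ m) (ts : List LETerm) (P A₀ : ℕ) (weight≤ : ∀ {τ} → τ ∈ ts → weight τ ℕ.≤ A₀)
    (holds : ∀ {τ} → τ ∈ ts → evalTerm (λ x → Y (idx x)) τ ≤ 0ℤ) where

  n : ℕ
  n = suc m

  gap : ℕ → ℕ
  gap ℓ = Y (suc ℓ) ∸ Y ℓ

  big : ℕ → Bool
  big ℓ = P ℕ.≤ᵇ gap ℓ

  -- A small gap is recorded exactly, whereas of a big gap only the lower bound `P` is kept; this
  -- leaves big gaps free to change.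
  lo : ℕ → ℕ
  lo ℓ = if big ℓ then P else gap ℓ

  lo-big : ∀ ℓ → big ℓ ≡ true → lo ℓ ≡ P
  lo-big ℓ e = cong (λ b → if b then P else gap ℓ) e

  lo-small : ∀ ℓ → big ℓ ≡ false → lo ℓ ≡ gap ℓ
  lo-small ℓ e = cong (λ b → if b then P else gap ℓ) e

  lo≤gap : ∀ ℓ → lo ℓ ℕ.≤ gap ℓ
  lo≤gap ℓ with P ℕ.≤ᵇ gap ℓ in e
  ... | true = ℕP.≤ᵇ⇒≤ P (gap ℓ) (subst IsTrue (sym e) _)
  ... | false = ℕP.≤-refl

  lo≤P : ∀ ℓ → lo ℓ ℕ.≤ P
  lo≤P ℓ with P ℕ.≤ᵇ gap ℓ in e
  ... | true = ℕP.≤-refl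
  ... | false = ℕP.≰⇒≥ (λ h → subst IsTrue e (ℕP.≤⇒≤ᵇ h))

  d : ℕ → ℕ → ℤ
  d ℓ j = + (ℕM._/_ (ℕM._%_ (Y j) (2 ^ Y (suc ℓ)) {{ℕP.m^n≢0 2 (Y (suc ℓ))}}) (2 ^ Y ℓ) {{ℕP.m^n≢0 2 (Y ℓ)}})

  -- The carries are computed once from the given solution and are constants afterwards. New states
  -- have to satisfy the rows with these old carries.
  mk : Coef → Family
  mk (a , k) = family a k (λ ℓ → proj₁ (carry (partial n (family a k (λ _ → 0ℤ)) d Y ℓ) (Y ℓ)))

  termCoef : LETerm → Coef
  termCoef (leterm ms e) = monosA idx ms , monosκ idx ms e

  gapCoefs : ℕ → List Coef
  gapCoefs zero    = []
  gapCoefs (suc ℓ) = gapCoef 1ℤ (lo ℓ) ℓ ∷ gapCoef (- 1ℤ) (lo ℓ) ℓ ∷ gapCoefs ℓ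

  gapCoef∈ : ∀ N ℓ → ℓ ℕ.< N → gapCoef 1ℤ (lo ℓ) ℓ ∈ gapCoefs N × gapCoef (- 1ℤ) (lo ℓ) ℓ ∈ gapCoefs N
  gapCoef∈ (suc N) ℓ p with ℓ ℕ.≟ N
  ... | yes refl = here refl , there (here refl)
  ... | no ne = there (there (proj₁ ih)) , there (there (proj₂ ih))
    where ih = gapCoef∈ N ℓ (ℕP.≤∧≢⇒< (ℕP.≤-pred p) ne)

  coefs : List Coef
  coefs = map termCoef ts ++ gapCoefs m

  fams : List Family
  fams = map mk coefs

  open System m big lo fams hiding (n)

  res-init : ∀ ℓ j → ℓ ℕ.≤ m → res d Y ℓ j ≡ + (ℕM._%_ (Y j) (2 ^ Y ℓ) {{ℕP.m^n≢0 2 (Y ℓ)}})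
  res-init zero j p = sym (cong +_ (lem (Y 0) Y-zero))
    where
    lem : ∀ y → y ≡ 0 → ℕM._%_ (Y j) (2 ^ y) {{ℕP.m^n≢0 2 y}} ≡ 0
    lem .0 refl = ℕM.n%1≡0 (Y j)
  res-init (suc ℓ) j p = trans (cong (_+ d ℓ j * pos2 (Y ℓ)) (res-init ℓ j (ℕP.<⇒≤ p))) (trans (cong (λ z → + (Y j ℕM.% 2 ^ Y ℓ) + z) (sym (ℤP.pos-* ((Y j ℕM.% 2 ^ Y (suc ℓ)) ℕM./ 2 ^ Y ℓ) (2 ^ Y ℓ)))) (trans (sym (ℤP.pos-+ (Y j ℕM.% 2 ^ Y ℓ) ((Y j ℕM.% 2 ^ Y (suc ℓ)) ℕM./ 2 ^ Y ℓ ℕ.* 2 ^ Y ℓ))) (cong +_ (sym eq))))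
    where
    instance
      nz₁ : NonZero (2 ^ Y ℓ)
      nz₁ = ℕP.m^n≢0 2 (Y ℓ)
      nz₂ : NonZero (2 ^ Y (suc ℓ))
      nz₂ = ℕP.m^n≢0 2 (Y (suc ℓ))
    modmod : (Y j ℕM.% 2 ^ Y (suc ℓ)) ℕM.% 2 ^ Y ℓ ≡ Y j ℕM.% 2 ^ Y ℓ
    modmod = ℕM.m∣n⇒o%n%m≡o%m (2 ^ Y ℓ) (2 ^ Y (suc ℓ)) (Y j) (^-∣-mono 2 (Y-mono ℓ p))
    eq : Y j ℕM.% 2 ^ Y (suc ℓ) ≡ Y j ℕM.% 2 ^ Y ℓ ℕ.+ (Y j ℕM.% 2 ^ Y (suc ℓ)) ℕM./ 2 ^ Y ℓ ℕ.* 2 ^ Y ℓ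
    eq = trans (ℕM.m≡m%n+[m/n]*n (Y j ℕM.% 2 ^ Y (suc ℓ)) (2 ^ Y ℓ)) (cong (ℕ._+ (Y j ℕM.% 2 ^ Y (suc ℓ)) ℕM./ 2 ^ Y ℓ ℕ.* 2 ^ Y ℓ) modmod)

  digit<B : ∀ ℓ j → ℓ ℕ.< m → d ℓ j + 1ℤ ≤ pos2 (gap ℓ)
  digit<B ℓ j p = subst (_≤ pos2 (gap ℓ)) (ℤP.+-comm 1ℤ (d ℓ j)) (+≤+ (ℕM.m<n*o⇒m/o<n {{ℕP.m^n≢0 2 (Y ℓ)}} (subst (ℕM._%_ (Y j) (2 ^ Y (suc ℓ)) {{ℕP.m^n≢0 2 (Y (suc ℓ))}} ℕ.<_) (trans (cong (2 ^_) (sym (ℕP.m∸n+n≡m (Y-mono ℓ p)))) (ℕP.^-distribˡ-+-* 2 (gap ℓ) (Y ℓ))) (ℕM.m%n<n (Y j) (2 ^ Y (suc ℓ)) {{ℕP.m^n≢0 2 (Y (suc ℓ))}}))))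

  Y-mono* : ∀ j ℓ → j ℕ.≤ ℓ → ℓ ℕ.≤ m → Y j ℕ.≤ Y ℓ
  Y-mono* j zero z≤n q = ℕP.≤-refl
  Y-mono* j (suc ℓ) p q with <suc-cases (s≤s p)
  ... | inj₁ refl = ℕP.≤-refl
  ... | inj₂ r = ℕP.≤-trans (Y-mono* j ℓ (ℕP.≤-pred r) (ℕP.<⇒≤ q)) (Y-mono ℓ q)

  digit0 : ∀ ℓ j → ℓ ℕ.< m → j ℕ.≤ ℓ → d ℓ j ≡ 0ℤ
  digit0 ℓ j p q = cong +_ (ℕM.m<n⇒m/n≡0 {{ℕP.m^n≢0 2 (Y ℓ)}} (ℕP.≤-<-trans (ℕM.m%n≤m (Y j) (2 ^ Y (suc ℓ)) {{ℕP.m^n≢0 2 (Y (suc ℓ))}}) (ℕP.≤-<-trans (Y-mono* j ℓ q (ℕP.<⇒≤ p)) (n<2^n (Y ℓ)))))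

  digit-room : ∀ ℓ j → ℓ ℕ.< m → d ℓ j + room ℓ j ≤ room ℓ j * pos2 (gap ℓ)
  digit-room ℓ j p with j ℕ.≤ᵇ ℓ in e
  ... | true = ℤP.≤-reflexive (trans (ℤP.+-identityʳ (d ℓ j)) (trans (digit0 ℓ j p (ℕP.≤ᵇ⇒≤ j ℓ (subst IsTrue (sym e) _))) (sym (ℤP.*-zeroˡ (pos2 (gap ℓ))))))
  ... | false = subst (d ℓ j + 1ℤ ≤_) (sym (ℤP.*-identityˡ (pos2 (gap ℓ)))) (digit<B ℓ j p)

  V : Coef → ℕ → ℤ
  V (a , k) ℓ = partial n (family a k (λ _ → 0ℤ)) d Y ℓ

  -- The upper carry bounds `V q (suc ℓ)`. Subtracting the contribution of level `ℓ` shows that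
  -- `c' * B - (D + k ℓ)` is admissible as a carry at `ℓ`, and `c` is the least such number.
  family-row : ∀ q ℓ → ℓ ℕ.< m → RowOK n (d ℓ) (pos2 (gap ℓ)) (familyRow ℓ (mk q))
  family-row q@(a , k) ℓ p = subst (_≤ c' * pos2 (gap ℓ)) (ℤP.+-assoc D (k ℓ) c) (≤-cert (c' * pos2 (gap ℓ) - (D + k ℓ) - c) (≤⇒0≤ (proj₂ (proj₂ (carry (V q ℓ) (Y ℓ))) (c' * pos2 (gap ℓ) - (D + k ℓ)) vle)) (l₀ D (k ℓ) c (c' * pos2 (gap ℓ))))
    where
    D = dot n (a ℓ) (d ℓ)
    c = fc (mk q) ℓ
    c' = fc (mk q) (suc ℓ)
    l₀ : ∀ D k c x → x ≡ D + k + c + (x - (D + k) - c)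
    l₀ = solve-∀
    l₁ : ∀ V x y p → (x - y) * p ≡ V + (x * p - (V + y * p))
    l₁ = solve-∀
    vle : V q ℓ ≤ (c' * pos2 (gap ℓ) - (D + k ℓ)) * pos2 (Y ℓ)
    vle = ≤-cert (c' * pos2 (gap ℓ) * pos2 (Y ℓ) - (V q ℓ + (D + k ℓ) * pos2 (Y ℓ))) (≤⇒0≤ (subst (V q (suc ℓ) ≤_) (trans (cong (c' *_) (sym (pos2-∸ (Y-mono ℓ p)))) (sym (ℤP.*-assoc c' (pos2 (gap ℓ)) (pos2 (Y ℓ))))) (proj₁ (proj₂ (carry (V q (suc ℓ)) (Y (suc ℓ))))))) (l₁ (V q ℓ) (c' * pos2 (gap ℓ)) (D + k ℓ) (pos2 (Y ℓ)))

  initial : State Y d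
  initial = record { Y-zero = Y-zero ; level = λ ℓ p → record
      { y-eq = trans (cong +_ (sym (ℕM.m<n⇒m%n≡m {{ℕP.m^n≢0 2 (Y (suc ℓ))}} (n<2^n (Y (suc ℓ)))))) (sym (res-init (suc ℓ) (suc ℓ) p))
      ; gap-lo = ℕP.≤-trans (ℕP.+-monoˡ-≤ (Y ℓ) (lo≤gap ℓ)) (ℕP.≤-reflexive (ℕP.m∸n+n≡m (Y-mono ℓ p)))
      ; gap-hi = λ e → trans (sym (ℕP.m∸n+n≡m (Y-mono ℓ p))) (cong (ℕ._+ Y ℓ) (sym (lo-small ℓ e)))
      ; row-ok = AllP.++⁺ (AllP.map⁺ (AllP.map⁺ (All.tabulate (λ {q} _ → family-row q ℓ p)))) (digitRows-ok ℓ n n (d ℓ) (pos2 (gap ℓ)) ℕP.≤-refl (λ j _ → +≤+ z≤n) (λ j _ → digit-room ℓ j p)) } }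

  carry-zero : ∀ q → fc (mk q) 0 ≡ 0ℤ
  carry-zero q = ℤP.≤-antisym (proj₂ (proj₂ c) 0ℤ (ℤP.≤-reflexive (sym (ℤP.*-zeroˡ (pos2 (Y 0)))))) (*-pos2-cancel-≤ (Y 0) (subst (_≤ proj₁ c * pos2 (Y 0)) (sym (ℤP.*-zeroˡ (pos2 (Y 0)))) (proj₁ (proj₂ c))))
    where c = carry 0ℤ (Y 0)

  gapFamily : ∀ σ ℓ → ℓ ℕ.< m → gapCoef σ (lo ℓ) ℓ ∈ gapCoefs m → σ * (+ Y ℓ - + Y (suc ℓ) + + lo ℓ) ≤ 0ℤ → GapFamily ℓ σ (mk (gapCoef σ (lo ℓ) ℓ))
  gapFamily σ ℓ p q∈ h = record { f∈ = ∈-map⁺ mk (∈-++⁺ʳ (map termCoef ts) q∈) ; coeff = λ _ _ → refl ; κ-0 = refl ; κ-suc = λ _ → refl ; c-0 = carry-zero q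
      ; c-end = proj₂ (proj₂ (carry (V q (suc ℓ)) (Y (suc ℓ)))) 0ℤ (subst₂ _≤_ (sym eq) (sym (ℤP.*-zeroˡ (pos2 (Y (suc ℓ))))) h) }
    where
    q = gapCoef σ (lo ℓ) ℓ
    f₀ = family (proj₁ q) (proj₂ q) (λ _ → 0ℤ)
    -- The quantity `V` is defined with zero carries, so `partial-gap` is applied to the family
    -- `f₀`, in a system that consists of it alone.
    g₀ : System.GapFamily m big lo (f₀ ∷ []) ℓ σ f₀
    g₀ = record { f∈ = here refl ; coeff = λ _ _ → refl ; κ-0 = refl ; κ-suc = λ _ → refl ; c-0 = refl ; c-end = ℤP.≤-refl }
    eq : V q (suc ℓ) ≡ σ * (+ Y ℓ - + Y (suc ℓ) + + lo ℓ)
    eq = trans (System.GapFamily.partial-gap g₀ p d Y ℓ Y-zero) (cong (λ z → σ * (z + + lo ℓ)) (cong₂ _-_ (Upto.res-stable initial ℕP.≤-refl (suc ℓ) ℓ (ℕP.n≤1+n ℓ) p) (Upto.res-stable initial ℕP.≤-refl (suc ℓ) (suc ℓ) ℕP.≤-refl p)))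

  gapLo : ∀ ℓ → ℓ ℕ.< m → Σ Family (GapFamily ℓ 1ℤ)
  gapLo ℓ p = _ , gapFamily 1ℤ ℓ p (proj₁ (gapCoef∈ m ℓ p)) (subst (_≤ 0ℤ) (l (+ lo ℓ) (+ Y ℓ) (+ Y (suc ℓ))) (≤⇒-≤0 (subst (_≤ + Y (suc ℓ)) (ℤP.pos-+ (lo ℓ) (Y ℓ)) (+≤+ (LevelOK.gap-lo (Upto.level initial ℓ p))))))
    where
    l : ∀ l a b → l + a - b ≡ 1ℤ * (a - b + l)
    l = solve-∀

  gapHi : ∀ ℓ → ℓ ℕ.< m → big ℓ ≡ false → Σ Family (GapFamily ℓ (- 1ℤ))
  gapHi ℓ p e = _ , gapFamily (- 1ℤ) ℓ p (proj₂ (gapCoef∈ m ℓ p)) (ℤP.≤-reflexive (trans (cong (λ z → - 1ℤ * (+ Y ℓ - z + + lo ℓ)) (trans (cong +_ (LevelOK.gap-hi (Upto.level initial ℓ p) e)) (ℤP.pos-+ (lo ℓ) (Y ℓ)))) (l (+ lo ℓ) (+ Y ℓ))))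
    where
    l : ∀ l a → - 1ℤ * (a - (l + a) + l) ≡ 0ℤ
    l = solve-∀

  -- `W` times the width bounds what one level contributes to a family, so all carries are at most
  -- `m * W`. The summand 2 in `A` covers the gap families and the summand 1 in `C` the `room` of
  -- the digit rows.
  A Kb W C : ℕ
  A = A₀ ℕ.+ 2
  Kb = A₀ ℕ.+ P
  W = n ℕ.* A ℕ.+ Kb
  C = Kb ℕ.+ m ℕ.* W ℕ.+ 1

  coef-bound : ∀ {q} → q ∈ coefs → (∀ ℓ j → ∣ proj₁ q ℓ j ∣ ℕ.≤ A) × (∀ ℓ → ∣ proj₂ q ℓ ∣ ℕ.≤ Kb)
  coef-bound q∈ with ∈-++⁻ (map termCoef ts) q∈
  ... | inj₁ t∈ with ∈-map⁻ termCoef t∈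
  ... | leterm ms e , τ∈ , refl = (λ ℓ j → ℕP.≤-trans (ℕP.≤-trans (monosA≤ idx ms e ℓ j) (weight≤ τ∈)) (ℕP.m≤m+n A₀ 2)) , (λ ℓ → ℕP.≤-trans (ℕP.≤-trans (monosκ≤ idx ms e ℓ) (weight≤ τ∈)) (ℕP.m≤m+n A₀ P))
  coef-bound q∈ | inj₂ g∈ = go m g∈
    where
    δδ : ∀ σ ℓ j → ∣ σ ∣ ≡ 1 → ∣ σ * (δ ℓ j - δ (suc ℓ) j) ∣ ℕ.≤ A
    δδ σ ℓ j e = ℕP.≤-trans (∣*∣≤ σ (δ ℓ j - δ (suc ℓ) j) (ℕP.≤-reflexive e) (ℕP.≤-trans (ℤP.∣i-j∣≤∣i∣+∣j∣ (δ ℓ j) (δ (suc ℓ) j)) (ℕP.+-mono-≤ (∣δ∣≤1 ℓ j) (∣δ∣≤1 (suc ℓ) j)))) (ℕP.m≤n+m 2 A₀)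
    kk : ∀ σ ℓ i → ∣ σ ∣ ≡ 1 → ∣ gapκ σ (lo ℓ) i ∣ ℕ.≤ Kb
    kk σ ℓ zero e = ℕP.≤-trans (∣*∣≤ σ (+ lo ℓ) (ℕP.≤-reflexive e) (lo≤P ℓ)) (ℕP.≤-trans (ℕP.≤-reflexive (ℕP.+-identityʳ P)) (ℕP.m≤n+m P A₀))
    kk σ ℓ (suc i) e = z≤n
    go : ∀ N {q} → q ∈ gapCoefs N → (∀ ℓ j → ∣ proj₁ q ℓ j ∣ ℕ.≤ A) × (∀ ℓ → ∣ proj₂ q ℓ ∣ ℕ.≤ Kb)
    go (suc N) (here refl) = (λ _ j → δδ 1ℤ N j refl) , (λ i → kk 1ℤ N i refl)
    go (suc N) (there (here refl)) = (λ _ j → δδ (- 1ℤ) N j refl) , (λ i → kk (- 1ℤ) N i refl)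
    go (suc N) (there (there h)) = go N h

  ∣V∣≤ : ∀ {q} → q ∈ coefs → ∀ ℓ → ℓ ℕ.≤ m → ∣ V q ℓ ∣ ℕ.≤ ℓ ℕ.* W ℕ.* 2 ^ Y ℓ
  ∣V∣≤ q∈ zero p = z≤n
  ∣V∣≤ {a , k} q∈ (suc ℓ) p = begin
    ∣ v + (D + k ℓ) * pos2 (Y ℓ) ∣              ≤⟨ ∣+∣≤ v ((D + k ℓ) * pos2 (Y ℓ)) (∣V∣≤ q∈ ℓ (ℕP.<⇒≤ p)) (∣*∣≤ (D + k ℓ) (pos2 (Y ℓ)) D+k≤ ℕP.≤-refl) ⟩
    ℓ ℕ.* W ℕ.* 2 ^ Y ℓ ℕ.+ W ℕ.* B ℕ.* 2 ^ Y ℓ ≤⟨ ℕP.+-mono-≤ (ℕP.*-monoʳ-≤ (ℓ ℕ.* W) (ℕP.^-monoʳ-≤ 2 (Y-mono ℓ p))) (ℕP.≤-reflexive (trans (ℕP.*-assoc W B (2 ^ Y ℓ)) (cong (W ℕ.*_) pw))) ⟩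
    ℓ ℕ.* W ℕ.* 2 ^ Y (suc ℓ) ℕ.+ W ℕ.* 2 ^ Y (suc ℓ) ≡⟨ l ℓ W (2 ^ Y (suc ℓ)) ⟩
    suc ℓ ℕ.* W ℕ.* 2 ^ Y (suc ℓ)               ∎
    where
    open ℕP.≤-Reasoning
    v = V (a , k) ℓ
    D = dot n (a ℓ) (d ℓ)
    B = 2 ^ gap ℓ
    l : ∀ x w y → x ℕ.* w ℕ.* y ℕ.+ w ℕ.* y ≡ (1 ℕ.+ x) ℕ.* w ℕ.* y
    l = solveℕ
    pw : B ℕ.* 2 ^ Y ℓ ≡ 2 ^ Y (suc ℓ)
    pw = trans (sym (ℕP.^-distribˡ-+-* 2 (gap ℓ) (Y ℓ))) (cong (2 ^_) (ℕP.m∸n+n≡m (Y-mono ℓ p)))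
    d≤ : ∀ j → ∣ d ℓ j ∣ ℕ.≤ B
    d≤ j = ℤP.drop‿+≤+ (ℤP.≤-trans (≤-cert 1ℤ (+≤+ z≤n) refl) (digit<B ℓ j p))
    D+k≤ : ∣ D + k ℓ ∣ ℕ.≤ W ℕ.* B
    D+k≤ = ℕP.≤-trans (∣+∣≤ D (k ℓ) (∣dot∣≤ n (a ℓ) (d ℓ) A B (λ j _ → proj₁ (coef-bound q∈) ℓ j) (λ j _ → d≤ j)) (proj₂ (coef-bound q∈) ℓ))
      (ℕP.≤-trans (ℕP.+-mono-≤ (ℕP.≤-reflexive (sym (ℕP.*-assoc n A B))) (ℕP.m≤m*n Kb B {{ℕP.m^n≢0 2 (gap ℓ)}})) (ℕP.≤-reflexive (sym (ℕP.*-distribʳ-+ B (n ℕ.* A) Kb))))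

  c≤ : ∀ {q} → q ∈ coefs → ∀ ℓ → ℓ ℕ.≤ m → ∣ fc (mk q) ℓ ∣ ℕ.≤ m ℕ.* W
  c≤ {q} q∈ ℓ p = ℕP.≤-trans (carry≤ (V q ℓ) (Y ℓ) (ℓ ℕ.* W) (∣V∣≤ q∈ ℓ p)) (ℕP.*-monoˡ-≤ W p)

  row-bound : ∀ ℓ → ℓ ℕ.< m → ∀ ρ → ρ ∈ rows ℓ → (∀ j → j ℕ.< suc m → ∣ ra ρ j ∣ ℕ.≤ A) × ∣ rc ρ ∣ ℕ.≤ C × ∣ rc' ρ ∣ ℕ.≤ C
  row-bound ℓ p ρ ρ∈ with ∈-++⁻ (map (familyRow ℓ) fams) ρ∈
  ... | inj₂ h = go n h
    where
    1≤A : 1 ℕ.≤ A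
    1≤A = ℕP.≤-trans (s≤s z≤n) (ℕP.m≤n+m 2 A₀)
    1≤C : 1 ℕ.≤ C
    1≤C = ℕP.m≤n+m 1 (Kb ℕ.+ m ℕ.* W)
    room≤ : ∀ j → ∣ room ℓ j ∣ ℕ.≤ C
    room≤ j with j ℕ.≤ᵇ ℓ
    ... | true = z≤n
    ... | false = 1≤C
    go : ∀ N {ρ} → ρ ∈ digitRows ℓ N → (∀ j → j ℕ.< suc m → ∣ ra ρ j ∣ ℕ.≤ A) × ∣ rc ρ ∣ ℕ.≤ C × ∣ rc' ρ ∣ ℕ.≤ C
    go (suc N) (here refl) = (λ j _ → ℕP.≤-trans (subst (ℕ._≤ 1) (sym (ℤP.∣-i∣≡∣i∣ (δ N j))) (∣δ∣≤1 N j)) 1≤A) , z≤n , z≤n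
    go (suc N) (there (here refl)) = (λ j _ → ℕP.≤-trans (∣δ∣≤1 N j) 1≤A) , room≤ N , room≤ N
    go (suc N) (there (there h)) = go N h
  ... | inj₁ h with ∈-map⁻ (familyRow ℓ) h
  ... | f , f∈ , refl with ∈-map⁻ mk f∈
  ... | q , q∈ , refl = (λ j _ → proj₁ (coef-bound q∈) ℓ j) , ℕP.≤-trans (∣+∣≤ (proj₂ q ℓ) (fc (mk q) ℓ) (proj₂ (coef-bound q∈) ℓ) (c≤ q∈ ℓ (ℕP.<⇒≤ p))) (ℕP.m≤m+n (Kb ℕ.+ m ℕ.* W) 1)
      , ℕP.≤-trans (c≤ q∈ (suc ℓ) p) (ℕP.≤-trans (ℕP.m≤n+m (m ℕ.* W) Kb) (ℕP.m≤m+n (Kb ℕ.+ m ℕ.* W) 1))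

  -- The given solution forces `fc f m + κ f m ≤ 0` by minimality of the last carry. In any other
  -- state the rows telescope to bound the term by this number times `2 ^ Y' m`.
  solves : ∀ {Y' d'} → State Y' d' → ∀ {τ} → τ ∈ ts → evalTerm (λ x → Y' (idx x)) τ ≤ 0ℤ
  solves {Y'} {d'} st {τ@(leterm ms e)} τ∈ = subst (_≤ 0ℤ) (trans (partial-total m f d' Y') (Evaluate.term-eval m big lo fams idx idx≤ st ms e))
      (ℤP.≤-trans (ℤP.+-monoˡ-≤ (κ f m * pos2 (Y' m)) (Upto.partial≤ st f f∈ (ℤP.≤-reflexive (sym (carry-zero q))) m ℕP.≤-refl))
        (subst₂ _≤_ (ℤP.*-distribʳ-+ (pos2 (Y' m)) (fc f m) (κ f m)) (ℤP.*-zeroˡ (pos2 (Y' m))) (*-monoʳ-≤-pos2 (Y' m) final)))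
    where
    q = termCoef τ
    f = mk q
    f∈ : f ∈ fams
    f∈ = ∈-map⁺ mk (∈-++⁺ˡ (∈-map⁺ termCoef τ∈))
    init≤ : partial n f d Y m + κ f m * pos2 (Y m) ≤ 0ℤ
    init≤ = subst (_≤ 0ℤ) (sym (trans (partial-total m f d Y) (Evaluate.term-eval m big lo fams idx idx≤ initial ms e))) (holds τ∈)
    cm : fc f m ≤ - κ f m
    cm = proj₂ (proj₂ (carry (V q m) (Y m))) (- κ f m) (≤-cert (0ℤ - (partial n f d Y m + κ f m * pos2 (Y m))) (≤⇒0≤ init≤) (trans (l₁ (partial n f d Y m) (κ f m) (pos2 (Y m))) (cong (λ v → v + (0ℤ - (partial n f d Y m + κ f m * pos2 (Y m)))) (partial-irrelevant n (fa f) (κ f) (fc f) (λ _ → 0ℤ) d Y m))))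
      where
      l₁ : ∀ v k p → - k * p ≡ v + (0ℤ - (v + k * p))
      l₁ = solve-∀
    final : fc f m + κ f m ≤ 0ℤ
    final = subst (fc f m + κ f m ≤_) (ℤP.+-inverseˡ (κ f m)) (ℤP.+-monoˡ-≤ (κ f m) cm)

-- Straight-line programs

nth-< : ∀ {A : Set} (xs : List A) i {x} → nth xs i ≡ just x → i ℕ.< length xs
nth-< (y ∷ xs) zero    e = s≤s z≤n
nth-< (y ∷ xs) (suc i) e = s≤s (nth-< xs i e)

nth-++ˡ : ∀ {A : Set} (xs ys : List A) i {x} → nth xs i ≡ just x → nth (xs ++ ys) i ≡ just x
nth-++ˡ (y ∷ xs) ys zero    e = e
nth-++ˡ (y ∷ xs) ys (suc i) e = nth-++ˡ xs ys i e

nth-++ʳ : ∀ {A : Set} (xs ys : List A) i → nth (xs ++ ys) (length xs ℕ.+ i) ≡ nth ys i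
nth-++ʳ []       ys i = refl
nth-++ʳ (x ∷ xs) ys i = nth-++ʳ xs ys i

nth-last : ∀ {A : Set} (xs : List A) x → nth (xs ++ [ x ]) (length xs) ≡ just x
nth-last []       x = refl
nth-last (y ∷ xs) x = nth-last xs x

runI-++ : ∀ vs ρs ρs' {vs'} → runI vs ρs ≡ just vs' → runI vs (ρs ++ ρs') ≡ runI vs' ρs'
runI-++ vs [] ρs' refl = refl
runI-++ vs (ρ ∷ ρs) ρs' e with stepI vs ρ
... | just v = runI-++ (vs ++ [ v ]) ρs ρs' e

runI-extends : ∀ vs ρs {vs'} → runI vs ρs ≡ just vs' → ∃ λ ws → vs' ≡ vs ++ ws × length ws ≡ length ρs
runI-extends vs [] refl = [] , sym (ListP.++-identityʳ vs) , refl
runI-extends vs (ρ ∷ ρs) e with stepI vs ρ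
... | just v with runI-extends (vs ++ [ v ]) ρs e
... | ws , refl , e' = v ∷ ws , ListP.++-assoc vs [ v ] ws , cong suc e'

runI-length : ∀ vs ρs {vs'} → runI vs ρs ≡ just vs' → length vs' ≡ length vs ℕ.+ length ρs
runI-length vs ρs e with runI-extends vs ρs e
... | ws , refl , l = trans (ListP.length-++ vs) (cong (length vs ℕ.+_) l)

runI-one : ∀ vs ρ {v} → stepI vs ρ ≡ just v → runI vs (ρ ∷ []) ≡ just (vs ++ [ v ])
runI-one vs ρ e with stepI vs ρ
runI-one vs ρ refl | just v = refl

-- An index written in unary costs as much as its position. The cost of an instruction is therefore
-- measured by the final length, while `b` covers the coefficients.
record Reach (b : ℕ) (vs : List ℤ) (K : ℕ) (vs' : List ℤ) : Set where
  field
    prog   : List RHS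
    runs   : runI vs prog ≡ just vs'
    short  : length prog ℕ.≤ K
    costs  : All (λ ρ → rhsSize ρ ℕ.≤ b ℕ.+ 2 ℕ.* length vs' ℕ.+ 3) prog

  keeps : ∀ i {v} → nth vs i ≡ just v → nth vs' i ≡ just v
  keeps i e with runI-extends vs prog runs
  ... | ws , refl , _ = nth-++ˡ vs ws i e

reach-refl : ∀ {b vs} → Reach b vs 0 vs
reach-refl = record { prog = [] ; runs = refl ; short = z≤n ; costs = [] }

reach-trans : ∀ {b vs K vs₁ K' vs₂} → Reach b vs K vs₁ → Reach b vs₁ K' vs₂ → Reach b vs (K ℕ.+ K') vs₂
reach-trans {b} {vs} {K} {vs₁} {K'} {vs₂} r r' = record
  { prog = R.prog ++ R'.prog
  ; runs = trans (runI-++ vs R.prog R'.prog R.runs) R'.runs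
  ; short = ℕP.≤-trans (ℕP.≤-reflexive (ListP.length-++ R.prog)) (ℕP.+-mono-≤ R.short R'.short)
  ; costs = AllP.++⁺ (All.map (λ h → ℕP.≤-trans h (ℕP.+-monoˡ-≤ 3 (ℕP.+-monoʳ-≤ b (ℕP.*-monoʳ-≤ 2 len)))) R.costs) R'.costs }
  where
  module R = Reach r
  module R' = Reach r'
  len : length vs₁ ℕ.≤ length vs₂
  len = ℕP.≤-trans (ℕP.m≤m+n (length vs₁) (length R'.prog)) (ℕP.≤-reflexive (sym (runI-length vs₁ R'.prog R'.runs)))

reach-weaken : ∀ {b vs K K' vs'} → K ℕ.≤ K' → Reach b vs K vs' → Reach b vs K' vs'
reach-weaken p r = record { prog = R.prog ; runs = R.runs ; short = ℕP.≤-trans R.short p ; costs = R.costs }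
  where module R = Reach r

record Gets (b : ℕ) (vs : List ℤ) (K : ℕ) (v : ℤ) : Set where
  constructor gets
  field
    vs'   : List ℤ
    reach : Reach b vs K vs'
    pos   : ℕ
    at    : nth vs' pos ≡ just v

one : ∀ {b} vs ρ {v} → stepI vs ρ ≡ just v → rhsSize ρ ℕ.≤ b ℕ.+ 2 ℕ.* length vs ℕ.+ 3 → Gets b vs 1 v
one {b} vs ρ {v} e h = gets (vs ++ [ v ]) (record { prog = ρ ∷ [] ; runs = runI-one vs ρ e ; short = ℕP.≤-refl ; costs = ℕP.≤-trans h (ℕP.+-monoˡ-≤ 3 (ℕP.+-monoʳ-≤ b (ℕP.*-monoʳ-≤ 2 (ℕP.≤-trans (ℕP.m≤m+n (length vs) 1) (ℕP.≤-reflexive (sym (ListP.length-++ vs))))))) ∷ [] }) (length vs) (nth-last vs v)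

get-zero : ∀ {b} vs → Gets b vs 1 0ℤ
get-zero {b} vs = one vs zeroR refl (ℕP.≤-trans (s≤s z≤n) (ℕP.m≤n+m 3 (b ℕ.+ 2 ℕ.* length vs)))

get-add : ∀ {b} vs i j {x y} → nth vs i ≡ just x → nth vs j ≡ just y → Gets b vs 1 (x + y)
get-add {b} vs i j {x} {y} ei ej = one vs (addR i j) step (ℕP.≤-trans (ℕP.+-mono-≤ (ℕP.+-mono-≤ (nth-< vs i ei) (nth-< vs j ej)) (s≤s z≤n)) (ℕP.≤-trans (ℕP.m≤n+m _ b) (ℕP.≤-reflexive (l b (length vs)))))
  where
  l : ∀ b n → b ℕ.+ (n ℕ.+ n ℕ.+ 3) ≡ b ℕ.+ 2 ℕ.* n ℕ.+ 3
  l = solveℕ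
  step : stepI vs (addR i j) ≡ just (x + y)
  step rewrite ei | ej = refl

get-pow : ∀ {b} vs i {k} → nth vs i ≡ just (+ k) → Gets b vs 1 (pos2 k)
get-pow {b} vs i {k} e = one vs (powR i) step (ℕP.≤-trans (ℕP.+-mono-≤ (nth-< vs i e) (s≤s (s≤s z≤n))) (ℕP.≤-trans (ℕP.m≤n+m _ (b ℕ.+ length vs)) (ℕP.≤-reflexive (l b (length vs)))))
  where
  l : ∀ b n → b ℕ.+ n ℕ.+ (n ℕ.+ 3) ≡ b ℕ.+ 2 ℕ.* n ℕ.+ 3
  l = solveℕ
  step : stepI vs (powR i) ≡ just (pos2 k)
  step rewrite e = refl

get-scale : ∀ {b} vs m d i {a q} → nth vs i ≡ just a → + suc d * q ≡ m * a → zsize m ℕ.+ nsize (suc d) ℕ.≤ b → Gets b vs 1 q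
get-scale {b} vs m d i {a} {q} e eq h = one vs (scaleR m d i) step (ℕP.≤-trans (ℕP.+-mono-≤ (ℕP.+-mono-≤ h (nth-< vs i e)) (s≤s (s≤s z≤n))) (ℕP.≤-trans (ℕP.m≤n+m _ (length vs)) (ℕP.≤-reflexive (l b (length vs)))))
  where
  l : ∀ b n → n ℕ.+ (b ℕ.+ n ℕ.+ 3) ≡ b ℕ.+ 2 ℕ.* n ℕ.+ 3
  l = solveℕ
  q' = (m * a) div (+ suc d)
  q'≡ : q' ≡ q
  q'≡ = trans (div-pos-is-/ℕ (m * a) (suc d)) (*-cancelˡ-pos d (trans (exact-/ℕ (m * a) d (divides q (trans (sym eq) (ℤP.*-comm (+ suc d) q)))) (sym eq)))
  test : does (+ suc d * q' ℤ.≟ m * a) ≡ true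
  test = dec-true (+ suc d * q' ℤ.≟ m * a) (trans (cong (+ suc d *_) q'≡) eq)
  step : stepI vs (scaleR m d i) ≡ just q
  step rewrite e = trans (cong (λ t → if t then just q' else nothing) test) (cong just q'≡)

-- The division by the denominator comes after the addition: `A * x` and `B * y` need not be
-- divisible separately, and every intermediate value has to be an integer.
get-term : ∀ {b} vs A B gp e e' c {x y total₀ t} → nth vs e ≡ just x → nth vs e' ≡ just y → nth vs c ≡ just total₀ → + suc gp * t ≡ A * x + B * y →
           zsize A ℕ.+ 1 ℕ.≤ b → zsize B ℕ.+ 1 ℕ.≤ b → 2 ℕ.+ nsize (suc gp) ℕ.≤ b → Gets b vs 5 (total₀ + t)
get-term {b} vs A B gp e e' c {x} {y} {total₀} {t} ex ey ec eq hA hB hg = gets G₅.vs' (reach-trans (reach-trans (reach-trans (reach-trans G₁.reach G₂.reach) G₃.reach) G₄.reach) G₅.reach) G₅.pos G₅.at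
  where
  module G₁ = Gets (get-scale {b} vs A 0 e {x} {A * x} ex (ℤP.*-identityˡ (A * x)) hA)
  k₁ = Reach.keeps G₁.reach
  module G₂ = Gets (get-scale {b} G₁.vs' B 0 e' {y} {B * y} (k₁ e' ey) (ℤP.*-identityˡ (B * y)) hB)
  k₂ = Reach.keeps G₂.reach
  module G₃ = Gets (get-add {b} G₂.vs' G₁.pos G₂.pos (k₂ G₁.pos G₁.at) G₂.at)
  k₃ = Reach.keeps G₃.reach
  module G₄ = Gets (get-scale {b} G₃.vs' 1ℤ gp G₃.pos {A * x + B * y} {t} G₃.at (trans eq (sym (ℤP.*-identityˡ (A * x + B * y)))) hg)
  k₄ = Reach.keeps G₄.reach
  module G₅ = Gets (get-add {b} G₄.vs' c G₄.pos (k₄ c (k₃ c (k₂ c (k₁ c ec)))) G₄.at)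

record Normal (m b : ℕ) (Y : ℕ → ℕ) : Set where
  field
    Y-zero  : Y 0 ≡ 0
    d       : ℕ → ℕ → ℤ
    sch     : ℕ → Scheme
    Y-mono  : ∀ ℓ → ℓ ℕ.< m → Y ℓ ℕ.≤ Y (suc ℓ)
    Y-res   : ∀ ℓ → ℓ ℕ.< m → + Y (suc ℓ) ≡ res d Y (suc ℓ) (suc ℓ)
    follows : ∀ ℓ → ℓ ℕ.< m → Follows (suc m) (sch ℓ) (pos2 (Y (suc ℓ) ∸ Y ℓ)) (d ℓ)
    α-next  : ∀ ℓ → ℓ ℕ.< m → α (sch ℓ) (suc ℓ) ≡ 0ℤ
    α-size  : ∀ ℓ j → ℓ ℕ.< m → j ℕ.< suc m → zsize (α (sch ℓ) j) ℕ.+ 1 ℕ.≤ b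
    β-size  : ∀ ℓ j → ℓ ℕ.< m → j ℕ.< suc m → zsize (β (sch ℓ) j) ℕ.+ 1 ℕ.≤ b
    g-size  : ∀ ℓ → ℓ ℕ.< m → 2 ℕ.+ nsize (g (sch ℓ)) ℕ.≤ b

module Build (m b : ℕ) (Y : ℕ → ℕ) (N : Normal m b Y) (4≤b : 4 ℕ.≤ b) where
  open Normal N

  Known : List ℤ → ℕ → Set
  Known vs j = ∀ i → i ℕ.≤ j → (∃ λ p → nth vs p ≡ just (+ Y i)) × (∃ λ p → nth vs p ≡ just (pos2 (Y i)))

  known-keeps : ∀ {vs K vs' j} → Reach b vs K vs' → Known vs j → Known vs' j
  known-keeps r k i p = (proj₁ (proj₁ (k i p)) , Reach.keeps r _ (proj₂ (proj₁ (k i p)))) , (proj₁ (proj₂ (k i p)) , Reach.keeps r _ (proj₂ (proj₂ (k i p))))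

  digit-value : ∀ ℓ j → ℓ ℕ.< m → j ℕ.< suc m → + g (sch ℓ) * (d ℓ j * pos2 (Y ℓ)) ≡ α (sch ℓ) j * pos2 (Y (suc ℓ)) + β (sch ℓ) j * pos2 (Y ℓ)
  digit-value ℓ j p q = contribution (suc m) (sch ℓ) j (Y ℓ) (Y (suc ℓ)) (d ℓ) q (follows ℓ p) (Y-mono ℓ p)

  residue : ∀ vs i → suc i ℕ.≤ m → Known vs i → ∀ ℓ → ℓ ℕ.≤ suc i → Gets b vs (1 ℕ.+ ℓ ℕ.* 5) (res d Y ℓ (suc i))
  residue vs i i<m k zero p = get-zero vs
  residue vs i i<m k (suc ℓ) p = gets T.vs' (reach-weaken (ℕP.≤-reflexive (l ℓ)) (reach-trans G.reach T.reach)) T.pos T.at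
    where
    l : ∀ ℓ → 1 ℕ.+ ℓ ℕ.* 5 ℕ.+ 5 ≡ 1 ℕ.+ (5 ℕ.+ ℓ ℕ.* 5)
    l = solveℕ
    ℓ<m : ℓ ℕ.< m
    ℓ<m = ℕP.<-≤-trans p i<m
    module G = Gets (residue vs i i<m k ℓ (ℕP.<⇒≤ p))
    K = known-keeps G.reach k
    s = sch ℓ
    j = suc i
    upper : ∃ λ e → ∃ λ x → nth G.vs' e ≡ just x × + g s * (d ℓ j * pos2 (Y ℓ)) ≡ α s j * x + β s j * pos2 (Y ℓ)
    upper = Data.Sum.[ top , below ]′ (<suc-cases p)
      where
      below : ℓ ℕ.< i → _
      below q = _ , pos2 (Y (suc ℓ)) , proj₂ (proj₂ (K (suc ℓ) q)) , digit-value ℓ j ℓ<m (s≤s i<m)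
      top : ℓ ≡ i → _
      top refl = _ , pos2 (Y ℓ) , proj₂ (proj₂ (K ℓ ℕP.≤-refl)) , trans (digit-value ℓ j ℓ<m (s≤s i<m)) (cong (_+ β s j * pos2 (Y ℓ)) (trans (cong (_* pos2 (Y (suc ℓ))) (α-next ℓ ℓ<m)) (trans (trans (ℤP.*-zeroˡ (pos2 (Y (suc ℓ)))) (sym (ℤP.*-zeroˡ (pos2 (Y ℓ))))) (cong (_* pos2 (Y ℓ)) (sym (α-next ℓ ℓ<m))))))
    module T = Gets (get-term {b} G.vs' (α s j) (β s j) (gp s) (proj₁ upper) (proj₁ (proj₂ (K ℓ (ℕP.≤-pred p)))) G.pos
                 (proj₁ (proj₂ (proj₂ upper))) (proj₂ (proj₂ (K ℓ (ℕP.≤-pred p)))) G.at (proj₂ (proj₂ (proj₂ upper))) (α-size ℓ j ℓ<m (s≤s i<m)) (β-size ℓ j ℓ<m (s≤s i<m)) (g-size ℓ ℓ<m))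

  stepsFor : ℕ
  stepsFor = 2 ℕ.+ m ℕ.* 5

  known-all : ∀ j → j ℕ.≤ m → Σ (List ℤ) λ vs → Reach b [] (2 ℕ.+ j ℕ.* stepsFor) vs × Known vs j
  known-all zero _ = E.vs' , reach-weaken ℕP.≤-refl (reach-trans Z.reach E.reach) , known
    where
    module Z = Gets (get-zero {b} [])
    Y0 : nth Z.vs' Z.pos ≡ just (+ Y 0)
    Y0 = trans Z.at (cong (λ y → just (+ y)) (sym Y-zero))
    module E = Gets (get-pow {b} Z.vs' Z.pos Y0)
    known : Known E.vs' 0
    known zero z≤n = (Z.pos , Reach.keeps E.reach Z.pos Y0) , (E.pos , E.at)
  known-all (suc i) p with known-all i (ℕP.<⇒≤ p)
  ... | vs , r , k = E.vs' , reach-weaken count (reach-trans r (reach-trans G.reach E.reach)) , known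
    where
    module G = Gets (residue vs i p k (suc i) ℕP.≤-refl)
    Yv : nth G.vs' G.pos ≡ just (+ Y (suc i))
    Yv = trans G.at (cong just (sym (Y-res i p)))
    module E = Gets (get-pow {b} G.vs' G.pos Yv)
    l : ∀ i s → 2 ℕ.+ i ℕ.* s ℕ.+ s ≡ 2 ℕ.+ (s ℕ.+ i ℕ.* s)
    l = solveℕ
    l' : ∀ x → 1 ℕ.+ x ℕ.+ 1 ≡ 2 ℕ.+ x
    l' = solveℕ
    count : 2 ℕ.+ i ℕ.* stepsFor ℕ.+ (1 ℕ.+ suc i ℕ.* 5 ℕ.+ 1) ℕ.≤ 2 ℕ.+ suc i ℕ.* stepsFor
    count = ℕP.≤-trans (ℕP.+-monoʳ-≤ (2 ℕ.+ i ℕ.* stepsFor) (ℕP.≤-trans (ℕP.≤-reflexive (l' (suc i ℕ.* 5))) (ℕP.+-monoʳ-≤ 2 (ℕP.*-monoˡ-≤ 5 p)))) (ℕP.≤-reflexive (l i stepsFor))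
    known : Known E.vs' (suc i)
    known j q = Data.Sum.[ (λ { refl → (G.pos , Reach.keeps E.reach G.pos Yv) , (E.pos , E.at) }) , (λ h → known-keeps E.reach (known-keeps G.reach k) j (ℕP.≤-pred h)) ]′ (<suc-cases (s≤s q))

  -- The values are copied to a contiguous block at the end, so that the program is named by a list
  -- of fresh names followed by the variables in sorted order.
  outputs : ℕ → List ℤ
  outputs zero    = []
  outputs (suc c) = outputs c ++ [ + Y (suc c) ]

  length-outputs : ∀ c → length (outputs c) ≡ c
  length-outputs zero = refl
  length-outputs (suc c) = trans (ListP.length-++ (outputs c)) (trans (cong (ℕ._+ 1) (length-outputs c)) (ℕP.+-comm c 1))

  nth-outputs : ∀ c i → i ℕ.< c → nth (outputs c) i ≡ just (+ Y (suc i))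
  nth-outputs (suc c) i p = Data.Sum.[ (λ { refl → trans (cong (nth (outputs (suc c))) (sym (length-outputs c))) (nth-last (outputs c) (+ Y (suc c))) }) , (λ q → nth-++ˡ (outputs c) [ + Y (suc c) ] i (nth-outputs c i q)) ]′ (<suc-cases p)

  copies : ∀ vs → Known vs m → ∀ c → c ℕ.≤ m → Reach b vs c (vs ++ outputs c)
  copies vs k zero p = subst (Reach b vs 0) (sym (ListP.++-identityʳ vs)) reach-refl
  copies vs k (suc c) p = subst₂ (Reach b vs) (ℕP.+-comm c 1) (trans vs'≡ (ListP.++-assoc vs (outputs c) [ + Y (suc c) ])) (reach-trans r G.reach)
    where
    r = copies vs k c (ℕP.<⇒≤ p)
    here' = proj₁ (known-keeps r k (suc c) p)
    module G = Gets (get-scale {b} (vs ++ outputs c) 1ℤ 0 (proj₁ here') {+ Y (suc c)} {+ Y (suc c)} (proj₂ here') refl (ℕP.≤-trans (s≤s (s≤s (s≤s z≤n))) 4≤b))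
    vs'≡ : G.vs' ≡ (vs ++ outputs c) ++ [ + Y (suc c) ]
    vs'≡ = refl

  final : Σ (List ℤ) λ vs → Reach b [] (2 ℕ.+ m ℕ.* stepsFor ℕ.+ m) (vs ++ outputs m)
  final with known-all m ℕP.≤-refl
  ... | vs , r , k = vs , reach-trans r (copies vs k m ℕP.≤-refl)

map-proj₁-zip : ∀ {A B : Set} (xs : List A) (ys : List B) → length xs ≡ length ys → map proj₁ (zip xs ys) ≡ xs
map-proj₁-zip [] [] _ = refl
map-proj₁-zip (x ∷ xs) (y ∷ ys) e = cong (x ∷_) (map-proj₁-zip xs ys (ℕP.suc-injective e))

map-proj₂-zip : ∀ {A B : Set} (xs : List A) (ys : List B) → length xs ≡ length ys → map proj₂ (zip xs ys) ≡ ys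
map-proj₂-zip [] [] _ = refl
map-proj₂-zip (x ∷ xs) (y ∷ ys) e = cong (y ∷_) (map-proj₂-zip xs ys (ℕP.suc-injective e))

leslpSize-zip : ∀ xs ρs c → length xs ≡ length ρs → All (λ ρ → rhsSize ρ ℕ.≤ c) ρs → leslpSize (zip xs ρs) ℕ.≤ length ρs ℕ.* (2 ℕ.+ c)
leslpSize-zip [] [] c _ _ = z≤n
leslpSize-zip (x ∷ xs) (ρ ∷ ρs) c e (h ∷ hs) = ℕP.+-mono-≤ (ℕP.+-monoʳ-≤ 2 h) (leslpSize-zip xs ρs c (ℕP.suc-injective e) hs)

-- A number above every element, which provides the fresh names here and the fresh objective
-- variable in `Objective`.
sum-bound : List ℕ → ℕ
sum-bound []       = 0
sum-bound (x ∷ xs) = suc x ℕ.+ sum-bound xs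

<sum-bound : ∀ {xs x} → x ∈ xs → x ℕ.< sum-bound xs
<sum-bound {y ∷ ys} (here refl) = ℕP.m≤m+n (suc y) (sum-bound ys)
<sum-bound {y ∷ ys} (there h) = ℕP.<-≤-trans (<sum-bound h) (ℕP.m≤n+m (sum-bound ys) (suc y))

normal⇒leslp : ∀ m b Y → Normal m b Y → 4 ℕ.≤ b → (L : List Var) → Unique L → length L ≡ m →
  let k = 2 ℕ.+ m ℕ.* (2 ℕ.+ m ℕ.* 5) ℕ.+ m in
  Σ LESLP λ σ → Σ (List ℤ) λ vs → ILESLPWith σ vs × leslpSize σ ℕ.≤ k ℕ.* (2 ℕ.+ (b ℕ.+ 2 ℕ.* k ℕ.+ 3)) ×
    (∀ i x → nth L i ≡ just x → Σ ℕ λ p → nth (names σ) p ≡ just x × nth vs p ≡ just (+ Y (suc i)))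
normal⇒leslp m b Y N 4≤b L uniq len = σ , vs ++ outputs m , (subst Unique (sym names≡) uniqNames , trans (cong (runI []) (map-proj₂-zip nms R.prog lens)) R.runs) , size , rep
  where
  open Build m b Y N 4≤b
  vs = proj₁ final
  module R = Reach (proj₂ final)
  k = 2 ℕ.+ m ℕ.* (2 ℕ.+ m ℕ.* 5) ℕ.+ m
  F = sum-bound L
  nms : List Var
  nms = map (F ℕ.+_) (upTo (length vs)) ++ L
  σ : LESLP
  σ = zip nms R.prog
  total-length : length (vs ++ outputs m) ≡ length R.prog
  total-length = runI-length [] R.prog R.runs
  length-fresh : length (map (F ℕ.+_) (upTo (length vs))) ≡ length vs
  length-fresh = trans (ListP.length-map (F ℕ.+_) (upTo (length vs))) (ListP.length-upTo (length vs))
  lens : length nms ≡ length R.prog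
  lens = trans (ListP.length-++ (map (F ℕ.+_) (upTo (length vs)))) (trans (cong₂ ℕ._+_ length-fresh (trans len (sym (length-outputs m)))) (trans (sym (ListP.length-++ vs)) total-length))
  names≡ : names σ ≡ nms
  names≡ = map-proj₁-zip nms R.prog lens
  uniqNames : Unique nms
  uniqNames = UniqueP.++⁺ (UniqueP.map⁺ (λ {x} {y} e → ℕP.+-cancelˡ-≡ F x y e) (UniqueP.upTo⁺ (length vs))) uniq disjoint
    where
    disjoint : ∀ {x} → ¬ (x ∈ map (F ℕ.+_) (upTo (length vs)) × x ∈ L)
    disjoint (x∈ , x∈L) with ∈-map⁻ (F ℕ.+_) x∈
    ... | y , _ , refl = ℕP.<⇒≱ (<sum-bound x∈L) (ℕP.m≤m+n F y)
  size : leslpSize σ ℕ.≤ k ℕ.* (2 ℕ.+ (b ℕ.+ 2 ℕ.* k ℕ.+ 3))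
  size = ℕP.≤-trans (leslpSize-zip nms R.prog (b ℕ.+ 2 ℕ.* k ℕ.+ 3) lens (All.map (λ h → ℕP.≤-trans h (ℕP.+-monoˡ-≤ 3 (ℕP.+-monoʳ-≤ b (ℕP.*-monoʳ-≤ 2 (ℕP.≤-trans (ℕP.≤-reflexive total-length) R.short))))) R.costs)) (ℕP.*-monoˡ-≤ (2 ℕ.+ (b ℕ.+ 2 ℕ.* k ℕ.+ 3)) R.short)
  rep : ∀ i x → nth L i ≡ just x → Σ ℕ λ p → nth (names σ) p ≡ just x × nth (vs ++ outputs m) p ≡ just (+ Y (suc i))
  rep i x e = length vs ℕ.+ i , trans (cong (λ l → nth l (length vs ℕ.+ i)) names≡) (trans (cong (λ c → nth nms (c ℕ.+ i)) (sym length-fresh)) (trans (nth-++ʳ (map (F ℕ.+_) (upTo (length vs))) L i) e))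
    , trans (nth-++ʳ vs (outputs m) i) (nth-outputs m i (subst (i ℕ.<_) len (nth-< L i e)))

-- Variables and sizes

module _ (ν : Var → ℕ) where
  insert : Var → List Var → List Var
  insert x []       = x ∷ []
  insert x (y ∷ ys) with ν x ℕ.≤? ν y
  ... | yes _ = x ∷ y ∷ ys
  ... | no _  = y ∷ insert x ys

  All-insert : ∀ {P : Var → Set} x ys → P x → All P ys → All P (insert x ys)
  All-insert x []       p []       = p ∷ []
  All-insert x (y ∷ ys) p (q ∷ qs) with ν x ℕ.≤? ν y
  ... | yes _ = p ∷ q ∷ qs
  ... | no _  = q ∷ All-insert x ys p qs

  ∈-insert : ∀ x ys → x ∈ insert x ys × (∀ {z} → z ∈ ys → z ∈ insert x ys)
  ∈-insert x []       = here refl , λ ()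
  ∈-insert x (y ∷ ys) with ν x ℕ.≤? ν y
  ... | yes _ = here refl , there
  ... | no _  = there (proj₁ (∈-insert x ys)) , λ { (here e) → here e ; (there h) → there (proj₂ (∈-insert x ys) h) }

  length-insert : ∀ x ys → length (insert x ys) ≡ suc (length ys)
  length-insert x []       = refl
  length-insert x (y ∷ ys) with ν x ℕ.≤? ν y
  ... | yes _ = refl
  ... | no _  = cong suc (length-insert x ys)

  unique-insert : ∀ x ys → ¬ (x ∈ ys) → Unique ys → Unique (insert x ys)
  unique-insert x []       _ [] = [] ∷ []
  unique-insert x (y ∷ ys) x∉ (q ∷ qs) with ν x ℕ.≤? ν y
  ... | yes _ = All.tabulate (λ {z} z∈ e → x∉ (subst (_∈ (y ∷ ys)) (sym e) z∈)) ∷ q ∷ qs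
  ... | no _  = All-insert x ys (λ e → x∉ (here (sym e))) q ∷ unique-insert x ys (λ h → x∉ (there h)) qs

  Sorted : List Var → Set
  Sorted = AllPairs (λ a b → ν a ℕ.≤ ν b)

  sorted-insert : ∀ x ys → Sorted ys → Sorted (insert x ys)
  sorted-insert x []       [] = [] ∷ []
  sorted-insert x (y ∷ ys) (q ∷ qs) with ν x ℕ.≤? ν y
  ... | yes p = (p ∷ All.map (ℕP.≤-trans p) q) ∷ q ∷ qs
  ... | no ¬p = All-insert x ys (ℕP.≰⇒≥ ¬p) q ∷ sorted-insert x ys qs

  record SortedVersion (xs : List Var) : Set where
    field
      L       : List Var
      unique  : Unique L
      sorted  : Sorted L
      covers  : ∀ {x} → x ∈ xs → x ∈ L
      shorter : length L ℕ.≤ length xs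

  sort : ∀ xs → SortedVersion xs
  sort [] = record { L = [] ; unique = [] ; sorted = [] ; covers = λ () ; shorter = z≤n }
  sort (x ∷ xs) = go (x ∈? S.L)
    where
    module S = SortedVersion (sort xs)
    go : Dec (x ∈ S.L) → SortedVersion (x ∷ xs)
    go (yes x∈) = record { L = S.L ; unique = S.unique ; sorted = S.sorted ; covers = λ { (here refl) → x∈ ; (there h) → S.covers h } ; shorter = ℕP.m≤n⇒m≤1+n S.shorter }
    go (no x∉) = record { L = insert x S.L ; unique = unique-insert x S.L x∉ S.unique ; sorted = sorted-insert x S.L S.sorted
      ; covers = λ { (here refl) → proj₁ (∈-insert x S.L) ; (there h) → proj₂ (∈-insert x S.L) (S.covers h) }
      ; shorter = ℕP.≤-trans (ℕP.≤-reflexive (length-insert x S.L)) (s≤s S.shorter) }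

  value : Maybe Var → ℕ
  value (just x) = ν x
  value nothing  = 0

  -- Position 0 carries the value 0; variable number i of L sits at position i + 1.
  sortedValue : List Var → ℕ → ℕ
  sortedValue L zero    = 0
  sortedValue L (suc i) = value (nth L i)

  sortedValue-mono : ∀ L → Sorted L → ∀ ℓ → ℓ ℕ.< length L → sortedValue L ℓ ℕ.≤ sortedValue L (suc ℓ)
  sortedValue-mono L s zero p = z≤n
  sortedValue-mono L s (suc i) p = go L s i p
    where
    go : ∀ L → Sorted L → ∀ i → suc i ℕ.< length L → value (nth L i) ℕ.≤ value (nth L (suc i))
    go (x ∷ y ∷ L) ((q ∷ _) ∷ _) zero p = q
    go (x ∷ L) (_ ∷ s) (suc i) (s≤s p) = go L s i p

-- Positions start at 1 because 0 belongs to the constant 0; a variable that does not occur is sent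
-- there as well.
position : Var → List Var → ℕ
position x []       = 0
position x (y ∷ ys) with x ℕ.≟ y | position x ys
... | yes _ | _     = 1
... | no _  | zero  = 0
... | no _  | suc k = suc (suc k)

position≤ : ∀ x L → position x L ℕ.≤ length L
position≤ x []       = z≤n
position≤ x (y ∷ ys) with x ℕ.≟ y | position x ys | position≤ x ys
... | yes _ | _     | _ = s≤s z≤n
... | no _  | zero  | _ = z≤n
... | no _  | suc k | h = s≤s h

position-nth : ∀ x L → x ∈ L → ∃ λ i → position x L ≡ suc i × nth L i ≡ just x
position-nth x (y ∷ ys) h with x ℕ.≟ y | position x ys | position-nth x ys
... | yes refl | _ | _ = 0 , refl , refl
position-nth x (y ∷ ys) (here e) | no ne | _ | _ = ⊥-elim (ne e)
position-nth x (y ∷ ys) (there h) | no ne | k | ih with ih h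
... | i , refl , e = suc i , refl , e

evalTerm-cong : ∀ {μ μ'} ms e → (∀ {x} → x ∈ termVars (leterm ms e) → μ x ≡ μ' x) → evalTerm μ (leterm ms e) ≡ evalTerm μ' (leterm ms e)
evalTerm-cong [] e h = refl
evalTerm-cong {μ} {μ'} ((c , a) ∷ ms) e h = cong₂ (λ x y → c * x + y) (atom a (λ x∈ → h (∈-++⁺ˡ x∈))) (evalTerm-cong ms e (λ x∈ → h (∈-++⁺ʳ (atomVars a) x∈)))
  where
  atom : ∀ a → (∀ {x} → x ∈ atomVars a → μ x ≡ μ' x) → evalAtom μ a ≡ evalAtom μ' a
  atom (lin x) h = cong +_ (h (here refl))
  atom (pow2 x) h = cong (λ v → + (2 ^ v)) (h (here refl))
  atom (modp x y) h = cong₂ (λ v w → + (ℕ._%_ v (2 ^ w) {{ℕP.m^n≢0 2 w}})) (h (here refl)) (h (there (here refl)))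

SatC-cong : ∀ {μ μ'} c → (∀ {x} → x ∈ termVars (constrTerm c) → μ x ≡ μ' x) → SatC μ c → SatC μ' c
SatC-cong (eq0 (leterm ms e)) h s = trans (sym (evalTerm-cong ms e h)) s
SatC-cong (le0 (leterm ms e)) h s = subst (_≤ 0ℤ) (evalTerm-cong ms e h) s

Sat-cong : ∀ {μ μ'} φ → (∀ {x} → x ∈ progVars φ → μ x ≡ μ' x) → Sat μ φ → Sat μ' φ
Sat-cong [] h s = s
Sat-cong (c ∷ φ) h (s , ss) = SatC-cong c (λ x∈ → h (∈-++⁺ˡ x∈)) s , Sat-cong φ (λ x∈ → h (∈-++⁺ʳ (termVars (constrTerm c)) x∈)) ss

-- Equations as pairs of inequalities

negMonos : List (ℤ × Atom) → List (ℤ × Atom)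
negMonos []             = []
negMonos ((c , a) ∷ ms) = (- c , a) ∷ negMonos ms

negTerm : LETerm → LETerm
negTerm (leterm ms e) = leterm (negMonos ms) (- e)

negTerm-eval : ∀ μ τ → evalTerm μ (negTerm τ) ≡ - evalTerm μ τ
negTerm-eval μ (leterm [] e) = refl
negTerm-eval μ (leterm ((c , a) ∷ ms) e) = trans (cong (λ z → - c * evalAtom μ a + z) (negTerm-eval μ (leterm ms e))) (l c (evalAtom μ a) (evalTerm μ (leterm ms e)))
  where
  l : ∀ c x y → - c * x + - y ≡ - (c * x + y)
  l = solve-∀

weight-neg : ∀ τ → weight (negTerm τ) ≡ weight τ
weight-neg (leterm [] e) = ℤP.∣-i∣≡∣i∣ e
weight-neg (leterm ((c , a) ∷ ms) e) = cong₂ ℕ._+_ (ℤP.∣-i∣≡∣i∣ c) (weight-neg (leterm ms e))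

inequalities : Program → List LETerm
inequalities []          = []
inequalities (eq0 τ ∷ φ) = τ ∷ negTerm τ ∷ inequalities φ
inequalities (le0 τ ∷ φ) = τ ∷ inequalities φ

Sat⇒≤ : ∀ μ φ → Sat μ φ → ∀ {τ} → τ ∈ inequalities φ → evalTerm μ τ ≤ 0ℤ
Sat⇒≤ μ (eq0 τ ∷ φ) (s , ss) (here refl) = ℤP.≤-reflexive s
Sat⇒≤ μ (eq0 τ ∷ φ) (s , ss) (there (here refl)) = ℤP.≤-reflexive (trans (negTerm-eval μ τ) (cong -_ s))
Sat⇒≤ μ (eq0 τ ∷ φ) (s , ss) (there (there h)) = Sat⇒≤ μ φ ss h
Sat⇒≤ μ (le0 τ ∷ φ) (s , ss) (here refl) = s
Sat⇒≤ μ (le0 τ ∷ φ) (s , ss) (there h) = Sat⇒≤ μ φ ss h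

≤⇒Sat : ∀ μ φ → (∀ {τ} → τ ∈ inequalities φ → evalTerm μ τ ≤ 0ℤ) → Sat μ φ
≤⇒Sat μ [] h = _
≤⇒Sat μ (eq0 τ ∷ φ) h = ℤP.≤-antisym (h (here refl)) (subst (0ℤ ≤_) (ℤP.neg-involutive (evalTerm μ τ)) (ℤP.neg-mono-≤ (subst (_≤ 0ℤ) (negTerm-eval μ τ) (h (there (here refl)))))) , ≤⇒Sat μ φ (λ x → h (there (there x)))
≤⇒Sat μ (le0 τ ∷ φ) h = h (here refl) , ≤⇒Sat μ φ (λ x → h (there x))

-- Bit sizes of the input

<2^log : ∀ n → n ℕ.< 2 ^ suc ⌊log₂ n ⌋
<2^log n = go n (<-wellFounded n)
  where
  go : ∀ n → Acc ℕ._<_ n → n ℕ.< 2 ^ suc ⌊log₂ n ⌋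
  go 0 _ = ℕP.m^n>0 2 (suc ⌊log₂ 0 ⌋)
  go 1 _ = ℕP.*-mono-≤ {2} {2} ℕP.≤-refl (ℕP.m^n>0 2 ⌊log₂ 1 ⌋)
  go n@(suc (suc n')) (acc rs) = ℕP.<-≤-trans (ℕP.≤-<-trans le (ℕP.≤-trans (ℕP.≤-reflexive (sym (l h))) (ℕP.*-monoʳ-≤ 2 ih))) (ℕP.≤-reflexive (cong (2 ^_) (cong suc e)))
    where
    h = ⌊ n /2⌋
    ih : h ℕ.< 2 ^ suc ⌊log₂ h ⌋
    ih = go h (rs (ℕP.⌊n/2⌋<n (suc n')))
    l : ∀ h → 2 ℕ.* (1 ℕ.+ h) ≡ 1 ℕ.+ (1 ℕ.+ (h ℕ.+ h))
    l = solveℕ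
    le : n ℕ.≤ suc (h ℕ.+ h)
    le = ℕP.≤-trans (ℕP.≤-reflexive (sym (ℕP.⌊n/2⌋+⌈n/2⌉≡n n))) (ℕP.≤-trans (ℕP.+-monoʳ-≤ h (ceil n)) (ℕP.≤-reflexive (ℕP.+-suc h h)))
      where
      ceil : ∀ n → ⌈ n /2⌉ ℕ.≤ suc ⌊ n /2⌋
      ceil 0 = z≤n
      ceil 1 = s≤s z≤n
      ceil (suc (suc n)) = s≤s (ceil n)
    1≤log : 1 ℕ.≤ ⌊log₂ n ⌋
    1≤log = ℕP.≤-trans (ℕP.≤-reflexive (sym (⌊log₂[2^n]⌋≡n 1))) (⌊log₂⌋-mono-≤ {2} {n} (s≤s (s≤s z≤n)))
    e : suc ⌊log₂ h ⌋ ≡ ⌊log₂ n ⌋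
    e = trans (cong suc (⌊log₂⌊n/2⌋⌋≡⌊log₂n⌋∸1 n)) (trans (ℕP.+-comm 1 (⌊log₂ n ⌋ ∸ 1)) (ℕP.m∸n+n≡m 1≤log))

log≤ : ∀ {n k} → n ℕ.≤ 2 ^ k → ⌊log₂ n ⌋ ℕ.≤ k
log≤ {n} {k} h = ℕP.≤-trans (⌊log₂⌋-mono-≤ h) (ℕP.≤-reflexive (⌊log₂[2^n]⌋≡n k))

∣∣≤2^zsize : ∀ z → ∣ z ∣ ℕ.≤ 2 ^ zsize z
∣∣≤2^zsize z = ℕP.≤-trans (ℕP.<⇒≤ (<2^log ∣ z ∣)) (ℕP.^-monoʳ-≤ 2 (ℕP.n≤1+n (suc ⌊log₂ ∣ z ∣ ⌋)))

2^-+≤ : ∀ a b → 1 ℕ.≤ a → 1 ℕ.≤ b → 2 ^ a ℕ.+ 2 ^ b ℕ.≤ 2 ^ (a ℕ.+ b)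
2^-+≤ a b p q = subst (2 ^ a ℕ.+ 2 ^ b ℕ.≤_) (sym (ℕP.^-distribˡ-+-* 2 a b)) (prod (2 ^ a) (2 ^ b) (ℕP.^-monoʳ-≤ 2 p) (ℕP.^-monoʳ-≤ 2 q))
  where
  prod : ∀ x y → 2 ℕ.≤ x → 2 ℕ.≤ y → x ℕ.+ y ℕ.≤ x ℕ.* y
  prod (suc (suc x)) (suc (suc y)) (s≤s (s≤s _)) (s≤s (s≤s _)) = ℕP.≤-trans (ℕP.m≤m+n _ (x ℕ.+ y ℕ.+ x ℕ.* y)) (ℕP.≤-reflexive (l x y))
    where
    l : ∀ x y → 2 ℕ.+ x ℕ.+ (2 ℕ.+ y) ℕ.+ (x ℕ.+ y ℕ.+ x ℕ.* y) ≡ (2 ℕ.+ x) ℕ.* (2 ℕ.+ y)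
    l = solveℕ

termSize≥ : ∀ ms e → 1 ℕ.≤ termSize (leterm ms e)
termSize≥ ms e = ℕP.≤-trans (s≤s z≤n) (ℕP.m≤n+m (zsize e) (sum (map (λ m → zsize (proj₁ m) ℕ.+ atomSize (proj₂ m) ℕ.+ 2) ms)))

weight≤ : ∀ τ → weight τ ℕ.≤ 2 ^ termSize τ
weight≤ (leterm [] e) = ∣∣≤2^zsize e
weight≤ (leterm ((c , a) ∷ ms) e) = ℕP.≤-trans (ℕP.+-mono-≤ (∣∣≤2^zsize c) (weight≤ (leterm ms e))) (ℕP.≤-trans (2^-+≤ (zsize c) (termSize (leterm ms e)) (s≤s z≤n) (termSize≥ ms e))
   (ℕP.^-monoʳ-≤ 2 (ℕP.≤-trans (ℕP.+-monoˡ-≤ (termSize (leterm ms e)) (ℕP.≤-trans (ℕP.m≤m+n (zsize c) (atomSize a)) (ℕP.m≤m+n (zsize c ℕ.+ atomSize a) 2))) (ℕP.≤-reflexive (sym (ℕP.+-assoc (zsize c ℕ.+ atomSize a ℕ.+ 2) _ (zsize e)))))))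

inequalities-weight : ∀ φ {τ} → τ ∈ inequalities φ → weight τ ℕ.≤ 2 ^ progSize φ
inequalities-weight φ τ∈ = go φ τ∈
  where
  first : ∀ c φ → 2 ^ termSize (constrTerm c) ℕ.≤ 2 ^ progSize (c ∷ φ)
  first c φ = ℕP.^-monoʳ-≤ 2 (ℕP.≤-trans (ℕP.m≤m+n (termSize (constrTerm c)) 3) (ℕP.m≤m+n (termSize (constrTerm c) ℕ.+ 3) (progSize φ)))
  rest : ∀ c φ → 2 ^ progSize φ ℕ.≤ 2 ^ progSize (c ∷ φ)
  rest c φ = ℕP.^-monoʳ-≤ 2 (ℕP.m≤n+m (progSize φ) (termSize (constrTerm c) ℕ.+ 3))
  go : ∀ φ {τ} → τ ∈ inequalities φ → weight τ ℕ.≤ 2 ^ progSize φ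
  go (eq0 τ ∷ φ) (here refl) = ℕP.≤-trans (weight≤ τ) (first (eq0 τ) φ)
  go (eq0 τ ∷ φ) (there (here refl)) = ℕP.≤-trans (ℕP.≤-reflexive (weight-neg τ)) (ℕP.≤-trans (weight≤ τ) (first (eq0 τ) φ))
  go (eq0 τ ∷ φ) (there (there h)) = ℕP.≤-trans (go φ h) (rest (eq0 τ) φ)
  go (le0 τ ∷ φ) (here refl) = ℕP.≤-trans (weight≤ τ) (first (le0 τ) φ)
  go (le0 τ ∷ φ) (there h) = ℕP.≤-trans (go φ h) (rest (le0 τ) φ)

length-termVars : ∀ ms e → length (termVars (leterm ms e)) ℕ.≤ termSize (leterm ms e)
length-termVars [] e = z≤n
length-termVars ((c , a) ∷ ms) e = ℕP.≤-trans (ℕP.≤-reflexive (ListP.length-++ (atomVars a))) (ℕP.≤-trans (ℕP.+-mono-≤ (at a) (length-termVars ms e)) (ℕP.≤-reflexive (sym (ℕP.+-assoc (zsize c ℕ.+ atomSize a ℕ.+ 2) _ (zsize e)))))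
  where
  two : ∀ x → 2 ℕ.≤ zsize c ℕ.+ x ℕ.+ 2
  two x = ℕP.m≤n+m 2 (zsize c ℕ.+ x)
  at : ∀ a → length (atomVars a) ℕ.≤ zsize c ℕ.+ atomSize a ℕ.+ 2
  at (lin x) = ℕP.≤-trans (s≤s z≤n) (two 1)
  at (pow2 x) = ℕP.≤-trans (s≤s z≤n) (two 2)
  at (modp x y) = two 4

length-progVars : ∀ φ → length (progVars φ) ℕ.≤ progSize φ
length-progVars [] = z≤n
length-progVars (c ∷ φ) = ℕP.≤-trans (ℕP.≤-reflexive (ListP.length-++ (termVars (constrTerm c)))) (ℕP.+-mono-≤ (ℕP.≤-trans (tv (constrTerm c)) (ℕP.m≤m+n (termSize (constrTerm c)) 3)) (length-progVars φ))
  where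
  tv : ∀ τ → length (termVars τ) ℕ.≤ termSize τ
  tv (leterm ms e) = length-termVars ms e

-- Magnitudes of the constants

-- The lower bound 50 makes `w` exceed the numerical constants of the estimates and the exponent of
-- `P`.
module Magnitude (w : ℕ) (50≤w : 50 ℕ.≤ w) where
  2≤w : 2 ℕ.≤ w
  2≤w = ℕP.≤-trans (ℕP.m≤m+n 2 48) 50≤w

  instance
    w≢0 : NonZero w
    w≢0 = ℕ.>-nonZero (ℕP.≤-trans (ℕP.m≤m+n 1 49) 50≤w)

  -- Each arithmetic operation raises the exponent k by one; the exponents below count these operations.
  record Bits (x k : ℕ) : Set where
    constructor bits
    field bounded : x ℕ.≤ 2 ^ (w ^ k)
  open Bits public

  w^k≥1 : ∀ k → 1 ℕ.≤ w ^ k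
  w^k≥1 k = ℕP.m^n>0 w k

  double : ∀ k → w ^ k ℕ.+ w ^ k ℕ.≤ w ^ suc k
  double k = ℕP.≤-trans (ℕP.≤-reflexive (cong (w ^ k ℕ.+_) (sym (ℕP.+-identityʳ (w ^ k))))) (ℕP.*-monoˡ-≤ (w ^ k) 2≤w)

  exact : ∀ k → Bits (2 ^ (w ^ k)) k
  exact k = bits ℕP.≤-refl

  below : ∀ {x y k} → x ℕ.≤ y → Bits y k → Bits x k
  below p (bits q) = bits (ℕP.≤-trans p q)

  lift : ∀ j {x k} → Bits x k → Bits x (j ℕ.+ k)
  lift j {x} {k} (bits p) = bits (ℕP.≤-trans p (ℕP.^-monoʳ-≤ 2 (ℕP.^-monoʳ-≤ w (ℕP.m≤n+m k j))))

  small : ∀ {x} → x ℕ.≤ w → Bits x 1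
  small p = bits (ℕP.≤-trans p (ℕP.≤-trans (ℕP.<⇒≤ (n<2^n w)) (ℕP.≤-reflexive (cong (2 ^_) (sym (ℕP.*-identityʳ w))))))

  mul : ∀ {x y k} → Bits x k → Bits y k → Bits (x ℕ.* y) (suc k)
  mul {k = k} (bits p) (bits q) = bits (ℕP.≤-trans (ℕP.*-mono-≤ p q) (ℕP.≤-trans (ℕP.≤-reflexive (sym (ℕP.^-distribˡ-+-* 2 (w ^ k) (w ^ k)))) (ℕP.^-monoʳ-≤ 2 (double k))))

  add : ∀ {x y k} → Bits x k → Bits y k → Bits (x ℕ.+ y) (suc k)
  add {k = k} (bits p) (bits q) = bits (ℕP.≤-trans (ℕP.+-mono-≤ p q) (ℕP.≤-trans (2^-+≤ (w ^ k) (w ^ k) (w^k≥1 k) (w^k≥1 k)) (ℕP.^-monoʳ-≤ 2 (double k))))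

  pow : ∀ {x k e} → Bits x k → e ℕ.≤ w → Bits (x ^ e) (suc k)
  pow {x} {k} {e} (bits p) q = bits (ℕP.≤-trans (ℕP.^-monoˡ-≤ e p) (ℕP.≤-trans (ℕP.≤-reflexive (ℕP.^-*-assoc 2 (w ^ k) e)) (ℕP.^-monoʳ-≤ 2 (ℕP.≤-trans (ℕP.*-monoʳ-≤ (w ^ k) q) (ℕP.≤-reflexive (ℕP.*-comm (w ^ k) w))))))

  strict : ∀ {x k} → Bits x k → x ℕ.< 2 ^ (w ^ suc k)
  strict {x} {k} (bits p) = ℕP.≤-<-trans p (ℕP.^-monoʳ-< 2 (s≤s (s≤s z≤n)) (ℕP.<-≤-trans (ℕP.m<m+n (w ^ k) (w^k≥1 k)) (double k)))

  const : ∀ c → c ℕ.≤ 50 → Bits c 1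
  const c p = small (ℕP.≤-trans p 50≤w)

  siegel-bits : ∀ n → n ℕ.≤ w → Bits (siegelBound n (2 ^ (w ^ 1))) 6
  siegel-bits n p = subst (λ x → Bits x 6) (sym (siegelBound-def n (2 ^ (w ^ 1))))
    (mul (lift 4 (const 2 (ℕP.m≤m+n 2 48))) (pow (add {1} (lift 2 (const 1 (ℕP.m≤m+n 1 49))) (mul (mul (const 2 (ℕP.m≤m+n 2 48)) (small p)) (lift 1 (exact 1)))) p))

  -- `P-large` sets the exponent: `S` has exponent 39, one multiplication raises it to 40, and
  -- strictness costs one more. As a plain number `P` is small, see `P-bits`, and may occur in
  -- bounds with far lower exponents.
  P : ℕ
  P = w ^ 41

  P-bits : Bits P 2
  P-bits = bits (ℕP.≤-trans (ℕP.^-monoˡ-≤ 41 (ℕP.<⇒≤ (n<2^n w))) (ℕP.≤-trans (ℕP.≤-reflexive (ℕP.^-*-assoc 2 w 41)) (ℕP.^-monoʳ-≤ 2 (ℕP.*-monoʳ-≤ w (ℕP.≤-trans (ℕP.≤-trans (ℕP.m≤m+n 41 9) 50≤w) (ℕP.≤-reflexive (sym (ℕP.*-identityʳ w))))))))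

  below-P : ∀ j {x k} → Bits x k → j ℕ.+ suc k ≡ 41 → x ℕ.< 2 ^ P
  below-P j {x} {k} b e = ℕP.<-≤-trans (strict b) (ℕP.^-monoʳ-≤ 2 (ℕP.^-monoʳ-≤ w (ℕP.≤-trans (ℕP.m≤n+m (suc k) j) (ℕP.≤-reflexive e))))

  module _ (m : ℕ) (m≤ : suc (suc m) ℕ.≤ w) where
    private
      A K T Sl C S₃ U E S : ℕ
      A  = 2 ^ (w ^ 1)
      C  = 2 ^ (w ^ 7)
      K  = 2 ^ (w ^ 9)
      T  = 2 ^ (w ^ 24)
      Sl = 2 ^ (w ^ 25)
      S₃ = 2 ^ (w ^ 31)
      U  = 2 ^ (w ^ 34)
      E  = 2 ^ (w ^ 36)
      S  = 2 ^ (w ^ 39)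

      n≤ : suc m ℕ.≤ w
      n≤ = ℕP.<⇒≤ m≤
      nb : Bits (suc m) 1
      nb = small n≤
      Km : Bits (K ^ m) 10
      Km = pow (exact 9) (ℕP.<⇒≤ n≤)

    -- The product of the denominators is below `2 ^ w^11`. For `L = w^11` the exponent `(L+1) L` of
    -- `selfPeriod` is at most `w^23`, and raising to the power `m + 2 ≤ w` gives `w^24`.
    periods : ∀ G → 1 ℕ.≤ G → G ℕ.≤ K ^ m → ∃ λ Z → G ℕD.∣ Z × 1 ℕ.≤ Z × Per Z Z × Z ^ suc (suc m) ℕ.≤ T
    periods G 1≤G G≤ with selfPeriod (w ^ 11) G 1≤G (strict (below G≤ Km))
    ... | Z , G∣Z , 1≤Z , Z≤ , per = Z , G∣Z , 1≤Z , per , bounded (pow {Z} {23} {suc (suc m)} (bits (ℕP.≤-trans Z≤ (ℕP.^-monoʳ-≤ 2 (ℕP.≤-trans (ℕP.*-monoˡ-≤ (w ^ 11) {suc (w ^ 11)} {w ^ 12} (ℕP.≤-trans (ℕP.+-monoˡ-≤ (w ^ 11) (w^k≥1 11)) (double 11))) (ℕP.≤-reflexive (sym (ℕP.^-distribˡ-+-* w 12 11))))))) m≤)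

    K-bound : suc m ℕ.* (siegelBound (suc (suc m)) A ^ suc m ℕ.* siegelBound (suc (suc m)) A) ℕ.≤ K
    K-bound = bounded (mul (lift 7 nb) (mul (pow (siegel-bits (suc (suc m)) m≤) n≤) (lift 1 (siegel-bits (suc (suc m)) m≤))))

    g-bound : siegelBound (suc (suc m)) A ^ suc m ℕ.≤ K
    g-bound = bounded (lift 2 (pow (siegel-bits (suc (suc m)) m≤) n≤))

    Γ-bound : siegelBound (suc m) A ℕ.≤ K
    Γ-bound = bounded (lift 3 (siegel-bits (suc m) n≤))

    Sl-bound : T ℕ.* (suc m ℕ.* (A ℕ.* siegelBound (suc m) A)) ℕ.≤ Sl
    Sl-bound = bounded (mul (exact 24) (lift 16 (mul (lift 6 nb) (mul (lift 5 (exact 1)) (siegel-bits (suc m) n≤)))))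

    S₃-bound : suc m ℕ.* (A ℕ.* (K ℕ.* (C ℕ.+ Sl))) ℕ.+ K ℕ.* C ℕ.+ suc m ℕ.* (A ℕ.* K) ℕ.≤ S₃
    S₃-bound = bounded (add (add (mul (lift 27 nb) (mul (lift 26 (exact 1)) (mul (lift 17 (exact 9)) (add (lift 18 (exact 7)) (exact 25))))) (lift 19 (mul (exact 9) (lift 2 (exact 7))))) (lift 19 (mul (lift 9 nb) (mul (lift 8 (exact 1)) (exact 9)))))

    U-bound : S₃ ℕ.+ T ℕ.+ P ℕ.+ 6 ℕ.≤ U
    U-bound = bounded (add (add (add (exact 31) (lift 7 (exact 24))) (lift 30 P-bits)) (lift 32 (const 6 (ℕP.m≤m+n 6 44))))

    E-bound : K ℕ.* C ℕ.+ K ℕ.* (C ℕ.+ Sl) ℕ.+ K ℕ.* U ℕ.≤ E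
    E-bound = bounded (add (lift 7 (add (lift 17 (mul (exact 9) (lift 2 (exact 7)))) (mul (lift 17 (exact 9)) (add (lift 18 (exact 7)) (exact 25))))) (mul (lift 25 (exact 9)) (exact 34)))

    p-bound : suc m ℕ.* (A ℕ.* E) ℕ.+ K ℕ.* C ℕ.< 2 ^ P
    p-bound = below-P 1 (add (mul (lift 36 nb) (mul (lift 35 (exact 1)) (exact 36))) (lift 28 (mul (exact 9) (lift 2 (exact 7))))) refl

    S-bound : K ^ m ℕ.* E ℕ.+ K ^ m ℕ.* (T ℕ.* K) ℕ.+ K ^ m ℕ.≤ S
    S-bound = bounded (add (add (mul (lift 26 Km) (exact 36)) (lift 11 (mul (lift 15 Km) (mul (exact 24) (lift 15 (exact 9)))))) (lift 28 Km))

    P-large : 4 ℕ.* suc m ℕ.* S ℕ.< 2 ^ P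
    P-large = below-P 0 (mul (lift 37 (mul (const 4 (ℕP.m≤m+n 4 46)) nb)) (exact 39)) refl

    T<2^P : T ℕ.< 2 ^ P
    T<2^P = below-P 16 (exact 24) refl

    A-bound : ∀ s → suc (suc s) ℕ.≤ w → 2 ^ s ℕ.+ 2 ℕ.≤ A
    A-bound s p = ℕP.≤-trans (ℕP.+-mono-≤ (ℕP.^-monoʳ-≤ 2 (ℕP.n≤1+n s)) (ℕP.^-monoʳ-≤ 2 {1} {suc s} (s≤s z≤n))) (ℕP.≤-trans (ℕP.≤-reflexive (cong (2 ^ suc s ℕ.+_) (sym (ℕP.+-identityʳ (2 ^ suc s))))) (ℕP.^-monoʳ-≤ 2 {suc (suc s)} (ℕP.≤-trans p (ℕP.≤-reflexive (sym (ℕP.*-identityʳ w))))))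

    C-bound : ∀ s → suc (suc s) ℕ.≤ w → let A₀ = 2 ^ s in A₀ ℕ.+ P ℕ.+ m ℕ.* (suc m ℕ.* (A₀ ℕ.+ 2) ℕ.+ (A₀ ℕ.+ P)) ℕ.+ 1 ℕ.≤ C
    C-bound s p = bounded (add (add (lift 2 Kb) (mul (lift 3 (small (ℕP.<⇒≤ n≤))) (add (lift 1 (mul nb Ab)) Kb))) (lift 5 (const 1 (ℕP.m≤m+n 1 49))))
      where
      Ab : Bits (2 ^ s ℕ.+ 2) 1
      Ab = bits (A-bound s p)
      Kb : Bits (2 ^ s ℕ.+ P) 3
      Kb = add (lift 1 (below (ℕP.m≤m+n (2 ^ s) 2) Ab)) P-bits

    size-bound : let k = 2 ℕ.+ m ℕ.* (2 ℕ.+ m ℕ.* 5) ℕ.+ m in k ℕ.* (2 ℕ.+ (P ℕ.+ 4 ℕ.+ 2 ℕ.* k ℕ.+ 3)) ℕ.≤ w ^ 46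
    size-bound = ℕP.≤-trans (ℕP.*-mono-≤ k≤ rest≤) (ℕP.≤-reflexive (sym (ℕP.^-distribˡ-+-* w 4 42)))
      where
      k = 2 ℕ.+ m ℕ.* (2 ℕ.+ m ℕ.* 5) ℕ.+ m
      mono : ∀ j k → w ^ k ℕ.≤ w ^ (j ℕ.+ k)
      mono j k = ℕP.^-monoʳ-≤ w (ℕP.m≤n+m k j)
      w≡ : w ℕ.≤ w ^ 1
      w≡ = ℕP.≤-reflexive (sym (ℕP.*-identityʳ w))
      k≤ : k ℕ.≤ w ^ 4
      k≤ = ℕP.≤-trans (ℕP.≤-reflexive (l m (2 ℕ.+ m ℕ.* 5))) (ℕP.≤-trans (ℕP.+-mono-≤ (ℕP.*-mono-≤ (ℕP.<⇒≤ n≤) inner) (ℕP.≤-trans m≤ (ℕP.≤-trans w≡ (mono 2 1)))) (double 3))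
        where
        l : ∀ m x → 2 ℕ.+ m ℕ.* x ℕ.+ m ≡ m ℕ.* x ℕ.+ (2 ℕ.+ m)
        l = solveℕ
        l' : ∀ m → (2 ℕ.+ m) ℕ.* 5 ≡ 2 ℕ.+ m ℕ.* 5 ℕ.+ 8
        l' = solveℕ
        inner : 2 ℕ.+ m ℕ.* 5 ℕ.≤ w ^ 2
        inner = ℕP.≤-trans (ℕP.m≤m+n _ 8) (ℕP.≤-trans (ℕP.≤-reflexive (sym (l' m))) (ℕP.*-mono-≤ m≤ (ℕP.≤-trans (ℕP.≤-trans (ℕP.m≤m+n 5 45) 50≤w) w≡)))
      rest≤ : 2 ℕ.+ (P ℕ.+ 4 ℕ.+ 2 ℕ.* k ℕ.+ 3) ℕ.≤ w ^ 42
      rest≤ = ℕP.≤-trans (ℕP.≤-reflexive (l P k)) (ℕP.≤-trans (ℕP.+-mono-≤ (ℕP.+-monoʳ-≤ (w ^ 41) (ℕP.≤-trans (ℕP.≤-trans (ℕP.m≤m+n 9 41) 50≤w) (ℕP.≤-trans w≡ (mono 40 1)))) (ℕP.+-mono-≤ (ℕP.≤-trans k≤ (mono 37 4)) (ℕP.≤-trans k≤ (mono 37 4)))) (ℕP.≤-trans (ℕP.≤-reflexive (l₂ (w ^ 41))) (ℕP.*-monoˡ-≤ (w ^ 41) (ℕP.≤-trans (ℕP.m≤m+n 4 46) 50≤w))))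
        where
        l : ∀ p k → 2 ℕ.+ (p ℕ.+ 4 ℕ.+ 2 ℕ.* k ℕ.+ 3) ≡ p ℕ.+ 9 ℕ.+ (k ℕ.+ k)
        l = solveℕ
        l₂ : ∀ x → x ℕ.+ x ℕ.+ (x ℕ.+ x) ≡ 4 ℕ.* x
        l₂ = solveℕ

    k≤P : ∀ j {k} → j ℕ.+ k ≡ 41 → w ^ k ℕ.≤ P
    k≤P j {k} e = ℕP.^-monoʳ-≤ w (ℕP.≤-trans (ℕP.m≤n+m k j) (ℕP.≤-reflexive e))

-- Extremal solutions

-- The number `w` is a variable with an equation instead of the sum itself, which keeps its high
-- powers symbolic.
module Extremum (φ : Program) (z : Var) (z∈ : z ∈ progVars φ) (ν : Assignment) (sat : Sat ν φ)
    (extremal : (∀ μ → Sat μ φ → μ z ℕ.≤ ν z) ⊎ (∀ μ → Sat μ φ → ν z ℕ.≤ μ z))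
    (w : ℕ) (w≡ : w ≡ progSize φ ℕ.+ 50) where

  s : ℕ
  s = progSize φ

  open Magnitude w (subst (50 ℕ.≤_) (sym w≡) (ℕP.m≤n+m 50 s))
  open SortedVersion (sort ν (progVars φ))

  m : ℕ
  m = length L

  s+2≤w : suc (suc s) ℕ.≤ w
  s+2≤w = ℕP.≤-trans (ℕP.≤-reflexive (ℕP.+-comm 2 s)) (ℕP.≤-trans (ℕP.+-monoʳ-≤ s (ℕP.m≤m+n 2 48)) (ℕP.≤-reflexive (sym w≡)))

  m≤ : suc (suc m) ℕ.≤ w
  m≤ = ℕP.≤-trans (s≤s (s≤s (ℕP.≤-trans shorter (length-progVars φ)))) s+2≤w

  idx : Var → ℕ
  idx x = position x L

  Y₀ : ℕ → ℕ
  Y₀ = sortedValue ν L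

  Y₀-idx : ∀ {x} → x ∈ progVars φ → Y₀ (idx x) ≡ ν x
  Y₀-idx {x} x∈ with position-nth x L (covers x∈)
  ... | i , e , n≡ = trans (cong Y₀ e) (cong (value ν) n≡)

  sat₀ : Sat (λ x → Y₀ (idx x)) φ
  sat₀ = Sat-cong φ (λ x∈ → sym (Y₀-idx x∈)) sat

  module I = Initial m Y₀ refl (sortedValue-mono ν L sorted) idx (λ x → position≤ x L) (inequalities φ) P (2 ^ s) (inequalities-weight φ) (Sat⇒≤ (λ x → Y₀ (idx x)) φ sat₀)

  solution : ∀ {Y d} → System.State m I.big I.lo I.fams Y d → Sat (λ x → Y (idx x)) φ
  solution {Y} st = ≤⇒Sat (λ x → Y (idx x)) φ (I.solves st)

  extremal' : (∀ Y d → System.State m I.big I.lo I.fams Y d → Y (idx z) ℕ.≤ Y₀ (idx z)) ⊎ (∀ Y d → System.State m I.big I.lo I.fams Y d → Y₀ (idx z) ℕ.≤ Y (idx z))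
  extremal' = Data.Sum.map (λ h Y d st → subst (Y (idx z) ℕ.≤_) (sym (Y₀-idx z∈)) (h _ (solution st))) (λ h Y d st → subst (ℕ._≤ Y (idx z)) (sym (Y₀-idx z∈)) (h _ (solution st))) extremal

  small-rows : ∀ ℓ → ℓ ℕ.< m → ∀ ρ → ρ ∈ System.rows m I.big I.lo I.fams ℓ → (∀ j → j ℕ.< suc m → ∣ ra ρ j ∣ ℕ.≤ 2 ^ (w ^ 1)) × ∣ rc ρ ∣ ℕ.≤ 2 ^ (w ^ 7) × ∣ rc' ρ ∣ ℕ.≤ 2 ^ (w ^ 7)
  small-rows ℓ p ρ ρ∈ = (λ j q → ℕP.≤-trans (proj₁ h j q) (A-bound m m≤ s s+2≤w)) , ℕP.≤-trans (proj₁ (proj₂ h)) (C-bound m m≤ s s+2≤w) , ℕP.≤-trans (proj₂ (proj₂ h)) (C-bound m m≤ s s+2≤w)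
    where h = I.row-bound ℓ p ρ ρ∈

  abstract
    normalForm : NormalForm m I.big I.lo I.fams (2 ^ (w ^ 9)) (2 ^ (w ^ 36)) (idx z) (Y₀ (idx z))
    normalForm = Stages.normalForm (record
      { m = m ; big = I.big ; lo = I.lo ; fams = I.fams ; P = P ; lo-big = λ ℓ _ → I.lo-big ℓ ; gapLo = I.gapLo ; gapHi = I.gapHi
      ; A = 2 ^ (w ^ 1) ; C = 2 ^ (w ^ 7) ; 1≤A = ℕP.m^n>0 2 (w ^ 1) ; row-bound = small-rows
      ; z = idx z ; z≤m = position≤ z L ; opt = Y₀ (idx z) ; extremal = extremal'
      ; K = 2 ^ (w ^ 9) ; E = 2 ^ (w ^ 36) ; T = 2 ^ (w ^ 24) ; Γ = 2 ^ (w ^ 9) ; Sl = 2 ^ (w ^ 25) ; S₃ = 2 ^ (w ^ 31) ; U = 2 ^ (w ^ 34) ; S = 2 ^ (w ^ 39)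
      ; 1≤K = ℕP.m^n>0 2 (w ^ 9) ; periods = periods m m≤ ; T<2^P = T<2^P m m≤ ; K-bound = K-bound m m≤ ; g-bound = g-bound m m≤
      ; Γ-bound = Γ-bound m m≤ ; K≤Γ = ℕP.≤-refl ; Sl-bound = Sl-bound m m≤ ; S₃-bound = S₃-bound m m≤ ; U-bound = U-bound m m≤
      ; E-bound = E-bound m m≤ ; p-bound = p-bound m m≤ ; S-bound = S-bound m m≤ ; P-large = P-large m m≤ }) Y₀ I.d I.initial refl

  module D = NormalForm normalForm

  zsize≤ : ∀ x k → ∣ x ∣ ℕ.≤ 2 ^ k → k ℕ.≤ P → zsize x ℕ.+ 1 ℕ.≤ P ℕ.+ 4
  zsize≤ x k h k≤ = ℕP.≤-trans (ℕP.+-monoˡ-≤ 1 (ℕP.+-monoʳ-≤ 2 (ℕP.≤-trans (log≤ h) k≤))) (ℕP.≤-trans (ℕP.≤-reflexive (l P)) (ℕP.+-monoʳ-≤ P (ℕP.n≤1+n 3)))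
    where
    l : ∀ p → 2 ℕ.+ p ℕ.+ 1 ≡ p ℕ.+ 3
    l = solveℕ

  normal : Normal m (P ℕ.+ 4) D.Y
  normal = record
    { Y-zero = System.Upto.Y-zero D.st ; d = D.d ; sch = D.sch
    ; Y-mono = λ ℓ p → System.LevelOK.y≤y' (System.Upto.level D.st ℓ p)
    ; Y-res = λ ℓ p → System.LevelOK.y-eq (System.Upto.level D.st ℓ p)
    ; follows = λ ℓ p → D.follows ℓ p
    ; α-next = λ ℓ p → D.α-next ℓ p
    ; α-size = λ ℓ j p q → α-sz ℓ j p q (I.big ℓ) refl
    ; β-size = λ ℓ j p q → β-sz ℓ j p q (I.big ℓ) refl
    ; g-size = λ ℓ p → ℕP.≤-trans (ℕP.+-monoʳ-≤ 3 (ℕP.≤-trans (log≤ (D.g≤K ℓ p)) (k≤P m m≤ 32 refl))) (ℕP.≤-trans (ℕP.≤-reflexive (ℕP.+-comm 3 P)) (ℕP.+-monoʳ-≤ P (ℕP.n≤1+n 3))) }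
    where
    α-sz : ∀ ℓ j → ℓ ℕ.< m → j ℕ.< suc m → ∀ b → I.big ℓ ≡ b → zsize (α (D.sch ℓ) j) ℕ.+ 1 ℕ.≤ P ℕ.+ 4
    α-sz ℓ j p q true e = zsize≤ (α (D.sch ℓ) j) (w ^ 36) (D.α≤E ℓ p e j q) (k≤P m m≤ 5 refl)
    α-sz ℓ j p q false e = zsize≤ (α (D.sch ℓ) j) 0 (subst (λ x → ∣ x ∣ ℕ.≤ 1) (sym (D.α-small ℓ p e j q)) z≤n) z≤n
    β-sz : ∀ ℓ j → ℓ ℕ.< m → j ℕ.< suc m → ∀ b → I.big ℓ ≡ b → zsize (β (D.sch ℓ) j) ℕ.+ 1 ℕ.≤ P ℕ.+ 4
    β-sz ℓ j p q true e = zsize≤ (β (D.sch ℓ) j) (w ^ 36) (D.β≤E ℓ p e j q) (k≤P m m≤ 5 refl)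
    β-sz ℓ j p q false e = zsize≤ (β (D.sch ℓ) j) (I.lo ℓ) (D.β-small ℓ p e j q) (I.lo≤P ℓ)

  result : Σ LESLP λ σ → Σ (List ℤ) λ vs → Σ Assignment λ μ →
    ILESLPWith σ vs × leslpSize σ ℕ.≤ w ^ 46 × Represents σ vs (progVars φ) μ × Sat μ φ × μ z ≡ ν z
  result = σ , vs , (λ x → D.Y (idx x)) , ok , ℕP.≤-trans size (size-bound m m≤) , represents , solution D.st , trans D.Y-opt (Y₀-idx z∈)
    where
    slp = normal⇒leslp m (P ℕ.+ 4) D.Y normal (ℕP.m≤n+m 4 P) L unique refl
    σ = proj₁ slp
    vs = proj₁ (proj₂ slp)
    ok = proj₁ (proj₂ (proj₂ slp))
    size = proj₁ (proj₂ (proj₂ (proj₂ slp)))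
    rep = proj₂ (proj₂ (proj₂ (proj₂ slp)))
    represents : Represents σ vs (progVars φ) (λ x → D.Y (idx x))
    represents x x∈ = proj₁ r , proj₁ (proj₂ r) , trans (proj₂ (proj₂ r)) (cong (λ k → just (+ D.Y k)) (sym (proj₁ (proj₂ pn))))
      where
      pn = position-nth x L (covers x∈)
      r = rep (proj₁ pn) x (proj₂ (proj₂ pn))

abstract
  extremum : ∀ (φ : Program) (z : Var) → z ∈ progVars φ → (ν : Assignment) → Sat ν φ →
    (∀ μ → Sat μ φ → μ z ℕ.≤ ν z) ⊎ (∀ μ → Sat μ φ → ν z ℕ.≤ μ z) → ∀ w → w ≡ progSize φ ℕ.+ 50 →
    Σ LESLP λ σ → Σ (List ℤ) λ vs → Σ Assignment λ μ →
      ILESLPWith σ vs × leslpSize σ ℕ.≤ w ^ 46 × Represents σ vs (progVars φ) μ × Sat μ φ × μ z ≡ ν z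
  extremum φ z z∈ ν sat ext w w≡ = Extremum.result φ z z∈ ν sat ext w w≡

-- From objective terms to an objective variable

abstract
  k₀ : ℕ
  k₀ = 46

  k₀-def : k₀ ≡ 46
  k₀-def = refl

-- The added equation contributes 8 symbols to the 50 of `Magnitude`, and `p + 58 ≤ 58 (p + 1)`.
c₀ : ℕ
c₀ = 58 ^ k₀

size≤poly : ∀ w p → w ≡ p ℕ.+ 58 → w ^ 46 ℕ.≤ c₀ ℕ.* (p ℕ.+ 1) ^ k₀
size≤poly .(p ℕ.+ 58) p refl = subst (λ k → (p ℕ.+ 58) ^ k ℕ.≤ c₀ ℕ.* (p ℕ.+ 1) ^ k₀) k₀-def
  (ℕP.≤-trans (ℕP.^-monoˡ-≤ k₀ {p ℕ.+ 58} {58 ℕ.* (p ℕ.+ 1)} (ℕP.≤-trans (ℕP.m≤m+n (p ℕ.+ 58) (57 ℕ.* p)) (ℕP.≤-reflexive (l p)))) (ℕP.≤-reflexive (^-distribʳ-* 58 (p ℕ.+ 1) k₀)))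
  where
  l : ∀ p → p ℕ.+ 58 ℕ.+ 57 ℕ.* p ≡ 58 ℕ.* (p ℕ.+ 1)
  l = solveℕ

module Objective (ms : List (ℤ × Atom)) (e : ℤ) (φ : Program) where
  τ : LETerm
  τ = leterm ms e

  xs : List Var
  xs = termVars τ ++ progVars φ

  z : Var
  z = sum-bound xs

  -- the program φ together with τ = -s z
  extended : ℤ → Program
  extended s = eq0 (leterm ((s , lin z) ∷ ms) e) ∷ φ

  extended-size : ∀ s → ∣ s ∣ ≡ 1 → progSize (extended s) ≡ probSize τ φ ℕ.+ 8
  extended-size s h = shift ⌊log₂ ∣ s ∣ ⌋ (sum (map (λ m → zsize (proj₁ m) ℕ.+ atomSize (proj₂ m) ℕ.+ 2) ms)) (zsize e) (progSize φ)
      (ℕP.n≤0⇒n≡0 (log≤ {∣ s ∣} {0} (ℕP.≤-reflexive h)))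
    where
    lem : ∀ a b c → 2 ℕ.+ 0 ℕ.+ 1 ℕ.+ 2 ℕ.+ a ℕ.+ b ℕ.+ 3 ℕ.+ c ≡ a ℕ.+ b ℕ.+ c ℕ.+ 8
    lem = solveℕ
    shift : ∀ x a b c → x ≡ 0 → 2 ℕ.+ x ℕ.+ 1 ℕ.+ 2 ℕ.+ a ℕ.+ b ℕ.+ 3 ℕ.+ c ≡ a ℕ.+ b ℕ.+ c ℕ.+ 8
    shift .0 a b c refl = lem a b c

  override : Assignment → ℕ → Assignment
  override ν v x with x ℕ.≟ z
  ... | yes _ = v
  ... | no _  = ν x

  override-z : ∀ ν v → override ν v z ≡ v
  override-z ν v with z ℕ.≟ z
  ... | yes _ = refl
  ... | no ne = ⊥-elim (ne refl)

  override-other : ∀ ν v {x} → x ∈ xs → ν x ≡ override ν v x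
  override-other ν v {x} x∈ with x ℕ.≟ z
  ... | yes refl = ⊥-elim (ℕP.<-irrefl refl (<sum-bound x∈))
  ... | no _ = refl

  SameValue : Assignment → Assignment → Set
  SameValue ν μ = Sat μ φ × evalTerm μ τ ≡ evalTerm ν τ

  -- Since `z` is fresh, solutions of the extended program are solutions of `φ` together with a
  -- natural number tied to the objective. Solutions at which the objective has the wrong sign admit
  -- no such number and drop out, while the given optimum stays. Reaching the extremal `z` gives the
  -- optimal objective back.
  small : ∀ ν s v → ∣ s ∣ ≡ 1 → Sat ν φ → s * + v + evalTerm ν τ ≡ 0ℤ →
          (∀ μ y → Sat μ φ → s * + y + evalTerm μ τ ≡ 0ℤ → y ℕ.≤ v) ⊎ (∀ μ y → Sat μ φ → s * + y + evalTerm μ τ ≡ 0ℤ → v ℕ.≤ y) →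
          HasSmallOptimal (SameValue ν) xs (c₀ ℕ.* (probSize τ φ ℕ.+ 1) ^ k₀)
  small ν s v s1 sat eq dir = go (progSize (extended s) ℕ.+ 50) refl
    where
    ν' = override ν v
    sat' : Sat ν' (extended s)
    sat' = trans (cong₂ (λ a b → s * + a + b) (override-z ν v) (sym (evalTerm-cong ms e (λ x∈ → override-other ν v (∈-++⁺ˡ x∈))))) eq
         , Sat-cong φ (λ x∈ → override-other ν v (∈-++⁺ʳ (termVars τ) x∈)) sat
    dir' : (∀ μ → Sat μ (extended s) → μ z ℕ.≤ ν' z) ⊎ (∀ μ → Sat μ (extended s) → ν' z ℕ.≤ μ z)
    dir' = Data.Sum.map (λ h μ st → subst (μ z ℕ.≤_) (sym (override-z ν v)) (h μ (μ z) (proj₂ st) (proj₁ st))) (λ h μ st → subst (ℕ._≤ μ z) (sym (override-z ν v)) (h μ (μ z) (proj₂ st) (proj₁ st))) dir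
    cancel : ∀ x a b → x + a ≡ 0ℤ → x + b ≡ 0ℤ → a ≡ b
    cancel x a b p q = trans (l x a) (trans (cong (_- x) (trans p (sym q))) (sym (l x b)))
      where
      l : ∀ x a → a ≡ (x + a) - x
      l = solve-∀
    go : ∀ w → w ≡ progSize (extended s) ℕ.+ 50 → HasSmallOptimal (SameValue ν) xs (c₀ ℕ.* (probSize τ φ ℕ.+ 1) ^ k₀)
    go w w≡ with extremum (extended s) z (here refl) ν' sat' dir' w w≡
    ... | σ , vs , μ , ok , size , rep , (eqμ , satμ) , μz = σ , vs , μ , ok , ℕP.≤-trans size bound , (λ x x∈ → rep x (there x∈)) , satμ , same
      where
      bound : w ^ 46 ℕ.≤ c₀ ℕ.* (probSize τ φ ℕ.+ 1) ^ k₀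
      bound = size≤poly w (probSize τ φ) (trans w≡ (trans (cong (ℕ._+ 50) (extended-size s s1)) (ℕP.+-assoc (probSize τ φ) 8 50)))
      same : evalTerm μ τ ≡ evalTerm ν τ
      same = cancel (s * + v) (evalTerm μ τ) (evalTerm ν τ) (trans (cong (λ a → s * + a + evalTerm μ τ) (sym (trans μz (override-z ν v)))) eqμ) eq

  private
    solve+ : ∀ y t → 1ℤ * + y + t ≡ 0ℤ → t ≡ - + y
    solve+ y t h = trans (l (+ y) t) (trans (cong (_- + y) h) (ℤP.+-identityˡ (- + y)))
      where
      l : ∀ y t → t ≡ (1ℤ * y + t) - y
      l = solve-∀

    solve- : ∀ y t → - 1ℤ * + y + t ≡ 0ℤ → t ≡ + y
    solve- y t h = trans (l (+ y) t) (trans (cong (_+ + y) h) (ℤP.+-identityˡ (+ y)))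
      where
      l : ∀ y t → t ≡ (- 1ℤ * y + t) + y
      l = solve-∀

    unneg : ∀ {a b} → - + a ≤ - + b → b ℕ.≤ a
    unneg {a} {b} h = ℤP.drop‿+≤+ (ℤP.neg-cancel-≤ h)

    at+ : ∀ v → - 1ℤ * + v + + v ≡ 0ℤ
    at+ v = l (+ v)
      where
      l : ∀ v → - 1ℤ * v + v ≡ 0ℤ
      l = solve-∀

    at- : ∀ v → 1ℤ * + v + - + v ≡ 0ℤ
    at- v = l (+ v)
      where
      l : ∀ v → 1ℤ * v + - v ≡ 0ℤ
      l = solve-∀

  maximal : ∃ (IsMaxSol τ φ) → HasSmallOptimal (IsMaxSol τ φ) xs (c₀ ℕ.* (probSize τ φ ℕ.+ 1) ^ k₀)
  maximal (ν , sat , best) = conclude (go (evalTerm ν τ) refl)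
    where
    conclude : HasSmallOptimal (SameValue ν) xs _ → HasSmallOptimal (IsMaxSol τ φ) xs _
    conclude (σ , vs , μ , ok , size , rep , satμ , same) = σ , vs , μ , ok , size , rep , satμ , λ μ' s → subst (evalTerm μ' τ ≤_) (sym same) (best μ' s)
    go : ∀ t → evalTerm ν τ ≡ t → HasSmallOptimal (SameValue ν) xs _
    -- A nonnegative maximum `v` is the largest `z = τ`.
    go (+ v) h = small ν (- 1ℤ) v refl sat (trans (cong (λ t → - 1ℤ * + v + t) h) (at+ v)) (inj₁ (λ μ y s q → ℤP.drop‿+≤+ (subst₂ _≤_ (solve- y _ q) h (best μ s))))
    -- For a negative maximum `z = - τ` is used, which turns the maximum into a minimum of `z`.
    go -[1+ v ] h = small ν 1ℤ (suc v) refl sat (trans (cong (λ t → 1ℤ * + suc v + t) h) (at- (suc v))) (inj₂ (λ μ y s q → unneg (subst₂ _≤_ (solve+ y _ q) h (best μ s))))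

  minimal : ∃ (IsMinSol τ φ) → HasSmallOptimal (IsMinSol τ φ) xs (c₀ ℕ.* (probSize τ φ ℕ.+ 1) ^ k₀)
  minimal (ν , sat , best) = conclude (go (evalTerm ν τ) refl)
    where
    conclude : HasSmallOptimal (SameValue ν) xs _ → HasSmallOptimal (IsMinSol τ φ) xs _
    conclude (σ , vs , μ , ok , size , rep , satμ , same) = σ , vs , μ , ok , size , rep , satμ , λ μ' s → subst (_≤ evalTerm μ' τ) (sym same) (best μ' s)
    go : ∀ t → evalTerm ν τ ≡ t → HasSmallOptimal (SameValue ν) xs _
    go (+ v) h = small ν (- 1ℤ) v refl sat (trans (cong (λ t → - 1ℤ * + v + t) h) (at+ v)) (inj₂ (λ μ y s q → ℤP.drop‿+≤+ (subst₂ _≤_ h (solve- y _ q) (best μ s))))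
    go -[1+ v ] h = small ν 1ℤ (suc v) refl sat (trans (cong (λ t → 1ℤ * + suc v + t) h) (at- (suc v))) (inj₁ (λ μ y s q → unneg (subst₂ _≤_ h (solve+ y _ q) (best μ s))))

theorem1 : Σ ℕ λ c → Σ ℕ λ k →
    ∀ (τ : LETerm) (φ : Program) →
    (∃ (IsMaxSol τ φ) →
    HasSmallOptimal (IsMaxSol τ φ) (termVars τ ++ progVars φ) (c ℕ.* (probSize τ φ ℕ.+ 1) ^ k))
    ×
    (∃ (IsMinSol τ φ) →
    HasSmallOptimal (IsMinSol τ φ) (termVars τ ++ progVars φ) (c ℕ.* (probSize τ φ ℕ.+ 1) ^ k))
theorem1 = c₀ , k₀ , λ { (leterm ms e) φ → Objective.maximal ms e φ , Objective.minimal ms e φ }
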